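{- Let $n\geqslant 2$, let $q$ be a prime power and let $c\in C_{n-1}(n,q)$ with $(3q-6)\theta_{n-2}+3\leqslant\mathrm{wt}(c)\leqslant B_{n,q}$. Then there exist a plane $\pi$ such that $c|_\pi$ is of type $T\in\{T^{\mathrm{odd}},T^{\triangle},T^{\star}\}$ and an $(n-3)$-space $\kappa$ with $\pi\cap\kappa=\emptyset$ such that \[ c=\sum_{P\in\pi}c(P)\cdot\langle\kappa,P\rangle, \] where $\langle\kappa,P\rangle$ denotes the incidence vector of the $(n-2)$-space spanned by $\kappa$ and $P$.
   Context: $q=p^h$, $p$ prime. $\mathrm{PG}(n,q)$ is the Desarguesian projective space over $\mathbb{F}_q$; $\mathcal{V}(n,q)$ is the $\mathbb{F}_p$-space of functions from its points to $\mathbb{F}_p$; a subspace is identified with its incidence (characteristic) vector; $C_{n-1}(n,q)$ is the $\mathbb{F}_p$-span of the incidence vectors of all hyperplanes. $\mathrm{wt}(v)$ is the number of points with $v(P)\neq0$. A $(-1)$-space is the empty set. $\theta_m=(q^{m+1}-1)/(q-1)$ for $m\geqslant0$, $\theta_m=0$ for $m<0$. For a plane $\pi$, $c|_\pi$ (restriction of $c$ to the points of $\pi$) is a code word of $C_1(2,q)$ when $\pi$ is identified with $\mathrm{PG}(2,q)$. It is of type $T^{\triangle}$ if it is an $\mathbb{F}_p$-linear combination of (incidence vectors of) three non-concurrent lines; of type $T^{\star}$ if it is a linear combination of three concurrent lines; of type $T^{\mathrm{odd}}$ if $q=p$ is an odd prime and, identifying $\pi$ with $\mathrm{PG}(2,p)$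 with coordinates $(X_0,X_1,X_2)$, $c|_\pi=(\gamma c_0+\lambda m+\lambda' m'+\lambda'' m'')^\sigma$ for a collineation $\sigma$, $\gamma\in\mathbb{F}_p\setminus\{0\}$, $\lambda,\lambda',\lambda''\in\mathbb{F}_p$, where $m:X_0=0$, $m':X_1=0$, $m'':X_0=X_1$ and $c_0(0,1,a)=a$, $c_0(1,0,b)=b$, $c_0(1,1,e)=-e$ ($a,b,e\in\mathbb{F}_p$), $c_0=0$ elsewhere. $B_{n,q}$: $2q^{n-1}$ if $q<7$ or $q\in\{8,9,16,25,27,49\}$; $(3q-\sqrt{6q}-\tfrac12)q^{n-2}$ if $q\in\{7,11,13,17\}$; $(3q-\sqrt{6q}+\tfrac92)q^{n-2}$ if $q\in\{19,121\}$; $(4q-4\sqrt{q}-\tfrac{25}{2})q^{n-2}$ if $q\in\{29,31,32\}$; $(4q-\sqrt{8q}-\tfrac{33}{2})q^{n-2}$ otherwise. -}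

module Defs where

open import Data.Nat using (ℕ; zero; suc; _<_; _≤_; _∸_; _^_; NonZero)
  renaming (_+_ to _+ℕ_; _*_ to _*ℕ_)
open import Data.Nat.Primality using (Prime; prime⇒nonZero)
open import Data.Nat.DivMod using (_mod_)
open import Data.Fin using (Fin; toℕ) renaming (zero to fzero)
import Data.Fin as Fin
open import Data.Bool using (Bool; true; false; if_then_else_; T; not; _∧_)
open import Data.List using (List; []; _∷_; [_]; length; map; filterᵇ; cartesianProductWith; mapMaybe)
open import Data.Nat.ListAction using (sum)
open import Data.Bool.ListAction using (any)
import Data.Nat as ℕ
open import Data.List.Membership.Propositional using (_∈_)
open import Data.List.Relation.Unary.Unique.Propositional using (Unique)
open import Data.List.Relation.Unary.All using (All)
open import Data.Vec using (Vec; []; _∷_; replicate; zipWith; foldr)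
import Data.Vec.Properties as VecP
open import Data.Maybe using (Maybe; just; nothing)
open import Data.Product using (Σ; ∃; _×_; _,_; proj₁; proj₂)
open import Data.Sum using (_⊎_)
open import Relation.Nullary using (¬_; Dec; yes; no)
open import Relation.Nullary.Decidable using (isYes)
open import Relation.Binary.PropositionalEquality using (_≡_; _≢_)
open import Relation.Binary.Definitions using (DecidableEquality)
open import Algebra.Structures using (IsCommutativeRing)
open import Data.Bool.Properties using (T?)

record FiniteField : Set₁ where
  infixl 6 _+_
  infixl 7 _*_
  field
    Carrier : Set
    _+_ _*_ : Carrier → Carrier → Carrier
    -_      : Carrier → Carrier
    0# 1#   : Carrier
    isCommutativeRing : IsCommutativeRing _≡_ _+_ _*_ -_ 0# 1#
    0≢1     : 0# ≢ 1#
    inverse : ∀ x → x ≢ 0# → ∃ λ y → x * y ≡ 1#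
    _≟_     : DecidableEquality Carrier
    elems   : List Carrier
    elems-complete : ∀ x → x ∈ elems
    elems-unique   : Unique elems

  q : ℕ
  q = length elems

  ι : ℕ → Carrier
  ι zero    = 0#
  ι (suc k) = 1# + ι k

θ : ℕ → ℕ → ℕ
θ q zero    = 1
θ q (suc m) = q ^ suc m +ℕ θ q m

-- The bound B_{n,q}.  Square roots are removed exactly: for reals
-- x ≤ a - b√d  (a,b,d ≥ 0)  iff  x ≤ a  and  b²d ≤ (a - x)².
-- Each inequality is first multiplied by 2 to clear the halves.

Small : ℕ → Set
Small q = q < 7 ⊎ q ∈ (8 ∷ 9 ∷ 16 ∷ 25 ∷ 27 ∷ 49 ∷ [])

ClassA ClassB ClassC : ℕ → Set
ClassA q = q ∈ (7 ∷ 11 ∷ 13 ∷ 17 ∷ [])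
ClassB q = q ∈ (19 ∷ 121 ∷ [])
ClassC q = q ∈ (29 ∷ 31 ∷ 32 ∷ [])

-- 2w ≤ X - 2·√(6q)·q^{n-2}, resp. with the given constants
-- (a - x ≥ 0 and (a - x)² ≥ b² d with everything in ℕ)
SqrtBound : (a b²d w : ℕ) → Set
SqrtBound a b²d w = 2 *ℕ w ≤ a × b²d ≤ (a ∸ 2 *ℕ w) ^ 2

WtLeB : (n q w : ℕ) → Set
WtLeB n q w =
    (Small q × w ≤ 2 *ℕ q ^ (n ∸ 1))
  -- (3q - √(6q) - 1/2) q^{n-2}
  ⊎ (ClassA q × SqrtBound ((6 *ℕ q ∸ 1) *ℕ q ^ (n ∸ 2)) (24 *ℕ q *ℕ q ^ (2 *ℕ (n ∸ 2))) w)
  -- (3q - √(6q) + 9/2) q^{n-2}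
  ⊎ (ClassB q × SqrtBound ((6 *ℕ q +ℕ 9) *ℕ q ^ (n ∸ 2)) (24 *ℕ q *ℕ q ^ (2 *ℕ (n ∸ 2))) w)
  -- (4q - 4√q - 25/2) q^{n-2}
  ⊎ (ClassC q × SqrtBound ((8 *ℕ q ∸ 25) *ℕ q ^ (n ∸ 2)) (64 *ℕ q *ℕ q ^ (2 *ℕ (n ∸ 2))) w)
  -- (4q - √(8q) - 33/2) q^{n-2}
  ⊎ ((¬ Small q × ¬ ClassA q × ¬ ClassB q × ¬ ClassC q)
      × SqrtBound ((8 *ℕ q ∸ 33) *ℕ q ^ (n ∸ 2)) (32 *ℕ q *ℕ q ^ (2 *ℕ (n ∸ 2))) w)

module Geometry (F : FiniteField) where
  open FiniteField F

  Vector : ℕ → Set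
  Vector m = Vec Carrier m

  Fam : ℕ → ℕ → Set
  Fam m k = Vec (Vector m) k

  zeroV : ∀ {m} → Vector m
  zeroV = replicate _ 0#

  _+V_ : ∀ {m} → Vector m → Vector m → Vector m
  _+V_ = zipWith _+_

  _·V_ : ∀ {m} → Carrier → Vector m → Vector m
  a ·V v = Data.Vec.map (a *_) v

  lincomb : ∀ {m k} → Vector k → Fam m k → Vector m
  lincomb []       []       = zeroV
  lincomb (a ∷ as) (v ∷ vs) = (a ·V v) +V lincomb as vs

  InSpan : ∀ {m k} → Fam m k → Vector m → Set
  InSpan {k = k} vs x = ∃ λ (a : Vector k) → lincomb a vs ≡ x

  Independent : ∀ {m k} → Fam m k → Set
  Independent {k = k} vs = ∀ (a : Vector k) → lincomb a vs ≡ zeroV → a ≡ zeroV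

  allVecs : (k : ℕ) → List (Vector k)
  allVecs zero    = [ [] ]
  allVecs (suc k) = cartesianProductWith _∷_ elems (allVecs k)

  _≟V_ : ∀ {m} → DecidableEquality (Vector m)
  _≟V_ = VecP.≡-dec _≟_

  inSpanᵇ : ∀ {m k} → Fam m k → Vector m → Bool
  inSpanᵇ {k = k} vs x = any (λ a → isYes (lincomb a vs ≟V x)) (allVecs k)

  normalised : ∀ {m} → Vector m → Bool
  normalised []       = false
  normalised (x ∷ xs) with x ≟ 0#
  ... | yes _ = normalised xs
  ... | no  _ = isYes (x ≟ 1#)

  -- points of PG(m,q): normalised non-zero vectors of F^{m+1}
  Point : ℕ → Set
  Point m = Σ (Vector (suc m)) (λ v → T (normalised v))

  vec : ∀ {m} → Point m → Vector (suc m)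
  vec = proj₁

  toPoint : ∀ {m} → Vector (suc m) → Maybe (Point m)
  toPoint v with T? (normalised v)
  ... | yes t = just (v , t)
  ... | no  _ = nothing

  allPoints : (m : ℕ) → List (Point m)
  allPoints m = mapMaybe toPoint (allVecs (suc m))

  _∈ₛ_ : ∀ {m k} → Point m → Fam (suc m) k → Set
  P ∈ₛ vs = InSpan vs (vec P)

  Collinear : ∀ {m} → Point m → Point m → Point m → Set
  Collinear P Q R = ¬ Independent (vec P ∷ vec Q ∷ vec R ∷ [])

  -- (d)-space of PG(m,q): spanned by d+1 independent vectors
  -- a plane of PG(m,q)
  IsPlane : ∀ {m} → Fam (suc m) 3 → Set
  IsPlane π = Independent π

  IsLineIn : ∀ {m} → Fam (suc m) 2 → Fam (suc m) 3 → Set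
  IsLineIn {m} ℓ π = Independent ℓ × (∀ (P : Point m) → P ∈ₛ ℓ → P ∈ₛ π)

  DisjointSpaces : ∀ {m k l} → Fam (suc m) k → Fam (suc m) l → Set
  DisjointSpaces {m} A B = ¬ (∃ λ (P : Point m) → P ∈ₛ A × P ∈ₛ B)

  search : ℕ → Carrier → ℕ
  search zero    x = 0
  search (suc k) x with ι k ≟ x
  ... | yes _ = k
  ... | no  _ = search k x

-- The code C_{n-1}(n,q) over F_p (F_p = Fin p with arithmetic mod p)

module Code (F : FiniteField) (p : ℕ) (pr : Prime p) where
  open FiniteField F
  open Geometry F

  instance
    p≢0 : NonZero p
    p≢0 = prime⇒nonZero pr

  [_]ₚ : ℕ → Fin p
  [ k ]ₚ = k mod p

  Word : ℕ → Set
  Word m = Point m → Fin p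

  χ : ∀ {m k} → Fam (suc m) k → Point m → ℕ
  χ vs P = if inSpanᵇ vs (vec P) then 1 else 0

  wt : ∀ {m} → Word m → ℕ
  wt {m} c = length (filterᵇ (λ P → not (isYes (toℕ (c P) ℕ.≟ 0))) (allPoints m))

  -- c ∈ C_{m-1}(m,q): F_p-linear combination of hyperplanes
  -- (a hyperplane of PG(m,q) is spanned by m independent vectors)
  InCode : (m : ℕ) → Word m → Set
  InCode m c = ∃ λ (L : List (Fin p × Fam (suc m) m)) →
      All (λ t → Independent (proj₂ t)) L
    × (∀ (P : Point m) → c P ≡ [ sum (map (λ t → toℕ (proj₁ t) *ℕ χ (proj₂ t) P) L) ]ₚ)

  CombOfLines : ∀ {m} → Word m → Fam (suc m) 3 → (ℓ₁ ℓ₂ ℓ₃ : Fam (suc m) 2) → Set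
  CombOfLines {m} c π ℓ₁ ℓ₂ ℓ₃ = ∃ λ (λ₁ : Fin p) → ∃ λ (λ₂ : Fin p) → ∃ λ (λ₃ : Fin p) →
    ∀ (P : Point m) → P ∈ₛ π →
      c P ≡ [ toℕ λ₁ *ℕ χ ℓ₁ P +ℕ toℕ λ₂ *ℕ χ ℓ₂ P +ℕ toℕ λ₃ *ℕ χ ℓ₃ P ]ₚ

  TypeTriangle : ∀ {m} → Word m → Fam (suc m) 3 → Set
  TypeTriangle {m} c π = ∃ λ ℓ₁ → ∃ λ ℓ₂ → ∃ λ ℓ₃ →
      IsLineIn ℓ₁ π × IsLineIn ℓ₂ π × IsLineIn ℓ₃ π
    × ¬ (∃ λ (P : Point m) → P ∈ₛ ℓ₁ × P ∈ₛ ℓ₂ × P ∈ₛ ℓ₃)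
    × CombOfLines c π ℓ₁ ℓ₂ ℓ₃

  TypeStar : ∀ {m} → Word m → Fam (suc m) 3 → Set
  TypeStar {m} c π = ∃ λ ℓ₁ → ∃ λ ℓ₂ → ∃ λ ℓ₃ →
      IsLineIn ℓ₁ π × IsLineIn ℓ₂ π × IsLineIn ℓ₃ π
    × (∃ λ (P : Point m) → P ∈ₛ ℓ₁ × P ∈ₛ ℓ₂ × P ∈ₛ ℓ₃)
    × CombOfLines c π ℓ₁ ℓ₂ ℓ₃

  -- field element (of the prime field F_p = F when q = p) as a number < p
  toFp : Carrier → ℕ
  toFp x = search p x

  [_≈_] : Carrier → Carrier → ℕ
  [ x ≈ y ] = if isYes (x ≟ y) then 1 else 0

  -- the function c₀ on PG(2,p) (values as numbers, reduced mod p later):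
  -- c₀(0,1,a) = a, c₀(1,0,b) = b, c₀(1,1,e) = -e, 0 elsewhere
  c₀ : Point 2 → ℕ
  c₀ ((x₀ ∷ x₁ ∷ x₂ ∷ []) , _) with x₀ ≟ 0# | x₀ ≟ 1# | x₁ ≟ 0# | x₁ ≟ 1#
  ... | yes _ | _     | _     | yes _ = toFp x₂
  ... | no  _ | yes _ | yes _ | _     = toFp x₂
  ... | no  _ | yes _ | no  _ | yes _ = p ∸ toFp x₂
  ... | _     | _     | _     | _     = 0

  X₀ X₁ : Point 2 → Carrier
  X₀ ((x₀ ∷ _ ∷ _ ∷ []) , _) = x₀
  X₁ ((_ ∷ x₁ ∷ _ ∷ []) , _) = x₁

  -- a collineation from PG(2,q) onto the plane π of PG(m,q)
  -- (identification of π with PG(2,q) composed with a collineation σ)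
  IsCollineationOnto : ∀ {m} → (Point 2 → Point m) → Fam (suc m) 3 → Set
  IsCollineationOnto {m} φ π =
      (∀ x y → φ x ≡ φ y → x ≡ y)
    × (∀ x → φ x ∈ₛ π)
    × (∀ (P : Point m) → P ∈ₛ π → ∃ λ x → φ x ≡ P)
    × (∀ x y z → (Collinear x y z → Collinear (φ x) (φ y) (φ z))
                × (Collinear (φ x) (φ y) (φ z) → Collinear x y z))

  -- type T^odd (q = p an odd prime):
  -- c|π = (γ c₀ + λ m + λ' m' + λ'' m'')^σ,  m: X₀=0, m': X₁=0, m'': X₀=X₁
  TypeOdd : ∀ {m} → Word m → Fam (suc m) 3 → Set
  TypeOdd {m} c π = q ≡ p × p ≢ 2 ×
    ∃ λ (φ : Point 2 → Point m) → IsCollineationOnto φ π ×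
    ∃ λ (γ : Fin p) → toℕ γ ≢ 0 ×
    ∃ λ (λ₀ : Fin p) → ∃ λ (λ₁ : Fin p) → ∃ λ (λ₂ : Fin p) →
    ∀ (x : Point 2) →
      c (φ x) ≡ [ toℕ γ *ℕ c₀ x
                  +ℕ toℕ λ₀ *ℕ [ X₀ x ≈ 0# ]
                  +ℕ toℕ λ₁ *ℕ [ X₁ x ≈ 0# ]
                  +ℕ toℕ λ₂ *ℕ [ X₀ x ≈ X₁ x ] ]ₚ

  sumOverPlane : ∀ {m k} → Word m → Fam (suc m) 3 → Fam (suc m) k → Point m → Fin p
  sumOverPlane {m} c π κ Q =
    [ sum (map (λ P → toℕ (c P) *ℕ χ (vec P ∷ κ) Q)
               (filterᵇ (λ P → inSpanᵇ π (vec P)) (allPoints m))) ]ₚ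

{-# OPTIONS --safe #-}

-- A code word is extended to a function f = Σ λᵢ [kᵢ = 0] on the vectors of F^{n+1}; its sum over an affine line
-- u + ⟨v⟩ is f(0) − f(v).
--
-- For q ≥ 26, a rank argument (pairing the restriction of f to a plane with products of affine functions) shows that a
-- line on which f differs from a constant in more than 3 and fewer than q − 3 places forces many nonzero values in every
-- plane containing it; the upper bound on the weight excludes such lines.  Double counting then makes every subspace
-- light or heavy, and induction on the dimension puts each support point in a heavy hyperplane, so that at most three
-- hyperplanes cover the support.  If they are independent, the line sums express f by their indicators.  If they form a
-- pencil, f is given on them by an additive map φ on the axis: φ = 0 yields concurrent lines, and φ ≠ 0 forces q = p and
-- yields T^odd.
--
-- For q = 2 a word is an affine function, for q = 3 a constant minus a quadratic form, which is treated by completing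
-- squares.  For the remaining q the two bounds on the weight contradict each other.
--
-- In all cases f depends on three coordinates only: it is a cone over its restriction to a plane π, with vertex κ the
-- common kernel of the coordinates.
module Submission where

open import Defs
open import Data.Nat using (ℕ; zero; suc; _≤_; _<_; _+_; _*_; _∸_; _^_; z≤n; s≤s; _≤?_; _<?_; NonZero; >-nonZero)
import Data.Nat.Properties as ℕ
open import Data.Nat.Primality using (Prime)
open import Data.Product using (∃; _×_; _,_; proj₁; proj₂)
open import Data.Sum using (_⊎_; inj₁; inj₂)
open import Data.Empty using (⊥; ⊥-elim)
open import Data.List using (List; []; _∷_; length; map; filter; _++_; upTo; cartesianProductWith; cartesianProduct; take; drop; filterᵇ; mapMaybe)
import Data.List.Properties as List
open import Data.List.Membership.Propositional using (_∈_; lose; find)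
open import Data.List.Membership.Propositional.Properties using (∈-map⁺; ∈-map⁻; ∈-filter⁺; ∈-filter⁻; ∈-∃++; ∈-++⁻; ∈-++⁺ˡ; ∈-++⁺ʳ; ∈-cartesianProductWith⁺)
open import Data.List.Relation.Unary.Any as Any using (Any; here; there)
open import Data.List.Relation.Unary.All as All using (All; []; _∷_)
open import Data.List.Relation.Unary.AllPairs as AllPairs using (AllPairs; []; _∷_)
open import Data.List.Relation.Unary.Unique.Propositional using (Unique)
import Data.List.Relation.Unary.Unique.Propositional.Properties as Unique
open import Data.List.Relation.Binary.Permutation.Propositional using (_↭_; prep; swap; ↭-sym; ↭-trans; ↭⇒↭ₛ)
open import Data.List.Relation.Binary.Permutation.Propositional.Properties using (shift; ∈-resp-↭; ↭-length)
open import Relation.Nullary using (¬_; Dec; yes; no)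
open import Relation.Nullary.Decidable using (isYes)
open import Relation.Unary using () renaming (Decidable to Decidable₁)
open import Relation.Binary.PropositionalEquality using (_≡_; _≢_; refl; sym; trans; cong; cong₂; subst; setoid; module ≡-Reasoning)
open import Algebra.Structures using (IsCommutativeMonoid)
open import Function using (_∘_; id; case_of_)
open import Algebra.Bundles using (RawRing; CommutativeRing)
import Algebra.Solver.Ring as RingSolver
import Algebra.Solver.Ring.AlmostCommutativeRing as ACR
import Algebra.Properties.Ring as RingProperties
open import Data.Maybe using (Maybe; just; nothing)
open import Relation.Nullary.Decidable using (¬?; _×-dec_)
open import Data.Nat.Tactic.RingSolver using (solve-∀)
open import Data.Vec using (Vec; []; _∷_)
import Data.Vec as Vec
import Data.Vec.Properties as Vec
open import Data.Fin using (Fin; toℕ)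
import Data.Fin as Fin
import Data.Fin.Properties as Fin
open import Data.Bool using (Bool; true; false; T; not; if_then_else_)
open import Data.Bool.Properties using (T?; T-irrelevant)
open import Data.List.Relation.Unary.Any.Properties using (any⁺; any⁻)
open import Data.Nat.ListAction using (sum)
open import Relation.Binary.Definitions using (tri<; tri≈; tri>)
import Data.List.Relation.Unary.AllPairs.Properties as AllPairs
import Data.List.Relation.Unary.All.Properties as All
open import Data.Nat.Solver using (module +-*-Solver)
open +-*-Solver using () renaming (solve to solveₙ; _:+_ to _⟨+⟩_; _:*_ to _⟨*⟩_; _:=_ to _⟨=⟩_; con to #_)

-- Everything is computed in F: words become functions on vectors with values in the image of the
-- integers modulo p, so that polynomial sums are available; the zero vector, where f is the sum of
-- all coefficients, supplies the constant in the line sums.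
--
-- The upper bounds for q ≥ 26 enter only through wt < 4(q - 7) q^(n-2), and 4(q - 7) is what the
-- rank argument yields for four exceptional places on a line. Double counting makes the proportion
-- of nonzero or of zero values about 3/q at most; light and heavy use 16/5 and 7/2 to absorb error
-- terms. The threshold comes from comparing a light space with four heavy hyperplanes: 4(q - 7/2) -
-- 6 ≤ 16q/5 means q ≤ 25.
--
-- The obstacle in the induction is that it yields a heavy subspace A of codimension two. If no
-- hyperplane through A is heavy, each of the q + 1 is light, and its support off A lies on two
-- further hyperplanes. By averaging, some support point R of A is on at most two of all these, and
-- a general plane through R then has no line through R with four support points, which the rank
-- argument forbids.

refute : ∀ {A B} C → A ≡ B + suc C → A ≤ B → ⊥
refute {B = B} C e le = ℕ.m+1+n≰m B (subst (_≤ B) e le)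

-- Duplicate-free lists

module _ {A : Set} where
  open import Data.List.Relation.Binary.Permutation.Setoid.Properties (setoid A) using (Unique-resp-↭)

  unique-∉ : ∀ {x : A} {xs} → Unique (x ∷ xs) → ¬ x ∈ xs
  unique-∉ (px ∷ _) x∈ = All.lookup px x∈ refl

  unique-⊆-length : ∀ {xs ys : List A} → Unique xs → (∀ {x} → x ∈ xs → x ∈ ys) → length xs ≤ length ys
  unique-⊆-length {[]}     _        _   = z≤n
  unique-⊆-length {x ∷ xs} (px ∷ u) sub with ∈-∃++ (sub (here refl))
  ... | as , bs , refl = ℕ.≤-trans (s≤s (unique-⊆-length u sub′)) (ℕ.≤-reflexive (sym (↭-length (shift x as bs))))
    where
    sub′ : ∀ {y} → y ∈ xs → y ∈ as ++ bs
    sub′ {y} y∈ with ∈-resp-↭ (shift x as bs) (sub (there y∈))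
    ... | here y≡x  = ⊥-elim (unique-∉ (px ∷ u) (subst (_∈ xs) y≡x y∈))
    ... | there y∈′ = y∈′

  unique-↭ : ∀ {xs ys : List A} → Unique xs → Unique ys → (∀ {x} → x ∈ xs → x ∈ ys) → (∀ {x} → x ∈ ys → x ∈ xs) → xs ↭ ys
  unique-↭ {[]}     {[]}    _ _ _ _ = _↭_.refl
  unique-↭ {[]}     {_ ∷ _} _ _ _ sup with () ← sup (here refl)
  unique-↭ {x ∷ xs} {ys} (px ∷ u) v sub sup with ∈-∃++ (sub (here refl))
  ... | as , bs , refl = ↭-trans (prep x (unique-↭ u (AllPairs.tail v′) sub′ sup′)) (↭-sym (shift x as bs))
    where
    v′ : Unique (x ∷ as ++ bs)
    v′ = Unique-resp-↭ (↭⇒↭ₛ (shift x as bs)) v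
    sub′ : ∀ {y} → y ∈ xs → y ∈ as ++ bs
    sub′ {y} y∈ with ∈-resp-↭ (shift x as bs) (sub (there y∈))
    ... | here y≡x  = ⊥-elim (unique-∉ (px ∷ u) (subst (_∈ xs) y≡x y∈))
    ... | there y∈′ = y∈′
    sup′ : ∀ {y} → y ∈ as ++ bs → y ∈ xs
    sup′ {y} y∈ with sup (∈-resp-↭ (↭-sym (shift x as bs)) (there y∈))
    ... | here y≡x  = ⊥-elim (unique-∉ v′ (subst (_∈ (as ++ bs)) y≡x y∈))
    ... | there y∈′ = y∈′

𝟏 : {P : Set} → Dec P → ℕ
𝟏 (yes _) = 1
𝟏 (no _)  = 0

-- Finite sums over lists

module FinSum {M : Set} {_∙_ : M → M → M} {ε : M} (cm : IsCommutativeMonoid _≡_ _∙_ ε) where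
  open IsCommutativeMonoid cm using (assoc; comm; identityˡ; identityʳ)

  ∑ : {A : Set} → List A → (A → M) → M
  ∑ []       f = ε
  ∑ (x ∷ xs) f = f x ∙ ∑ xs f

  private
    interchange : ∀ a b c d → (a ∙ b) ∙ (c ∙ d) ≡ (a ∙ c) ∙ (b ∙ d)
    interchange a b c d = begin
      (a ∙ b) ∙ (c ∙ d)  ≡⟨ assoc a b (c ∙ d) ⟩
      a ∙ (b ∙ (c ∙ d))  ≡⟨ cong (a ∙_) (sym (assoc b c d)) ⟩
      a ∙ ((b ∙ c) ∙ d)  ≡⟨ cong (λ z → a ∙ (z ∙ d)) (comm b c) ⟩
      a ∙ ((c ∙ b) ∙ d)  ≡⟨ cong (a ∙_) (assoc c b d) ⟩
      a ∙ (c ∙ (b ∙ d))  ≡⟨ sym (assoc a c (b ∙ d)) ⟩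
      (a ∙ c) ∙ (b ∙ d)  ∎
      where open ≡-Reasoning

  ∑-cong∈ : {A : Set} (xs : List A) {f g : A → M} → (∀ {x} → x ∈ xs → f x ≡ g x) → ∑ xs f ≡ ∑ xs g
  ∑-cong∈ []       e = refl
  ∑-cong∈ (x ∷ xs) e = cong₂ _∙_ (e (here refl)) (∑-cong∈ xs (e ∘ there))

  ∑-cong : {A : Set} (xs : List A) {f g : A → M} → (∀ x → f x ≡ g x) → ∑ xs f ≡ ∑ xs g
  ∑-cong xs e = ∑-cong∈ xs (λ {x} _ → e x)

  ∑-ε : {A : Set} (xs : List A) → ∑ xs (λ _ → ε) ≡ ε
  ∑-ε []       = refl
  ∑-ε (x ∷ xs) = trans (identityˡ _) (∑-ε xs)

  ∑-zero : {A : Set} (xs : List A) {f : A → M} → (∀ x → f x ≡ ε) → ∑ xs f ≡ ε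
  ∑-zero xs e = trans (∑-cong xs e) (∑-ε xs)

  ∑-∙ : {A : Set} (xs : List A) (f g : A → M) → ∑ xs (λ x → f x ∙ g x) ≡ ∑ xs f ∙ ∑ xs g
  ∑-∙ []       f g = sym (identityˡ ε)
  ∑-∙ (x ∷ xs) f g = trans (cong ((f x ∙ g x) ∙_) (∑-∙ xs f g)) (interchange _ _ _ _)

  ∑-swap : {A B : Set} (xs : List A) (ys : List B) (f : A → B → M) →
           ∑ xs (λ x → ∑ ys (f x)) ≡ ∑ ys (λ y → ∑ xs (λ x → f x y))
  ∑-swap []       ys f = sym (∑-ε ys)
  ∑-swap (x ∷ xs) ys f = trans (cong (∑ ys (f x) ∙_) (∑-swap xs ys f)) (sym (∑-∙ ys (f x) _))

  ∑-++ : {A : Set} (xs ys : List A) (f : A → M) → ∑ (xs ++ ys) f ≡ ∑ xs f ∙ ∑ ys f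
  ∑-++ []       ys f = sym (identityˡ _)
  ∑-++ (x ∷ xs) ys f = trans (cong (f x ∙_) (∑-++ xs ys f)) (sym (assoc _ _ _))

  ∑-map : {A B : Set} (g : A → B) (xs : List A) (f : B → M) → ∑ (map g xs) f ≡ ∑ xs (f ∘ g)
  ∑-map g []       f = refl
  ∑-map g (x ∷ xs) f = cong (f (g x) ∙_) (∑-map g xs f)

  ∑-× : {A B C : Set} (g : A → B → C) (xs : List A) (ys : List B) (f : C → M) →
        ∑ (cartesianProductWith g xs ys) f ≡ ∑ xs (λ x → ∑ ys (λ y → f (g x y)))
  ∑-× g []       ys f = refl
  ∑-× g (x ∷ xs) ys f = trans (∑-++ (map (g x) ys) _ f) (cong₂ _∙_ (∑-map (g x) ys f) (∑-× g xs ys f))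

  ∑-↭ : {A : Set} {xs ys : List A} (f : A → M) → xs ↭ ys → ∑ xs f ≡ ∑ ys f
  ∑-↭ f _↭_.refl      = refl
  ∑-↭ f (prep x p)    = cong (f x ∙_) (∑-↭ f p)
  ∑-↭ f (swap x y p)  = trans (sym (assoc _ _ _)) (trans (cong₂ _∙_ (comm _ _) (∑-↭ f p)) (assoc _ _ _))
  ∑-↭ f (_↭_.trans p r) = trans (∑-↭ f p) (∑-↭ f r)

  -- The summand may change together with the range, which is how a sum over a support becomes a sum
  -- over everything with an indicator.
  ∑-filter : {A : Set} {P : A → Set} (P? : Decidable₁ P) (xs : List A) (f : A → M) {g : A → M} →
             (∀ x → P x → f x ≡ g x) → (∀ x → ¬ P x → g x ≡ ε) → ∑ (filter P? xs) f ≡ ∑ xs g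
  ∑-filter P? []       f e₁ e₀ = refl
  ∑-filter P? (x ∷ xs) f {g} e₁ e₀ with P? x
  ... | yes px = cong₂ _∙_ (e₁ x px) (∑-filter P? xs f e₁ e₀)
  ... | no ¬px = trans (∑-filter P? xs f e₁ e₀) (sym (trans (cong (_∙ ∑ xs g) (e₀ x ¬px)) (identityˡ _)))

  ∑-single∈ : {A : Set} {xs : List A} (a : A) (f : A → M) → Unique xs → a ∈ xs → (∀ {x} → x ∈ xs → x ≢ a → f x ≡ ε) → ∑ xs f ≡ f a
  ∑-single∈ {xs = x ∷ xs} a f u (here refl) e =
    trans (cong (f x ∙_) (trans (∑-cong∈ xs (λ {y} y∈ → e (there y∈) (λ { refl → unique-∉ u y∈ }))) (∑-ε xs))) (identityʳ _)
  ∑-single∈ {xs = x ∷ xs} a f u (there a∈) e =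
    trans (cong (_∙ ∑ xs f) (e (here refl) (λ { refl → unique-∉ u a∈ }))) (trans (identityˡ _) (∑-single∈ a f (AllPairs.tail u) a∈ (e ∘ there)))

  ∑-single : {A : Set} {xs : List A} (a : A) (f : A → M) → Unique xs → a ∈ xs → (∀ x → x ≢ a → f x ≡ ε) → ∑ xs f ≡ f a
  ∑-single a f u a∈ e = ∑-single∈ a f u a∈ (λ {x} _ → e x)

  ∑-bij : {A : Set} {xs : List A} (g h : A → A) (f : A → M) → Unique xs →
          (∀ {x} → x ∈ xs → g x ∈ xs) → (∀ {x} → x ∈ xs → h x ∈ xs) →
          (∀ x → h (g x) ≡ x) → (∀ x → g (h x) ≡ x) → ∑ xs (f ∘ g) ≡ ∑ xs f
  ∑-bij {A} {xs} g h f u g∈ h∈ hg gh = trans (sym (∑-map g xs f)) (∑-↭ f (unique-↭ u′ u to from))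
    where
    u′ : Unique (map g xs)
    u′ = Unique.map⁺ (λ {x} {y} e → trans (sym (hg x)) (trans (cong h e) (hg y))) u
    to : ∀ {y} → y ∈ map g xs → y ∈ xs
    to y∈ with ∈-map⁻ g y∈
    ... | x , x∈ , refl = g∈ x∈
    from : ∀ {y} → y ∈ xs → y ∈ map g xs
    from {y} y∈ = subst (_∈ map g xs) (gh y) (∈-map⁺ g (h∈ y∈))

module N where
  open FinSum ℕ.+-0-isCommutativeMonoid public

  ∑-mono∈ : {A : Set} (xs : List A) {f g : A → ℕ} → (∀ {x} → x ∈ xs → f x ≤ g x) → ∑ xs f ≤ ∑ xs g
  ∑-mono∈ []       e = z≤n
  ∑-mono∈ (x ∷ xs) e = ℕ.+-mono-≤ (e (here refl)) (∑-mono∈ xs (e ∘ there))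

  ∑-mono : {A : Set} (xs : List A) {f g : A → ℕ} → (∀ x → f x ≤ g x) → ∑ xs f ≤ ∑ xs g
  ∑-mono xs e = ∑-mono∈ xs (λ {x} _ → e x)

  ∑-const : {A : Set} (xs : List A) (c : ℕ) → ∑ xs (λ _ → c) ≡ length xs * c
  ∑-const []       c = refl
  ∑-const (x ∷ xs) c = cong (c +_) (∑-const xs c)

  ∑-*ˡ : {A : Set} (xs : List A) (c : ℕ) (f : A → ℕ) → ∑ xs (λ x → c * f x) ≡ c * ∑ xs f
  ∑-*ˡ []       c f = sym (ℕ.*-zeroʳ c)
  ∑-*ˡ (x ∷ xs) c f = trans (cong (c * f x +_) (∑-*ˡ xs c f)) (sym (ℕ.*-distribˡ-+ c (f x) _))

  ∑-*ʳ : {A : Set} (xs : List A) (c : ℕ) (f : A → ℕ) → ∑ xs (λ x → f x * c) ≡ ∑ xs f * c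
  ∑-*ʳ xs c f = trans (∑-cong xs (λ x → ℕ.*-comm (f x) c)) (trans (∑-*ˡ xs c f) (ℕ.*-comm c _))

  -- The averaging principle: it produces a place where one count lies below another.
  ∑-<-∃ : {A : Set} (xs : List A) {f g : A → ℕ} → ∑ xs f < ∑ xs g → ∃ λ x → x ∈ xs × f x < g x
  ∑-<-∃ []       ()
  ∑-<-∃ (x ∷ xs) {f} {g} lt with f x <? g x
  ... | yes p = x , here refl , p
  ... | no ¬p with ∑-<-∃ xs {f} {g} (ℕ.≰⇒> (λ le → ℕ.<⇒≱ lt (ℕ.+-mono-≤ (ℕ.≮⇒≥ ¬p) le)))
  ... | y , y∈ , fy<gy = y , there y∈ , fy<gy

  ∑-member : {A : Set} {xs : List A} {x : A} (f : A → ℕ) → x ∈ xs → f x ≤ ∑ xs f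
  ∑-member {xs = x ∷ xs} f (here refl) = ℕ.m≤m+n (f x) _
  ∑-member {xs = y ∷ xs} f (there x∈)  = ℕ.≤-trans (∑-member f x∈) (ℕ.m≤n+m _ (f y))

length-× : {A B C : Set} (g : A → B → C) (xs : List A) (ys : List B) → length (cartesianProductWith g xs ys) ≡ length xs * length ys
length-× g []       ys = refl
length-× g (x ∷ xs) ys = trans (List.length-++ (map (g x) ys)) (cong₂ _+_ (List.length-map (g x) ys) (length-× g xs ys))

-- Arithmetic and polynomial sums in the finite field

module Field (F : FiniteField) where
  open FiniteField F public
    using (isCommutativeRing; 0≢1; inverse; elems; elems-complete; elems-unique; q; ι)
    renaming (Carrier to 𝔽; _+_ to _⊞_; _*_ to _⊠_; -_ to ⊟_; 0# to 0F; 1# to 1F; _≟_ to _≟F_)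

  commutativeRing : CommutativeRing _ _
  commutativeRing = record { isCommutativeRing = isCommutativeRing }

  open CommutativeRing commutativeRing public
    using (+-assoc; +-comm; +-identityˡ; +-identityʳ; *-assoc; *-comm; *-identityˡ; *-identityʳ;
           distribˡ; distribʳ; zeroˡ; zeroʳ; -‿inverseˡ; -‿inverseʳ; +-isCommutativeMonoid; *-isCommutativeMonoid)
  private module RP = RingProperties (CommutativeRing.ring commutativeRing)

  ι-+ : ∀ a b → ι (a + b) ≡ ι a ⊞ ι b
  ι-+ zero    b = sym (+-identityˡ _)
  ι-+ (suc a) b = trans (cong (1F ⊞_) (ι-+ a b)) (sym (+-assoc _ _ _))

  ι-* : ∀ a b → ι (a * b) ≡ ι a ⊠ ι b
  ι-* zero    b = sym (zeroˡ _)
  ι-* (suc a) b = trans (ι-+ b (a * b)) (trans (cong₂ _⊞_ (sym (*-identityˡ _)) (ι-* a b)) (sym (distribʳ _ _ _)))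

  module Solver where
    -- The pair (a , b) stands for the integer a - b.
    coefficients : RawRing _ _
    coefficients = record
      { Carrier = ℕ × ℕ
      ; _≈_ = _≡_
      ; _+_ = λ { (a , b) (c , d) → a + c , b + d }
      ; _*_ = λ { (a , b) (c , d) → a * c + b * d , a * d + b * c }
      ; -_  = λ { (a , b) → b , a }
      ; 0#  = 0 , 0
      ; 1#  = 1 , 0
      }

    -- The coefficients 0 and 1 are interpreted literally as `0F` and `1F`, so that `𝟎` and `𝟙`
    -- match goals definitionally; every other coefficient is a difference of two numerals.
    ⟦_⟧d ⟦_⟧c : ℕ × ℕ → 𝔽
    ⟦ a , b ⟧d = ι a ⊞ ⊟ ι b
    ⟦ 0 , 0 ⟧c = 0F
    ⟦ 1 , 0 ⟧c = 1F
    ⟦ a , b ⟧c = ⟦ a , b ⟧d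

    c≡d : ∀ x → ⟦ x ⟧c ≡ ⟦ x ⟧d
    c≡d (0 , 0)           = sym (-‿inverseʳ 0F)
    c≡d (0 , suc b)       = refl
    c≡d (1 , 0)           = sym (trans (cong₂ _⊞_ (+-identityʳ 1F) RP.-0#≈0#) (+-identityʳ 1F))
    c≡d (1 , suc b)       = refl
    c≡d (suc (suc a) , b) = refl

    interchange : ∀ a b c d → (a ⊞ b) ⊞ (c ⊞ d) ≡ (a ⊞ c) ⊞ (b ⊞ d)
    interchange a b c d = trans (+-assoc a b _) (trans (cong (a ⊞_) (trans (sym (+-assoc b c d))
      (trans (cong (_⊞ d) (+-comm b c)) (+-assoc c b d)))) (sym (+-assoc a c _)))

    +-homo : ∀ x y → ⟦ RawRing._+_ coefficients x y ⟧d ≡ ⟦ x ⟧d ⊞ ⟦ y ⟧d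
    +-homo (a , b) (c , d) = trans (cong₂ _⊞_ (ι-+ a c) (trans (cong ⊟_ (ι-+ b d)) (sym (RP.-‿+-comm (ι b) (ι d)))))
      (interchange _ _ _ _)

    *-homo : ∀ x y → ⟦ RawRing._*_ coefficients x y ⟧d ≡ ⟦ x ⟧d ⊠ ⟦ y ⟧d
    *-homo (a , b) (c , d) = begin
      ι (a * c + b * d) ⊞ ⊟ ι (a * d + b * c)
        ≡⟨ cong₂ (λ x y → x ⊞ ⊟ y) (trans (ι-+ (a * c) _) (cong₂ _⊞_ (ι-* a c) (ι-* b d)))
                                   (trans (ι-+ (a * d) _) (cong₂ _⊞_ (ι-* a d) (ι-* b c))) ⟩
      (A ⊠ C ⊞ B ⊠ D) ⊞ ⊟ (A ⊠ D ⊞ B ⊠ C)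
        ≡⟨ cong₂ _⊞_ (cong (A ⊠ C ⊞_) (sym (trans (sym (RP.-‿distribˡ-* B (⊟ D)))
             (trans (cong ⊟_ (sym (RP.-‿distribʳ-* B D))) (RP.-‿involutive _)))))
             (trans (sym (RP.-‿+-comm _ _)) (cong₂ _⊞_ (RP.-‿distribʳ-* A D) (RP.-‿distribˡ-* B C))) ⟩
      (A ⊠ C ⊞ ⊟ B ⊠ ⊟ D) ⊞ (A ⊠ ⊟ D ⊞ ⊟ B ⊠ C)
        ≡⟨ trans (interchange _ _ _ _) (cong₂ _⊞_ (sym (distribˡ A C (⊟ D))) (trans (+-comm _ _) (sym (distribˡ (⊟ B) C (⊟ D))))) ⟩
      A ⊠ (C ⊞ ⊟ D) ⊞ ⊟ B ⊠ (C ⊞ ⊟ D)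
        ≡⟨ sym (distribʳ _ _ _) ⟩
      (A ⊞ ⊟ B) ⊠ (C ⊞ ⊟ D) ∎
      where
      open ≡-Reasoning
      A B C D : 𝔽
      A = ι a
      B = ι b
      C = ι c
      D = ι d

    neg-homo : ∀ a b → ι b ⊞ ⊟ ι a ≡ ⊟ (ι a ⊞ ⊟ ι b)
    neg-homo a b = trans (+-comm _ _) (trans (cong (⊟ ι a ⊞_) (sym (RP.-‿involutive (ι b)))) (RP.-‿+-comm (ι a) (⊟ ι b)))

    morphism : coefficients ACR.-Raw-AlmostCommutative⟶ ACR.fromCommutativeRing commutativeRing
    morphism = record
      { ⟦_⟧ = ⟦_⟧c
      ; +-homo = λ x y → trans (c≡d (RawRing._+_ coefficients x y)) (trans (+-homo x y) (sym (cong₂ _⊞_ (c≡d x) (c≡d y))))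
      ; *-homo = λ x y → trans (c≡d (RawRing._*_ coefficients x y)) (trans (*-homo x y) (sym (cong₂ _⊠_ (c≡d x) (c≡d y))))
      ; -‿homo = λ { (a , b) → trans (c≡d (b , a)) (trans (neg-homo a b) (cong ⊟_ (sym (c≡d (a , b))))) }
      ; 0-homo = refl
      ; 1-homo = refl
      }

    -- Distinct integers may agree in F, so only a positive answer carries a proof; the test
    -- compares a - b with c - d crosswise.
    weak≟ : ∀ x y → Maybe (⟦ x ⟧c ≡ ⟦ y ⟧c)
    weak≟ (a , b) (c , d) with a + d ℕ.≟ c + b
    ... | no _  = nothing
    ... | yes e = just (begin
      ⟦ a , b ⟧c                           ≡⟨ c≡d (a , b) ⟩
      ι a ⊞ ⊟ ι b                         ≡⟨ sym (+-identityʳ _) ⟩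
      (ι a ⊞ ⊟ ι b) ⊞ 0F                   ≡⟨ cong ((ι a ⊞ ⊟ ι b) ⊞_) (sym (-‿inverseʳ (ι d))) ⟩
      (ι a ⊞ ⊟ ι b) ⊞ (ι d ⊞ ⊟ ι d)        ≡⟨ interchange _ _ _ _ ⟩
      (ι a ⊞ ι d) ⊞ (⊟ ι b ⊞ ⊟ ι d)        ≡⟨ cong (_⊞ (⊟ ι b ⊞ ⊟ ι d)) (trans (sym (ι-+ a d)) (trans (cong ι e) (ι-+ c b))) ⟩
      (ι c ⊞ ι b) ⊞ (⊟ ι b ⊞ ⊟ ι d)        ≡⟨ cong ((ι c ⊞ ι b) ⊞_) (+-comm _ _) ⟩
      (ι c ⊞ ι b) ⊞ (⊟ ι d ⊞ ⊟ ι b)        ≡⟨ interchange _ _ _ _ ⟩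
      (ι c ⊞ ⊟ ι d) ⊞ (ι b ⊞ ⊟ ι b)        ≡⟨ cong ((ι c ⊞ ⊟ ι d) ⊞_) (-‿inverseʳ (ι b)) ⟩
      (ι c ⊞ ⊟ ι d) ⊞ 0F                   ≡⟨ trans (+-identityʳ _) (sym (c≡d (c , d))) ⟩
      ⟦ c , d ⟧c                           ∎)
      where open ≡-Reasoning

    open RingSolver coefficients (ACR.fromCommutativeRing commutativeRing) morphism weak≟ public
      using (solve; _:=_; _:+_; _:*_; :-_; con; Polynomial)

    𝟎 𝟙 : ∀ {n} → Polynomial n
    𝟎 = con (0 , 0)
    𝟙 = con (1 , 0)

  open Solver using (solve; _:=_; _:+_; _:*_; :-_; 𝟎; 𝟙)

  neg-zero : ⊟ 0F ≡ 0F
  neg-zero = RP.-0#≈0#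

  1≢0 : 1F ≢ 0F
  1≢0 e = 0≢1 (sym e)

  sub-zero⇒≡ : ∀ x y → x ⊞ ⊟ y ≡ 0F → x ≡ y
  sub-zero⇒≡ x y e = trans (sym (trans (solve 2 (λ x y → (x :+ :- y) :+ y := x) refl x y) refl))
    (trans (cong (_⊞ y) e) (+-identityˡ y))

  ⊞-cancelˡ : ∀ x {y z} → x ⊞ y ≡ x ⊞ z → y ≡ z
  ⊞-cancelˡ x {y} {z} e = trans (solve 2 (λ x y → y := :- x :+ (x :+ y)) refl x y)
    (trans (cong (⊟ x ⊞_) e) (solve 2 (λ x y → :- x :+ (x :+ y) := y) refl x z))

  -- The convention 0⁻¹ = 0 makes inversion total, so that terms need not carry a proof of being
  -- nonzero.
  _⁻¹ : 𝔽 → 𝔽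
  x ⁻¹ with x ≟F 0F
  ... | yes _ = 0F
  ... | no x≢0 = proj₁ (inverse x x≢0)

  ⊠-inv : ∀ {x} → x ≢ 0F → x ⊠ x ⁻¹ ≡ 1F
  ⊠-inv {x} x≢0 with x ≟F 0F
  ... | yes e = ⊥-elim (x≢0 e)
  ... | no n  = proj₂ (inverse x n)

  inv-⊠ : ∀ {x} → x ≢ 0F → x ⁻¹ ⊠ x ≡ 1F
  inv-⊠ n = trans (*-comm _ _) (⊠-inv n)

  ⊠-integral : ∀ {x y} → x ≢ 0F → x ⊠ y ≡ 0F → y ≡ 0F
  ⊠-integral {x} {y} x≢0 e = begin
    y                ≡⟨ sym (*-identityˡ y) ⟩
    1F ⊠ y           ≡⟨ cong (_⊠ y) (sym (inv-⊠ x≢0)) ⟩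
    (x ⁻¹ ⊠ x) ⊠ y   ≡⟨ *-assoc _ _ _ ⟩
    x ⁻¹ ⊠ (x ⊠ y)   ≡⟨ cong (x ⁻¹ ⊠_) e ⟩
    x ⁻¹ ⊠ 0F        ≡⟨ zeroʳ _ ⟩
    0F               ∎
    where open ≡-Reasoning

  zero-⊠ : ∀ {x y} → x ≡ 0F → x ⊠ y ≡ 0F
  zero-⊠ {y = y} e = trans (cong (_⊠ y) e) (zeroˡ y)

  ⊠-zero : ∀ {x y} → y ≡ 0F → x ⊠ y ≡ 0F
  ⊠-zero {x} e = trans (cong (x ⊠_) e) (zeroʳ x)

  ⊠-nonzero : ∀ {x y} → x ≢ 0F → y ≢ 0F → x ⊠ y ≢ 0F
  ⊠-nonzero x≢0 y≢0 e = y≢0 (⊠-integral x≢0 e)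

  inv-nonzero : ∀ {x} → x ≢ 0F → x ⁻¹ ≢ 0F
  inv-nonzero {x} n e = 1≢0 (trans (sym (⊠-inv n)) (trans (cong (x ⊠_) e) (zeroʳ x)))

  neg-nonzero : ∀ {x} → x ≢ 0F → ⊟ x ≢ 0F
  neg-nonzero {x} n e = n (trans (solve 1 (λ x → x := :- (:- x)) refl x) (trans (cong ⊟_ e) neg-zero))

  module S where
    open FinSum +-isCommutativeMonoid public

    ∑-⊠ˡ : {A : Set} (xs : List A) (c : 𝔽) (f : A → 𝔽) → ∑ xs (λ x → c ⊠ f x) ≡ c ⊠ ∑ xs f
    ∑-⊠ˡ []       c f = sym (zeroʳ c)
    ∑-⊠ˡ (x ∷ xs) c f = trans (cong (c ⊠ f x ⊞_) (∑-⊠ˡ xs c f)) (sym (distribˡ c _ _))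

    ∑-⊠ʳ : {A : Set} (xs : List A) (c : 𝔽) (f : A → 𝔽) → ∑ xs (λ x → f x ⊠ c) ≡ ∑ xs f ⊠ c
    ∑-⊠ʳ xs c f = trans (∑-cong xs (λ x → *-comm (f x) c)) (trans (∑-⊠ˡ xs c f) (*-comm c _))

  δ : 𝔽 → 𝔽
  δ x with x ≟F 0F
  ... | yes _ = 1F
  ... | no _  = 0F

  -- Counting needs indicators in ℕ, since sums of `δ` are only counts modulo p.
  zz nz : 𝔽 → ℕ
  zz x with x ≟F 0F
  ... | yes _ = 1
  ... | no _  = 0
  nz x with x ≟F 0F
  ... | yes _ = 0
  ... | no _  = 1

  δ-yes : ∀ {x} → x ≡ 0F → δ x ≡ 1F
  δ-yes {x} e with x ≟F 0F
  ... | yes _ = refl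
  ... | no n  = ⊥-elim (n e)

  δ-no : ∀ {x} → x ≢ 0F → δ x ≡ 0F
  δ-no {x} n with x ≟F 0F
  ... | yes e = ⊥-elim (n e)
  ... | no _  = refl

  zz-yes : ∀ {x} → x ≡ 0F → zz x ≡ 1
  zz-yes {x} e with x ≟F 0F
  ... | yes _ = refl
  ... | no n  = ⊥-elim (n e)

  zz-no : ∀ {x} → x ≢ 0F → zz x ≡ 0
  zz-no {x} n with x ≟F 0F
  ... | yes e = ⊥-elim (n e)
  ... | no _  = refl

  nz-yes : ∀ {x} → x ≡ 0F → nz x ≡ 0
  nz-yes {x} e with x ≟F 0F
  ... | yes _ = refl
  ... | no n  = ⊥-elim (n e)

  nz-no : ∀ {x} → x ≢ 0F → nz x ≡ 1
  nz-no {x} n with x ≟F 0F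
  ... | yes e = ⊥-elim (n e)
  ... | no _  = refl

  nz+zz : ∀ x → nz x + zz x ≡ 1
  nz+zz x with x ≟F 0F
  ... | yes _ = refl
  ... | no _  = refl

  nz≤1 : ∀ x → nz x ≤ 1
  nz≤1 x with x ≟F 0F
  ... | yes _ = z≤n
  ... | no _  = s≤s z≤n

  elems⁺ : List 𝔽
  elems⁺ = filter (λ x → ¬? (x ≟F 0F)) elems

  elems⁺-nonzero : ∀ {x} → x ∈ elems⁺ → x ≢ 0F
  elems⁺-nonzero x∈ = proj₂ (∈-filter⁻ (λ x → ¬? (x ≟F 0F)) {xs = elems} x∈)

  elems⁺-complete : ∀ {x} → x ≢ 0F → x ∈ elems⁺
  elems⁺-complete n = ∈-filter⁺ (λ x → ¬? (x ≟F 0F)) (elems-complete _) n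

  elems⁺-unique : Unique elems⁺
  elems⁺-unique = Unique.filter⁺ (λ x → ¬? (x ≟F 0F)) elems-unique

  elems-↭ : elems ↭ 0F ∷ elems⁺
  elems-↭ = unique-↭ elems-unique (All.tabulate (λ x∈ e → elems⁺-nonzero x∈ (sym e)) ∷ elems⁺-unique) to (λ {x} _ → elems-complete x)
    where
    to : ∀ {x} → x ∈ elems → x ∈ 0F ∷ elems⁺
    to {x} _ with x ≟F 0F
    ... | yes e = here e
    ... | no n  = there (elems⁺-complete n)

  q≡ : q ≡ suc (length elems⁺)
  q≡ = ↭-length elems-↭

  ∑-split : (f : 𝔽 → 𝔽) → S.∑ elems f ≡ f 0F ⊞ S.∑ elems⁺ f
  ∑-split f = S.∑-↭ f elems-↭

  N∑-split : (f : 𝔽 → ℕ) → N.∑ elems f ≡ f 0F + N.∑ elems⁺ f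
  N∑-split f = N.∑-↭ f elems-↭

  ∑-translate : (c : 𝔽) (f : 𝔽 → 𝔽) → S.∑ elems (λ x → f (x ⊞ c)) ≡ S.∑ elems f
  ∑-translate c f = S.∑-bij (_⊞ c) (_⊞ ⊟ c) f elems-unique (λ _ → elems-complete _) (λ _ → elems-complete _)
    (λ x → solve 2 (λ x c → (x :+ c) :+ :- c := x) refl x c) (λ x → solve 2 (λ x c → (x :+ :- c) :+ c := x) refl x c)

  ∑-scale : (c : 𝔽) → c ≢ 0F → (f : 𝔽 → 𝔽) → S.∑ elems (λ x → f (c ⊠ x)) ≡ S.∑ elems f
  ∑-scale c n f = S.∑-bij (c ⊠_) (c ⁻¹ ⊠_) f elems-unique (λ _ → elems-complete _) (λ _ → elems-complete _)
    (λ x → trans (sym (*-assoc _ _ _)) (trans (cong (_⊠ x) (inv-⊠ n)) (*-identityˡ x)))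
    (λ x → trans (sym (*-assoc _ _ _)) (trans (cong (_⊠ x) (⊠-inv n)) (*-identityˡ x)))

  -- Replacing x by x + c in the sum of all x leaves its value unchanged and adds the sum of the
  -- constant c.
  ∑-constant : (c : 𝔽) → S.∑ elems (λ _ → c) ≡ 0F
  ∑-constant c = ⊞-cancelˡ (S.∑ elems id)
    (trans (sym (S.∑-∙ elems id (λ _ → c))) (trans (∑-translate c id) (sym (+-identityʳ _))))

  -- There are q - 1 nonzero elements and q is zero in F. This sign converts sums over vectors into
  -- sums over points.
  ∑⁺-constant : (c : 𝔽) → S.∑ elems⁺ (λ _ → c) ≡ ⊟ c
  ∑⁺-constant c = ⊞-cancelˡ c (trans (sym (∑-split (λ _ → c))) (trans (∑-constant c) (sym (-‿inverseʳ c))))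

  ∑-δ : (a : 𝔽) (f : 𝔽 → 𝔽) → S.∑ elems (λ x → δ (x ⊞ ⊟ a) ⊠ f x) ≡ f a
  ∑-δ a f = trans (S.∑-single a _ elems-unique (elems-complete a)
      (λ x x≢a → trans (cong (_⊠ f x) (δ-no (x≢a ∘ sub-zero⇒≡ x a))) (zeroˡ _)))
    (trans (cong (_⊠ f a) (δ-yes (-‿inverseʳ a))) (*-identityˡ _))

  -- Polynomials in one variable, as lists of coefficients.

  eval : List 𝔽 → 𝔽 → 𝔽
  eval []       x = 0F
  eval (c ∷ cs) x = c ⊞ x ⊠ eval cs x

  quotient : List 𝔽 → 𝔽 → List 𝔽
  quotient []           a = []
  quotient (c ∷ [])     a = []
  quotient (c ∷ d ∷ cs) a = eval (d ∷ cs) a ∷ quotient (d ∷ cs) a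

  quotient-eval : ∀ cs a x → eval cs x ≡ eval cs a ⊞ (x ⊞ ⊟ a) ⊠ eval (quotient cs a) x
  quotient-eval []           a x = solve 2 (λ a x → 𝟎 := 𝟎 :+ (x :+ :- a) :* 𝟎) refl a x
  quotient-eval (c ∷ [])     a x = solve 3 (λ a x c → c :+ x :* 𝟎 := (c :+ a :* 𝟎) :+ (x :+ :- a) :* 𝟎) refl a x c
  quotient-eval (c ∷ d ∷ cs) a x = trans (cong (λ z → c ⊞ x ⊠ z) (quotient-eval (d ∷ cs) a x))
    (solve 5 (λ a x c E Q → c :+ x :* (E :+ (x :+ :- a) :* Q) := (c :+ a :* E) :+ (x :+ :- a) :* (E :+ x :* Q)) refl
      a x c (eval (d ∷ cs) a) (eval (quotient (d ∷ cs) a) x))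

  quotient-length : ∀ c cs a → length (quotient (c ∷ cs) a) ≡ length cs
  quotient-length c []       a = refl
  quotient-length c (d ∷ cs) a = cong suc (quotient-length d cs a)

  -- Division by x - r costs one coefficient and one root, and the other roots remain roots of the
  -- quotient.
  many-roots⇒zero : ∀ cs rs → Unique rs → (∀ {r} → r ∈ rs → eval cs r ≡ 0F) → length cs ≤ length rs → ∀ x → eval cs x ≡ 0F
  many-roots⇒zero []       rs       u root le x = refl
  many-roots⇒zero (c ∷ cs) (r ∷ rs) u root (s≤s le) x =
    trans (quotient-eval (c ∷ cs) r x) (trans (cong₂ (λ y z → y ⊞ (x ⊞ ⊟ r) ⊠ z) (root (here refl))
      (many-roots⇒zero (quotient (c ∷ cs) r) rs (AllPairs.tail u) root′
        (ℕ.≤-trans (ℕ.≤-reflexive (quotient-length c cs r)) le) x)) (trans (cong (0F ⊞_) (zeroʳ _)) (+-identityˡ _)))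
    where
    root′ : ∀ {r′} → r′ ∈ rs → eval (quotient (c ∷ cs) r) r′ ≡ 0F
    root′ {r′} r′∈ = ⊠-integral (λ e → unique-∉ u (subst (_∈ rs) (sub-zero⇒≡ r′ r e) r′∈))
      (trans (sym (+-identityˡ _)) (trans (cong (_⊞ ((r′ ⊞ ⊟ r) ⊠ eval (quotient (c ∷ cs) r) r′)) (sym (root (here refl))))
        (trans (sym (quotient-eval (c ∷ cs) r r′)) (root (there r′∈)))))

  pow : 𝔽 → ℕ → 𝔽
  pow x zero    = 1F
  pow x (suc k) = x ⊠ pow x k

  pow-⊠ : ∀ x y k → pow (x ⊠ y) k ≡ pow x k ⊠ pow y k
  pow-⊠ x y zero    = sym (*-identityˡ 1F)
  pow-⊠ x y (suc k) = trans (cong ((x ⊠ y) ⊠_) (pow-⊠ x y k))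
    (solve 4 (λ x y a b → (x :* y) :* (a :* b) := (x :* a) :* (y :* b)) refl x y (pow x k) (pow y k))

  monomial : ℕ → List 𝔽
  monomial zero    = 1F ∷ []
  monomial (suc k) = 0F ∷ monomial k

  eval-monomial : ∀ k x → eval (monomial k) x ≡ pow x k
  eval-monomial zero    x = solve 1 (λ x → 𝟙 :+ x :* 𝟎 := 𝟙) refl x
  eval-monomial (suc k) x = trans (+-identityˡ _) (cong (x ⊠_) (eval-monomial k x))

  length-monomial : ∀ k → length (monomial k) ≡ suc k
  length-monomial zero    = refl
  length-monomial (suc k) = cong suc (length-monomial k)

  -- For 0 < k the sum is invariant under multiplication by every g ^ k.
  power-sum : ∀ k → suc k < q → S.∑ elems (λ x → pow x k) ≡ 0F
  power-sum zero    _  = ∑-constant 1F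
  power-sum (suc k) lt with S.∑ elems (λ x → pow x (suc k)) ≟F 0F
  ... | yes e = e
  ... | no n  = ⊥-elim (neg-nonzero 1≢0 (trans (sym (solve 1 (λ e → :- 𝟙 :+ 𝟎 :* e := :- 𝟙) refl (eval (monomial k) 0F)))
                  (many-roots⇒zero (⊟ 1F ∷ monomial k) elems⁺ elems⁺-unique root
                    (ℕ.≤-trans (s≤s (ℕ.≤-reflexive (length-monomial k))) (ℕ.≤-pred (subst (suc (suc k) <_) q≡ lt))) 0F)))
    where
    invariant : ∀ {g} → g ≢ 0F → pow g (suc k) ≡ 1F
    invariant {g} g≢0 = sub-zero⇒≡ _ _ (⊠-integral n (trans
      (solve 2 (λ s g → s :* (g :+ :- 𝟙) := g :* s :+ :- s) refl (S.∑ elems (λ x → pow x (suc k))) (pow g (suc k)))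
      (trans (cong (_⊞ ⊟ S.∑ elems (λ x → pow x (suc k))) (trans (sym (S.∑-⊠ˡ elems _ _))
        (trans (S.∑-cong elems (λ x → sym (pow-⊠ g x (suc k)))) (∑-scale g g≢0 (λ x → pow x (suc k)))))) (-‿inverseʳ _))))
    root : ∀ {r} → r ∈ elems⁺ → eval (⊟ 1F ∷ monomial k) r ≡ 0F
    root {r} r∈ = trans (cong (λ z → ⊟ 1F ⊞ r ⊠ z) (eval-monomial k r))
      (trans (cong (⊟ 1F ⊞_) (invariant (elems⁺-nonzero r∈))) (-‿inverseˡ 1F))

  -- The exponent j collects the powers of x peeled off by Horner's scheme, so that each coefficient
  -- meets a power sum of exponent below q - 1.
  polynomial-sum : ∀ j cs → j + length cs < q → S.∑ elems (λ x → pow x j ⊠ eval cs x) ≡ 0F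
  polynomial-sum j []       lt = S.∑-zero elems (λ x → zeroʳ _)
  polynomial-sum j (c ∷ cs) lt = begin
    S.∑ elems (λ x → pow x j ⊠ (c ⊞ x ⊠ eval cs x))
      ≡⟨ S.∑-cong elems (λ x → solve 4 (λ p c x e → p :* (c :+ x :* e) := p :* c :+ (x :* p) :* e) refl (pow x j) c x (eval cs x)) ⟩
    S.∑ elems (λ x → pow x j ⊠ c ⊞ pow x (suc j) ⊠ eval cs x)
      ≡⟨ S.∑-∙ elems _ _ ⟩
    S.∑ elems (λ x → pow x j ⊠ c) ⊞ S.∑ elems (λ x → pow x (suc j) ⊠ eval cs x)
      ≡⟨ cong₂ _⊞_ (trans (S.∑-⊠ʳ elems c _) (trans (cong (_⊠ c) (power-sum j (ℕ.≤-trans (s≤s (ℕ.≤-trans (s≤s (ℕ.m≤m+n j _)) (ℕ.≤-reflexive (sym (ℕ.+-suc j _))))) lt))) (zeroˡ c)))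
                   (polynomial-sum (suc j) cs (subst (_< q) (ℕ.+-suc j _) lt)) ⟩
    0F ⊞ 0F ≡⟨ +-identityˡ 0F ⟩
    0F ∎
    where open ≡-Reasoning

  addHead : 𝔽 → List 𝔽 → List 𝔽
  addHead a []       = a ∷ []
  addHead a (d ∷ ds) = (a ⊞ d) ∷ ds

  mulLinear : 𝔽 → 𝔽 → List 𝔽 → List 𝔽
  mulLinear a b []       = []
  mulLinear a b (c ∷ cs) = a ⊠ c ∷ addHead (b ⊠ c) (mulLinear a b cs)

  eval-addHead : ∀ a cs x → eval (addHead a cs) x ≡ a ⊞ eval cs x
  eval-addHead a []       x = solve 2 (λ a x → a :+ x :* 𝟎 := a :+ 𝟎) refl a x
  eval-addHead a (d ∷ ds) x = +-assoc _ _ _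

  eval-mulLinear : ∀ a b cs x → eval (mulLinear a b cs) x ≡ (a ⊞ b ⊠ x) ⊠ eval cs x
  eval-mulLinear a b []       x = sym (zeroʳ _)
  eval-mulLinear a b (c ∷ cs) x = trans (cong (λ z → a ⊠ c ⊞ x ⊠ z) (trans (eval-addHead (b ⊠ c) (mulLinear a b cs) x) (cong (b ⊠ c ⊞_) (eval-mulLinear a b cs x))))
    (solve 5 (λ a b c x e → a :* c :+ x :* (b :* c :+ (a :+ b :* x) :* e) := (a :+ b :* x) :* (c :+ x :* e)) refl a b c x (eval cs x))

  length-mulLinear : ∀ a b cs → length (mulLinear a b cs) ≤ suc (length cs)
  length-mulLinear a b []       = z≤n
  length-mulLinear a b (c ∷ cs) = s≤s (addHead-length (b ⊠ c) (mulLinear a b cs) (length-mulLinear a b cs))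
    where
    addHead-length : ∀ x ds → length ds ≤ suc (length cs) → length (addHead x ds) ≤ suc (length cs)
    addHead-length x []       _  = s≤s z≤n
    addHead-length x (d ∷ ds) le = le

  linearProduct : List (𝔽 × 𝔽) → 𝔽 → 𝔽
  linearProduct []             x = 1F
  linearProduct ((a , b) ∷ fs) x = (a ⊞ b ⊠ x) ⊠ linearProduct fs x

  expand : List (𝔽 × 𝔽) → List 𝔽
  expand []             = 1F ∷ []
  expand ((a , b) ∷ fs) = mulLinear a b (expand fs)

  eval-expand : ∀ fs x → eval (expand fs) x ≡ linearProduct fs x
  eval-expand []             x = solve 1 (λ x → 𝟙 :+ x :* 𝟎 := 𝟙) refl x
  eval-expand ((a , b) ∷ fs) x = trans (eval-mulLinear a b (expand fs) x) (cong ((a ⊞ b ⊠ x) ⊠_) (eval-expand fs x))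

  length-expand : ∀ fs → length (expand fs) ≤ suc (length fs)
  length-expand []             = s≤s z≤n
  length-expand ((a , b) ∷ fs) = ℕ.≤-trans (length-mulLinear a b (expand fs)) (s≤s (length-expand fs))

  -- A product of at most q - 2 affine factors has degree at most q - 2, the range in which all
  -- power sums vanish.
  linearProduct-sum : ∀ fs → suc (length fs) < q → S.∑ elems (linearProduct fs) ≡ 0F
  linearProduct-sum fs lt = trans (S.∑-cong elems (λ x → sym (trans (*-identityˡ _) (eval-expand fs x))))
    (polynomial-sum 0 (expand fs) (ℕ.≤-trans (s≤s (length-expand fs)) lt))

-- Linear algebra over the field

module LinearAlgebra (F : FiniteField) where
  open Field F public
  open Geometry F public hiding (search) renaming (_+V_ to infixl 6 _+V_; _·V_ to infixr 7 _·V_)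
  open Solver using (solve; _:=_; _:+_; _:*_; :-_; 𝟎; 𝟙)

  -- Vector identities follow from the ring identities of their coordinates.

  data VExpr (k : ℕ) : Set where
    var  : Fin k → VExpr k
    _⊕_  : VExpr k → VExpr k → VExpr k
    _⊙_  : 𝔽 → VExpr k → VExpr k
    ∅    : VExpr k

  infixl 6 _⊕_
  infixr 7 _⊙_

  ⟦_⟧V : ∀ {k m} → VExpr k → Vec (Vector m) k → Vector m
  ⟦ var i ⟧V us = Vec.lookup us i
  ⟦ e ⊕ f ⟧V us = ⟦ e ⟧V us +V ⟦ f ⟧V us
  ⟦ t ⊙ e ⟧V us = t ·V ⟦ e ⟧V us
  ⟦ ∅ ⟧V     us = zeroV

  ⟦_⟧F : ∀ {k} → VExpr k → Vec 𝔽 k → 𝔽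
  ⟦ var i ⟧F xs = Vec.lookup xs i
  ⟦ e ⊕ f ⟧F xs = ⟦ e ⟧F xs ⊞ ⟦ f ⟧F xs
  ⟦ t ⊙ e ⟧F xs = t ⊠ ⟦ e ⟧F xs
  ⟦ ∅ ⟧F     xs = 0F

  private
    head-⟦⟧ : ∀ {k m} (e : VExpr k) (us : Vec (Vector (suc m)) k) → Vec.head (⟦ e ⟧V us) ≡ ⟦ e ⟧F (Vec.map Vec.head us)
    head-⟦⟧ (var i) us = sym (Vec.lookup-map i Vec.head us)
    head-⟦⟧ (e ⊕ f) us with ⟦ e ⟧V us | ⟦ f ⟧V us | head-⟦⟧ e us | head-⟦⟧ f us
    ... | x ∷ _ | y ∷ _ | p | r = cong₂ _⊞_ p r
    head-⟦⟧ (t ⊙ e) us with ⟦ e ⟧V us | head-⟦⟧ e us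
    ... | x ∷ _ | p = cong (t ⊠_) p
    head-⟦⟧ ∅       us = refl

    tail-⟦⟧ : ∀ {k m} (e : VExpr k) (us : Vec (Vector (suc m)) k) → Vec.tail (⟦ e ⟧V us) ≡ ⟦ e ⟧V (Vec.map Vec.tail us)
    tail-⟦⟧ (var i) us = sym (Vec.lookup-map i Vec.tail us)
    tail-⟦⟧ (e ⊕ f) us with ⟦ e ⟧V us | ⟦ f ⟧V us | tail-⟦⟧ e us | tail-⟦⟧ f us
    ... | _ ∷ x | _ ∷ y | p | r = cong₂ _+V_ p r
    tail-⟦⟧ (t ⊙ e) us with ⟦ e ⟧V us | tail-⟦⟧ e us
    ... | _ ∷ x | p = cong (t ·V_) p
    tail-⟦⟧ ∅       us = refl

  vsolve : ∀ {k m} (e f : VExpr k) → (∀ xs → ⟦ e ⟧F xs ≡ ⟦ f ⟧F xs) → (us : Vec (Vector m) k) → ⟦ e ⟧V us ≡ ⟦ f ⟧V us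
  vsolve {m = zero}  e f eq us with ⟦ e ⟧V us | ⟦ f ⟧V us
  ... | [] | [] = refl
  vsolve {m = suc m} e f eq us
    with ⟦ e ⟧V us | ⟦ f ⟧V us | head-⟦⟧ e us | head-⟦⟧ f us | tail-⟦⟧ e us | tail-⟦⟧ f us
  ... | x ∷ xs | y ∷ ys | p | r | p′ | r′ =
    cong₂ _∷_ (trans p (trans (eq _) (sym r))) (trans p′ (trans (vsolve e f eq (Vec.map Vec.tail us)) (sym r′)))

  x₀ : ∀ {k} → VExpr (suc k)
  x₀ = var Fin.zero
  x₁ : ∀ {k} → VExpr (suc (suc k))
  x₁ = var (Fin.suc Fin.zero)
  x₂ : ∀ {k} → VExpr (suc (suc (suc k)))
  x₂ = var (Fin.suc (Fin.suc Fin.zero))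
  x₃ : ∀ {k} → VExpr (suc (suc (suc (suc k))))
  x₃ = var (Fin.suc (Fin.suc (Fin.suc Fin.zero)))

  +V-identityˡ : ∀ {m} (v : Vector m) → zeroV +V v ≡ v
  +V-identityˡ v = vsolve (∅ ⊕ x₀) x₀ (λ { (x ∷ []) → +-identityˡ x }) (v ∷ [])

  +V-identityʳ : ∀ {m} (v : Vector m) → v +V zeroV ≡ v
  +V-identityʳ v = vsolve (x₀ ⊕ ∅) x₀ (λ { (x ∷ []) → +-identityʳ x }) (v ∷ [])

  0·V : ∀ {m} (v : Vector m) → 0F ·V v ≡ zeroV
  0·V v = vsolve (0F ⊙ x₀) ∅ (λ { (x ∷ []) → zeroˡ x }) (v ∷ [])

  ·V-zeroʳ : ∀ {m} t → t ·V zeroV {m} ≡ zeroV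
  ·V-zeroʳ t = vsolve (t ⊙ ∅) ∅ (λ { [] → zeroʳ t }) []

  1·V : ∀ {m} (v : Vector m) → 1F ·V v ≡ v
  1·V v = vsolve (1F ⊙ x₀) x₀ (λ { (x ∷ []) → *-identityˡ x }) (v ∷ [])

  ·V-assoc : ∀ {m} s t (v : Vector m) → s ·V t ·V v ≡ (s ⊠ t) ·V v
  ·V-assoc s t v = vsolve (s ⊙ t ⊙ x₀) ((s ⊠ t) ⊙ x₀) (λ { (x ∷ []) → sym (*-assoc s t x) }) (v ∷ [])

  ·V-cancel : ∀ {m} {t} → t ≢ 0F → (v : Vector m) → t ⁻¹ ·V t ·V v ≡ v
  ·V-cancel {t = t} n v = trans (·V-assoc (t ⁻¹) t v) (trans (cong (_·V v) (inv-⊠ n)) (1·V v))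

  ·V-cancel′ : ∀ {m} {t} → t ≢ 0F → (v : Vector m) → t ·V t ⁻¹ ·V v ≡ v
  ·V-cancel′ {t = t} n v = trans (·V-assoc t (t ⁻¹) v) (trans (cong (_·V v) (⊠-inv n)) (1·V v))

  -- Functionals are given by their values and not by coordinates: pulling one back along a frame,
  -- or reading one off a word, then needs no choice of basis.
  record Lin (m : ℕ) : Set where
    field
      ap   : Vector m → 𝔽
      ap-+ : ∀ u v → ap (u +V v) ≡ ap u ⊞ ap v
      ap-· : ∀ t v → ap (t ·V v) ≡ t ⊠ ap v
  open Lin public

  ap-zero : ∀ {m} (k : Lin m) → ap k zeroV ≡ 0F
  ap-zero k = trans (cong (ap k) (sym (0·V zeroV))) (trans (ap-· k 0F zeroV) (zeroˡ _))

  ap-line : ∀ {m} (k : Lin m) u t v → ap k (u +V t ·V v) ≡ ap k u ⊞ t ⊠ ap k v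
  ap-line k u t v = trans (ap-+ k _ _) (cong (ap k u ⊞_) (ap-· k t v))

  ap-line-zero : ∀ {m} (k : Lin m) {u t v} → ap k u ≡ 0F → ap k v ≡ 0F → ap k (u +V t ·V v) ≡ 0F
  ap-line-zero k {u} {t} {v} e f = trans (ap-line k u t v) (trans (cong₂ (λ x y → x ⊞ t ⊠ y) e f) (solve 1 (λ t → 𝟎 :+ t :* 𝟎 := 𝟎) refl t))

  ap-·-nonzero : ∀ {m} (k : Lin m) {t v} → t ≢ 0F → ap k v ≢ 0F → ap k (t ·V v) ≢ 0F
  ap-·-nonzero k t≢0 n e = ⊠-nonzero t≢0 n (trans (sym (ap-· k _ _)) e)

  combine : ∀ {m} → Lin m → 𝔽 → Lin m → Lin m
  combine k c l = record
    { ap   = λ v → ap k v ⊞ c ⊠ ap l v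
    ; ap-+ = λ u v → trans (cong₂ (λ x y → x ⊞ c ⊠ y) (ap-+ k u v) (ap-+ l u v))
        (solve 5 (λ a b c d e → (a :+ b) :+ c :* (d :+ e) := (a :+ c :* d) :+ (b :+ c :* e)) refl _ _ c _ _)
    ; ap-· = λ t v → trans (cong₂ (λ x y → x ⊞ c ⊠ y) (ap-· k t v) (ap-· l t v))
        (solve 4 (λ t a c b → t :* a :+ c :* (t :* b) := t :* (a :+ c :* b)) refl t _ c _)
    }

  zeroL : ∀ {m} → Lin m
  zeroL = record { ap = λ _ → 0F ; ap-+ = λ _ _ → sym (+-identityˡ 0F) ; ap-· = λ t _ → sym (zeroʳ t) }

  scaleL : ∀ {m} → 𝔽 → Lin m → Lin m
  scaleL c k = combine zeroL c k

  ap-scaleL : ∀ {m} c (k : Lin m) v → ap (scaleL c k) v ≡ c ⊠ ap k v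
  ap-scaleL c k v = +-identityˡ _

  headL : ∀ {m} → Lin (suc m)
  headL = record { ap = Vec.head ; ap-+ = λ { (x ∷ _) (y ∷ _) → refl } ; ap-· = λ { t (x ∷ _) → refl } }

  tailL : ∀ {m} → Lin m → Lin (suc m)
  tailL k = record { ap = ap k ∘ Vec.tail ; ap-+ = λ { (_ ∷ u) (_ ∷ v) → ap-+ k u v } ; ap-· = λ { t (_ ∷ v) → ap-· k t v } }

  dot : ∀ {m} → Vector m → Lin m
  dot []       = zeroL
  dot (a ∷ as) = combine (tailL (dot as)) a headL

  separating : ∀ {m} (v : Vector m) → v ≢ zeroV → ∃ λ (k : Lin m) → ap k v ≢ 0F
  separating []       n = ⊥-elim (n refl)
  separating (x ∷ xs) n with x ≟F 0F
  ... | no x≢0  = headL , x≢0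
  ... | yes x≡0 with separating xs (λ e → n (cong₂ _∷_ x≡0 e))
  ... | k , kx = tailL k , kx

  lincomb-+ : ∀ {m k} (a b : Vector k) (vs : Fam m k) → lincomb (a +V b) vs ≡ lincomb a vs +V lincomb b vs
  lincomb-+ []       []       []       = sym (+V-identityˡ zeroV)
  lincomb-+ (a ∷ as) (b ∷ bs) (v ∷ vs) = trans (cong ((a ⊞ b) ·V v +V_) (lincomb-+ as bs vs))
    (vsolve ((a ⊞ b) ⊙ x₀ ⊕ (x₁ ⊕ x₂)) ((a ⊙ x₀ ⊕ x₁) ⊕ (b ⊙ x₀ ⊕ x₂))
      (λ { (x ∷ y ∷ z ∷ []) → solve 5 (λ a b x y z → (a :+ b) :* x :+ (y :+ z) := (a :* x :+ y) :+ (b :* x :+ z)) refl a b x y z })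
      (v ∷ lincomb as vs ∷ lincomb bs vs ∷ []))

  lincomb-· : ∀ {m k} t (a : Vector k) (vs : Fam m k) → lincomb (t ·V a) vs ≡ t ·V lincomb a vs
  lincomb-· t []       []       = sym (·V-zeroʳ t)
  lincomb-· t (a ∷ as) (v ∷ vs) = trans (cong ((t ⊠ a) ·V v +V_) (lincomb-· t as vs))
    (vsolve ((t ⊠ a) ⊙ x₀ ⊕ t ⊙ x₁) (t ⊙ (a ⊙ x₀ ⊕ x₁))
      (λ { (x ∷ y ∷ []) → solve 4 (λ t a x y → (t :* a) :* x :+ t :* y := t :* (a :* x :+ y)) refl t a x y }) (v ∷ lincomb as vs ∷ []))

  lincomb-zero : ∀ {m k} (vs : Fam m k) → lincomb zeroV vs ≡ zeroV
  lincomb-zero vs = trans (cong (λ z → lincomb z vs) (sym (0·V zeroV))) (trans (lincomb-· 0F zeroV vs) (0·V _))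

  pull : ∀ {m r} → Lin m → Fam m r → Lin r
  pull k vs = record
    { ap   = λ a → ap k (lincomb a vs)
    ; ap-+ = λ a b → trans (cong (ap k) (lincomb-+ a b vs)) (ap-+ k _ _)
    ; ap-· = λ t a → trans (cong (ap k) (lincomb-· t a vs)) (ap-· k t _)
    }

  ap-lincomb-zero : ∀ {m r} (k : Lin m) (a : Vector r) (vs : Fam m r) → (∀ i → ap k (Vec.lookup vs i) ≡ 0F) → ap k (lincomb a vs) ≡ 0F
  ap-lincomb-zero k []       []       e = ap-zero k
  ap-lincomb-zero k (a ∷ as) (v ∷ vs) e = trans (ap-+ k _ _) (trans (cong₂ _⊞_ (trans (ap-· k a v) (trans (cong (a ⊠_) (e Fin.zero)) (zeroʳ a)))
    (ap-lincomb-zero k as vs (e ∘ Fin.suc))) (+-identityˡ 0F))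

  -- Gaussian elimination along a functional k: a family spanning the same space,
  -- whose members other than the pivot lie in the kernel of k.

  record Elimination {m d} (k : Lin m) (vs : Fam m (suc d)) : Set where
    field
      pivot    : Vector m
      pivot-ap : ap k pivot ≢ 0F
      rest     : Fam m d
      rest-ap  : ∀ i → ap k (Vec.lookup rest i) ≡ 0F
      to       : Vector (suc d) → Vector (suc d)
      from     : Vector (suc d) → Vector (suc d)
      to-eq    : ∀ a → lincomb (to a) (pivot ∷ rest) ≡ lincomb a vs
      from-eq  : ∀ b → lincomb (from b) vs ≡ lincomb b (pivot ∷ rest)
      from-inj : ∀ b → from b ≡ zeroV → b ≡ zeroV

  private
    clear : ∀ {m} → Lin m → Vector m → Vector m → Vector m
    clear k v w = w +V (⊟ (ap k w ⊠ ap k v ⁻¹)) ·V v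

    clear-ap : ∀ {m} (k : Lin m) v w → ap k v ≢ 0F → ap k (clear k v w) ≡ 0F
    clear-ap k v w n = trans (ap-line k w _ v) (trans (solve 3 (λ w v i → w :+ (:- (w :* i)) :* v := w :+ :- (w :* (v :* i))) refl (ap k w) (ap k v) (ap k v ⁻¹))
      (trans (cong (λ z → ap k w ⊞ ⊟ (ap k w ⊠ z)) (⊠-inv n)) (solve 1 (λ w → w :+ :- (w :* 𝟙) := 𝟎) refl (ap k w))))

    weight : ∀ {m d} → Lin m → Vector m → Vector d → Fam m d → 𝔽
    weight k v []       []       = 0F
    weight k v (a ∷ as) (w ∷ ws) = a ⊠ (ap k w ⊠ ap k v ⁻¹) ⊞ weight k v as ws

    weight-zero : ∀ {m d} (k : Lin m) v (ws : Fam m d) → weight k v zeroV ws ≡ 0F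
    weight-zero k v []       = refl
    weight-zero k v (w ∷ ws) = trans (cong₂ _⊞_ (zeroˡ _) (weight-zero k v ws)) (+-identityˡ 0F)

    clear-lincomb : ∀ {m d} (k : Lin m) v (a : Vector d) (ws : Fam m d) →
      lincomb a (Vec.map (clear k v) ws) ≡ lincomb a ws +V (⊟ weight k v a ws) ·V v
    clear-lincomb k v []       []       = sym (trans (+V-identityˡ _) (trans (cong (_·V v) neg-zero) (0·V v)))
    clear-lincomb k v (a ∷ as) (w ∷ ws) = trans (cong (a ·V clear k v w +V_) (clear-lincomb k v as ws))
      (vsolve (a ⊙ (x₀ ⊕ (⊟ c) ⊙ x₁) ⊕ (x₂ ⊕ (⊟ d) ⊙ x₁)) ((a ⊙ x₀ ⊕ x₂) ⊕ (⊟ (a ⊠ c ⊞ d)) ⊙ x₁)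
        (λ { (w ∷ v ∷ l ∷ []) → solve 6 (λ a c d w v l → a :* (w :+ (:- c) :* v) :+ (l :+ (:- d) :* v) := (a :* w :+ l) :+ (:- (a :* c :+ d)) :* v) refl a c d w v l })
        (w ∷ v ∷ lincomb as ws ∷ []))
      where
      c d : 𝔽
      c = ap k w ⊠ ap k v ⁻¹
      d = weight k v as ws

  -- Vectors in the kernel of k are passed over; the first one outside becomes the pivot, and
  -- multiples of it clear the later ones. Without such a vector k vanishes on the whole family.
  eliminate : ∀ {m d} (k : Lin m) (vs : Fam m (suc d)) → (∀ i → ap k (Vec.lookup vs i) ≡ 0F) ⊎ Elimination k vs
  eliminate {d = d} k (v ∷ vs) with ap k v ≟F 0F
  ... | no n = inj₂ (record
    { pivot = v ; pivot-ap = n ; rest = Vec.map (clear k v) vs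
    ; rest-ap = λ i → trans (cong (ap k) (Vec.lookup-map i (clear k v) vs)) (clear-ap k v (Vec.lookup vs i) n)
    ; to = λ { (a ∷ as) → a ⊞ weight k v as vs ∷ as }
    ; from = λ { (b ∷ bs) → b ⊞ ⊟ weight k v bs vs ∷ bs }
    ; to-eq = λ { (a ∷ as) → trans (cong ((a ⊞ weight k v as vs) ·V v +V_) (clear-lincomb k v as vs))
        (vsolve ((a ⊞ weight k v as vs) ⊙ x₀ ⊕ (x₁ ⊕ (⊟ weight k v as vs) ⊙ x₀)) (a ⊙ x₀ ⊕ x₁)
          (λ { (x ∷ y ∷ []) → solve 4 (λ a w x y → (a :+ w) :* x :+ (y :+ (:- w) :* x) := a :* x :+ y) refl a (weight k v as vs) x y })
          (v ∷ lincomb as vs ∷ [])) }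
    ; from-eq = λ { (b ∷ bs) → sym (trans (cong (b ·V v +V_) (clear-lincomb k v bs vs))
        (vsolve (b ⊙ x₀ ⊕ (x₁ ⊕ (⊟ weight k v bs vs) ⊙ x₀)) ((b ⊞ ⊟ weight k v bs vs) ⊙ x₀ ⊕ x₁)
          (λ { (x ∷ y ∷ []) → solve 4 (λ a w x y → a :* x :+ (y :+ (:- w) :* x) := (a :+ :- w) :* x :+ y) refl b (weight k v bs vs) x y })
          (v ∷ lincomb bs vs ∷ []))) }
    ; from-inj = λ { (b ∷ bs) e → from-inj b bs (Vec.∷-injective e) }
    })
    where
    from-inj : ∀ b (bs : Vector d) → b ⊞ ⊟ weight k v bs vs ≡ 0F × bs ≡ zeroV → b ∷ bs ≡ zeroV
    from-inj b bs (e , refl) = cong (_∷ zeroV) (trans (sym (trans (cong (λ z → b ⊞ ⊟ z) (weight-zero k v vs))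
      (trans (cong (b ⊞_) neg-zero) (+-identityʳ b)))) e)
  eliminate {d = zero}  k (v ∷ []) | yes e = inj₁ (λ { Fin.zero → e })
  eliminate {d = suc d} k (v ∷ vs) | yes e with eliminate k vs
  ... | inj₁ z = inj₁ (λ { Fin.zero → e ; (Fin.suc i) → z i })
  ... | inj₂ E = inj₂ (record
    { pivot = E.pivot ; pivot-ap = E.pivot-ap ; rest = v ∷ E.rest
    ; rest-ap = λ { Fin.zero → e ; (Fin.suc i) → E.rest-ap i }
    ; to = λ { (a ∷ as) → Vec.head (E.to as) ∷ a ∷ Vec.tail (E.to as) }
    ; from = λ { (b ∷ c ∷ bs) → c ∷ E.from (b ∷ bs) }
    ; to-eq = λ { (a ∷ as) → to-eq a as (E.to as) (E.to-eq as) }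
    ; from-eq = λ { (b ∷ c ∷ bs) → trans (cong (c ·V v +V_) (E.from-eq (b ∷ bs))) (rotate (c ·V v) (b ·V E.pivot) (lincomb bs E.rest)) }
    ; from-inj = λ { (b ∷ c ∷ bs) f → from-inj b c bs (Vec.∷-injective f) }
    })
    where
    module E = Elimination E
    rotate : ∀ {m} (x y z : Vector m) → x +V (y +V z) ≡ y +V (x +V z)
    rotate x y z = vsolve (x₀ ⊕ (x₁ ⊕ x₂)) (x₁ ⊕ (x₀ ⊕ x₂)) (λ { (x ∷ y ∷ z ∷ []) → solve 3 (λ x y z → x :+ (y :+ z) := y :+ (x :+ z)) refl x y z }) (x ∷ y ∷ z ∷ [])
    to-eq : ∀ a as b → lincomb b (E.pivot ∷ E.rest) ≡ lincomb as vs → lincomb (Vec.head b ∷ a ∷ Vec.tail b) (E.pivot ∷ v ∷ E.rest) ≡ a ·V v +V lincomb as vs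
    to-eq a as (b ∷ bs) f = trans (rotate (b ·V E.pivot) (a ·V v) (lincomb bs E.rest)) (cong (a ·V v +V_) f)
    from-inj : ∀ b c bs → c ≡ 0F × E.from (b ∷ bs) ≡ zeroV → b ∷ c ∷ bs ≡ zeroV
    from-inj b c bs (refl , f) with Vec.∷-injective (E.from-inj (b ∷ bs) f)
    ... | refl , refl = refl

  private
    tails : ∀ {m d} → Fam (suc m) d → Fam m d
    tails = Vec.map Vec.tail

    lincomb-tails : ∀ {m d} (a : Vector d) (vs : Fam (suc m) d) → (∀ i → ap headL (Vec.lookup vs i) ≡ 0F) →
      lincomb a (tails vs) ≡ zeroV → lincomb a vs ≡ zeroV
    lincomb-tails {m} a vs z e with lincomb a vs | ap-lincomb-zero headL a vs z | tail-lincomb a vs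
      where
      tail-lincomb : ∀ {d} (a : Vector d) (vs : Fam (suc m) d) → Vec.tail (lincomb a vs) ≡ lincomb a (tails vs)
      tail-lincomb []       []             = refl
      tail-lincomb (a ∷ as) ((x ∷ v) ∷ vs) with lincomb as vs | tail-lincomb as vs
      ... | _ ∷ _ | f = cong (a ·V v +V_) f
    ... | x ∷ xs | h | t = cong₂ _∷_ h (trans t e)

  -- Elimination along the first coordinate leaves one vector fewer, all with first coordinate zero,
  -- hence a family in one dimension less.
  dependent : ∀ {m d} (vs : Fam m d) → m < d → ∃ λ a → a ≢ zeroV × lincomb a vs ≡ zeroV
  dependent {zero} {suc d} (v ∷ vs) _ = 1F ∷ zeroV , (λ e → 1≢0 (proj₁ (Vec.∷-injective e))) , nil _
    where
    nil : (x : Vector 0) → x ≡ zeroV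
    nil [] = refl
  dependent {suc m} {suc d} vs (s≤s lt) with eliminate headL vs
  ... | inj₁ z with dependent (tails vs) (ℕ.m<n⇒m<1+n lt)
  ...   | a , a≢0 , e = a , a≢0 , lincomb-tails a vs z e
  dependent {suc m} {suc d} vs (s≤s lt) | inj₂ E with dependent (tails (Elimination.rest E)) lt
  ... | b , b≢0 , e = E.from (0F ∷ b) , (λ f → b≢0 (proj₂ (Vec.∷-injective (E.from-inj _ f)))) ,
        trans (E.from-eq _) (trans (cong₂ _+V_ (0·V E.pivot) (lincomb-tails b E.rest E.rest-ap e)) (+V-identityˡ zeroV))
    where module E = Elimination E

  -- After elimination along k only the pivot has a nonzero value, so a combination lies in the
  -- kernel exactly when the coefficient of the pivot is zero.
  kernel-basis : ∀ {m d} (k : Lin m) (vs : Fam m (suc d)) → Independent vs → (∃ λ v → InSpan vs v × ap k v ≢ 0F) →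
    ∃ λ (ws : Fam m d) → Independent ws × (∀ x → InSpan ws x → InSpan vs x × ap k x ≡ 0F) × (∀ x → InSpan vs x → ap k x ≡ 0F → InSpan ws x)
  kernel-basis k vs ind (v , (a , refl) , n) with eliminate k vs
  ... | inj₁ z = ⊥-elim (n (ap-lincomb-zero k a vs z))
  ... | inj₂ E = E.rest , ind′ , sub , sup
    where
    module E = Elimination E
    extend : ∀ b → lincomb (0F ∷ b) (E.pivot ∷ E.rest) ≡ lincomb b E.rest
    extend b = trans (cong (_+V lincomb b E.rest) (0·V E.pivot)) (+V-identityˡ _)
    ind′ : Independent E.rest
    ind′ b e = proj₂ (Vec.∷-injective (E.from-inj (0F ∷ b) (ind _ (trans (E.from-eq _) (trans (extend b) e)))))
    sub : ∀ x → InSpan E.rest x → InSpan vs x × ap k x ≡ 0F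
    sub _ (b , refl) = (E.from (0F ∷ b) , trans (E.from-eq _) (extend b)) , ap-lincomb-zero k b E.rest E.rest-ap
    sup : ∀ x → InSpan vs x → ap k x ≡ 0F → InSpan E.rest x
    sup _ (a , refl) kx with E.to a | E.to-eq a
    ... | b ∷ bs | e = bs , trans (sym (trans (cong (λ z → z ·V E.pivot +V lincomb bs E.rest) b≡0) (extend bs))) e
      where
      b≡0 : b ≡ 0F
      b≡0 = ⊠-integral E.pivot-ap (trans (*-comm _ _) (trans (sym (ap-· k b E.pivot)) (trans (sym (trans (ap-+ k _ _)
        (trans (cong (ap k (b ·V E.pivot) ⊞_) (ap-lincomb-zero k bs E.rest E.rest-ap)) (+-identityʳ _)))) (trans (cong (ap k) e) kx))))

-- The rank argument in a plane

module RankBound (F : FiniteField) where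
  open LinearAlgebra F
  open Solver using (solve; _:=_; _:+_; _:*_; :-_; 𝟎; 𝟙)

  -- The term (l , a , b , c) is l times the indicator of the line a + b t + c x = 0.
  Term : Set
  Term = 𝔽 × 𝔽 × 𝔽 × 𝔽

  term : Term → 𝔽 → 𝔽 → 𝔽
  term (l , a , b , c) x t = l ⊠ δ (a ⊞ b ⊠ t ⊞ c ⊠ x)

  value : List Term → 𝔽 → 𝔽 → 𝔽
  value Ts x t = S.∑ Ts (λ T → term T x t)

  product : List (𝔽 × 𝔽 × 𝔽) → 𝔽 → 𝔽 → 𝔽
  product []                 x t = 1F
  product ((a , b , c) ∷ fs) x t = (a ⊞ b ⊠ t ⊞ c ⊠ x) ⊠ product fs x t

  product-++ : ∀ fs gs x t → product (fs ++ gs) x t ≡ product fs x t ⊠ product gs x t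
  product-++ []       gs x t = sym (*-identityˡ _)
  product-++ (f ∷ fs) gs x t = trans (cong (_ ⊠_) (product-++ fs gs x t)) (sym (*-assoc _ _ _))

  private
    δ-cong : ∀ {x y} → (x ≡ 0F → y ≡ 0F) → (y ≡ 0F → x ≡ 0F) → δ x ≡ δ y
    δ-cong {x} {y} to from with x ≟F 0F
    ... | yes e = sym (δ-yes (to e))
    ... | no n  = sym (δ-no (n ∘ from))

    onGraph : 𝔽 → 𝔽 → 𝔽 × 𝔽 × 𝔽 → 𝔽 × 𝔽
    onGraph A B (a , b , c) = a ⊞ b ⊠ A , b ⊠ B ⊞ c

    product-graph : ∀ A B fs x → product fs x (A ⊞ B ⊠ x) ≡ linearProduct (map (onGraph A B) fs) x
    product-graph A B []                 x = refl
    product-graph A B ((a , b , c) ∷ fs) x = cong₂ _⊠_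
      (solve 6 (λ a b c A B x → a :+ b :* (A :+ B :* x) :+ c :* x := (a :+ b :* A) :+ (b :* B :+ c) :* x) refl a b c A B x)
      (product-graph A B fs x)

    product-vertical : ∀ x fs t → product fs x t ≡ linearProduct (map (λ { (a , b , c) → a ⊞ c ⊠ x , b }) fs) t
    product-vertical x []                 t = refl
    product-vertical x ((a , b , c) ∷ fs) t = cong₂ _⊠_
      (solve 5 (λ a b c x t → a :+ b :* t :+ c :* x := (a :+ c :* x) :+ b :* t) refl a b c x t) (product-vertical x fs t)

    product-column : ∀ x fs → suc (length fs) < q → S.∑ elems (product fs x) ≡ 0F
    product-column x fs lt = trans (S.∑-cong elems (product-vertical x fs))
      (linearProduct-sum (map (λ { (a , b , c) → a ⊞ c ⊠ x , b }) fs) (subst (λ n → suc n < q) (sym (List.length-map (λ { (a , b , c) → a ⊞ c ⊠ x , b }) fs)) lt))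

  -- On a line the product becomes a polynomial in one variable of degree at most q - 2, whose sum
  -- over F vanishes. For b = c = 0 the indicator is that of the whole plane or of nothing, and each
  -- column already sums to zero.
  line-moment : ∀ a b c fs → suc (length fs) < q →
    S.∑ elems (λ x → S.∑ elems (λ t → δ (a ⊞ b ⊠ t ⊞ c ⊠ x) ⊠ product fs x t)) ≡ 0F
  line-moment a b c fs lt with b ≟F 0F
  ... | no b≢0 = trans (S.∑-cong elems column) (linearProduct-sum (map (onGraph A B) fs) (subst (λ n → suc n < q) (sym (List.length-map (onGraph A B) fs)) lt))
    where
    A B : 𝔽
    A = ⊟ (b ⁻¹ ⊠ a)
    B = ⊟ (b ⁻¹ ⊠ c)
    rewrite-δ : ∀ x t → a ⊞ b ⊠ t ⊞ c ⊠ x ≡ b ⊠ (t ⊞ ⊟ (A ⊞ B ⊠ x))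
    rewrite-δ x t = trans (solve 5 (λ a b c x t → a :+ b :* t :+ c :* x := b :* t :+ 𝟙 :* (a :+ c :* x)) refl a b c x t)
      (trans (cong (λ z → b ⊠ t ⊞ z ⊠ (a ⊞ c ⊠ x)) (sym (⊠-inv b≢0)))
        (solve 6 (λ a b c x t i → b :* t :+ (b :* i) :* (a :+ c :* x) := b :* (t :+ :- (:- (i :* a) :+ (:- (i :* c)) :* x))) refl a b c x t (b ⁻¹)))
    column : ∀ x → S.∑ elems (λ t → δ (a ⊞ b ⊠ t ⊞ c ⊠ x) ⊠ product fs x t) ≡ linearProduct (map (onGraph A B) fs) x
    column x = trans (S.∑-cong elems (λ t → cong (_⊠ product fs x t) (trans (cong δ (rewrite-δ x t))
        (δ-cong (⊠-integral b≢0) (λ e → trans (cong (b ⊠_) e) (zeroʳ b))))))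
      (trans (∑-δ (A ⊞ B ⊠ x) (product fs x)) (product-graph A B fs x))
  ... | yes refl with c ≟F 0F
  ...   | no c≢0 = trans (S.∑-swap elems elems _) (trans (S.∑-cong elems row) (product-column x′ fs lt))
    where
    x′ : 𝔽
    x′ = ⊟ (c ⁻¹ ⊠ a)
    rewrite-δ : ∀ x t → a ⊞ 0F ⊠ t ⊞ c ⊠ x ≡ c ⊠ (x ⊞ ⊟ x′)
    rewrite-δ x t = trans (solve 4 (λ a c x t → a :+ 𝟎 :* t :+ c :* x := c :* x :+ 𝟙 :* a) refl a c x t)
      (trans (cong (λ z → c ⊠ x ⊞ z ⊠ a) (sym (⊠-inv c≢0)))
        (solve 4 (λ a c x i → c :* x :+ (c :* i) :* a := c :* (x :+ :- (:- (i :* a)))) refl a c x (c ⁻¹)))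
    row : ∀ t → S.∑ elems (λ x → δ (a ⊞ 0F ⊠ t ⊞ c ⊠ x) ⊠ product fs x t) ≡ product fs x′ t
    row t = trans (S.∑-cong elems (λ x → cong (_⊠ product fs x t) (trans (cong δ (rewrite-δ x t))
        (δ-cong (⊠-integral c≢0) (λ e → trans (cong (c ⊠_) e) (zeroʳ c))))))
      (∑-δ x′ (λ x → product fs x t))
  ...   | yes refl = S.∑-zero elems (λ x → trans (S.∑-cong elems (λ t → cong (λ z → δ z ⊠ product fs x t)
              (solve 3 (λ a t x → a :+ 𝟎 :* t :+ 𝟎 :* x := a) refl a t x)))
            (trans (S.∑-⊠ˡ elems (δ a) _) (trans (cong (δ a ⊠_) (product-column x fs lt)) (zeroʳ _))))

  -- Products of at most q - 2 affine functions are orthogonal to every word; these are the parity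
  -- checks behind the rank argument.
  moment : ∀ Ts fs → suc (length fs) < q → S.∑ elems (λ x → S.∑ elems (λ t → value Ts x t ⊠ product fs x t)) ≡ 0F
  moment Ts fs lt = begin
    S.∑ elems (λ x → S.∑ elems (λ t → value Ts x t ⊠ product fs x t))
      ≡⟨ S.∑-cong elems (λ x → trans (S.∑-cong elems (λ t → sym (S.∑-⊠ʳ Ts (product fs x t) (λ T → term T x t)))) (S.∑-swap elems Ts _)) ⟩
    S.∑ elems (λ x → S.∑ Ts (λ T → S.∑ elems (λ t → term T x t ⊠ product fs x t)))
      ≡⟨ S.∑-swap elems Ts _ ⟩
    S.∑ Ts (λ T → S.∑ elems (λ x → S.∑ elems (λ t → term T x t ⊠ product fs x t)))
      ≡⟨ S.∑-zero Ts each ⟩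
    0F ∎
    where
    open ≡-Reasoning
    each : ∀ T → S.∑ elems (λ x → S.∑ elems (λ t → term T x t ⊠ product fs x t)) ≡ 0F
    each (l , a , b , c) = trans (S.∑-cong elems (λ x → trans (S.∑-cong elems (λ t → *-assoc l _ _)) (S.∑-⊠ˡ elems l _)))
      (trans (S.∑-⊠ˡ elems l _) (trans (cong (l ⊠_) (line-moment a b c fs lt)) (zeroʳ l)))

  module _ {A : Set} (pts : List A) (D : A → 𝔽) where

    pairing : (A → 𝔽) → (A → 𝔽) → 𝔽
    pairing H K = S.∑ pts (λ P → D P ⊠ (H P ⊠ K P))

    private
      comb : (hks : List ((A → 𝔽) × (A → 𝔽))) → Vector (length hks) → A → 𝔽
      comb []              []       P = 0F
      comb ((H , K) ∷ hks) (a ∷ as) P = a ⊠ H P ⊞ comb hks as P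

      rows : (hks : List ((A → 𝔽) × (A → 𝔽))) → Fam (length pts) (length hks)
      rows []              = []
      rows ((H , K) ∷ hks) = Vec.map H (Vec.fromList pts) ∷ rows hks

      lincomb-rows : ∀ hks a → lincomb a (rows hks) ≡ Vec.map (comb hks a) (Vec.fromList pts)
      lincomb-rows []              []       = sym (Vec.map-const (Vec.fromList pts) 0F)
      lincomb-rows ((H , K) ∷ hks) (a ∷ as) = trans (cong (a ·V Vec.map H (Vec.fromList pts) +V_) (lincomb-rows hks as)) (pointwise (Vec.fromList pts))
        where
        pointwise : ∀ {k} (xs : Vec A k) → a ·V Vec.map H xs +V Vec.map (comb hks as) xs ≡ Vec.map (λ P → a ⊠ H P ⊞ comb hks as P) xs
        pointwise []       = refl
        pointwise (x ∷ xs) = cong (_ ∷_) (pointwise xs)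

      pairing-split : ∀ H a G K → pairing (λ P → a ⊠ H P ⊞ G P) K ≡ a ⊠ pairing H K ⊞ pairing G K
      pairing-split H a G K = trans (S.∑-cong pts (λ P → solve 5 (λ d a h g k → d :* ((a :* h :+ g) :* k) := a :* (d :* (h :* k)) :+ d :* (g :* k)) refl (D P) a (H P) (G P) (K P)))
        (trans (S.∑-∙ pts _ _) (cong (_⊞ pairing G K) (S.∑-⊠ˡ pts a _)))

      pairing-comb : ∀ hks a K → All (λ hk → pairing (proj₁ hk) K ≡ 0F) hks → pairing (comb hks a) K ≡ 0F
      pairing-comb []              []       K []       = S.∑-zero pts (λ P → ⊠-zero (zeroˡ _))
      pairing-comb ((H , _) ∷ hks) (a ∷ as) K (p ∷ ps) = trans (pairing-split H a (comb hks as) K)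
        (trans (cong₂ (λ x y → a ⊠ x ⊞ y) p (pairing-comb hks as K ps)) (trans (+-identityʳ _) (zeroʳ a)))

      independent : ∀ hks → AllPairs (λ e l → pairing (proj₁ l) (proj₂ e) ≡ 0F) hks → All (λ hk → pairing (proj₁ hk) (proj₂ hk) ≢ 0F) hks →
        ∀ a → (∀ {P} → P ∈ pts → comb hks a P ≡ 0F) → a ≡ zeroV
      independent []              _         _        []       _ = refl
      independent ((H , K) ∷ hks) (up ∷ ups) (d ∷ ds) (a ∷ as) z = cong₂ _∷_ a≡0
        (independent hks ups ds as (λ P∈ → trans (sym (trans (cong (_⊞ comb hks as _) (zero-⊠ a≡0)) (+-identityˡ _))) (z P∈)))
        where
        a≡0 : a ≡ 0F
        a≡0 = ⊠-integral d (trans (*-comm _ _) (trans (sym (trans (pairing-split H a (comb hks as) K)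
          (trans (cong (a ⊠ pairing H K ⊞_) (pairing-comb hks as K up)) (+-identityʳ _))))
          (trans (S.∑-cong∈ pts (λ {P} P∈ → trans (cong (λ y → D P ⊠ (y ⊠ K P)) (z P∈)) (⊠-zero (zeroˡ _)))) (S.∑-ε pts))))

    -- The matrix of pairings factors through the functions on `pts`, so its rank is at most their
    -- number, while a triangular matrix with nonzero diagonal has full rank. Concretely, a linear
    -- relation between the H on `pts` is paired with the K in order: against the first K only the
    -- first H survives, so its coefficient vanishes.
    triangular-bound : ∀ hks → AllPairs (λ e l → pairing (proj₁ l) (proj₂ e) ≡ 0F) hks →
      All (λ hk → pairing (proj₁ hk) (proj₂ hk) ≢ 0F) hks → length hks ≤ length pts
    triangular-bound hks ups ds with length hks ≤? length pts
    ... | yes le = le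
    ... | no gt with dependent (rows hks) (ℕ.≰⇒> gt)
    ...   | a , a≢0 , e = ⊥-elim (a≢0 (independent hks ups ds a (vanish pts (trans (sym (lincomb-rows hks a)) e))))
      where
      vanish : ∀ xs → Vec.map (comb hks a) (Vec.fromList xs) ≡ Vec.replicate (length xs) 0F → ∀ {P} → P ∈ xs → comb hks a P ≡ 0F
      vanish (x ∷ xs) f (here refl) = proj₁ (Vec.∷-injective f)
      vanish (x ∷ xs) f (there P∈)  = vanish xs (proj₂ (Vec.∷-injective f)) P∈

  private
    roots : List 𝔽 → 𝔽 → 𝔽
    roots us t = product (map (λ u → ⊟ u , 1F , 0F) us) 0F t

    roots-product : ∀ us x t → product (map (λ u → ⊟ u , 1F , 0F) us) x t ≡ roots us t
    roots-product []       x t = refl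
    roots-product (u ∷ us) x t = cong₂ _⊠_ (solve 3 (λ u x t → :- u :+ 𝟙 :* t :+ 𝟎 :* x := :- u :+ 𝟙 :* t :+ 𝟎 :* 𝟎) refl u x t) (roots-product us x t)

    roots-zero : ∀ {us t} → t ∈ us → roots us t ≡ 0F
    roots-zero {u ∷ us} {t} (here refl) = zero-⊠ (solve 1 (λ t → :- t :+ 𝟙 :* t :+ 𝟎 :* 𝟎 := 𝟎) refl t)
    roots-zero {u ∷ us} {t} (there t∈)  = ⊠-zero (roots-zero t∈)

    roots-nonzero : ∀ {us t} → ¬ t ∈ us → roots us t ≢ 0F
    roots-nonzero {[]}     {t} _ = 1≢0
    roots-nonzero {u ∷ us} {t} n = ⊠-nonzero
      (λ e → n (here (sub-zero⇒≡ t u (trans (solve 2 (λ t u → t :+ :- u := :- u :+ 𝟙 :* t :+ 𝟎 :* 𝟎) refl t u) e))))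
      (roots-nonzero (n ∘ there))

    powers : ℕ → List (𝔽 × 𝔽 × 𝔽)
    powers zero    = []
    powers (suc b) = (0F , 0F , 1F) ∷ powers b

    powers-product : ∀ b x t → product (powers b) x t ≡ pow x b
    powers-product zero    x t = refl
    powers-product (suc b) x t = cong₂ _⊠_ (solve 2 (λ x t → 𝟎 :+ 𝟎 :* t :+ 𝟙 :* x := x) refl x t) (powers-product b x t)

    powers-length : ∀ b → length (powers b) ≡ b
    powers-length zero    = refl
    powers-length (suc b) = cong suc (powers-length b)

    pow-+ : ∀ x a b → pow x (a + b) ≡ pow x a ⊠ pow x b
    pow-+ x zero    b = sym (*-identityˡ _)
    pow-+ x (suc a) b = trans (cong (x ⊠_) (pow-+ x a b)) (sym (*-assoc _ _ _))

    pow-one : ∀ b → pow 1F b ≡ 1F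
    pow-one zero    = refl
    pow-one (suc b) = trans (*-identityˡ _) (pow-one b)

    pow-sub : ∀ {x} → x ≢ 0F → ∀ {b b′} → b′ ≤ b → pow x b ⊠ pow (x ⁻¹) b′ ≡ pow x (b ∸ b′)
    pow-sub {x} n {b} {b′} le = begin
      pow x b ⊠ pow (x ⁻¹) b′                         ≡⟨ cong (λ c → pow x c ⊠ pow (x ⁻¹) b′) (sym (ℕ.m∸n+n≡m le)) ⟩
      pow x (b ∸ b′ + b′) ⊠ pow (x ⁻¹) b′             ≡⟨ cong (_⊠ pow (x ⁻¹) b′) (pow-+ x (b ∸ b′) b′) ⟩
      (pow x (b ∸ b′) ⊠ pow x b′) ⊠ pow (x ⁻¹) b′     ≡⟨ *-assoc _ _ _ ⟩
      pow x (b ∸ b′) ⊠ (pow x b′ ⊠ pow (x ⁻¹) b′)     ≡⟨ cong (pow x (b ∸ b′) ⊠_) (trans (sym (pow-⊠ x (x ⁻¹) b′)) (trans (cong (λ z → pow z b′) (⊠-inv n)) (pow-one b′))) ⟩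
      pow x (b ∸ b′) ⊠ 1F                             ≡⟨ *-identityʳ _ ⟩
      pow x (b ∸ b′)                                  ∎
      where open ≡-Reasoning

    lex-× : {A B : Set} {R : A → A → Set} {Q : B → B → Set} (xs : List A) (ys : List B) → AllPairs R xs → AllPairs Q ys →
      AllPairs (λ { (a , b) (c , d) → R a c ⊎ (a ≡ c × Q b d) }) (cartesianProduct xs ys)
    lex-× []       ys _          _  = []
    lex-× (x ∷ xs) ys (px ∷ pxs) qs = AllPairs.++⁺ (AllPairs.map⁺ (AllPairs.map (λ r → inj₂ (refl , r)) qs)) (lex-× xs ys pxs qs)
      (All.map⁺ (All.universal (λ y → All.tabulate (λ {z} z∈ → inj₁ (All.lookup px (first∈ z∈)))) ys))
      where
      open import Data.List.Membership.Propositional.Properties using (∈-cartesianProduct⁻)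
      first∈ : ∀ {z} → z ∈ cartesianProduct xs ys → proj₁ z ∈ xs
      first∈ z∈ = proj₁ (∈-cartesianProduct⁻ xs ys z∈)

  -- The line is x = 0. Test functions are indexed by τ of its support points y and by Q + 1
  -- exponents b. `L₁` and `L₂` share out the remaining support points in dependence on b, so that
  -- for equal b every support point except y = y′ is a root of H · K, while for b′ ≤ b the degree
  -- of the product stays within Q + 2(τ - 1) = q - 2.
  module TestFunctions (Ts : List Term) (τ Q : ℕ) (qτ : q ≡ τ + τ + Q) (τ≥1 : 1 ≤ τ) where

    supp : List 𝔽
    supp = filter (λ t → ¬? (value Ts 0F t ≟F 0F)) elems

    supp-unique : Unique supp
    supp-unique = Unique.filter⁺ _ elems-unique

    supp-nonzero : ∀ {t} → t ∈ supp → value Ts 0F t ≢ 0F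
    supp-nonzero t∈ = proj₂ (∈-filter⁻ (λ t → ¬? (value Ts 0F t ≟F 0F)) {xs = elems} t∈)

    supp-complete : ∀ {t} → value Ts 0F t ≢ 0F → t ∈ supp
    supp-complete n = ∈-filter⁺ (λ t → ¬? (value Ts 0F t ≟F 0F)) (elems-complete _) n

    ys rest : List 𝔽
    ys   = take τ supp
    rest = drop τ supp

    others : 𝔽 → List 𝔽
    others y = filter (λ z → ¬? (z ≟F y)) ys

    L₁ L₂ : ℕ → 𝔽 → List 𝔽
    L₁ b y = drop b rest ++ others y
    L₂ b y = take b rest ++ others y

    -- Off the line the powers of x combine to x^(b - b′). Read as a polynomial this vanishes on the
    -- line unless b = b′, which makes the matrix of pairings triangular in b.
    H K : ℕ × 𝔽 → 𝔽 × 𝔽 → 𝔽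
    H (b , y) (x , t) = pow x b ⊠ roots (L₁ b y) t
    K (b , y) (x , t) = pow (x ⁻¹) b ⊠ roots (L₂ b y) t

    grid points : List (𝔽 × 𝔽)
    grid = cartesianProduct elems⁺ elems
    points = filter (λ { (x , t) → ¬? (value Ts x t ≟F 0F) }) grid

    D : 𝔽 × 𝔽 → 𝔽
    D (x , t) = value Ts x t

    factors : ℕ × 𝔽 → ℕ × 𝔽 → List (𝔽 × 𝔽 × 𝔽)
    factors (b , y) (b′ , y′) = powers (b ∸ b′) ++ map (λ u → ⊟ u , 1F , 0F) (L₁ b y ++ L₂ b′ y′)

    roots-++ : ∀ us vs t → roots (us ++ vs) t ≡ roots us t ⊠ roots vs t
    roots-++ us vs t = trans (cong (λ l → product l 0F t) (List.map-++ _ us vs)) (product-++ (map _ us) _ 0F t)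

    factors-product : ∀ i j x t → product (factors i j) x t ≡ pow x (proj₁ i ∸ proj₁ j) ⊠ (roots (L₁ (proj₁ i) (proj₂ i)) t ⊠ roots (L₂ (proj₁ j) (proj₂ j)) t)
    factors-product (b , y) (b′ , y′) x t = trans (product-++ (powers (b ∸ b′)) _ x t)
      (cong₂ _⊠_ (powers-product (b ∸ b′) x t) (trans (roots-product (L₁ b y ++ L₂ b′ y′) x t) (roots-++ (L₁ b y) _ t)))

    -- Summed over the whole plane the product vanishes, so the pairing is minus the x = 0 part.
    pairing-formula : ∀ i j → proj₁ j ≤ proj₁ i → suc (length (factors i j)) < q →
      pairing points D (H i) (K j) ≡ ⊟ S.∑ elems (λ t → value Ts 0F t ⊠ product (factors i j) 0F t)
    pairing-formula i@(b , y) j@(b′ , y′) le lt = begin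
      S.∑ points (λ P → D P ⊠ (H i P ⊠ K j P))
        ≡⟨ S.∑-filter (λ { (x , t) → ¬? (value Ts x t ≟F 0F) }) grid _ (λ _ _ → refl) (λ { (x , t) nn → vanish (x , t) nn }) ⟩
      S.∑ grid (λ P → D P ⊠ (H i P ⊠ K j P))
        ≡⟨ S.∑-× _,_ elems⁺ elems _ ⟩
      S.∑ elems⁺ (λ x → S.∑ elems (λ t → value Ts x t ⊠ (H i (x , t) ⊠ K j (x , t))))
        ≡⟨ S.∑-cong∈ elems⁺ (λ {x} x∈ → S.∑-cong elems (λ t → cong (value Ts x t ⊠_) (merge x t (elems⁺-nonzero x∈)))) ⟩
      S.∑ elems⁺ Ψ
        ≡⟨ ⊞-cancelˡ (Ψ 0F) (trans (sym (∑-split Ψ)) (trans (moment Ts (factors i j) lt) (sym (-‿inverseʳ (Ψ 0F))))) ⟩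
      ⊟ Ψ 0F ∎
      where
      open ≡-Reasoning
      Ψ : 𝔽 → 𝔽
      Ψ x = S.∑ elems (λ t → value Ts x t ⊠ product (factors i j) x t)
      vanish : ∀ P → ¬ (D P ≢ 0F) → D P ⊠ (H i P ⊠ K j P) ≡ 0F
      vanish P nn with D P ≟F 0F
      ... | yes e = zero-⊠ e
      ... | no n  = ⊥-elim (nn n)
      merge : ∀ x t → x ≢ 0F → H i (x , t) ⊠ K j (x , t) ≡ product (factors i j) x t
      merge x t n = trans (solve 4 (λ a r c s → (a :* r) :* (c :* s) := (a :* c) :* (r :* s)) refl (pow x b) (roots (L₁ b y) t) (pow (x ⁻¹) b′) (roots (L₂ b′ y′) t))
        (trans (cong (_⊠ (roots (L₁ b y) t ⊠ roots (L₂ b′ y′) t)) (pow-sub n le)) (sym (factors-product i j x t)))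

    private
      ys++rest : ys ++ rest ≡ supp
      ys++rest = List.take++drop≡id τ supp

      disjoint : ∀ {t} → t ∈ ys → t ∈ rest → ⊥
      disjoint t∈ys t∈rest = cross (subst Unique (sym ys++rest) supp-unique) t∈ys t∈rest
        where
        cross : ∀ {xs zs : List 𝔽} {t} → Unique (xs ++ zs) → t ∈ xs → t ∈ zs → ⊥
        cross {x ∷ xs} u (here refl) t∈ = unique-∉ u (∈-++⁺ʳ xs t∈)
        cross {x ∷ xs} u (there p)   t∈ = cross (AllPairs.tail u) p t∈

      in-supp : ∀ {t} → t ∈ ys → t ∈ supp
      in-supp t∈ = subst (_ ∈_) ys++rest (∈-++⁺ˡ t∈)

      ys-unique : Unique ys
      ys-unique = Unique.take⁺ τ supp-unique

      take-∈ : ∀ b {t} → t ∈ take b rest → t ∈ rest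
      take-∈ b t∈ = subst (_ ∈_) (List.take++drop≡id b rest) (∈-++⁺ˡ t∈)

      drop-∈ : ∀ b {t} → t ∈ drop b rest → t ∈ rest
      drop-∈ b t∈ = subst (_ ∈_) (List.take++drop≡id b rest) (∈-++⁺ʳ (take b rest) t∈)

      others-length : ∀ {y} → y ∈ ys → suc (length (others y)) ≤ τ
      others-length {y} y∈ = ℕ.≤-trans (unique-⊆-length (All.tabulate (λ {z} z∈ e → proj₂ (∈-filter⁻ (λ z → ¬? (z ≟F y)) {xs = ys} z∈) (sym e)) ∷ Unique.filter⁺ _ ys-unique)
        (λ { (here refl) → y∈ ; (there z∈) → proj₁ (∈-filter⁻ (λ z → ¬? (z ≟F y)) {xs = ys} z∈) }))
        (ℕ.≤-trans (ℕ.≤-reflexive (List.length-take τ supp)) (ℕ.m⊓n≤m τ _))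

      others-∈ : ∀ {y t} → t ∈ ys → t ≢ y → t ∈ others y
      others-∈ {y} t∈ n = ∈-filter⁺ (λ z → ¬? (z ≟F y)) t∈ n

      ∉L₁ : ∀ b {y} → y ∈ ys → ¬ y ∈ L₁ b y
      ∉L₁ b {y} y∈ p with ∈-++⁻ (drop b rest) p
      ... | inj₁ r = disjoint y∈ (drop-∈ b r)
      ... | inj₂ o = proj₂ (∈-filter⁻ (λ z → ¬? (z ≟F y)) {xs = ys} o) refl

      ∉L₂ : ∀ b {y} → y ∈ ys → ¬ y ∈ L₂ b y
      ∉L₂ b {y} y∈ p with ∈-++⁻ (take b rest) p
      ... | inj₁ r = disjoint y∈ (take-∈ b r)
      ... | inj₂ o = proj₂ (∈-filter⁻ (λ z → ¬? (z ≟F y)) {xs = ys} o) refl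

      at : ∀ i j t → value Ts 0F t ⊠ product (factors i j) 0F t ≡
        value Ts 0F t ⊠ (pow 0F (proj₁ i ∸ proj₁ j) ⊠ (roots (L₁ (proj₁ i) (proj₂ i)) t ⊠ roots (L₂ (proj₁ j) (proj₂ j)) t))
      at i j t = cong (value Ts 0F t ⊠_) (factors-product i j 0F t)

      kill : ∀ i j t → pow 0F (proj₁ i ∸ proj₁ j) ≡ 0F ⊎ roots (L₁ (proj₁ i) (proj₂ i)) t ≡ 0F ⊎ roots (L₂ (proj₁ j) (proj₂ j)) t ≡ 0F ⊎ value Ts 0F t ≡ 0F →
        value Ts 0F t ⊠ product (factors i j) 0F t ≡ 0F
      kill i j t (inj₁ e) = trans (at i j t) (⊠-zero (zero-⊠ e))
      kill i j t (inj₂ (inj₁ e)) = trans (at i j t) (⊠-zero (⊠-zero (zero-⊠ e)))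
      kill i j t (inj₂ (inj₂ (inj₁ e))) = trans (at i j t) (⊠-zero (⊠-zero (⊠-zero e)))
      kill i j t (inj₂ (inj₂ (inj₂ e))) = zero-⊠ e

      locate : ∀ b t → t ∈ supp → t ∈ ys ⊎ t ∈ drop b rest ⊎ t ∈ take b rest
      locate b t t∈ with ∈-++⁻ ys (subst (t ∈_) (sym ys++rest) t∈)
      ... | inj₁ p = inj₁ p
      ... | inj₂ p with ∈-++⁻ (take b rest) (subst (t ∈_) (sym (List.take++drop≡id b rest)) p)
      ...   | inj₁ p₁ = inj₂ (inj₂ p₁)
      ...   | inj₂ p₂ = inj₂ (inj₁ p₂)

      -- Every point of the support other than y = y′ is a root of one of the two products.
      dead : ∀ b y y′ t → t ≢ y ⊎ t ≢ y′ → value Ts 0F t ⊠ product (factors (b , y) (b , y′)) 0F t ≡ 0F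
      dead b y y′ t ne with value Ts 0F t ≟F 0F
      ... | yes e = kill (b , y) (b , y′) t (inj₂ (inj₂ (inj₂ e)))
      ... | no n with locate b t (supp-complete n)
      ...   | inj₂ (inj₁ p) = kill (b , y) (b , y′) t (inj₂ (inj₁ (roots-zero (∈-++⁺ˡ p))))
      ...   | inj₂ (inj₂ p) = kill (b , y) (b , y′) t (inj₂ (inj₂ (inj₁ (roots-zero (∈-++⁺ˡ p)))))
      ...   | inj₁ p = kill (b , y) (b , y′) t (case ne of λ
                { (inj₁ t≢y)  → inj₂ (inj₁ (roots-zero (∈-++⁺ʳ (drop b rest) (others-∈ p t≢y))))
                ; (inj₂ t≢y′) → inj₂ (inj₂ (inj₁ (roots-zero (∈-++⁺ʳ (take b rest) (others-∈ p t≢y′))))) })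

    -- The first bound supplies the τ chosen support points; the second leaves at most Q others,
    -- which is the degree still available.
    module Count (τ≤s : τ ≤ length supp) (s+τ≤q : length supp + τ ≤ q) where

      private
        rest≤Q : length rest ≤ Q
        rest≤Q = ℕ.+-cancelˡ-≤ (τ + τ) _ _ (ℕ.≤-trans (ℕ.≤-reflexive
          (trans (cong (τ + τ +_) (List.length-drop τ supp)) (trans (ℕ.+-assoc τ τ _) (trans (cong (τ +_) (ℕ.m+[n∸m]≡n τ≤s)) (ℕ.+-comm τ _)))))
          (ℕ.≤-trans s+τ≤q (ℕ.≤-reflexive qτ)))

        short : ∀ i j → proj₂ i ∈ ys → proj₂ j ∈ ys → proj₁ j ≤ proj₁ i → proj₁ i ≤ Q → suc (length (factors i j)) < q
        short i@(b , y) j@(b′ , y′) y∈ y′∈ le b≤Q = begin-strict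
          suc (length (factors i j))
            ≡⟨ cong suc (trans (List.length-++ (powers (b ∸ b′))) (cong₂ _+_ (powers-length (b ∸ b′))
                 (trans (List.length-map _ (L₁ b y ++ L₂ b′ y′)) (trans (List.length-++ (L₁ b y))
                   (cong₂ _+_ (List.length-++ (drop b rest)) (List.length-++ (take b′ rest))))))) ⟩
          suc (b ∸ b′ + ((length (drop b rest) + o) + (length (take b′ rest) + o′)))
            ≡⟨ cong suc (rearrange (b ∸ b′) (length (drop b rest)) o (length (take b′ rest)) o′) ⟩
          suc (o + o′ + (b ∸ b′ + length (take b′ rest) + length (drop b rest)))
            <⟨ s≤s (s≤s (ℕ.+-monoʳ-≤ (o + o′) (ℕ.+-mono-≤ (ℕ.≤-trans (ℕ.+-monoʳ-≤ (b ∸ b′)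
                 (ℕ.≤-trans (ℕ.≤-reflexive (List.length-take b′ rest)) (ℕ.m⊓n≤m b′ _))) (ℕ.≤-reflexive (ℕ.m∸n+n≡m le)))
                 (ℕ.≤-reflexive (List.length-drop b rest))))) ⟩
          suc (suc (o + o′ + (b + (length rest ∸ b))))
            ≤⟨ s≤s (s≤s (ℕ.+-monoʳ-≤ (o + o′) (bound b b≤Q))) ⟩
          suc (suc (o + o′ + Q))
            ≡⟨ cong suc (cong (_+ Q) (sym (ℕ.+-suc o o′))) ⟩
          suc o + suc o′ + Q
            ≤⟨ ℕ.+-monoˡ-≤ Q (ℕ.+-mono-≤ (others-length y∈) (others-length y′∈)) ⟩
          τ + τ + Q
            ≡⟨ sym qτ ⟩
          q ∎
          where
          open ℕ.≤-Reasoning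
          o o′ : ℕ
          o  = length (others y)
          o′ = length (others y′)
          rearrange : ∀ d r o r′ o′ → d + ((r + o) + (r′ + o′)) ≡ o + o′ + (d + r′ + r)
          rearrange = solve-∀
          bound : ∀ b → b ≤ Q → b + (length rest ∸ b) ≤ Q
          bound b b≤Q with ℕ.≤-total b (length rest)
          ... | inj₁ p = ℕ.≤-trans (ℕ.≤-reflexive (ℕ.m+[n∸m]≡n p)) rest≤Q
          ... | inj₂ p = ℕ.≤-trans (ℕ.≤-reflexive (trans (cong (b +_) (ℕ.m≤n⇒m∸n≡0 p)) (ℕ.+-identityʳ b))) b≤Q

      indices : List (ℕ × 𝔽)
      indices = cartesianProduct (upTo (suc Q)) ys

      private
        index-∈ : ∀ {i} → i ∈ indices → proj₁ i ≤ Q × proj₂ i ∈ ys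
        index-∈ {i} i∈ with ∈-cartesianProduct⁻ (upTo (suc Q)) ys i∈
          where open import Data.List.Membership.Propositional.Properties using (∈-cartesianProduct⁻)
        ... | p , r = ℕ.≤-pred (∈-upTo⁻ p) , r
          where open import Data.List.Membership.Propositional.Properties using (∈-upTo⁻)

        Lex : ℕ × 𝔽 → ℕ × 𝔽 → Set
        Lex (b′ , y′) (b , y) = b′ < b ⊎ (b′ ≡ b × y′ ≢ y)

        ordered : AllPairs Lex indices
        ordered = AllPairs.map (λ r → r) (lex-× (upTo (suc Q)) ys (AllPairs.applyUpTo⁺₁ id (suc Q) (λ lt _ → lt)) ys-unique)

        upper : ∀ {e l} → e ∈ indices → l ∈ indices → Lex e l → pairing points D (H l) (K e) ≡ 0F
        upper {b′ , y′} {b , y} e∈ l∈ (inj₁ lt) = trans (pairing-formula (b , y) (b′ , y′) (ℕ.<⇒≤ lt)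
            (short (b , y) (b′ , y′) (proj₂ (index-∈ l∈)) (proj₂ (index-∈ e∈)) (ℕ.<⇒≤ lt) (proj₁ (index-∈ l∈))))
          (trans (cong ⊟_ (S.∑-zero elems (λ t → kill (b , y) (b′ , y′) t (inj₁ (pow-zero (ℕ.m<n⇒0<n∸m lt)))))) neg-zero)
          where
          pow-zero : ∀ {d} → 0 < d → pow 0F d ≡ 0F
          pow-zero {suc d} _ = zeroˡ _
        upper {b , y′} {b , y} e∈ l∈ (inj₂ (refl , ne)) = trans (pairing-formula (b , y) (b , y′) ℕ.≤-refl
            (short (b , y) (b , y′) (proj₂ (index-∈ l∈)) (proj₂ (index-∈ e∈)) ℕ.≤-refl (proj₁ (index-∈ l∈))))
          (trans (cong ⊟_ (S.∑-zero elems (λ t → dead b y y′ t (differ t)))) neg-zero)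
          where
          differ : ∀ t → t ≢ y ⊎ t ≢ y′
          differ t with t ≟F y
          ... | yes refl = inj₂ (ne ∘ sym)
          ... | no n     = inj₁ n

        diagonal : ∀ {i} → i ∈ indices → pairing points D (H i) (K i) ≢ 0F
        diagonal {b , y} i∈ e = neg-nonzero nonzero (trans (sym formula) e)
          where
          y∈ : y ∈ ys
          y∈ = proj₂ (index-∈ i∈)
          G : 𝔽
          G = value Ts 0F y ⊠ product (factors (b , y) (b , y)) 0F y
          formula : pairing points D (H (b , y)) (K (b , y)) ≡ ⊟ G
          formula = trans (pairing-formula (b , y) (b , y) ℕ.≤-refl (short (b , y) (b , y) y∈ y∈ ℕ.≤-refl (proj₁ (index-∈ i∈))))
            (cong ⊟_ (S.∑-single y _ elems-unique (elems-complete y) (λ t n → dead b y y t (inj₁ n))))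
          nonzero : G ≢ 0F
          nonzero = ⊠-nonzero (supp-nonzero (in-supp y∈)) (λ f → ⊠-nonzero (roots-nonzero (∉L₁ b y∈)) (roots-nonzero (∉L₂ b y∈))
            (trans (sym (trans (cong (λ d → pow 0F d ⊠ (roots (L₁ b y) y ⊠ roots (L₂ b y) y)) (ℕ.n∸n≡0 b)) (*-identityˡ _))) (trans (sym (factors-product (b , y) (b , y) 0F y)) f)))

        AllPairs-∈ : {A : Set} {R : A → A → Set} {T : A → A → Set} (xs : List A) → AllPairs R xs →
          (∀ {x y} → x ∈ xs → y ∈ xs → R x y → T x y) → AllPairs T xs
        AllPairs-∈ []       _          f = []
        AllPairs-∈ (x ∷ xs) (px ∷ pxs) f = All.tabulate (λ y∈ → f (here refl) (there y∈) (All.lookup px y∈)) ∷ AllPairs-∈ xs pxs (λ x∈ y∈ → f (there x∈) (there y∈))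

      bound : suc Q * τ ≤ length points
      bound = ℕ.≤-trans (ℕ.≤-reflexive (sym count)) (triangular-bound points D (map (λ i → H i , K i) indices)
          (AllPairs.map⁺ (AllPairs-∈ indices ordered upper)) (All.map⁺ (All.tabulate diagonal)))
        where
        count : length (map (λ i → H i , K i) indices) ≡ suc Q * τ
        count = trans (List.length-map _ indices) (trans (length-× _,_ (upTo (suc Q)) ys)
          (cong₂ _*_ (List.length-upTo (suc Q)) (trans (List.length-take τ supp) (ℕ.m≤n⇒m⊓n≡m τ≤s))))

  nz-count : {A : Set} (f : A → 𝔽) (xs : List A) → length (filter (λ t → ¬? (f t ≟F 0F)) xs) ≡ N.∑ xs (λ t → nz (f t))
  nz-count f []       = refl
  nz-count f (x ∷ xs) with f x ≟F 0F
  ... | yes _ = nz-count f xs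
  ... | no _  = cong suc (nz-count f xs)

  -- Subtracting μ times the indicator of the line x = 0 changes the word on that line only, so
  -- deviations from any constant are treated like nonzero values, and the points counted off the
  -- line are unaffected.
  rank-bound : ∀ Ts μ τ Q → q ≡ τ + τ + Q → 1 ≤ τ →
    τ ≤ N.∑ elems (λ t → nz (value Ts 0F t ⊞ ⊟ μ)) → N.∑ elems (λ t → nz (value Ts 0F t ⊞ ⊟ μ)) + τ ≤ q →
    suc Q * τ ≤ N.∑ elems⁺ (λ x → N.∑ elems (λ t → nz (value Ts x t)))
  rank-bound Ts μ τ Q qτ τ≥1 lo hi = ℕ.≤-trans (Count.bound (subst (τ ≤_) (sym supp-count) lo) (subst (λ s → s + τ ≤ q) (sym supp-count) hi)) (ℕ.≤-reflexive points-count)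
    where
    Ts′ : List Term
    Ts′ = (⊟ μ , 0F , 0F , 1F) ∷ Ts
    open TestFunctions Ts′ τ Q qτ τ≥1
    on-line : ∀ t → value Ts′ 0F t ≡ value Ts 0F t ⊞ ⊟ μ
    on-line t = trans (cong (λ z → ⊟ μ ⊠ z ⊞ value Ts 0F t) (δ-yes (solve 1 (λ t → 𝟎 :+ 𝟎 :* t :+ 𝟙 :* 𝟎 := 𝟎) refl t)))
      (solve 2 (λ m v → :- m :* 𝟙 :+ v := v :+ :- m) refl μ _)
    off-line : ∀ {x} t → x ≢ 0F → value Ts′ x t ≡ value Ts x t
    off-line {x} t n = trans (cong (λ z → ⊟ μ ⊠ z ⊞ value Ts x t) (δ-no (n ∘ trans (solve 2 (λ t x → x := 𝟎 :+ 𝟎 :* t :+ 𝟙 :* x) refl t x))))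
      (solve 2 (λ m v → :- m :* 𝟎 :+ v := v) refl μ _)
    supp-count : length supp ≡ N.∑ elems (λ t → nz (value Ts 0F t ⊞ ⊟ μ))
    supp-count = trans (nz-count (value Ts′ 0F) elems) (N.∑-cong elems (λ t → cong nz (on-line t)))
    points-count : length points ≡ N.∑ elems⁺ (λ x → N.∑ elems (λ t → nz (value Ts x t)))
    points-count = trans (nz-count D grid) (trans (N.∑-× _,_ elems⁺ elems _)
      (N.∑-cong∈ elems⁺ (λ {x} x∈ → N.∑-cong elems (λ t → cong nz (off-line t (elems⁺-nonzero x∈))))))

-- Words as functions on vectors, and counts along lines

module Words (F : FiniteField) where
  open LinearAlgebra F public
  open RankBound F using (Term; value; rank-bound)
  open Solver using (solve; _:=_; _:+_; _:*_; :-_; 𝟎; 𝟙)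

  -- A combination of hyperplanes, as a function on vectors; k = 0 gives the constant functions.
  Code : ℕ → Set
  Code m = List (𝔽 × Lin m)

  val : ∀ {m} → Code m → Vector m → 𝔽
  val L v = S.∑ L (λ lk → proj₁ lk ⊠ δ (ap (proj₂ lk) v))

  pullCode : ∀ {m r} → Code m → Fam m r → Code r
  pullCode L vs = map (λ lk → proj₁ lk , pull (proj₂ lk) vs) L

  val-pull : ∀ {m r} (L : Code m) (vs : Fam m r) a → val (pullCode L vs) a ≡ val L (lincomb a vs)
  val-pull L vs a = S.∑-map _ L _

  val-scale : ∀ {m} (L : Code m) {t} v → t ≢ 0F → val L (t ·V v) ≡ val L v
  val-scale L {t} v t≢0 = S.∑-cong L (λ lk → cong (proj₁ lk ⊠_) (same (proj₂ lk)))
    where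
    same : ∀ k → δ (ap k (t ·V v)) ≡ δ (ap k v)
    same k with ap k v ≟F 0F
    ... | yes e = δ-yes (trans (ap-· k t v) (⊠-zero e))
    ... | no n  = δ-no (ap-·-nonzero k t≢0 n)

  -- Subspaces are duplicate-free lists: sums run over them directly, and intersecting with a kernel
  -- is filtering, without a choice of basis.
  record Sub (m : ℕ) : Set where
    field
      els    : List (Vector m)
      unique : Unique els
      has-0  : zeroV ∈ els
      closed : ∀ {u v} t → u ∈ els → v ∈ els → u +V t ·V v ∈ els
  open Sub public

  ∣_∣ : ∀ {m} → Sub m → ℕ
  ∣ U ∣ = length (els U)

  allVecs-complete : ∀ {m} (v : Vector m) → v ∈ allVecs m
  allVecs-complete []       = here refl
  allVecs-complete (x ∷ xs) = ∈-cartesianProductWith⁺ _∷_ (elems-complete x) (allVecs-complete xs)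

  allVecs-unique : ∀ m → Unique (allVecs m)
  allVecs-unique zero    = [] ∷ []
  allVecs-unique (suc m) = Unique.cartesianProductWith⁺ _∷_ Vec.∷-injective elems-unique (allVecs-unique m)

  allVecs-length : ∀ m → length (allVecs m) ≡ q ^ m
  allVecs-length zero    = refl
  allVecs-length (suc m) = trans (length-× _∷_ elems (allVecs m)) (cong (q *_) (allVecs-length m))

  full : ∀ m → Sub m
  full m = record { els = allVecs m ; unique = allVecs-unique m ; has-0 = allVecs-complete _ ; closed = λ _ _ _ → allVecs-complete _ }

  ∑-affine : ∀ {m} (U : Sub m) {u t} (g : Vector m → ℕ) → u ∈ els U → t ≢ 0F → N.∑ (els U) (λ v → g (u +V t ·V v)) ≡ N.∑ (els U) g
  ∑-affine U {u} {t} g u∈ t≢0 = N.∑-bij (λ v → u +V t ·V v) (λ w → zeroV +V t ⁻¹ ·V (w +V (⊟ 1F) ·V u)) g (unique U)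
    (closed U t u∈) (λ w∈ → closed U (t ⁻¹) (has-0 U) (closed U (⊟ 1F) w∈ u∈))
    (λ v → trans (vsolve (∅ ⊕ t ⁻¹ ⊙ ((x₀ ⊕ t ⊙ x₁) ⊕ (⊟ 1F) ⊙ x₀)) (t ⁻¹ ⊙ t ⊙ x₁)
       (λ { (u ∷ v ∷ []) → solve 4 (λ t i u v → 𝟎 :+ i :* ((u :+ t :* v) :+ (:- 𝟙) :* u) := i :* (t :* v)) refl t (t ⁻¹) u v }) (u ∷ v ∷ []))
       (·V-cancel t≢0 v))
    (λ w → trans (vsolve (x₀ ⊕ t ⊙ (∅ ⊕ t ⁻¹ ⊙ (x₁ ⊕ (⊟ 1F) ⊙ x₀))) (x₀ ⊕ t ⊙ t ⁻¹ ⊙ (x₁ ⊕ (⊟ 1F) ⊙ x₀))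
       (λ { (u ∷ w ∷ []) → solve 4 (λ t i u w → u :+ t :* (𝟎 :+ i :* (w :+ (:- 𝟙) :* u)) := u :+ t :* (i :* (w :+ (:- 𝟙) :* u))) refl t (t ⁻¹) u w }) (u ∷ w ∷ []))
       (trans (cong (u +V_) (·V-cancel′ t≢0 _)) (vsolve (x₀ ⊕ (x₁ ⊕ (⊟ 1F) ⊙ x₀)) x₁
         (λ { (u ∷ w ∷ []) → solve 2 (λ u w → u :+ (w :+ (:- 𝟙) :* u) := w) refl u w }) (u ∷ w ∷ []))))

  ∑-shift : ∀ {m} (U : Sub m) {v} t (g : Vector m → ℕ) → v ∈ els U → N.∑ (els U) (λ u → g (u +V t ·V v)) ≡ N.∑ (els U) g
  ∑-shift U {v} t g v∈ = N.∑-bij (λ u → u +V t ·V v) (λ u → u +V (⊟ t) ·V v) g (unique U)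
    (λ u∈ → closed U t u∈ v∈) (λ u∈ → closed U (⊟ t) u∈ v∈)
    (λ u → vsolve ((x₀ ⊕ t ⊙ x₁) ⊕ (⊟ t) ⊙ x₁) x₀ (λ { (x ∷ y ∷ []) → solve 3 (λ t x y → (x :+ t :* y) :+ (:- t) :* y := x) refl t x y }) (u ∷ v ∷ []))
    (λ u → vsolve ((x₀ ⊕ (⊟ t) ⊙ x₁) ⊕ t ⊙ x₁) x₀ (λ { (x ∷ y ∷ []) → solve 3 (λ t x y → (x :+ (:- t) :* y) :+ t :* y := x) refl t x y }) (u ∷ v ∷ []))

  N∑-translate : (c : 𝔽) (f : 𝔽 → ℕ) → N.∑ elems (λ x → f (c ⊞ x)) ≡ N.∑ elems f
  N∑-translate c f = N.∑-bij (c ⊞_) (⊟ c ⊞_) f elems-unique (λ _ → elems-complete _) (λ _ → elems-complete _)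
    (λ x → solve 2 (λ x c → :- c :+ (c :+ x) := x) refl x c) (λ x → solve 2 (λ x c → c :+ (:- c :+ x) := x) refl x c)

  module _ {m} (L : Code m) where

    W Z : Sub m → ℕ
    W U = N.∑ (els U) (λ v → nz (val L v))
    Z U = N.∑ (els U) (λ v → zz (val L v))

    W+Z : ∀ U → W U + Z U ≡ ∣ U ∣
    W+Z U = trans (sym (N.∑-∙ (els U) _ _)) (trans (N.∑-cong (els U) (λ v → nz+zz (val L v))) (trans (N.∑-const (els U) 1) (ℕ.*-identityʳ _)))

    offCount : Vector m → Vector m → 𝔽 → ℕ
    offCount u v μ = N.∑ elems (λ t → nz (val L (u +V t ·V v) ⊞ ⊟ μ))

    lineCount : Vector m → Vector m → ℕ
    lineCount u v = N.∑ elems (λ t → nz (val L (u +V t ·V v)))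

    lineCount≡ : ∀ u v → offCount u v 0F ≡ lineCount u v
    lineCount≡ u v = N.∑-cong elems (λ t → cong nz (solve 1 (λ x → x :+ :- 𝟎 := x) refl _))

    private
      planeTerms : Vector m → Vector m → Vector m → List Term
      planeTerms u v z = map (λ lk → proj₁ lk , ap (proj₂ lk) u , ap (proj₂ lk) v , ap (proj₂ lk) z) L

      plane-value : ∀ u v z x t → value (planeTerms u v z) x t ≡ val L (u +V t ·V v +V x ·V z)
      plane-value u v z x t = trans (S.∑-map _ L _) (S.∑-cong L (λ lk → cong (λ y → proj₁ lk ⊠ δ y) (sym
        (trans (ap-line (proj₂ lk) _ x z) (trans (cong (_⊞ x ⊠ ap (proj₂ lk) z) (ap-line (proj₂ lk) u t v))
          (solve 5 (λ a b c x t → a :+ t :* b :+ x :* c := a :+ b :* t :+ c :* x) refl (ap (proj₂ lk) u) (ap (proj₂ lk) v) (ap (proj₂ lk) z) x t))))))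

    -- Sum the plane bound over the planes u + t v + x z, z ranging over U.
    space-bound : ∀ U {u v} μ τ Q → q ≡ τ + τ + Q → 1 ≤ τ → u ∈ els U → v ∈ els U →
      τ ≤ offCount u v μ → offCount u v μ + τ ≤ q → ∣ U ∣ * (suc Q * τ) ≤ length elems⁺ * (q * W U)
    space-bound U {u} {v} μ τ Q qτ τ≥1 u∈ v∈ lo hi = begin
      ∣ U ∣ * (suc Q * τ)
        ≡⟨ sym (N.∑-const (els U) _) ⟩
      N.∑ (els U) (λ z → suc Q * τ)
        ≤⟨ N.∑-mono (els U) (λ z → ℕ.≤-trans (rank-bound (planeTerms u v z) μ τ Q qτ τ≥1 (subst (τ ≤_) (same z) lo) (subst (λ s → s + τ ≤ q) (same z) hi))
             (ℕ.≤-reflexive (N.∑-cong elems⁺ (λ x → N.∑-cong elems (λ t → cong nz (plane-value u v z x t)))))) ⟩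
      N.∑ (els U) (λ z → N.∑ elems⁺ (λ x → N.∑ elems (λ t → nz (val L (u +V t ·V v +V x ·V z)))))
        ≡⟨ trans (N.∑-swap (els U) elems⁺ _) (N.∑-cong elems⁺ (λ x → N.∑-swap (els U) elems _)) ⟩
      N.∑ elems⁺ (λ x → N.∑ elems (λ t → N.∑ (els U) (λ z → nz (val L (u +V t ·V v +V x ·V z)))))
        ≡⟨ N.∑-cong∈ elems⁺ (λ x∈ → N.∑-cong elems (λ t → ∑-affine U (λ y → nz (val L y)) (closed U t u∈ v∈) (elems⁺-nonzero x∈))) ⟩
      N.∑ elems⁺ (λ x → N.∑ elems (λ t → W U))
        ≡⟨ trans (N.∑-cong elems⁺ (λ x → N.∑-const elems (W U))) (N.∑-const elems⁺ _) ⟩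
      length elems⁺ * (q * W U) ∎
      where
      open ℕ.≤-Reasoning
      same : ∀ z → offCount u v μ ≡ N.∑ elems (λ t → nz (value (planeTerms u v z) 0F t ⊞ ⊟ μ))
      same z = N.∑-cong elems (λ t → cong (λ y → nz (y ⊞ ⊟ μ)) (sym (trans (plane-value u v z 0F t)
        (cong (val L) (trans (cong (u +V t ·V v +V_) (0·V z)) (+V-identityʳ _))))))

    -- All constants μ are included and not only zero: for a pencil of hyperplanes the condition is
    -- applied to a line on which the word deviates from f₀ by an additive map.
    Good : Set
    Good = ∀ u v μ → offCount u v μ ≤ 3 ⊎ q ≤ offCount u v μ + 3

    good-line : Good → ∀ u v → lineCount u v ≤ 3 ⊎ q ≤ lineCount u v + 3
    good-line good u v = subst (λ s → s ≤ 3 ⊎ q ≤ s + 3) (lineCount≡ u v) (good u v 0F)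

    -- A line violating the dichotomy has between 4 and q - 4 exceptional places, the range of the
    -- rank bound with τ = 4 and Q = q - 8.
    few⇒good : ∀ r → q ≡ 8 + r → length elems⁺ * (q * W (full m)) < q ^ m * (suc r * 4) → Good
    few⇒good r qr lt u v μ with offCount u v μ ≤? 3 | q ≤? offCount u v μ + 3
    ... | yes p | _     = inj₁ p
    ... | no _  | yes p = inj₂ p
    ... | no ¬p | no ¬r = ⊥-elim (ℕ.<⇒≱ lt (ℕ.≤-trans (ℕ.≤-reflexive (cong (_* (suc r * 4)) (sym (allVecs-length m))))
            (space-bound (full m) μ 4 r qr (s≤s z≤n) (allVecs-complete u) (allVecs-complete v) (ℕ.≰⇒> ¬p)
              (ℕ.≤-trans (ℕ.≤-reflexive (ℕ.+-suc _ 3)) (ℕ.≰⇒> ¬r)))))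

    lineCount-split : ∀ u v → lineCount u v ≡ nz (val L u) + N.∑ elems⁺ (λ t → nz (val L (u +V t ·V v)))
    lineCount-split u v = trans (N∑-split _) (cong (λ y → nz (val L y) + N.∑ elems⁺ (λ t → nz (val L (u +V t ·V v))))
      (trans (cong (u +V_) (0·V v)) (+V-identityʳ u)))

    lineCount-shift : ∀ u v t → lineCount (u +V t ·V v) v ≡ lineCount u v
    lineCount-shift u v t = trans (N.∑-cong elems (λ s → cong (λ y → nz (val L y))
        (vsolve ((x₀ ⊕ t ⊙ x₁) ⊕ s ⊙ x₁) (x₀ ⊕ (t ⊞ s) ⊙ x₁) (λ { (x ∷ y ∷ []) → solve 4 (λ t s x y → (x :+ t :* y) :+ s :* y := x :+ (t :+ s) :* y) refl t s x y }) (u ∷ v ∷ []))))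
      (N∑-translate t (λ s → nz (val L (u +V s ·V v))))

    -- For each fixed t ≠ 0 the vector u + t v runs through U exactly once as v does.
    star-count : ∀ U {u} → u ∈ els U → N.∑ (els U) (λ v → N.∑ elems⁺ (λ t → nz (val L (u +V t ·V v)))) ≡ length elems⁺ * W U
    star-count U {u} u∈ = trans (N.∑-swap (els U) elems⁺ _)
      (trans (N.∑-cong∈ elems⁺ (λ t∈ → ∑-affine U (λ y → nz (val L y)) u∈ (elems⁺-nonzero t∈))) (N.∑-const elems⁺ _))

    -- Lines are counted as pairs of a base point u and a direction v. A line with four nonzero
    -- values has at most three zeros and is called long; X counts long pairs based at a zero, Y
    -- those based at a nonzero value.
    module Dichotomy (good : Good) (U : Sub m) (r : ℕ) (qr : q ≡ 4 + r) where
      private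
        f : Vector m → 𝔽
        f = val L
        V : List (Vector m)
        V = els U
        q′ w z : ℕ
        q′ = length elems⁺
        w  = W U
        z  = Z U

        long : Vector m → Vector m → ℕ
        long u v = 𝟏 (4 ≤? lineCount u v)

        long-cases : ∀ u v → (lineCount u v ≤ 3 × long u v ≡ 0) ⊎ (q ≤ lineCount u v + 3 × long u v ≡ 1)
        long-cases u v with 4 ≤? lineCount u v | good-line good u v
        ... | yes p | inj₁ s = ⊥-elim (ℕ.<⇒≱ (s≤s s) p)
        ... | yes p | inj₂ s = inj₂ (s , refl)
        ... | no n  | _      = inj₁ (ℕ.≤-pred (ℕ.≰⇒> n) , refl)

        q′≡ : q′ ≡ 3 + r
        q′≡ = ℕ.suc-injective (trans (sym q≡) qr)

        ⁺-bound : ∀ u v → N.∑ elems⁺ (λ t → nz (f (u +V t ·V v))) ≤ 3 + r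
        ⁺-bound u v = ℕ.≤-trans (N.∑-mono elems⁺ (λ t → nz≤1 _)) (ℕ.≤-reflexive (trans (N.∑-const elems⁺ 1) (trans (ℕ.*-identityʳ _) q′≡)))

        Y X : ℕ
        Y = N.∑ V (λ u → N.∑ V (λ v → nz (f u) * long u v))
        X = N.∑ V (λ u → N.∑ V (λ v → zz (f u) * long u v))

        -- From a zero u each nonzero value in U is seen q - 1 times, once for each t ≠ 0. A short
        -- line shows at most 3 of them, a long one at most q - 1 = 3 + r.
        step₁ : z * (q′ * w) ≤ 3 * (z * ∣ U ∣) + r * X
        step₁ = begin
          z * (q′ * w)
            ≡⟨ sym (N.∑-*ʳ V (q′ * w) _) ⟩
          N.∑ V (λ u → zz (f u) * (q′ * w))
            ≡⟨ N.∑-cong∈ V (λ {u} u∈ → trans (cong (zz (f u) *_) (sym (star-count U u∈))) (sym (N.∑-*ˡ V (zz (f u)) _))) ⟩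
          N.∑ V (λ u → N.∑ V (λ v → zz (f u) * N.∑ elems⁺ (λ t → nz (f (u +V t ·V v)))))
            ≤⟨ N.∑-mono V (λ u → N.∑-mono V (λ v → pointwise u v)) ⟩
          N.∑ V (λ u → N.∑ V (λ v → 3 * zz (f u) + r * (zz (f u) * long u v)))
            ≡⟨ trans (N.∑-cong V (λ u → trans (N.∑-∙ V _ _) (cong₂ _+_ (N.∑-const V _) (N.∑-*ˡ V r _)))) (trans (N.∑-∙ V _ _) (cong₂ _+_ first (N.∑-*ˡ V r _))) ⟩
          3 * (z * ∣ U ∣) + r * X ∎
          where
          open ℕ.≤-Reasoning
          first : N.∑ V (λ u → length V * (3 * zz (f u))) ≡ 3 * (z * ∣ U ∣)
          first = trans (N.∑-*ˡ V (length V) _) (trans (cong (length V *_) (N.∑-*ˡ V 3 _)) (commute (length V) z))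
            where
            commute : ∀ a b → a * (3 * b) ≡ 3 * (b * a)
            commute = solve-∀
          pointwise : ∀ u v → zz (f u) * N.∑ elems⁺ (λ t → nz (f (u +V t ·V v))) ≤ 3 * zz (f u) + r * (zz (f u) * long u v)
          pointwise u v with f u ≟F 0F
          ... | no n  = z≤n
          ... | yes e with long-cases u v
          ...   | inj₁ (s , l) = ℕ.≤-trans (ℕ.≤-reflexive (ℕ.+-identityʳ _)) (ℕ.≤-trans (ℕ.m≤n+m _ (nz (f u)))
                    (ℕ.≤-trans (ℕ.≤-reflexive (sym (lineCount-split u v))) (ℕ.≤-trans s (ℕ.m≤m+n 3 _))))
          ...   | inj₂ (s , l) = ℕ.≤-trans (ℕ.≤-reflexive (ℕ.+-identityʳ _)) (ℕ.≤-trans (⁺-bound u v)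
                    (ℕ.≤-reflexive (cong (3 +_) (sym (trans (cong (λ y → r * (1 * y)) l) (ℕ.*-identityʳ r))))))

        -- Moving the base point along its own line does not affect whether the line is long, so q
        -- times a count over base points is a count over all points of the lines.
        average : (g : 𝔽 → ℕ) → q * N.∑ V (λ u → N.∑ V (λ v → g (f u) * long u v)) ≡ N.∑ V (λ u → N.∑ V (λ v → N.∑ elems (λ t → g (f (u +V t ·V v))) * long u v))
        average g = begin
          q * N.∑ V (λ u → N.∑ V (λ v → g (f u) * long u v))
            ≡⟨ trans (sym (N.∑-const elems _)) (N.∑-cong elems (λ t → trans (N.∑-swap V V _) (N.∑-cong∈ V (λ {v} v∈ → sym (∑-shift U t (λ u → g (f u) * long u v) v∈))))) ⟩
          N.∑ elems (λ t → N.∑ V (λ v → N.∑ V (λ u → g (f (u +V t ·V v)) * long (u +V t ·V v) v)))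
            ≡⟨ N.∑-cong elems (λ t → trans (N.∑-swap V V _) (N.∑-cong V (λ u → N.∑-cong V (λ v → cong (λ s → g (f (u +V t ·V v)) * 𝟏 (4 ≤? s)) (lineCount-shift u v t))))) ⟩
          N.∑ elems (λ t → N.∑ V (λ u → N.∑ V (λ v → g (f (u +V t ·V v)) * long u v)))
            ≡⟨ trans (N.∑-swap elems V _) (N.∑-cong V (λ u → trans (N.∑-swap elems V _) (N.∑-cong V (λ v → N.∑-*ʳ elems (long u v) _)))) ⟩
          N.∑ V (λ u → N.∑ V (λ v → N.∑ elems (λ t → g (f (u +V t ·V v))) * long u v)) ∎
          where open ≡-Reasoning

        -- A long line has at most 3 zeros and at least q - 3 = 1 + r nonzero values.
        step₂ : suc r * X ≤ 3 * Y
        step₂ = ℕ.*-cancelˡ-≤ q (begin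
          q * (suc r * X)
            ≡⟨ swap₁ q (suc r) X ⟩
          suc r * (q * X)
            ≡⟨ cong (suc r *_) (average zz) ⟩
          suc r * N.∑ V (λ u → N.∑ V (λ v → zeros u v * long u v))
            ≡⟨ sym (trans (N.∑-cong V (λ u → N.∑-*ˡ V (suc r) _)) (N.∑-*ˡ V (suc r) _)) ⟩
          N.∑ V (λ u → N.∑ V (λ v → suc r * (zeros u v * long u v)))
            ≤⟨ N.∑-mono V (λ u → N.∑-mono V (λ v → pointwise u v)) ⟩
          N.∑ V (λ u → N.∑ V (λ v → 3 * (lineCount u v * long u v)))
            ≡⟨ trans (N.∑-cong V (λ u → N.∑-*ˡ V 3 _)) (N.∑-*ˡ V 3 _) ⟩
          3 * N.∑ V (λ u → N.∑ V (λ v → lineCount u v * long u v))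
            ≡⟨ cong (3 *_) (sym (average nz)) ⟩
          3 * (q * Y)
            ≡⟨ swap₁ 3 q Y ⟩
          q * (3 * Y) ∎)
          where
          open ℕ.≤-Reasoning
          instance
            q≢0 : NonZero q
            q≢0 = subst NonZero (sym qr) _
          swap₁ : ∀ a b c → a * (b * c) ≡ b * (a * c)
          swap₁ = solve-∀
          zeros : Vector m → Vector m → ℕ
          zeros u v = N.∑ elems (λ t → zz (f (u +V t ·V v)))
          total : ∀ u v → lineCount u v + zeros u v ≡ q
          total u v = trans (sym (N.∑-∙ elems _ _)) (trans (N.∑-cong elems (λ t → nz+zz _)) (trans (N.∑-const elems 1) (ℕ.*-identityʳ _)))
          pointwise : ∀ u v → suc r * (zeros u v * long u v) ≤ 3 * (lineCount u v * long u v)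
          pointwise u v with long-cases u v
          ... | inj₁ (_ , l) = ℕ.≤-trans (ℕ.≤-reflexive (trans (cong (λ y → suc r * (zeros u v * y)) l) (trans (cong (suc r *_) (ℕ.*-zeroʳ (zeros u v))) (ℕ.*-zeroʳ (suc r))))) z≤n
          ... | inj₂ (s , l) = begin
            suc r * (zeros u v * long u v)  ≡⟨ cong (λ y → suc r * y) (trans (cong (zeros u v *_) l) (ℕ.*-identityʳ _)) ⟩
            suc r * zeros u v               ≤⟨ ℕ.*-monoʳ-≤ (suc r) (ℕ.+-cancelˡ-≤ (lineCount u v) _ _ (ℕ.≤-trans (ℕ.≤-reflexive (total u v)) s)) ⟩
            suc r * 3                       ≡⟨ ℕ.*-comm (suc r) 3 ⟩
            3 * suc r                       ≤⟨ ℕ.*-monoʳ-≤ 3 (ℕ.+-cancelˡ-≤ 3 _ _ (ℕ.≤-trans (ℕ.≤-reflexive (sym qr)) (ℕ.≤-trans s (ℕ.≤-reflexive (ℕ.+-comm _ 3))))) ⟩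
            3 * lineCount u v               ≡⟨ cong (3 *_) (sym (trans (cong (lineCount u v *_) l) (ℕ.*-identityʳ (lineCount u v)))) ⟩
            3 * (lineCount u v * long u v)  ∎

        -- A long line based at a nonzero value carries at least q - 4 = r further ones.
        step₃ : r * Y ≤ q′ * (w * w)
        step₃ = begin
          r * Y
            ≡⟨ sym (trans (N.∑-cong V (λ u → N.∑-*ˡ V r _)) (N.∑-*ˡ V r _)) ⟩
          N.∑ V (λ u → N.∑ V (λ v → r * (nz (f u) * long u v)))
            ≤⟨ N.∑-mono V (λ u → N.∑-mono V (λ v → pointwise u v)) ⟩
          N.∑ V (λ u → N.∑ V (λ v → nz (f u) * N.∑ elems⁺ (λ t → nz (f (u +V t ·V v)))))
            ≡⟨ N.∑-cong∈ V (λ {u} u∈ → trans (N.∑-*ˡ V (nz (f u)) _) (cong (nz (f u) *_) (star-count U u∈))) ⟩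
          N.∑ V (λ u → nz (f u) * (q′ * w))
            ≡⟨ trans (N.∑-*ʳ V (q′ * w) _) (rearrange w q′) ⟩
          q′ * (w * w) ∎
          where
          open ℕ.≤-Reasoning
          rearrange : ∀ a b → a * (b * a) ≡ b * (a * a)
          rearrange = solve-∀
          pointwise : ∀ u v → r * (nz (f u) * long u v) ≤ nz (f u) * N.∑ elems⁺ (λ t → nz (f (u +V t ·V v)))
          pointwise u v with f u ≟F 0F
          ... | yes _ = ℕ.≤-reflexive (ℕ.*-zeroʳ r)
          ... | no n with long-cases u v
          ...   | inj₁ (_ , l) = ℕ.≤-trans (ℕ.≤-reflexive (trans (cong (λ y → r * (1 * y)) l) (ℕ.*-zeroʳ r))) z≤n
          ...   | inj₂ (s , l) = ℕ.≤-trans (ℕ.≤-reflexive (trans (cong (λ y → r * (1 * y)) l) (ℕ.*-identityʳ r)))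
                    (ℕ.≤-trans (ℕ.+-cancelˡ-≤ 4 _ _ (begin
                      4 + r                                                           ≡⟨ sym qr ⟩
                      q                                                               ≤⟨ s ⟩
                      lineCount u v + 3                                               ≡⟨ cong (_+ 3) (trans (lineCount-split u v) (cong (_+ N.∑ elems⁺ (λ t → nz (f (u +V t ·V v)))) (nz-no n))) ⟩
                      suc (N.∑ elems⁺ (λ t → nz (f (u +V t ·V v)))) + 3                 ≡⟨ ℕ.+-comm _ 3 ⟩
                      4 + N.∑ elems⁺ (λ t → nz (f (u +V t ·V v)))                       ∎))
                    (ℕ.≤-reflexive (sym (ℕ.+-identityʳ _))))

      -- With α the proportion of nonzero values this says roughly α(1 - α) ≤ 3(1 - α)/q + 3α²/q, so
      -- that α or 1 - α is at most about 3/q.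
      inequality : suc r * (Z U * ((3 + r) * W U)) ≤ 3 * (suc r * (Z U * ∣ U ∣)) + 3 * ((3 + r) * (W U * W U))
      inequality = begin
        suc r * (z * ((3 + r) * w))            ≡⟨ cong (λ y → suc r * (z * (y * w))) (sym q′≡) ⟩
        suc r * (z * (q′ * w))                 ≤⟨ ℕ.*-monoʳ-≤ (suc r) step₁ ⟩
        suc r * (3 * (z * ∣ U ∣) + r * X)       ≡⟨ regroup r (z * ∣ U ∣) X ⟩
        3 * (suc r * (z * ∣ U ∣)) + r * (suc r * X) ≤⟨ ℕ.+-monoʳ-≤ (3 * (suc r * (z * ∣ U ∣))) (ℕ.*-monoʳ-≤ r step₂) ⟩
        3 * (suc r * (z * ∣ U ∣)) + r * (3 * Y) ≡⟨ cong (3 * (suc r * (z * ∣ U ∣)) +_) (swap₁ r Y) ⟩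
        3 * (suc r * (z * ∣ U ∣)) + 3 * (r * Y) ≤⟨ ℕ.+-monoʳ-≤ (3 * (suc r * (z * ∣ U ∣))) (ℕ.*-monoʳ-≤ 3 step₃) ⟩
        3 * (suc r * (z * ∣ U ∣)) + 3 * (q′ * (w * w)) ≡⟨ cong (λ y → 3 * (suc r * (z * ∣ U ∣)) + 3 * (y * (w * w))) q′≡ ⟩
        3 * (suc r * (z * ∣ U ∣)) + 3 * ((3 + r) * (w * w)) ∎
        where
        open ℕ.≤-Reasoning
        regroup : ∀ r a x → suc r * (3 * a + r * x) ≡ 3 * (suc r * a) + r * (suc r * x)
        regroup = solve-∀
        swap₁ : ∀ r y → r * (3 * y) ≡ 3 * (r * y)
        swap₁ = solve-∀

-- Light and heavy subspaces

module LightHeavy (F : FiniteField) (r : ℕ) (qr : FiniteField.q F ≡ 26 + r) where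
  open Words F public
  open Solver using (solve; _:=_; _:+_; _:*_; :-_; 𝟎; 𝟙)

  instance
    q-nonZero : NonZero q
    q-nonZero = subst NonZero (sym qr) _

  private
    q′ : ℕ
    q′ = length elems⁺

    q′≡ : q′ ≡ 25 + r
    q′≡ = ℕ.suc-injective (trans (sym q≡) qr)

    ∑-zz : N.∑ elems zz ≡ 1
    ∑-zz = trans (N.∑-single 0F zz elems-unique (elems-complete 0F) (λ x n → zz-no n)) (zz-yes refl)

    below : ∀ {a b} c → a + suc c ≡ b → a < b
    below {a} c e = ℕ.≤-trans (s≤s (ℕ.m≤m+n a c)) (ℕ.≤-reflexive (trans (sym (ℕ.+-suc a c)) e))

  -- Otherwise all lines through e₁ are short, the word is small, and the bound for τ = 3, 2, 1 in turn makes them shorter.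
  long-line : (L : Code 3) → val L (1F ∷ 0F ∷ 0F ∷ []) ≢ 0F →
    ∃ λ a → ∃ λ b → ∃ λ c → ¬ (b ≡ 0F × c ≡ 0F) × 4 ≤ lineCount L (1F ∷ 0F ∷ 0F ∷ []) (a ∷ b ∷ c ∷ [])
  long-line L f≢0 with Any.any? test (allVecs 3)
    where
    test : (v : Vector 3) → Dec (¬ (Vec.head (Vec.tail v) ≡ 0F × Vec.head (Vec.tail (Vec.tail v)) ≡ 0F) × 4 ≤ lineCount L (1F ∷ 0F ∷ 0F ∷ []) v)
    test v = ¬? ((_ ≟F 0F) ×-dec (_ ≟F 0F)) ×-dec (4 ≤? _)
  ... | yes any with Any.satisfied any
  ...   | (a ∷ b ∷ c ∷ []) , p = a , b , c , p
  long-line L f≢0 | no none = ⊥-elim contradiction₀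
    where
    R : Vector 3
    R = 1F ∷ 0F ∷ 0F ∷ []
    U : Sub 3
    U = full 3
    -- The q directions along e₁ itself are set aside: the word is constant on the nonzero multiples
    -- of e₁, so lines in these directions are never short.
    Proper : Vector 3 → Set
    Proper (a ∷ b ∷ c ∷ []) = ¬ (b ≡ 0F × c ≡ 0F)
    axis : Vector 3 → ℕ
    axis (a ∷ b ∷ c ∷ []) = zz b * zz c
    short₃ : ∀ v → Proper v → lineCount L R v ≤ 3
    short₃ v@(a ∷ b ∷ c ∷ []) p = ℕ.≤-pred (ℕ.≰⇒> (λ four → none (lose (allVecs-complete v) (p , four))))

    split : ∀ v → lineCount L R v ≡ suc (N.∑ elems⁺ (λ t → nz (val L (R +V t ·V v))))
    split v = trans (lineCount-split L R v) (cong (_+ N.∑ elems⁺ (λ t → nz (val L (R +V t ·V v)))) (nz-no f≢0))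

    axis-count : N.∑ (allVecs 3) axis ≡ q
    axis-count = trans (N.∑-× _∷_ elems (allVecs 2) axis) (trans (N.∑-cong elems (λ a → trans (N.∑-× _∷_ elems (allVecs 1) (λ v → axis (a ∷ v)))
        (trans (N.∑-cong elems (λ b → trans (N.∑-× _∷_ elems (allVecs 0) (λ v → axis (a ∷ b ∷ v)))
          (trans (N.∑-cong elems (λ c → ℕ.+-identityʳ _)) (trans (N.∑-*ˡ elems (zz b) zz) (trans (cong (zz b *_) ∑-zz) (ℕ.*-identityʳ _))))))
          ∑-zz))) (trans (N.∑-const elems 1) (ℕ.*-identityʳ q)))

    -- Each of the q³ directions shows at most j further nonzero values, except for the q directions
    -- along e₁, which show at most q - 1.
    small : ∀ j → (∀ v → Proper v → lineCount L R v ≤ suc j) → q′ * W L U ≤ q * (q * (q * j)) + q * q′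
    small j short = begin
      q′ * W L U
        ≡⟨ sym (star-count L U (allVecs-complete R)) ⟩
      N.∑ (allVecs 3) (λ v → N.∑ elems⁺ (λ t → nz (val L (R +V t ·V v))))
        ≤⟨ N.∑-mono (allVecs 3) pointwise ⟩
      N.∑ (allVecs 3) (λ v → j + axis v * q′)
        ≡⟨ trans (N.∑-∙ (allVecs 3) _ _) (cong₂ _+_ (trans (N.∑-const (allVecs 3) j) (trans (cong (_* j) (allVecs-length 3)) (cube q j)))
             (trans (N.∑-*ʳ (allVecs 3) q′ axis) (cong (_* q′) axis-count))) ⟩
      q * (q * (q * j)) + q * q′ ∎
      where
      open ℕ.≤-Reasoning
      cube : ∀ q j → q * (q * (q * 1)) * j ≡ q * (q * (q * j))
      cube = solve-∀
      pointwise : ∀ v → N.∑ elems⁺ (λ t → nz (val L (R +V t ·V v))) ≤ j + axis v * q′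
      pointwise v@(a ∷ b ∷ c ∷ []) with b ≟F 0F | c ≟F 0F
      ... | yes _ | yes _ = ℕ.≤-trans (N.∑-mono elems⁺ (λ t → nz≤1 _)) (ℕ.≤-trans (ℕ.≤-reflexive (trans (N.∑-const elems⁺ 1) (ℕ.*-comm _ 1))) (ℕ.m≤n+m _ j))
      ... | no n  | _     = ℕ.≤-trans (ℕ.≤-pred (ℕ.≤-trans (ℕ.≤-reflexive (sym (split v))) (short v (n ∘ proj₁)))) (ℕ.m≤m+n j _)
      ... | yes _ | no n  = ℕ.≤-trans (ℕ.≤-pred (ℕ.≤-trans (ℕ.≤-reflexive (sym (split v))) (short v (n ∘ proj₂)))) (ℕ.m≤m+n j _)

    -- A line attaining the value j + 1 would, by the space bound with τ = j + 1, force more nonzero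
    -- values than `small` allows.
    shorter : ∀ j Q → q ≡ suc j + suc j + Q → q * q * j + q′ < q * (suc Q * suc j) → suc j + suc j ≤ q →
      (∀ v → Proper v → lineCount L R v ≤ suc j) → ∀ v → Proper v → lineCount L R v ≤ j
    shorter j Q qj num le short v p with ℕ.m≤n⇒m<n∨m≡n (short v p)
    ... | inj₁ lt = ℕ.≤-pred lt
    ... | inj₂ eq = ⊥-elim (ℕ.<⇒≱ (ℕ.*-monoʳ-< q (ℕ.*-monoʳ-< q num)) (begin
        q * (q * (q * (suc Q * suc j)))
          ≡⟨ cube q (suc Q * suc j) ⟩
        q * (q * (q * 1)) * (suc Q * suc j)
          ≡⟨ cong (_* (suc Q * suc j)) (sym (allVecs-length 3)) ⟩
        ∣ U ∣ * (suc Q * suc j)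
          ≤⟨ space-bound L U 0F (suc j) Q qj (s≤s z≤n) (allVecs-complete R) (allVecs-complete v)
               (ℕ.≤-reflexive (sym count)) (ℕ.≤-trans (ℕ.≤-reflexive (cong (_+ suc j) count)) le) ⟩
        q′ * (q * W L U)
          ≡⟨ swap₁ q′ q (W L U) ⟩
        q * (q′ * W L U)
          ≤⟨ ℕ.*-monoʳ-≤ q (small j short) ⟩
        q * (q * (q * (q * j)) + q * q′)
          ≡⟨ factor q j q′ ⟩
        q * (q * (q * q * j + q′)) ∎))
      where
      open ℕ.≤-Reasoning
      count : offCount L R v 0F ≡ suc j
      count = trans (lineCount≡ L R v) eq
      cube : ∀ q a → q * (q * (q * a)) ≡ q * (q * (q * 1)) * a
      cube = solve-∀
      swap₁ : ∀ a b c → a * (b * c) ≡ b * (a * c)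
      swap₁ = solve-∀
      factor : ∀ q j p → q * (q * (q * (q * j)) + q * p) ≡ q * (q * (q * q * j + p))
      factor = solve-∀

    short₂ : ∀ v → Proper v → lineCount L R v ≤ 2
    short₂ = shorter 2 (20 + r) qr (strict qr q′≡)
      (ℕ.≤-trans (ℕ.m≤m+n 6 (20 + r)) (ℕ.≤-reflexive (sym qr))) short₃
      where
      identity : ∀ r → (26 + r) * (26 + r) * 2 + (25 + r) + suc (260 + 36 * r + r * r) ≡ (26 + r) * (suc (20 + r) * 3)
      identity = solveₙ 1 (λ r → (# 26 ⟨+⟩ r) ⟨*⟩ (# 26 ⟨+⟩ r) ⟨*⟩ # 2 ⟨+⟩ (# 25 ⟨+⟩ r) ⟨+⟩ (# 1 ⟨+⟩ (# 260 ⟨+⟩ # 36 ⟨*⟩ r ⟨+⟩ r ⟨*⟩ r)) ⟨=⟩ (# 26 ⟨+⟩ r) ⟨*⟩ ((# 1 ⟨+⟩ (# 20 ⟨+⟩ r)) ⟨*⟩ # 3)) refl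
      strict : ∀ {s s′} → s ≡ 26 + r → s′ ≡ 25 + r → s * s * 2 + s′ < s * (suc (20 + r) * 3)
      strict refl refl = below (260 + 36 * r + r * r) (identity r)
    short₁ : ∀ v → Proper v → lineCount L R v ≤ 1
    short₁ = shorter 1 (22 + r) qr (strict qr q′≡)
      (ℕ.≤-trans (ℕ.m≤m+n 4 (22 + r)) (ℕ.≤-reflexive (sym qr))) short₂
      where
      identity : ∀ r → (26 + r) * (26 + r) * 1 + (25 + r) + suc (494 + 45 * r + r * r) ≡ (26 + r) * (suc (22 + r) * 2)
      identity = solveₙ 1 (λ r → (# 26 ⟨+⟩ r) ⟨*⟩ (# 26 ⟨+⟩ r) ⟨*⟩ # 1 ⟨+⟩ (# 25 ⟨+⟩ r) ⟨+⟩ (# 1 ⟨+⟩ (# 494 ⟨+⟩ # 45 ⟨*⟩ r ⟨+⟩ r ⟨*⟩ r)) ⟨=⟩ (# 26 ⟨+⟩ r) ⟨*⟩ ((# 1 ⟨+⟩ (# 22 ⟨+⟩ r)) ⟨*⟩ # 2)) refl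
      strict : ∀ {s s′} → s ≡ 26 + r → s′ ≡ 25 + r → s * s * 1 + s′ < s * (suc (22 + r) * 2)
      strict refl refl = below (494 + 45 * r + r * r) (identity r)
    short₀ : ∀ v → Proper v → lineCount L R v ≤ 0
    short₀ = shorter 0 (24 + r) qr (strict qr q′≡)
      (ℕ.≤-trans (ℕ.m≤m+n 2 (24 + r)) (ℕ.≤-reflexive (sym qr))) short₁
      where
      identity : ∀ r → (26 + r) * (26 + r) * 0 + (25 + r) + suc (624 + 50 * r + r * r) ≡ (26 + r) * (suc (24 + r) * 1)
      identity = solveₙ 1 (λ r → (# 26 ⟨+⟩ r) ⟨*⟩ (# 26 ⟨+⟩ r) ⟨*⟩ # 0 ⟨+⟩ (# 25 ⟨+⟩ r) ⟨+⟩ (# 1 ⟨+⟩ (# 624 ⟨+⟩ # 50 ⟨*⟩ r ⟨+⟩ r ⟨*⟩ r)) ⟨=⟩ (# 26 ⟨+⟩ r) ⟨*⟩ ((# 1 ⟨+⟩ (# 24 ⟨+⟩ r)) ⟨*⟩ # 1)) refl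
      strict : ∀ {s s′} → s ≡ 26 + r → s′ ≡ 25 + r → s * s * 0 + s′ < s * (suc (24 + r) * 1)
      strict refl refl = below (624 + 50 * r + r * r) (identity r)
    contradiction₀ : ⊥
    contradiction₀ with subst (_≤ 0) (split (0F ∷ 1F ∷ 0F ∷ [])) (short₀ (0F ∷ 1F ∷ 0F ∷ []) (1≢0 ∘ proj₁))
    ... | ()

  private
    -- If the ratio w / z lies between a / b and d / c, the inequality forces the negation of the hypothesis.
    ratio : ∀ a b c d w z → 0 < w → 0 < z →
      suc (22 + r) * (z * ((25 + r) * w)) ≤ 3 * (suc (22 + r) * (z * (w + z))) + 3 * ((25 + r) * (w * w)) →
      a * z ≤ b * w → c * w ≤ d * z →
      3 * (a * (c * (23 + r))) + 3 * (b * (c * (23 + r))) + 3 * (a * (d * (25 + r))) < a * (c * ((23 + r) * (25 + r))) → ⊥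
    ratio a b c d w z w>0 z>0 ineq lo hi num = ℕ.<⇒≱ (ℕ.*-monoˡ-< (w * z) {{ℕ.m*n≢0 w z {{>-nonZero w>0}} {{>-nonZero z>0}}}} num) (begin
      a * (c * (A * B)) * (w * z)
        ≡⟨ e₁ a c A B w z ⟩
      a * (c * (A * (z * (B * w))))
        ≤⟨ ℕ.*-monoʳ-≤ a (ℕ.*-monoʳ-≤ c ineq) ⟩
      a * (c * (3 * (A * (z * (w + z))) + 3 * (B * (w * w))))
        ≡⟨ e₂ a c A B w z ⟩
      3 * (a * (c * A)) * (w * z) + 3 * (c * A * z) * (a * z) + 3 * (a * (B * w)) * (c * w)
        ≤⟨ ℕ.+-mono-≤ (ℕ.+-monoʳ-≤ (3 * (a * (c * A)) * (w * z)) (ℕ.*-monoʳ-≤ (3 * (c * A * z)) lo)) (ℕ.*-monoʳ-≤ (3 * (a * (B * w))) hi) ⟩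
      3 * (a * (c * A)) * (w * z) + 3 * (c * A * z) * (b * w) + 3 * (a * (B * w)) * (d * z)
        ≡⟨ e₃ a b c d A B w z ⟩
      (3 * (a * (c * A)) + 3 * (b * (c * A)) + 3 * (a * (d * B))) * (w * z) ∎)
      where
      open ℕ.≤-Reasoning
      A B : ℕ
      A = 23 + r
      B = 25 + r
      e₁ : ∀ a c A B w z → a * (c * (A * B)) * (w * z) ≡ a * (c * (A * (z * (B * w))))
      e₁ = solve-∀
      e₂ : ∀ a c A B w z → a * (c * (3 * (A * (z * (w + z))) + 3 * (B * (w * w)))) ≡ 3 * (a * (c * A)) * (w * z) + 3 * (c * A * z) * (a * z) + 3 * (a * (B * w)) * (c * w)
      e₂ = solve-∀
      e₃ : ∀ a b c d A B w z → 3 * (a * (c * A)) * (w * z) + 3 * (c * A * z) * (b * w) + 3 * (a * (B * w)) * (d * z) ≡ (3 * (a * (c * A)) + 3 * (b * (c * A)) + 3 * (a * (d * B))) * (w * z)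
      e₃ = solve-∀

    -- `ratio` estimates z / w by one end of an interval and w / z by the other, which loses too
    -- much on a long interval. The range left by the two strict bounds is therefore cut at w / z =
    -- 1/7, 1/6, 1/3 and 3, and on each piece a polynomial inequality in r remains.
    no-middle : ∀ w z M → w + z ≡ q * M →
      suc (22 + r) * (z * ((25 + r) * w)) ≤ 3 * (suc (22 + r) * (z * (w + z))) + 3 * ((25 + r) * (w * w)) → 16 * M < 5 * w → 7 * M < 2 * z → ⊥
    no-middle w z M wz ineq lo hi = cases
      where
      w>0 : 0 < w
      w>0 = ℕ.n≢0⇒n>0 (λ { refl → ℕ.<⇒≱ lo z≤n })
      z>0 : 0 < z
      z>0 = ℕ.n≢0⇒n>0 (λ { refl → ℕ.<⇒≱ hi z≤n })
      wz′ : w + z ≡ (26 + r) * M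
      wz′ = trans wz (cong (_* M) qr)
      lower : 16 * z ≤ (114 + 5 * r) * w
      lower = ℕ.+-cancelˡ-≤ (16 * w) _ _ (begin
        16 * w + 16 * z          ≡⟨ sym (ℕ.*-distribˡ-+ 16 w z) ⟩
        16 * (w + z)             ≡⟨ cong (16 *_) wz′ ⟩
        16 * ((26 + r) * M)      ≡⟨ e₁ r M ⟩
        (26 + r) * (16 * M)      ≤⟨ ℕ.*-monoʳ-≤ (26 + r) (ℕ.<⇒≤ lo) ⟩
        (26 + r) * (5 * w)       ≡⟨ e₂ r w ⟩
        16 * w + (114 + 5 * r) * w ∎)
        where
        open ℕ.≤-Reasoning
        e₁ : ∀ r M → 16 * ((26 + r) * M) ≡ (26 + r) * (16 * M)
        e₁ = solveₙ 2 (λ r M → # 16 ⟨*⟩ ((# 26 ⟨+⟩ r) ⟨*⟩ M) ⟨=⟩ (# 26 ⟨+⟩ r) ⟨*⟩ (# 16 ⟨*⟩ M)) refl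
        e₂ : ∀ r w → (26 + r) * (5 * w) ≡ 16 * w + (114 + 5 * r) * w
        e₂ = solveₙ 2 (λ r w → (# 26 ⟨+⟩ r) ⟨*⟩ (# 5 ⟨*⟩ w) ⟨=⟩ # 16 ⟨*⟩ w ⟨+⟩ (# 114 ⟨+⟩ # 5 ⟨*⟩ r) ⟨*⟩ w) refl
      upper : 7 * w ≤ (45 + 2 * r) * z
      upper = ℕ.+-cancelʳ-≤ (7 * z) _ _ (begin
        7 * w + 7 * z            ≡⟨ sym (ℕ.*-distribˡ-+ 7 w z) ⟩
        7 * (w + z)              ≡⟨ cong (7 *_) wz′ ⟩
        7 * ((26 + r) * M)       ≡⟨ e₁ r M ⟩
        (26 + r) * (7 * M)       ≤⟨ ℕ.*-monoʳ-≤ (26 + r) (ℕ.<⇒≤ hi) ⟩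
        (26 + r) * (2 * z)       ≡⟨ e₂ r z ⟩
        (45 + 2 * r) * z + 7 * z ∎)
        where
        open ℕ.≤-Reasoning
        e₁ : ∀ r M → 7 * ((26 + r) * M) ≡ (26 + r) * (7 * M)
        e₁ = solveₙ 2 (λ r M → # 7 ⟨*⟩ ((# 26 ⟨+⟩ r) ⟨*⟩ M) ⟨=⟩ (# 26 ⟨+⟩ r) ⟨*⟩ (# 7 ⟨*⟩ M)) refl
        e₂ : ∀ r z → (26 + r) * (2 * z) ≡ (45 + 2 * r) * z + 7 * z
        e₂ = solveₙ 2 (λ r z → (# 26 ⟨+⟩ r) ⟨*⟩ (# 2 ⟨*⟩ z) ⟨=⟩ (# 45 ⟨+⟩ # 2 ⟨*⟩ r) ⟨*⟩ z ⟨+⟩ # 7 ⟨*⟩ z) refl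
      one : ∀ n → 1 * n ≡ n
      one n = ℕ.+-identityʳ n
      cases : ⊥
      cases with ℕ.≤-total (7 * w) z
      ... | inj₁ p = ratio 16 (114 + 5 * r) 7 1 w z w>0 z>0 ineq lower (subst (7 * w ≤_) (sym (one z)) p) (below (409 + 183 * r + 7 * (r * r)) (identity r))
        where
        identity : ∀ r → 3 * (16 * (7 * (23 + r))) + 3 * ((114 + 5 * r) * (7 * (23 + r))) + 3 * (16 * (1 * (25 + r))) + suc (409 + 183 * r + 7 * (r * r)) ≡ 16 * (7 * ((23 + r) * (25 + r)))
        identity = solveₙ 1 (λ r → # 3 ⟨*⟩ (# 16 ⟨*⟩ (# 7 ⟨*⟩ (# 23 ⟨+⟩ r))) ⟨+⟩ # 3 ⟨*⟩ ((# 114 ⟨+⟩ # 5 ⟨*⟩ r) ⟨*⟩ (# 7 ⟨*⟩ (# 23 ⟨+⟩ r))) ⟨+⟩ # 3 ⟨*⟩ (# 16 ⟨*⟩ (# 1 ⟨*⟩ (# 25 ⟨+⟩ r))) ⟨+⟩ (# 1 ⟨+⟩ (# 409 ⟨+⟩ # 183 ⟨*⟩ r ⟨+⟩ # 7 ⟨*⟩ (r ⟨*⟩ r))) ⟨=⟩ # 16 ⟨*⟩ (# 7 ⟨*⟩ ((# 23 ⟨+⟩ r) ⟨*⟩ (# 25 ⟨+⟩ r)))) refl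
      ... | inj₂ p₇ with ℕ.≤-total (6 * w) z
      ...   | inj₁ p = ratio 1 7 6 1 w z w>0 z>0 ineq (subst (_≤ 7 * w) (sym (one z)) p₇) (subst (6 * w ≤_) (sym (one z)) p) (below (62 + 141 * r + 6 * (r * r)) (identity r))
        where
        identity : ∀ r → 3 * (1 * (6 * (23 + r))) + 3 * (7 * (6 * (23 + r))) + 3 * (1 * (1 * (25 + r))) + suc (62 + 141 * r + 6 * (r * r)) ≡ 1 * (6 * ((23 + r) * (25 + r)))
        identity = solveₙ 1 (λ r → # 3 ⟨*⟩ (# 1 ⟨*⟩ (# 6 ⟨*⟩ (# 23 ⟨+⟩ r))) ⟨+⟩ # 3 ⟨*⟩ (# 7 ⟨*⟩ (# 6 ⟨*⟩ (# 23 ⟨+⟩ r))) ⟨+⟩ # 3 ⟨*⟩ (# 1 ⟨*⟩ (# 1 ⟨*⟩ (# 25 ⟨+⟩ r))) ⟨+⟩ (# 1 ⟨+⟩ (# 62 ⟨+⟩ # 141 ⟨*⟩ r ⟨+⟩ # 6 ⟨*⟩ (r ⟨*⟩ r))) ⟨=⟩ # 1 ⟨*⟩ (# 6 ⟨*⟩ ((# 23 ⟨+⟩ r) ⟨*⟩ (# 25 ⟨+⟩ r)))) refl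
      ...   | inj₂ p₆ with ℕ.≤-total (3 * w) z
      ...     | inj₁ p = ratio 1 6 3 1 w z w>0 z>0 ineq (subst (_≤ 6 * w) (sym (one z)) p₆) (subst (3 * w ≤_) (sym (one z)) p) (below (200 + 78 * r + 3 * (r * r)) (identity r))
        where
        identity : ∀ r → 3 * (1 * (3 * (23 + r))) + 3 * (6 * (3 * (23 + r))) + 3 * (1 * (1 * (25 + r))) + suc (200 + 78 * r + 3 * (r * r)) ≡ 1 * (3 * ((23 + r) * (25 + r)))
        identity = solveₙ 1 (λ r → # 3 ⟨*⟩ (# 1 ⟨*⟩ (# 3 ⟨*⟩ (# 23 ⟨+⟩ r))) ⟨+⟩ # 3 ⟨*⟩ (# 6 ⟨*⟩ (# 3 ⟨*⟩ (# 23 ⟨+⟩ r))) ⟨+⟩ # 3 ⟨*⟩ (# 1 ⟨*⟩ (# 1 ⟨*⟩ (# 25 ⟨+⟩ r))) ⟨+⟩ (# 1 ⟨+⟩ (# 200 ⟨+⟩ # 78 ⟨*⟩ r ⟨+⟩ # 3 ⟨*⟩ (r ⟨*⟩ r))) ⟨=⟩ # 1 ⟨*⟩ (# 3 ⟨*⟩ ((# 23 ⟨+⟩ r) ⟨*⟩ (# 25 ⟨+⟩ r)))) refl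
      ...     | inj₂ p₃ with ℕ.≤-total w (3 * z)
      ...       | inj₁ p = ratio 1 3 1 3 w z w>0 z>0 ineq (subst (_≤ 3 * w) (sym (one z)) p₃) (subst (_≤ 3 * z) (sym (one w)) p) (below (73 + 27 * r + r * r) (identity r))
        where
        identity : ∀ r → 3 * (1 * (1 * (23 + r))) + 3 * (3 * (1 * (23 + r))) + 3 * (1 * (3 * (25 + r))) + suc (73 + 27 * r + r * r) ≡ 1 * (1 * ((23 + r) * (25 + r)))
        identity = solveₙ 1 (λ r → # 3 ⟨*⟩ (# 1 ⟨*⟩ (# 1 ⟨*⟩ (# 23 ⟨+⟩ r))) ⟨+⟩ # 3 ⟨*⟩ (# 3 ⟨*⟩ (# 1 ⟨*⟩ (# 23 ⟨+⟩ r))) ⟨+⟩ # 3 ⟨*⟩ (# 1 ⟨*⟩ (# 3 ⟨*⟩ (# 25 ⟨+⟩ r))) ⟨+⟩ (# 1 ⟨+⟩ (# 73 ⟨+⟩ # 27 ⟨*⟩ r ⟨+⟩ r ⟨*⟩ r)) ⟨=⟩ # 1 ⟨*⟩ (# 1 ⟨*⟩ ((# 23 ⟨+⟩ r) ⟨*⟩ (# 25 ⟨+⟩ r)))) refl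
      ...       | inj₂ p = ratio 3 1 7 (45 + 2 * r) w z w>0 z>0 ineq (subst (3 * z ≤_) (sym (one w)) p) upper (below (17 + 69 * r + 3 * (r * r)) (identity r))
        where
        identity : ∀ r → 3 * (3 * (7 * (23 + r))) + 3 * (1 * (7 * (23 + r))) + 3 * (3 * ((45 + 2 * r) * (25 + r))) + suc (17 + 69 * r + 3 * (r * r)) ≡ 3 * (7 * ((23 + r) * (25 + r)))
        identity = solveₙ 1 (λ r → # 3 ⟨*⟩ (# 3 ⟨*⟩ (# 7 ⟨*⟩ (# 23 ⟨+⟩ r))) ⟨+⟩ # 3 ⟨*⟩ (# 1 ⟨*⟩ (# 7 ⟨*⟩ (# 23 ⟨+⟩ r))) ⟨+⟩ # 3 ⟨*⟩ (# 3 ⟨*⟩ ((# 45 ⟨+⟩ # 2 ⟨*⟩ r) ⟨*⟩ (# 25 ⟨+⟩ r))) ⟨+⟩ (# 1 ⟨+⟩ (# 17 ⟨+⟩ # 69 ⟨*⟩ r ⟨+⟩ # 3 ⟨*⟩ (r ⟨*⟩ r))) ⟨=⟩ # 3 ⟨*⟩ (# 7 ⟨*⟩ ((# 23 ⟨+⟩ r) ⟨*⟩ (# 25 ⟨+⟩ r)))) refl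

  module _ {m} (L : Code m) where

    -- The integer M stands for ∣ U ∣ / q.
    record Light (U : Sub m) (M : ℕ) : Set where
      constructor light
      field bound : 5 * W L U ≤ 16 * M

    -- Both constants lie above 3, the value to which the double count tends for large q, by enough
    -- to exclude everything in between from q = 26 on.
    record Heavy (U : Sub m) (M : ℕ) : Set where
      constructor heavy
      field bound : 2 * Z L U ≤ 7 * M

    light-or-heavy : Good L → ∀ U M → ∣ U ∣ ≡ q * M → Light U M ⊎ Heavy U M
    light-or-heavy good U M card with 5 * W L U ≤? 16 * M | 2 * Z L U ≤? 7 * M
    ... | yes p | _     = inj₁ (light p)
    ... | no _  | yes p = inj₂ (heavy p)
    ... | no ¬p | no ¬h = ⊥-elim (no-middle (W L U) (Z L U) M (trans (W+Z L U) card)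
            (ℕ.≤-trans (Dichotomy.inequality L good U (22 + r) qr) (ℕ.≤-reflexive (cong (λ n → 3 * (suc (22 + r) * (Z L U * n)) + 3 * ((25 + r) * (W L U * W L U))) (sym (W+Z L U)))))
            (ℕ.≰⇒> ¬p) (ℕ.≰⇒> ¬h))

-- Covering the support by three hyperplanes

module Covering (F : FiniteField) (r : ℕ) (qr : FiniteField.q F ≡ 26 + r) where
  open LightHeavy F r qr public
  open Solver using (solve; _:=_; _:+_; _:*_; :-_; 𝟎; 𝟙)

  26≤q : 26 ≤ q
  26≤q = ℕ.≤-trans (ℕ.m≤m+n 26 r) (ℕ.≤-reflexive (sym qr))

  private
    -- Three hyperplanes of a heavy space of s μ vectors hold at most 3 μ vectors, too few for a
    -- support of at least (s - 7/2) μ; the extra 1 pays for the origin.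
    heavy⇒many : ∀ s μ w → 26 ≤ s → 0 < μ → 2 * (s * μ) ≤ 2 * w + 7 * μ → w ≤ 1 + 3 * μ → ⊥
    heavy⇒many s μ w le μ>0 p b = ℕ.<⇒≱ (ℕ.m<m+n (2 * (μ + 3 * μ) + 7 * μ) {37 * μ} (ℕ.≤-trans μ>0 (ℕ.m≤m+n μ (36 * μ)))) (begin
      2 * (μ + 3 * μ) + 7 * μ + 37 * μ   ≡⟨ identity μ ⟩
      2 * (26 * μ)                       ≤⟨ ℕ.*-monoʳ-≤ 2 (ℕ.*-monoˡ-≤ μ le) ⟩
      2 * (s * μ)                        ≤⟨ p ⟩
      2 * w + 7 * μ                      ≤⟨ ℕ.+-monoˡ-≤ (7 * μ) (ℕ.*-monoʳ-≤ 2 (ℕ.≤-trans b (ℕ.+-monoˡ-≤ (3 * μ) μ>0))) ⟩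
      2 * (μ + 3 * μ) + 7 * μ            ∎)
      where
      open ℕ.≤-Reasoning
      identity : ∀ μ → 2 * (μ + 3 * μ) + 7 * μ + 37 * μ ≡ 2 * (26 * μ)
      identity = solveₙ 1 (λ μ → # 2 ⟨*⟩ (μ ⟨+⟩ # 3 ⟨*⟩ μ) ⟨+⟩ # 7 ⟨*⟩ μ ⟨+⟩ # 37 ⟨*⟩ μ ⟨=⟩ # 2 ⟨*⟩ (# 26 ⟨*⟩ μ)) refl

    -- The left side totals the 2(s + 1) hyperplanes of μ vectors that a pencil can list, with 3 for
    -- the origin; being less than three times the support, it leaves a support vector on at most
    -- two of them.
    heavy⇒average : ∀ s μ w → 26 ≤ s → 0 < μ → 2 * (s * μ) ≤ 2 * w + 7 * μ → 3 * 1 + 2 * suc s * μ < 3 * w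
    heavy⇒average s μ w le μ>0 p = ℕ.*-cancelˡ-< 2 _ _ (ℕ.+-cancelʳ-< (21 * μ) _ _ (begin-strict
      2 * (3 * 1 + 2 * suc s * μ) + 21 * μ          ≡⟨ e₁ s μ ⟩
      6 * 1 + (4 * (s * μ) + 25 * μ)                ≤⟨ ℕ.+-monoˡ-≤ (4 * (s * μ) + 25 * μ) (ℕ.*-monoʳ-≤ 6 μ>0) ⟩
      6 * μ + (4 * (s * μ) + 25 * μ)                <⟨ ℕ.m<m+n (6 * μ + (4 * (s * μ) + 25 * μ)) {21 * μ} (ℕ.≤-trans μ>0 (ℕ.m≤m+n μ (20 * μ))) ⟩
      6 * μ + (4 * (s * μ) + 25 * μ) + 21 * μ       ≡⟨ e₂ (s * μ) μ ⟩
      4 * (s * μ) + 2 * (26 * μ)                    ≤⟨ ℕ.+-monoʳ-≤ (4 * (s * μ)) (ℕ.*-monoʳ-≤ 2 (ℕ.*-monoˡ-≤ μ le)) ⟩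
      4 * (s * μ) + 2 * (s * μ)                     ≡⟨ e₃ (s * μ) ⟩
      3 * (2 * (s * μ))                             ≤⟨ ℕ.*-monoʳ-≤ 3 p ⟩
      3 * (2 * w + 7 * μ)                           ≡⟨ e₄ w μ ⟩
      2 * (3 * w) + 21 * μ                          ∎))
      where
      open ℕ.≤-Reasoning
      e₁ : ∀ s μ → 2 * (3 * 1 + 2 * suc s * μ) + 21 * μ ≡ 6 * 1 + (4 * (s * μ) + 25 * μ)
      e₁ = solveₙ 2 (λ s μ → # 2 ⟨*⟩ (# 3 ⟨*⟩ # 1 ⟨+⟩ # 2 ⟨*⟩ (# 1 ⟨+⟩ s) ⟨*⟩ μ) ⟨+⟩ # 21 ⟨*⟩ μ ⟨=⟩ # 6 ⟨*⟩ # 1 ⟨+⟩ (# 4 ⟨*⟩ (s ⟨*⟩ μ) ⟨+⟩ # 25 ⟨*⟩ μ)) refl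
      e₂ : ∀ x μ → 6 * μ + (4 * x + 25 * μ) + 21 * μ ≡ 4 * x + 2 * (26 * μ)
      e₂ = solveₙ 2 (λ x μ → # 6 ⟨*⟩ μ ⟨+⟩ (# 4 ⟨*⟩ x ⟨+⟩ # 25 ⟨*⟩ μ) ⟨+⟩ # 21 ⟨*⟩ μ ⟨=⟩ # 4 ⟨*⟩ x ⟨+⟩ # 2 ⟨*⟩ (# 26 ⟨*⟩ μ)) refl
      e₃ : ∀ x → 4 * x + 2 * x ≡ 3 * (2 * x)
      e₃ = solve-∀
      e₄ : ∀ w μ → 3 * (2 * w + 7 * μ) ≡ 2 * (3 * w) + 21 * μ
      e₄ = solveₙ 2 (λ w μ → # 3 ⟨*⟩ (# 2 ⟨*⟩ w ⟨+⟩ # 7 ⟨*⟩ μ) ⟨=⟩ # 2 ⟨*⟩ (# 3 ⟨*⟩ w) ⟨+⟩ # 21 ⟨*⟩ μ) refl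

  zz-filter-length : {A : Set} (f : A → 𝔽) (xs : List A) → length (filter (λ v → f v ≟F 0F) xs) ≡ N.∑ xs (λ v → zz (f v))
  zz-filter-length f []       = refl
  zz-filter-length f (x ∷ xs) with f x ≟F 0F
  ... | yes _ = cong suc (zz-filter-length f xs)
  ... | no _  = zz-filter-length f xs

  affine-roots : ∀ a b → ¬ (a ≡ 0F × b ≡ 0F) → N.∑ elems (λ t → zz (a ⊞ t ⊠ b)) ≤ 1
  affine-roots a b n with b ≟F 0F
  ... | yes refl = ℕ.≤-trans (ℕ.≤-reflexive (trans (N.∑-cong elems (λ t → zz-no (λ e → n (trans (solve 2 (λ a t → a := a :+ t :* 𝟎) refl a t) e , refl)))) (N.∑-ε elems))) z≤n
  ... | no b≢0 = ℕ.≤-trans (ℕ.≤-reflexive (N.∑-single (⊟ (a ⊠ b ⁻¹)) _ elems-unique (elems-complete _)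
        (λ t t≢ → zz-no (λ e → t≢ (root t e))))) (zz≤1 _)
    where
    zz≤1 : ∀ x → zz x ≤ 1
    zz≤1 x with x ≟F 0F
    ... | yes _ = s≤s z≤n
    ... | no _  = z≤n
    root : ∀ t → a ⊞ t ⊠ b ≡ 0F → t ≡ ⊟ (a ⊠ b ⁻¹)
    root t e = trans (trans (sym (*-identityʳ t)) (cong (t ⊠_) (sym (⊠-inv b≢0))))
      (trans (solve 4 (λ a b i t → t :* (b :* i) := (a :+ t :* b) :* i :+ :- (a :* i)) refl a b (b ⁻¹) t)
        (trans (cong (λ z → z ⊠ b ⁻¹ ⊞ ⊟ (a ⊠ b ⁻¹)) e) (solve 2 (λ i c → 𝟎 :* i :+ :- c := :- c) refl (b ⁻¹) (a ⊠ b ⁻¹))))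

  infixl 7 _∩_
  _∩_ : ∀ {m} → Sub m → Lin m → Sub m
  U ∩ k = record
    { els    = filter (λ v → ap k v ≟F 0F) (els U)
    ; unique = Unique.filter⁺ (λ v → ap k v ≟F 0F) (unique U)
    ; has-0  = ∈-filter⁺ (λ v → ap k v ≟F 0F) (has-0 U) (ap-zero k)
    ; closed = λ {u} {v} t u∈ v∈ → ∈-filter⁺ (λ v → ap k v ≟F 0F) (closed U t (proj₁ (split u∈)) (proj₁ (split v∈)))
                 (ap-line-zero k (proj₂ (split u∈)) (proj₂ (split v∈)))
    }
    where
    split : ∀ {v} → v ∈ filter (λ v → ap k v ≟F 0F) (els U) → v ∈ els U × ap k v ≡ 0F
    split = ∈-filter⁻ (λ v → ap k v ≟F 0F) {xs = els U}

  ∩⁺ : ∀ {m} (U : Sub m) k {v} → v ∈ els U → ap k v ≡ 0F → v ∈ els (U ∩ k)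
  ∩⁺ U k = ∈-filter⁺ (λ v → ap k v ≟F 0F)

  ∩⁻ : ∀ {m} (U : Sub m) k {v} → v ∈ els (U ∩ k) → v ∈ els U × ap k v ≡ 0F
  ∩⁻ U k = ∈-filter⁻ (λ v → ap k v ≟F 0F) {xs = els U}

  ∑-∩ : ∀ {m} (U : Sub m) k (g : Vector m → ℕ) → N.∑ (els (U ∩ k)) g ≡ N.∑ (els U) (λ v → zz (ap k v) * g v)
  ∑-∩ U k g = N.∑-filter (λ v → ap k v ≟F 0F) (els U) g
    (λ v e → sym (trans (cong (_* g v) (zz-yes e)) (ℕ.+-identityʳ _))) (λ v n → cong (_* g v) (zz-no n))

  sub-scale : ∀ {m} (U : Sub m) {v} t → v ∈ els U → t ·V v ∈ els U
  sub-scale U {v} t v∈ = subst (_∈ els U) (+V-identityˡ _) (closed U t (has-0 U) v∈)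

  sub-add : ∀ {m} (U : Sub m) {u v} → u ∈ els U → v ∈ els U → u +V v ∈ els U
  sub-add U {u} {v} u∈ v∈ = subst (λ w → u +V w ∈ els U) (1·V v) (closed U 1F u∈ v∈)

  -- This is exactly the case in which `U ∩ k` is a hyperplane of U and not all of U.
  Moves : ∀ {m} → Sub m → Lin m → Set
  Moves U k = ∃ λ w → w ∈ els U × ap k w ≢ 0F

  -- Adding a multiple of w permutes U and carries the kernel of k onto any other fibre.
  ∣∩∣ : ∀ {m} (U : Sub m) k → Moves U k → ∣ U ∣ ≡ q * ∣ U ∩ k ∣
  ∣∩∣ U k (w , w∈ , kw) = begin
    ∣ U ∣
      ≡⟨ sym (trans (N.∑-const (els U) 1) (ℕ.*-identityʳ _)) ⟩
    N.∑ (els U) (λ v → 1)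
      ≡⟨ N.∑-cong (els U) (λ v → sym (each (ap k v))) ⟩
    N.∑ (els U) (λ v → N.∑ elems (λ x → zz (ap k v ⊞ ⊟ x)))
      ≡⟨ N.∑-swap (els U) elems _ ⟩
    N.∑ elems (λ x → N.∑ (els U) (λ v → zz (ap k v ⊞ ⊟ x)))
      ≡⟨ N.∑-cong elems fibre ⟩
    N.∑ elems (λ x → N.∑ (els U) (λ v → zz (ap k v)))
      ≡⟨ N.∑-const elems _ ⟩
    q * N.∑ (els U) (λ v → zz (ap k v))
      ≡⟨ cong (q *_) (sym (zz-filter-length (ap k) (els U))) ⟩
    q * ∣ U ∩ k ∣ ∎
    where
    open ≡-Reasoning
    each : ∀ y → N.∑ elems (λ x → zz (y ⊞ ⊟ x)) ≡ 1
    each y = trans (N.∑-single y _ elems-unique (elems-complete y) (λ x n → zz-no (n ∘ sym ∘ sub-zero⇒≡ y x))) (zz-yes (-‿inverseʳ y))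
    fibre : ∀ x → N.∑ (els U) (λ v → zz (ap k v ⊞ ⊟ x)) ≡ N.∑ (els U) (λ v → zz (ap k v))
    fibre x = trans (sym (∑-affine U (λ v → zz (ap k v ⊞ ⊟ x)) (sub-scale U c w∈) 1≢0)) (N.∑-cong (els U) (λ v → cong zz
        (trans (cong (_⊞ ⊟ x) (trans (ap-line k _ 1F v) (cong (_⊞ 1F ⊠ ap k v) (trans (ap-· k c w) c-value))))
          (solve 2 (λ x y → (x :+ 𝟙 :* y) :+ :- x := y) refl x (ap k v)))))
      where
      c : 𝔽
      c = x ⊠ ap k w ⁻¹
      c-value : c ⊠ ap k w ≡ x
      c-value = trans (*-assoc _ _ _) (trans (cong (x ⊠_) (inv-⊠ kw)) (*-identityʳ x))

  ∣∩∣-power : ∀ {m} (U : Sub m) k e → ∣ U ∣ ≡ q ^ suc e → Moves U k → ∣ U ∩ k ∣ ≡ q ^ e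
  ∣∩∣-power U k e card mv = ℕ.*-cancelˡ-≡ _ _ q (trans (sym (∣∩∣ U k mv)) card)

  escape : ∀ {m} (U : Sub m) (xs : List (Vector m)) → length xs < ∣ U ∣ → ∃ λ w → w ∈ els U × ¬ w ∈ xs
  escape U xs lt with Any.any? (λ w → ¬? (Any.any? (w ≟V_) xs)) (els U)
  ... | yes any = let w , w∈ , n = find any in w , w∈ , n
  ... | no none = ⊥-elim (ℕ.<⇒≱ lt (unique-⊆-length (unique U) inside))
    where
    inside : ∀ {w} → w ∈ els U → w ∈ xs
    inside {w} w∈ with Any.any? (w ≟V_) xs
    ... | yes p = p
    ... | no n  = ⊥-elim (none (lose w∈ n))

  -- Some w in U is not a multiple of R, because q² > q. A functional k₀ nonzero at R determines the
  -- multiple of R to be subtracted from w; k₁ separates the difference from zero, and correcting k₁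
  -- by a multiple of k₀ makes it vanish at R without losing that.
  moving-through : ∀ {m} (U : Sub m) e → ∣ U ∣ ≡ q ^ suc (suc e) → ∀ {R} → R ≢ zeroV → ∃ λ k → Moves U k × ap k R ≡ 0F
  moving-through U e card {R} R≢0 with escape U (map (_·V R) elems) small
    where
    small : length (map (_·V R) elems) < ∣ U ∣
    small = ℕ.≤-trans (s≤s (ℕ.≤-reflexive (trans (List.length-map _ elems) (sym (ℕ.*-identityʳ q)))))
      (ℕ.≤-trans (ℕ.*-monoʳ-< q (ℕ.≤-trans (ℕ.≤-reflexive (sym (cong (1 +_) refl))) (ℕ.≤-trans two (ℕ.≤-trans (ℕ.≤-reflexive (sym (ℕ.*-identityʳ q))) (ℕ.*-monoʳ-≤ q (ℕ.m^n>0 q e))))))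
        (ℕ.≤-reflexive (sym card)))
      where
      two : 2 ≤ q
      two = ℕ.≤-trans (s≤s (s≤s z≤n)) 26≤q
  ... | w , w∈ , w∉ with separating R R≢0
  ... | k₀ , k₀R with separating w′ w′≢0
    where
    s : 𝔽
    s = ap k₀ w ⊠ ap k₀ R ⁻¹
    w′ : Vector _
    w′ = w +V (⊟ s) ·V R
    w′≢0 : w′ ≢ zeroV
    w′≢0 e = w∉ (subst (_∈ map (_·V R) elems) (sym (trans
      (vsolve x₀ ((x₀ ⊕ (⊟ s) ⊙ x₁) ⊕ s ⊙ x₁) (λ { (x ∷ y ∷ []) → solve 3 (λ s x y → x := (x :+ (:- s) :* y) :+ s :* y) refl s x y }) (w ∷ R ∷ []))
      (trans (cong (_+V s ·V R) e) (+V-identityˡ _)))) (∈-map⁺ (_·V R) (elems-complete s)))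
  ... | k₁ , k₁w′ = combine k₁ c k₀ , (w , w∈ , moved) , kills
    where
    s c : 𝔽
    s = ap k₀ w ⊠ ap k₀ R ⁻¹
    c = ⊟ (ap k₁ R ⊠ ap k₀ R ⁻¹)
    kills : ap k₁ R ⊞ c ⊠ ap k₀ R ≡ 0F
    kills = trans (solve 3 (λ a b i → a :+ (:- (a :* i)) :* b := a :+ :- (a :* (b :* i))) refl (ap k₁ R) (ap k₀ R) (ap k₀ R ⁻¹))
      (trans (cong (λ z → ap k₁ R ⊞ ⊟ (ap k₁ R ⊠ z)) (⊠-inv k₀R)) (solve 1 (λ a → a :+ :- (a :* 𝟙) := 𝟎) refl (ap k₁ R)))
    moved : ap k₁ w ⊞ c ⊠ ap k₀ w ≢ 0F
    moved e = k₁w′ (trans (ap-line k₁ w (⊟ s) R) (trans (solve 4 (λ a b d i → a :+ (:- (b :* i)) :* d := a :+ (:- (d :* i)) :* b) refl (ap k₁ w) (ap k₀ w) (ap k₁ R) (ap k₀ R ⁻¹)) e))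

  Any⇒∑ : ∀ {m} (v : Vector m) (ks : List (Lin m)) → Any (λ k → ap k v ≡ 0F) ks → 1 ≤ N.∑ ks (λ k → zz (ap k v))
  Any⇒∑ v ks any = let k , k∈ , z = find any in ℕ.≤-trans (ℕ.≤-reflexive (sym (zz-yes z))) (N.∑-member (λ k → zz (ap k v)) k∈)

  -- Every line through R in the plane ⟨R, v₁, v₂⟩ would meet the support in few points.
  plane-contradiction : ∀ {m} (L : Code m) (R v₁ v₂ : Vector m) → val L R ≢ 0F →
    (∀ b c → ¬ (b ≡ 0F × c ≡ 0F) → ∃ λ ks → length ks ≤ 2 × (∀ {k} → k ∈ ks → ¬ (ap k R ≡ 0F × ap k (b ·V v₁ +V c ·V v₂) ≡ 0F)) ×
      (∀ a t → t ≢ 0F → val L (R +V t ·V (a ·V R +V (b ·V v₁ +V c ·V v₂))) ≢ 0F → Any (λ k → ap k (R +V t ·V (a ·V R +V (b ·V v₁ +V c ·V v₂))) ≡ 0F) ks)) → ⊥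
  plane-contradiction {m} L R v₁ v₂ fR hyp = finish (long-line (pullCode L frame) (λ z → fR (trans (cong f (sym at-R)) (trans (sym (val-pull L frame e₁)) z))))
    where
    f : Vector m → 𝔽
    f = val L
    frame : Fam m 3
    frame = R ∷ v₁ ∷ v₂ ∷ []
    e₁ : Vector 3
    e₁ = 1F ∷ 0F ∷ 0F ∷ []
    at-R : lincomb e₁ frame ≡ R
    at-R = vsolve (1F ⊙ x₀ ⊕ (0F ⊙ x₁ ⊕ (0F ⊙ x₂ ⊕ ∅))) x₀
      (λ { (x ∷ y ∷ z ∷ []) → solve 3 (λ x y z → 𝟙 :* x :+ (𝟎 :* y :+ (𝟎 :* z :+ 𝟎)) := x) refl x y z }) frame
    finish : (∃ λ a → ∃ λ b → ∃ λ c → ¬ (b ≡ 0F × c ≡ 0F) × 4 ≤ lineCount (pullCode L frame) e₁ (a ∷ b ∷ c ∷ [])) → ⊥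
    finish (a , b , c , bc , four) with hyp b c bc
    ... | ks , len , avoid , cov = ℕ.<⇒≱ three (begin
      N.∑ elems⁺ (λ t → nz (f (point t)))
        ≤⟨ N.∑-mono∈ elems⁺ (λ {t} t∈ → pointwise t (elems⁺-nonzero t∈) (f (point t) ≟F 0F)) ⟩
      N.∑ elems⁺ (λ t → N.∑ ks (λ k → zz (ap k R ⊞ t ⊠ ap k d)))
        ≡⟨ N.∑-swap elems⁺ ks _ ⟩
      N.∑ ks (λ k → N.∑ elems⁺ (λ t → zz (ap k R ⊞ t ⊠ ap k d)))
        ≤⟨ N.∑-mono∈ ks (λ {k} k∈ → ℕ.≤-trans (ℕ.m≤n+m _ (zz (ap k R ⊞ 0F ⊠ ap k d))) (ℕ.≤-trans (ℕ.≤-reflexive (sym (N∑-split (λ t → zz (ap k R ⊞ t ⊠ ap k d)))))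
             (affine-roots (ap k R) (ap k d) (λ z → avoid k∈ (proj₁ z , trans (sym (along k (proj₁ z))) (proj₂ z)))))) ⟩
      N.∑ ks (λ k → 1)
        ≡⟨ trans (N.∑-const ks 1) (ℕ.*-identityʳ _) ⟩
      length ks
        ≤⟨ len ⟩
      2 ∎)
      where
      open ℕ.≤-Reasoning
      x d : Vector m
      x = b ·V v₁ +V c ·V v₂
      d = a ·V R +V x
      point : 𝔽 → Vector m
      point t = R +V t ·V d
      abc : Vector 3
      abc = a ∷ b ∷ c ∷ []
      along : ∀ k → ap k R ≡ 0F → ap k d ≡ ap k x
      along k z = trans (ap-+ k (a ·V R) x) (trans (cong (_⊞ ap k x) (trans (ap-· k a R) (⊠-zero z))) (+-identityˡ _))
      same : ∀ t → val (pullCode L frame) (e₁ +V t ·V abc) ≡ f (point t)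
      same t = trans (val-pull L frame (e₁ +V t ·V abc)) (cong f (trans (lincomb-+ e₁ (t ·V abc) frame) (cong₂ _+V_ at-R (trans (lincomb-· t abc frame) (cong (t ·V_)
        (vsolve (a ⊙ x₀ ⊕ (b ⊙ x₁ ⊕ (c ⊙ x₂ ⊕ ∅))) (a ⊙ x₀ ⊕ (b ⊙ x₁ ⊕ c ⊙ x₂))
          (λ { (x ∷ y ∷ z ∷ []) → solve 6 (λ a b c x y z → a :* x :+ (b :* y :+ (c :* z :+ 𝟎)) := a :* x :+ (b :* y :+ c :* z)) refl a b c x y z }) frame))))))
      three : 2 < N.∑ elems⁺ (λ t → nz (f (point t)))
      three = ℕ.≤-pred (ℕ.≤-trans (ℕ.≤-trans four (ℕ.≤-reflexive (trans (lineCount-split (pullCode L frame) e₁ abc)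
          (cong (nz (val (pullCode L frame) e₁) +_) (N.∑-cong elems⁺ (λ t → cong nz (same t)))))))
        (ℕ.+-monoˡ-≤ (N.∑ elems⁺ (λ t → nz (f (point t)))) (nz≤1 (val (pullCode L frame) e₁))))
      pointwise : ∀ t → t ≢ 0F → Dec (f (point t) ≡ 0F) → nz (f (point t)) ≤ N.∑ ks (λ k → zz (ap k R ⊞ t ⊠ ap k d))
      pointwise t t≢0 (yes e) = ℕ.≤-trans (ℕ.≤-reflexive (nz-yes e)) z≤n
      pointwise t t≢0 (no fv) = ℕ.≤-trans (nz≤1 _) (ℕ.≤-trans (Any⇒∑ (point t) ks (cov a t t≢0 fv)) (ℕ.≤-reflexive (N.∑-cong ks (λ k → cong zz (ap-line k R t d)))))

  module _ {m} (L : Code m) (good : Good L) where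
    private
      f : Vector m → 𝔽
      f = val L

    -- With μ = q^e, four heavy hyperplanes together contain at least 4(q - 7/2)μ - 6μ = (4q - 20)μ
    -- nonzero values, more than 16/5 · qμ once q > 25. The last six hypotheses say that the
    -- hyperplanes are distinct, so that any two share only μ vectors.
    four-heavy : ∀ e (U : Sub m) → ∣ U ∣ ≡ q ^ suc (suc e) → Light L U (q ^ suc e) → ∀ k₁ k₂ k₃ k₄ →
      Moves U k₁ → Moves U k₂ → Moves U k₃ → Moves U k₄ →
      Heavy L (U ∩ k₁) (q ^ e) → Heavy L (U ∩ k₂) (q ^ e) → Heavy L (U ∩ k₃) (q ^ e) → Heavy L (U ∩ k₄) (q ^ e) →
      Moves (U ∩ k₂) k₁ → Moves (U ∩ k₃) k₁ → Moves (U ∩ k₃) k₂ → Moves (U ∩ k₄) k₁ → Moves (U ∩ k₄) k₂ → Moves (U ∩ k₄) k₃ → ⊥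
    four-heavy e U card (light lt) k₁ k₂ k₃ k₄ m₁ m₂ m₃ m₄ (heavy h₁) (heavy h₂) (heavy h₃) (heavy h₄) m₂₁ m₃₁ m₃₂ m₄₁ m₄₂ m₄₃ =
      arithmetic (W L U) (W L (U ∩ k₁)) (W L (U ∩ k₂)) (W L (U ∩ k₃)) (W L (U ∩ k₄)) (Z L (U ∩ k₁)) (Z L (U ∩ k₂)) (Z L (U ∩ k₃)) (Z L (U ∩ k₄)) (q ^ e) (ℕ.m^n>0 q e)
        lt (sizes k₁ m₁) (sizes k₂ m₂) (sizes k₃ m₃) (sizes k₄ m₄) h₁ h₂ h₃ h₄ union
      where
      sizes : ∀ k → Moves U k → W L (U ∩ k) + Z L (U ∩ k) ≡ q * q ^ e
      sizes k mv = trans (W+Z L (U ∩ k)) (∣∩∣-power U k (suc e) card mv)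
      c : Lin m → Vector m → ℕ
      c k v = zz (ap k v)
      pair : ∀ k l → Moves U k → Moves (U ∩ k) l → N.∑ (els U) (λ v → c k v * c l v) ≡ q ^ e
      pair k l mv mv′ = trans (sym (∑-∩ U k (c l))) (trans (sym (zz-filter-length (ap l) (els (U ∩ k)))) (∣∩∣-power (U ∩ k) l e (∣∩∣-power U k (suc e) card mv) mv′))
      -- For a support vector on j of the hyperplanes this is j ≤ 1 + j(j - 1)/2.
      bonferroni : ∀ a b c d y → a ≤ 1 → b ≤ 1 → c ≤ 1 → d ≤ 1 → y ≤ 1 →
        a * y + b * y + c * y + d * y ≤ y + (b * a + c * a + c * b + d * a + d * b + d * c)
      bonferroni a b c d 0 _ _ _ _ _ = ℕ.≤-trans (ℕ.≤-reflexive (zeros a b c d)) z≤n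
        where
        zeros : ∀ a b c d → a * 0 + b * 0 + c * 0 + d * 0 ≡ 0
        zeros = solveₙ 4 (λ a b c d → a ⟨*⟩ # 0 ⟨+⟩ b ⟨*⟩ # 0 ⟨+⟩ c ⟨*⟩ # 0 ⟨+⟩ d ⟨*⟩ # 0 ⟨=⟩ # 0) refl
      bonferroni 0 0 0 0 1 _ _ _ _ _ = z≤n
      bonferroni 0 0 0 1 1 _ _ _ _ _ = ℕ.m≤m+n 1 _
      bonferroni 0 0 1 0 1 _ _ _ _ _ = ℕ.m≤m+n 1 _
      bonferroni 0 0 1 1 1 _ _ _ _ _ = ℕ.m≤m+n 2 _
      bonferroni 0 1 0 0 1 _ _ _ _ _ = ℕ.m≤m+n 1 _
      bonferroni 0 1 0 1 1 _ _ _ _ _ = ℕ.m≤m+n 2 _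
      bonferroni 0 1 1 0 1 _ _ _ _ _ = ℕ.m≤m+n 2 _
      bonferroni 0 1 1 1 1 _ _ _ _ _ = ℕ.m≤m+n 3 _
      bonferroni 1 0 0 0 1 _ _ _ _ _ = ℕ.m≤m+n 1 _
      bonferroni 1 0 0 1 1 _ _ _ _ _ = ℕ.m≤m+n 2 _
      bonferroni 1 0 1 0 1 _ _ _ _ _ = ℕ.m≤m+n 2 _
      bonferroni 1 0 1 1 1 _ _ _ _ _ = ℕ.m≤m+n 3 _
      bonferroni 1 1 0 0 1 _ _ _ _ _ = ℕ.m≤m+n 2 _
      bonferroni 1 1 0 1 1 _ _ _ _ _ = ℕ.m≤m+n 3 _
      bonferroni 1 1 1 0 1 _ _ _ _ _ = ℕ.m≤m+n 3 _
      bonferroni 1 1 1 1 1 _ _ _ _ _ = ℕ.m≤m+n 4 _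
      bonferroni (suc (suc _)) _ _ _ (suc _) (s≤s ()) _ _ _ _
      bonferroni _ (suc (suc _)) _ _ (suc _) _ (s≤s ()) _ _ _
      bonferroni _ _ (suc (suc _)) _ (suc _) _ _ (s≤s ()) _ _
      bonferroni _ _ _ (suc (suc _)) (suc _) _ _ _ (s≤s ()) _
      bonferroni _ _ _ _ (suc (suc _)) _ _ _ _ (s≤s ())
      c≤1 : ∀ k v → c k v ≤ 1
      c≤1 k v with ap k v ≟F 0F
      ... | yes _ = s≤s z≤n
      ... | no _  = z≤n
      union : W L (U ∩ k₁) + W L (U ∩ k₂) + W L (U ∩ k₃) + W L (U ∩ k₄) ≤ W L U + 6 * q ^ e
      union = begin
        W L (U ∩ k₁) + W L (U ∩ k₂) + W L (U ∩ k₃) + W L (U ∩ k₄)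
          ≡⟨ sym (add (add (add (sym (∑-∩ U k₁ _)) (sym (∑-∩ U k₂ _))) (sym (∑-∩ U k₃ _))) (sym (∑-∩ U k₄ _))) ⟩
        N.∑ (els U) (λ v → c k₁ v * nz (f v) + c k₂ v * nz (f v) + c k₃ v * nz (f v) + c k₄ v * nz (f v))
          ≤⟨ N.∑-mono (els U) (λ v → bonferroni (c k₁ v) (c k₂ v) (c k₃ v) (c k₄ v) (nz (f v)) (c≤1 k₁ v) (c≤1 k₂ v) (c≤1 k₃ v) (c≤1 k₄ v) (nz≤1 (f v))) ⟩
        N.∑ (els U) (λ v → nz (f v) + (c k₂ v * c k₁ v + c k₃ v * c k₁ v + c k₃ v * c k₂ v + c k₄ v * c k₁ v + c k₄ v * c k₂ v + c k₄ v * c k₃ v))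
          ≡⟨ trans (N.∑-∙ (els U) _ _) (cong (W L U +_) six) ⟩
        W L U + 6 * q ^ e ∎
        where
        open ℕ.≤-Reasoning
        add : ∀ {g h : Vector m → ℕ} {a b} → N.∑ (els U) g ≡ a → N.∑ (els U) h ≡ b → N.∑ (els U) (λ v → g v + h v) ≡ a + b
        add p s = trans (N.∑-∙ (els U) _ _) (cong₂ _+_ p s)
        collect : ∀ x → x + x + x + x + x + x ≡ 6 * x
        collect = solve-∀
        six : N.∑ (els U) (λ v → c k₂ v * c k₁ v + c k₃ v * c k₁ v + c k₃ v * c k₂ v + c k₄ v * c k₁ v + c k₄ v * c k₂ v + c k₄ v * c k₃ v) ≡ 6 * q ^ e
        six = trans (add (add (add (add (add (pair k₂ k₁ m₂ m₂₁) (pair k₃ k₁ m₃ m₃₁)) (pair k₃ k₂ m₃ m₃₂)) (pair k₄ k₁ m₄ m₄₁)) (pair k₄ k₂ m₄ m₄₂)) (pair k₄ k₃ m₄ m₄₃)) (collect (q ^ e))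
      arithmetic : ∀ w w₁ w₂ w₃ w₄ z₁ z₂ z₃ z₄ μ → 0 < μ → 5 * w ≤ 16 * (q * μ) →
        w₁ + z₁ ≡ q * μ → w₂ + z₂ ≡ q * μ → w₃ + z₃ ≡ q * μ → w₄ + z₄ ≡ q * μ →
        2 * z₁ ≤ 7 * μ → 2 * z₂ ≤ 7 * μ → 2 * z₃ ≤ 7 * μ → 2 * z₄ ≤ 7 * μ → w₁ + w₂ + w₃ + w₄ ≤ w + 6 * μ → ⊥
      arithmetic w w₁ w₂ w₃ w₄ z₁ z₂ z₃ z₄ μ μ>0 lt e₁ e₂ e₃ e₄ l₁ l₂ l₃ l₄ u = ℕ.<⇒≱ (strict<< qr) (begin
        40 * (q * μ)
          ≡⟨ i₁ (q * μ) ⟩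
        10 * (q * μ + q * μ + q * μ + q * μ)
          ≡⟨ cong (10 *_) (sym (cong₂ _+_ (cong₂ _+_ (cong₂ _+_ e₁ e₂) e₃) e₄)) ⟩
        10 * (w₁ + z₁ + (w₂ + z₂) + (w₃ + z₃) + (w₄ + z₄))
          ≡⟨ i₂ w₁ w₂ w₃ w₄ z₁ z₂ z₃ z₄ ⟩
        10 * (w₁ + w₂ + w₃ + w₄) + 5 * (2 * z₁ + 2 * z₂ + 2 * z₃ + 2 * z₄)
          ≤⟨ ℕ.+-mono-≤ (ℕ.*-monoʳ-≤ 10 u) (ℕ.*-monoʳ-≤ 5 (ℕ.+-mono-≤ (ℕ.+-mono-≤ (ℕ.+-mono-≤ l₁ l₂) l₃) l₄)) ⟩
        10 * (w + 6 * μ) + 5 * (7 * μ + 7 * μ + 7 * μ + 7 * μ)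
          ≡⟨ i₃ w μ ⟩
        2 * (5 * w) + 200 * μ
          ≤⟨ ℕ.+-monoˡ-≤ (200 * μ) (ℕ.*-monoʳ-≤ 2 lt) ⟩
        2 * (16 * (q * μ)) + 200 * μ ∎)
        where
        open ℕ.≤-Reasoning
        i₁ : ∀ x → 40 * x ≡ 10 * (x + x + x + x)
        i₁ = solveₙ 1 (λ x → # 40 ⟨*⟩ x ⟨=⟩ # 10 ⟨*⟩ (x ⟨+⟩ x ⟨+⟩ x ⟨+⟩ x)) refl
        i₂ : ∀ a b c d x y z t → 10 * (a + x + (b + y) + (c + z) + (d + t)) ≡ 10 * (a + b + c + d) + 5 * (2 * x + 2 * y + 2 * z + 2 * t)
        i₂ = solveₙ 8 (λ a b c d x y z t → # 10 ⟨*⟩ (a ⟨+⟩ x ⟨+⟩ (b ⟨+⟩ y) ⟨+⟩ (c ⟨+⟩ z) ⟨+⟩ (d ⟨+⟩ t)) ⟨=⟩ # 10 ⟨*⟩ (a ⟨+⟩ b ⟨+⟩ c ⟨+⟩ d) ⟨+⟩ # 5 ⟨*⟩ (# 2 ⟨*⟩ x ⟨+⟩ # 2 ⟨*⟩ y ⟨+⟩ # 2 ⟨*⟩ z ⟨+⟩ # 2 ⟨*⟩ t)) refl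
        i₃ : ∀ w μ → 10 * (w + 6 * μ) + 5 * (7 * μ + 7 * μ + 7 * μ + 7 * μ) ≡ 2 * (5 * w) + 200 * μ
        i₃ = solveₙ 2 (λ w μ → # 10 ⟨*⟩ (w ⟨+⟩ # 6 ⟨*⟩ μ) ⟨+⟩ # 5 ⟨*⟩ (# 7 ⟨*⟩ μ ⟨+⟩ # 7 ⟨*⟩ μ ⟨+⟩ # 7 ⟨*⟩ μ ⟨+⟩ # 7 ⟨*⟩ μ) ⟨=⟩ # 2 ⟨*⟩ (# 5 ⟨*⟩ w) ⟨+⟩ # 200 ⟨*⟩ μ) refl
        i₄ : ∀ r μ → 2 * (16 * ((26 + r) * μ)) + 200 * μ + (8 + 8 * r) * μ ≡ 40 * ((26 + r) * μ)
        i₄ = solveₙ 2 (λ r μ → # 2 ⟨*⟩ (# 16 ⟨*⟩ ((# 26 ⟨+⟩ r) ⟨*⟩ μ)) ⟨+⟩ # 200 ⟨*⟩ μ ⟨+⟩ (# 8 ⟨+⟩ # 8 ⟨*⟩ r) ⟨*⟩ μ ⟨=⟩ # 40 ⟨*⟩ ((# 26 ⟨+⟩ r) ⟨*⟩ μ)) refl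
        strict<< : ∀ {s} → s ≡ 26 + r → 2 * (16 * (s * μ)) + 200 * μ < 40 * (s * μ)
        strict<< refl = ℕ.≤-trans (ℕ.m<m+n (2 * (16 * ((26 + r) * μ)) + 200 * μ) {(8 + 8 * r) * μ} (ℕ.≤-trans μ>0 (ℕ.m≤m+n μ ((7 + 8 * r) * μ)))) (ℕ.≤-reflexive (i₄ r μ))

    Covers : Sub m → List (Lin m) → Set
    Covers U ks = ∀ {v} → v ∈ els U → v ≢ zeroV → f v ≢ 0F → Any (λ k → ap k v ≡ 0F) ks

    HeavyThrough : ℕ → Sub m → Set
    HeavyThrough e U = ∀ {R} → R ∈ els U → R ≢ zeroV → f R ≢ 0F → ∃ λ k → Moves U k × ap k R ≡ 0F × Heavy L (U ∩ k) (q ^ e)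

    search-uncovered : ∀ U ks → (∃ λ v → v ∈ els U × v ≢ zeroV × f v ≢ 0F × All (λ k → ap k v ≢ 0F) ks) ⊎ Covers U ks
    search-uncovered U ks with Any.any? (λ v → ¬? (v ≟V zeroV) ×-dec (¬? (f v ≟F 0F) ×-dec All.all? (λ k → ¬? (ap k v ≟F 0F)) ks)) (els U)
    ... | yes any = let v , v∈ , p = find any in inj₁ (v , v∈ , p)
    ... | no none = inj₂ covers
      where
      covers : Covers U ks
      covers {v} v∈ v≢0 fv with Any.any? (λ k → ap k v ≟F 0F) ks
      ... | yes p = p
      ... | no n  = ⊥-elim (none (lose v∈ (v≢0 , fv , All.¬Any⇒All¬ ks n)))

    -- A greedy choice: as long as a support vector is uncovered, a heavy hyperplane through it is
    -- added. Each new vector avoids the earlier hyperplanes, so all are distinct, and a fourth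
    -- contradicts `four-heavy`.
    cover : ∀ e (U : Sub m) → ∣ U ∣ ≡ q ^ suc (suc e) → Light L U (q ^ suc e) → HeavyThrough e U →
      ∃ λ ks → length ks ≤ 3 × All (Moves U) ks × Covers U ks
    cover e U card lt through with search-uncovered U []
    ... | inj₂ cov = [] , z≤n , [] , cov
    ... | inj₁ (v₁ , v₁∈ , n₁ , f₁ , []) with through v₁∈ n₁ f₁
    ... | k₁ , m₁ , z₁ , h₁ with search-uncovered U (k₁ ∷ [])
    ... | inj₂ cov = k₁ ∷ [] , s≤s z≤n , m₁ ∷ [] , cov
    ... | inj₁ (v₂ , v₂∈ , n₂ , f₂ , o₂₁ ∷ []) with through v₂∈ n₂ f₂
    ... | k₂ , m₂ , z₂ , h₂ with search-uncovered U (k₁ ∷ k₂ ∷ [])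
    ... | inj₂ cov = k₁ ∷ k₂ ∷ [] , s≤s (s≤s z≤n) , m₁ ∷ m₂ ∷ [] , cov
    ... | inj₁ (v₃ , v₃∈ , n₃ , f₃ , o₃₁ ∷ o₃₂ ∷ []) with through v₃∈ n₃ f₃
    ... | k₃ , m₃ , z₃ , h₃ with search-uncovered U (k₁ ∷ k₂ ∷ k₃ ∷ [])
    ... | inj₂ cov = k₁ ∷ k₂ ∷ k₃ ∷ [] , s≤s (s≤s (s≤s z≤n)) , m₁ ∷ m₂ ∷ m₃ ∷ [] , cov
    ... | inj₁ (v₄ , v₄∈ , n₄ , f₄ , o₄₁ ∷ o₄₂ ∷ o₄₃ ∷ []) with through v₄∈ n₄ f₄
    ... | k₄ , m₄ , z₄ , h₄ = ⊥-elim (four-heavy e U card lt k₁ k₂ k₃ k₄ m₁ m₂ m₃ m₄ h₁ h₂ h₃ h₄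
            (v₂ , ∩⁺ U k₂ v₂∈ z₂ , o₂₁) (v₃ , ∩⁺ U k₃ v₃∈ z₃ , o₃₁) (v₃ , ∩⁺ U k₃ v₃∈ z₃ , o₃₂)
            (v₄ , ∩⁺ U k₄ v₄∈ z₄ , o₄₁) (v₄ , ∩⁺ U k₄ v₄∈ z₄ , o₄₂) (v₄ , ∩⁺ U k₄ v₄∈ z₄ , o₄₃))

    private
      -- The setting of the inductive step: A is a heavy hyperplane of a hyperplane of U, and `ih`
      -- provides heavy hyperplanes in all subspaces one dimension below U. The aim is a heavy
      -- member of the pencil of hyperplanes through A.
      module Pencil (e : ℕ) (U : Sub m) (card : ∣ U ∣ ≡ q ^ suc (suc (suc e))) (k₀ k₁ : Lin m) (mv₀ : Moves U k₀) (mv₁ : Moves (U ∩ k₀) k₁)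
          (heavyA : Heavy L (U ∩ k₀ ∩ k₁) (q ^ e)) (ih : ∀ (V : Sub m) → ∣ V ∣ ≡ q ^ suc (suc e) → HeavyThrough e V) where

        A : Sub m
        A = U ∩ k₀ ∩ k₁

        A⁺ : ∀ {v} → v ∈ els U → ap k₀ v ≡ 0F → ap k₁ v ≡ 0F → v ∈ els A
        A⁺ v∈ z₀ z₁ = ∩⁺ (U ∩ k₀) k₁ (∩⁺ U k₀ v∈ z₀) z₁

        A⁻ : ∀ {v} → v ∈ els A → v ∈ els U × ap k₀ v ≡ 0F × ap k₁ v ≡ 0F
        A⁻ v∈ = let v∈₀ , z₁ = ∩⁻ (U ∩ k₀) k₁ v∈ ; v∈U , z₀ = ∩⁻ U k₀ v∈₀ in v∈U , z₀ , z₁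

        -- the hyperplanes p through A, each with a functional p′ cutting A out of U ∩ p
        pencil : List (Lin m × Lin m)
        pencil = (k₁ , k₀) ∷ map (λ β → combine k₀ β k₁ , k₁) elems

        pencil-length : length pencil ≡ suc q
        pencil-length = cong suc (List.length-map _ elems)

        record Member (p p′ : Lin m) : Set where
          field
            moves : Moves U p
            toA   : ∀ {v} → ap p v ≡ 0F → ap p′ v ≡ 0F → ap k₀ v ≡ 0F × ap k₁ v ≡ 0F
            fromA : ∀ {v} → ap k₀ v ≡ 0F → ap k₁ v ≡ 0F → ap p v ≡ 0F × ap p′ v ≡ 0F

        member : ∀ {pp} → pp ∈ pencil → Member (proj₁ pp) (proj₂ pp)
        member (here refl) = record
          { moves = let w , w∈ , n = mv₁ in w , proj₁ (∩⁻ U k₀ w∈) , n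
          ; toA = λ z₁ z₀ → z₀ , z₁ ; fromA = λ z₀ z₁ → z₁ , z₀ }
        member (there pp∈) with ∈-map⁻ (λ β → combine k₀ β k₁ , k₁) pp∈
        ... | β , _ , refl = record
          { moves = moves β
          ; toA = λ {v} zp z₁ → trans (sym (trans (cong (λ y → ap k₀ v ⊞ β ⊠ y) z₁) (solve 2 (λ a b → a :+ b :* 𝟎 := a) refl (ap k₀ v) β))) zp , z₁
          ; fromA = λ z₀ z₁ → trans (cong₂ (λ x y → x ⊞ β ⊠ y) z₀ z₁) (solve 1 (λ b → 𝟎 :+ b :* 𝟎 := 𝟎) refl β) , z₁ }
          where
          moves : ∀ β → Moves U (combine k₀ β k₁)
          moves β with β ≟F 0F
          ... | yes refl = let w , w∈ , n = mv₀ in w , w∈ , n ∘ trans (solve 2 (λ a b → a := a :+ 𝟎 :* b) refl (ap k₀ w) (ap k₁ w))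
          ... | no β≢0 = let w , w∈ , n = mv₁ ; w∈U , z₀ = ∩⁻ U k₀ w∈ in w , w∈U ,
                ⊠-nonzero β≢0 n ∘ trans (sym (trans (cong (_⊞ β ⊠ ap k₁ w) z₀) (+-identityˡ _)))

        through : ∀ x → ∃ λ pp → pp ∈ pencil × ap (proj₁ pp) x ≡ 0F
        through x with ap k₁ x ≟F 0F
        ... | yes z = (k₁ , k₀) , here refl , z
        ... | no n  = _ , there (∈-map⁺ (λ β → combine k₀ β k₁ , k₁) (elems-complete (⊟ (ap k₀ x ⊠ ap k₁ x ⁻¹)))) ,
              trans (solve 3 (λ a b i → a :+ (:- (a :* i)) :* b := a :+ :- (a :* (b :* i))) refl (ap k₀ x) (ap k₁ x) (ap k₁ x ⁻¹))
                (trans (cong (λ z → ap k₀ x ⊞ ⊟ (ap k₀ x ⊠ z)) (⊠-inv n)) (solve 1 (λ a → a :+ :- (a :* 𝟙) := 𝟎) refl (ap k₀ x)))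

        μ : ℕ
        μ = q ^ e

        cardA : ∣ A ∣ ≡ q * μ
        cardA = ∣∩∣-power (U ∩ k₀) k₁ (suc e) (∣∩∣-power U k₀ (suc (suc e)) card mv₀) mv₁

        weightA : 2 * (q * μ) ≤ 2 * W L A + 7 * μ
        weightA = ℕ.≤-trans (ℕ.≤-reflexive (trans (cong (2 *_) (sym (trans (W+Z L A) cardA))) (ℕ.*-distribˡ-+ 2 (W L A) (Z L A)))) (ℕ.+-monoʳ-≤ (2 * W L A) (Heavy.bound heavyA))

        moves? : ∀ k → Dec (Moves A k)
        moves? k with Any.any? (λ w → ¬? (ap k w ≟F 0F)) (els A)
        ... | yes any = yes (find any)
        ... | no none = no (λ { (w , w∈ , n) → none (lose w∈ n) })

        origin : ∀ {m} → Vector m → ℕ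
        origin v = 𝟏 (v ≟V zeroV)

        origin-on : ∀ (v : Vector m) → v ≡ zeroV → origin v ≡ 1
        origin-on v e with v ≟V zeroV
        ... | yes _ = refl
        ... | no n  = ⊥-elim (n e)

        origin-sum : N.∑ (els A) origin ≡ 1
        origin-sum = trans (N.∑-single zeroV origin (unique A) (has-0 A) (λ v n → off v n)) (origin-on zeroV refl)
          where
          off : ∀ (v : Vector m) → v ≢ zeroV → origin v ≡ 0
          off v n with v ≟V zeroV
          ... | yes e = ⊥-elim (n e)
          ... | no _  = refl

        kernels : ∀ {B : Set} (κ : B → Lin m) (xs : List B) → All (Moves A ∘ κ) xs → N.∑ (els A) (λ v → N.∑ xs (λ x → zz (ap (κ x) v))) ≡ length xs * μ
        kernels κ xs mvs = trans (N.∑-swap (els A) xs _) (trans (N.∑-cong∈ xs (λ {x} x∈ → trans (sym (zz-filter-length (ap (κ x)) (els A)))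
          (∣∩∣-power A (κ x) e cardA (All.lookup mvs x∈)))) (N.∑-const xs μ))

        μ>0 : 0 < μ
        μ>0 = ℕ.m^n>0 q e

        -- Three hyperplanes of A cannot cover the heavy space A.
        not-all-move : ∀ p ks → (∀ {v} → v ∈ els A → v ∈ els (U ∩ p)) → length ks ≤ 3 → Covers (U ∩ p) ks → ¬ All (Moves A) ks
        not-all-move p ks A⊆ len cov mvs = heavy⇒many q μ (W L A) 26≤q μ>0 weightA bound
          where
          bound : W L A ≤ 1 + 3 * μ
          bound = begin
            W L A
              ≤⟨ N.∑-mono∈ (els A) pointwise ⟩
            N.∑ (els A) (λ v → origin v + N.∑ ks (λ k → zz (ap k v)))
              ≡⟨ trans (N.∑-∙ (els A) _ _) (cong₂ _+_ origin-sum (kernels id ks mvs)) ⟩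
            1 + length ks * μ
              ≤⟨ s≤s (ℕ.*-monoˡ-≤ μ len) ⟩
            1 + 3 * μ ∎
            where
            open ℕ.≤-Reasoning
            pointwise : ∀ {v} → v ∈ els A → nz (f v) ≤ origin v + N.∑ ks (λ k → zz (ap k v))
            pointwise {v} v∈ with v ≟V zeroV | f v ≟F 0F
            ... | _     | yes _ = z≤n
            ... | yes _ | no _  = s≤s z≤n
            ... | no n  | no fv = Any⇒∑ v ks (cov (A⊆ v∈) n fv)

        Residual : Lin m → List (Lin m) → Set
        Residual p ks = ∀ {v} → v ∈ els U → ap p v ≡ 0F → ¬ v ∈ els A → f v ≢ 0F → Any (λ k → ap k v ≡ 0F) ks

        residual : ∀ {pp} → pp ∈ pencil → Light L (U ∩ proj₁ pp) (q ^ suc e) → ∃ λ ks → length ks ≤ 2 × All (Moves A) ks × Residual (proj₁ pp) ks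
        residual {p , p′} pp∈ lt with cover e (U ∩ p) card′ lt (ih (U ∩ p) card′)
          where
          card′ : ∣ U ∩ p ∣ ≡ q ^ suc (suc e)
          card′ = ∣∩∣-power U p (suc (suc e)) card (Member.moves (member pp∈))
        ... | ks , len , mvs , cov = filter moves? ks , shorter , All.all-filter moves? ks , res
          where
          open Member (member pp∈)
          A⊆ : ∀ {v} → v ∈ els A → v ∈ els (U ∩ p)
          A⊆ v∈ = let v∈U , z₀ , z₁ = A⁻ v∈ in ∩⁺ U p v∈U (proj₁ (fromA z₀ z₁))
          shorter : length (filter moves? ks) ≤ 2
          shorter = ℕ.≤-pred (ℕ.≤-trans (List.filter-notAll moves? ks (All.¬All⇒Any¬ moves? ks (not-all-move p ks A⊆ len cov))) len)
          res : Residual p (filter moves? ks)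
          res {v} v∈ pv v∉A fv with find (cov (∩⁺ U p v∈ pv) (λ { refl → v∉A (has-0 A) }) fv)
          ... | k , k∈ , kv with moves? k in eq
          ...   | yes mv = lose (∈-filter⁺ moves? k∈ mv) kv
          -- A functional k vanishing on A and at v, off A, would vanish on all of U ∩ p, because
          -- every w there differs from a vector of A by a multiple of v.
          ...   | no still = ⊥-elim (proj₂ (proj₂ (All.lookup mvs k∈)) (vanish (proj₁ (proj₂ (All.lookup mvs k∈)))))
            where
            p′v : ap p′ v ≢ 0F
            p′v z = let z₀ , z₁ = toA pv z in v∉A (A⁺ v∈ z₀ z₁)
            vanish : ∀ {w} → w ∈ els (U ∩ p) → ap k w ≡ 0F
            vanish {w} w∈ with ap k w ≟F 0F
            ... | yes z = z
            ... | no n  = ⊥-elim (still (a , a∈ , n ∘ trans (sym ka)))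
              where
              s : 𝔽
              s = ⊟ (ap p′ w ⊠ ap p′ v ⁻¹)
              a : Vector m
              a = w +V s ·V v
              ka : ap k a ≡ ap k w
              ka = trans (ap-line k w s v) (trans (cong (λ y → ap k w ⊞ s ⊠ y) kv) (solve 2 (λ x s → x :+ s :* 𝟎 := x) refl (ap k w) s))
              p′a : ap p′ a ≡ 0F
              p′a = trans (ap-line p′ w s v) (trans (solve 3 (λ a b i → a :+ (:- (a :* i)) :* b := a :+ :- (a :* (b :* i))) refl (ap p′ w) (ap p′ v) (ap p′ v ⁻¹))
                (trans (cong (λ z → ap p′ w ⊞ ⊟ (ap p′ w ⊠ z)) (⊠-inv p′v)) (solve 1 (λ a → a :+ :- (a :* 𝟙) := 𝟎) refl (ap p′ w))))
              a∈ : a ∈ els A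
              a∈ = let w∈U , pw = ∩⁻ U p w∈ ; z₀ , z₁ = toA (ap-line-zero p pw pv) p′a in A⁺ (closed U s w∈U v∈) z₀ z₁

        module AllLight (all-light : ∀ {pp} → pp ∈ pencil → Light L (U ∩ proj₁ pp) (q ^ suc e)) where

          Through-A : Lin m × Lin m → Set
          Through-A (p , k) = Moves U p × (∀ {v} → v ∈ els A → ap p v ≡ 0F) × Moves A k

          Listed : List (Lin m × Lin m) → Lin m → Set
          Listed Bs p = ∃ λ ks → length ks ≤ 2 × (∀ {k} → k ∈ ks → (p , k) ∈ Bs) × Residual p ks

          record Collection (ps : List (Lin m × Lin m)) : Set where
            field
              Bs        : List (Lin m × Lin m)
              Bs-length : length Bs ≤ 2 * length ps
              Bs-ok     : All Through-A Bs
              listed    : ∀ {pp} → pp ∈ ps → Listed Bs (proj₁ pp)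

          collect-one : ∀ pp ps → pp ∈ pencil → (∃ λ ks → length ks ≤ 2 × All (Moves A) ks × Residual (proj₁ pp) ks) → Collection ps → Collection (pp ∷ ps)
          collect-one (p , p′) ps pp∈ (ks , len , mvs , res) C = record
            { Bs = map (p ,_) ks ++ Bs
            ; Bs-length = ℕ.≤-trans (ℕ.≤-reflexive (trans (List.length-++ (map (p ,_) ks)) (cong (_+ length Bs) (List.length-map _ ks))))
                (ℕ.≤-trans (ℕ.+-mono-≤ len Bs-length) (ℕ.≤-reflexive (sym (ℕ.*-suc 2 (length ps)))))
            ; Bs-ok = All.++⁺ (All.map⁺ {P = Through-A} (All.map (λ {k} mv → through-A {k} mv) mvs)) Bs-ok
            ; listed = enlist
            }
            where
            open Collection C
            through-A : ∀ {k} → Moves A k → Through-A (p , k)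
            through-A mv = Member.moves (member pp∈) , (λ v∈ → proj₁ (Member.fromA (member pp∈) (proj₁ (proj₂ (A⁻ v∈))) (proj₂ (proj₂ (A⁻ v∈))))) , mv
            enlist : ∀ {pp} → pp ∈ (p , p′) ∷ ps → Listed (map (p ,_) ks ++ Bs) (proj₁ pp)
            enlist (here refl) = ks , len , (λ k∈ → ∈-++⁺ˡ (∈-map⁺ (p ,_) k∈)) , res
            enlist (there pp∈′) = let ks₁ , l₁ , i₁ , r₁ = listed pp∈′ in ks₁ , l₁ , (λ k∈ → ∈-++⁺ʳ (map (p ,_) ks) (i₁ k∈)) , r₁

          collect : ∀ ps → (∀ {pp} → pp ∈ ps → pp ∈ pencil) → Collection ps
          collect []        _   = record { Bs = [] ; Bs-length = z≤n ; Bs-ok = [] ; listed = λ () }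
          collect (pp ∷ ps) sub = collect-one pp ps (sub (here refl)) (residual (sub (here refl)) (all-light (sub (here refl)))) (collect ps (sub ∘ there))

          module FromCollection (C : Collection pencil) where
            open Collection C

            degree : Vector m → ℕ
            degree v = N.∑ Bs (λ pk → zz (ap (proj₂ pk) v))

            -- On average fewer than three of the listed hyperplanes pass through a point of A.
            center : ∃ λ R → R ∈ els A × R ≢ zeroV × f R ≢ 0F × degree R ≤ 2
            center = pick (N.∑-<-∃ (els A) {λ v → 3 * origin v + degree v} {λ v → 3 * nz (f v)} average)
              where
              open ℕ.≤-Reasoning
              average : N.∑ (els A) (λ v → 3 * origin v + degree v) < N.∑ (els A) (λ v → 3 * nz (f v))
              average = begin-strict
                N.∑ (els A) (λ v → 3 * origin v + degree v)
                  ≡⟨ trans (N.∑-∙ (els A) _ _) (cong₂ _+_ (trans (N.∑-*ˡ (els A) 3 _) (cong (3 *_) origin-sum)) (kernels proj₂ Bs (All.map (proj₂ ∘ proj₂) Bs-ok))) ⟩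
                3 * 1 + length Bs * μ
                  ≤⟨ ℕ.+-monoʳ-≤ 3 (ℕ.*-monoˡ-≤ μ (subst (λ n → length Bs ≤ 2 * n) pencil-length Bs-length)) ⟩
                3 * 1 + 2 * suc q * μ
                  <⟨ heavy⇒average q μ (W L A) 26≤q μ>0 weightA ⟩
                3 * W L A
                  ≡⟨ sym (N.∑-*ˡ (els A) 3 _) ⟩
                N.∑ (els A) (λ v → 3 * nz (f v)) ∎
              pick : (∃ λ v → v ∈ els A × 3 * origin v + degree v < 3 * nz (f v)) → ∃ λ R → R ∈ els A × R ≢ zeroV × f R ≢ 0F × degree R ≤ 2
              pick (R , R∈ , lt) = R , R∈ ,
                (λ e → ℕ.<⇒≱ lt (ℕ.≤-trans (ℕ.*-monoʳ-≤ 3 (ℕ.≤-trans (nz≤1 (f R)) (ℕ.≤-reflexive (sym (origin-on R e))))) (ℕ.m≤m+n (3 * origin R) (degree R)))) ,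
                (λ e → ℕ.<⇒≱ lt (ℕ.≤-trans (ℕ.≤-reflexive (cong (3 *_) (nz-yes e))) z≤n)) ,
                ℕ.≤-pred (ℕ.≤-trans (ℕ.≤-trans (s≤s (ℕ.m≤n+m (degree R) (3 * origin R))) lt) (ℕ.*-monoʳ-≤ 3 (nz≤1 (f R))))

            -- Besides A at most two of the listed subspaces U ∩ p ∩ k pass through R. All of them
            -- have codimension two in U, so counting leaves room for v₁ and v₂ no nonzero
            -- combination of which lies in any of the three.
            module AtCenter (R : Vector m) (R∈ : R ∈ els A) (R≢0 : R ≢ zeroV) (fR : f R ≢ 0F) (deg : degree R ≤ 2) where
              R∈U : R ∈ els U
              R∈U = proj₁ (A⁻ R∈)
              through-R : List (Lin m × Lin m)
              through-R = filter (λ pk → ap (proj₂ pk) R ≟F 0F) Bs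
              subs : List (Sub m)
              subs = A ∷ map (λ pk → U ∩ proj₁ pk ∩ proj₂ pk) through-R
              subs-length : length subs ≤ 3
              subs-length = s≤s (ℕ.≤-trans (ℕ.≤-reflexive (trans (List.length-map _ through-R) (zz-filter-length (λ pk → ap (proj₂ pk) R) Bs))) deg)
              subs-card : All (λ X → ∣ X ∣ ≡ q * μ) subs
              subs-card = cardA ∷ All.map⁺ (All.tabulate λ {pk} pk∈ →
                let mvU , van , w , w∈ , n = All.lookup Bs-ok (proj₁ (∈-filter⁻ (λ pk → ap (proj₂ pk) R ≟F 0F) {xs = Bs} pk∈))
                in ∣∩∣-power (U ∩ proj₁ pk) (proj₂ pk) (suc e) (∣∩∣-power U (proj₁ pk) (suc (suc e)) card mvU) (w , ∩⁺ U (proj₁ pk) (proj₁ (A⁻ w∈)) (van w∈) , n))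
              gather : (Sub m → List (Vector m)) → List (Sub m) → List (Vector m)
              gather g []       = []
              gather g (X ∷ Xs) = g X ++ gather g Xs
              gather-length : ∀ g n Xs → All (λ X → length (g X) ≡ n) Xs → length (gather g Xs) ≡ length Xs * n
              gather-length g n []       []       = refl
              gather-length g n (X ∷ Xs) (p ∷ ps) = trans (List.length-++ (g X)) (cong₂ _+_ p (gather-length g n Xs ps))
              gather-∈ : ∀ g {X Xs v} → X ∈ Xs → v ∈ g X → v ∈ gather g Xs
              gather-∈ g {Xs = Y ∷ Ys} (here refl) v∈ = ∈-++⁺ˡ v∈
              gather-∈ g {Xs = Y ∷ Ys} (there X∈)  v∈ = ∈-++⁺ʳ (g Y) (gather-∈ g X∈ v∈)
              -- The span of X and v, possibly with repetitions; avoiding it keeps v₂ independent of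
              -- v₁ modulo X.
              sweep : Vector m → Sub m → List (Vector m)
              sweep v X = cartesianProductWith (λ x t → x +V t ·V v) (els X) elems
              three< : ∀ n → 0 < n → 3 * n < q * n
              three< n n>0 = ℕ.*-monoˡ-< n {{>-nonZero n>0}} (ℕ.≤-trans (s≤s (s≤s (s≤s (s≤s z≤n)))) 26≤q)
              qμ>0 : 0 < q * μ
              qμ>0 = ℕ.m^n>0 q (suc e)
              avoid₁ : length (gather els subs) < ∣ U ∣
              avoid₁ = ℕ.≤-trans (s≤s (ℕ.≤-trans (ℕ.≤-reflexive (gather-length els (q * μ) subs subs-card)) (ℕ.*-monoˡ-≤ (q * μ) subs-length)))
                (ℕ.≤-trans (three< (q * μ) qμ>0) (ℕ.≤-trans (ℕ.m≤n*m (q * (q * μ)) q) (ℕ.≤-reflexive (sym card))))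
              avoid₂ : ∀ v₁ → length (gather (sweep v₁) subs) < ∣ U ∣
              avoid₂ v₁ = ℕ.≤-trans (s≤s (ℕ.≤-trans (ℕ.≤-reflexive (gather-length (sweep v₁) (q * (q * μ)) subs
                  (All.map (λ {X} c → trans (length-× _ (els X) elems) (trans (cong (_* q) c) (ℕ.*-comm (q * μ) q))) subs-card))) (ℕ.*-monoˡ-≤ (q * (q * μ)) subs-length)))
                (ℕ.≤-trans (three< (q * (q * μ)) (ℕ.m^n>0 q (suc (suc e)))) (ℕ.≤-reflexive (sym card)))
              module Chosen (v₁ : Vector m) (v₁∈ : v₁ ∈ els U) (v₁∉ : ¬ v₁ ∈ gather els subs)
                            (v₂ : Vector m) (v₂∈ : v₂ ∈ els U) (v₂∉ : ¬ v₂ ∈ gather (sweep v₁) subs) where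

                outside : ∀ {X} b c → X ∈ subs → ¬ (b ≡ 0F × c ≡ 0F) → ¬ (b ·V v₁ +V c ·V v₂) ∈ els X
                outside {X} b c X∈ bc x∈ = cases (c ≟F 0F)
                 where
                 cases : Dec (c ≡ 0F) → ⊥
                 cases (no c≢0) = v₂∉ (gather-∈ (sweep v₁) X∈ (subst (_∈ sweep v₁ X) eq
                        (∈-cartesianProductWith⁺ (λ x t → x +V t ·V v₁) (sub-scale X (c ⁻¹) x∈) (elems-complete (⊟ (c ⁻¹ ⊠ b))))))
                  where
                  eq : c ⁻¹ ·V (b ·V v₁ +V c ·V v₂) +V (⊟ (c ⁻¹ ⊠ b)) ·V v₁ ≡ v₂
                  eq = trans (vsolve (c ⁻¹ ⊙ (b ⊙ x₀ ⊕ c ⊙ x₁) ⊕ (⊟ (c ⁻¹ ⊠ b)) ⊙ x₀) (c ⁻¹ ⊙ c ⊙ x₁)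
                    (λ { (x ∷ y ∷ []) → solve 5 (λ b c i x y → i :* (b :* x :+ c :* y) :+ (:- (i :* b)) :* x := i :* (c :* y)) refl b c (c ⁻¹) x y }) (v₁ ∷ v₂ ∷ [])) (·V-cancel c≢0 v₂)
                 cases (yes refl) = v₁∉ (gather-∈ els X∈ (subst (_∈ els X) eq (sub-scale X (b ⁻¹) x∈)))
                  where
                  b≢0 : b ≢ 0F
                  b≢0 b≡0 = bc (b≡0 , refl)
                  eq : b ⁻¹ ·V (b ·V v₁ +V 0F ·V v₂) ≡ v₁
                  eq = trans (vsolve (b ⁻¹ ⊙ (b ⊙ x₀ ⊕ 0F ⊙ x₁)) (b ⁻¹ ⊙ b ⊙ x₀)
                    (λ { (x ∷ y ∷ []) → solve 4 (λ b i x y → i :* (b :* x :+ 𝟎 :* y) := i :* (b :* x)) refl b (b ⁻¹) x y }) (v₁ ∷ v₂ ∷ [])) (·V-cancel b≢0 v₁)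

                -- A line through R with direction x modulo R lies in one member p of the pencil and
                -- meets A only in R. The hyperplanes listed for p cover the rest of its support,
                -- and none contains the line: one that passes through R is among the avoided
                -- subspaces.
                hyperplanes : ∀ b c → ¬ (b ≡ 0F × c ≡ 0F) → ∃ λ ks → length ks ≤ 2 × (∀ {k} → k ∈ ks → ¬ (ap k R ≡ 0F × ap k (b ·V v₁ +V c ·V v₂) ≡ 0F)) ×
                  (∀ a t → t ≢ 0F → f (R +V t ·V (a ·V R +V (b ·V v₁ +V c ·V v₂))) ≢ 0F → Any (λ k → ap k (R +V t ·V (a ·V R +V (b ·V v₁ +V c ·V v₂))) ≡ 0F) ks)
                hyperplanes b c bc = package (through x)
                  where
                  x : Vector m
                  x = b ·V v₁ +V c ·V v₂
                  x∈U : x ∈ els U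
                  x∈U = closed U c (sub-scale U b v₁∈) v₂∈
                  R₀ : ap k₀ R ≡ 0F × ap k₁ R ≡ 0F
                  R₀ = proj₂ (A⁻ R∈)
                  along : ∀ k a → ap k R ≡ 0F → ap k (a ·V R +V x) ≡ ap k x
                  along k a z = trans (ap-+ k (a ·V R) x) (trans (cong (_⊞ ap k x) (trans (ap-· k a R) (⊠-zero z))) (+-identityˡ _))
                  back : ∀ k a {t} → t ≢ 0F → ap k R ≡ 0F → ap k (R +V t ·V (a ·V R +V x)) ≡ 0F → ap k x ≡ 0F
                  back k a {t} t≢0 z z′ = trans (sym (along k a z)) (⊠-integral t≢0 (trans (sym (trans (ap-line k R t (a ·V R +V x)) (trans (cong (_⊞ t ⊠ ap k (a ·V R +V x)) z) (+-identityˡ _)))) z′))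
                  package : (∃ λ pp → pp ∈ pencil × ap (proj₁ pp) x ≡ 0F) → _
                  package ((p , p′) , pp∈ , px) = pack (listed pp∈)
                    where
                    pR : ap p R ≡ 0F
                    pR = proj₁ (Member.fromA (member pp∈) (proj₁ R₀) (proj₂ R₀))
                    pack : Listed Bs p → _
                    pack (ks , len , inBs , res) = ks , len ,
                      (λ {k} k∈ z → outside b c (there (∈-map⁺ (λ pk → U ∩ proj₁ pk ∩ proj₂ pk) (∈-filter⁺ (λ pk → ap (proj₂ pk) R ≟F 0F) (inBs k∈) (proj₁ z)))) bc
                        (∩⁺ (U ∩ p) k (∩⁺ U p x∈U px) (proj₂ z))) ,
                      (λ a t t≢0 fv → res (closed U t R∈U (sub-add U (sub-scale U a R∈U) x∈U)) (ap-line-zero p pR (trans (along p a pR) px))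
                        (λ pt∈ → outside b c (here refl) bc (A⁺ x∈U (back k₀ a t≢0 (proj₁ R₀) (proj₁ (proj₂ (A⁻ pt∈)))) (back k₁ a t≢0 (proj₂ R₀) (proj₂ (proj₂ (A⁻ pt∈)))))) fv)

            absurd : ⊥
            absurd = at-center center
              where
              at-center : (∃ λ R → R ∈ els A × R ≢ zeroV × f R ≢ 0F × degree R ≤ 2) → ⊥
              at-center (R , R∈ , R≢0 , fR , deg) = first (escape U (gather els subs) avoid₁)
                where
                open AtCenter R R∈ R≢0 fR deg
                first : (∃ λ w → w ∈ els U × ¬ w ∈ gather els subs) → ⊥
                first (v₁ , v₁∈ , v₁∉) = second (escape U (gather (sweep v₁) subs) (avoid₂ v₁))
                  where
                  second : (∃ λ w → w ∈ els U × ¬ w ∈ gather (sweep v₁) subs) → ⊥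
                  second (v₂ , v₂∈ , v₂∉) = plane-contradiction L R v₁ v₂ fR (Chosen.hyperplanes v₁ v₁∈ v₁∉ v₂ v₂∈ v₂∉)

    private
      -- A hyperplane k₀ through R is either heavy itself or contains, by induction, a heavy A
      -- through R; any heavy member of the pencil through A then passes through R too.
      heavy-step : ∀ e → (∀ (V : Sub m) → ∣ V ∣ ≡ q ^ suc (suc e) → HeavyThrough e V) → ∀ U → ∣ U ∣ ≡ q ^ suc (suc (suc e)) → HeavyThrough (suc e) U
      heavy-step e ih U card {R} R∈ R≢0 fR = first (moving-through U (suc e) card R≢0)
        where
        Result : Set
        Result = ∃ λ k → Moves U k × ap k R ≡ 0F × Heavy L (U ∩ k) (q ^ suc e)
        first : (∃ λ k → Moves U k × ap k R ≡ 0F) → Result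
        first (k₀ , mv₀ , k₀R) = choose (light-or-heavy L good (U ∩ k₀) (q ^ suc e) (∣∩∣-power U k₀ (suc (suc e)) card mv₀))
          where
          second : (∃ λ k → Moves (U ∩ k₀) k × ap k R ≡ 0F × Heavy L (U ∩ k₀ ∩ k) (q ^ e)) → Result
          second (k₁ , mv₁ , k₁R , heavyA) = finish (Any.any? (λ pp → 2 * Z L (U ∩ proj₁ pp) ≤? 7 * q ^ suc e) pencil)
            where
            open Pencil e U card k₀ k₁ mv₀ mv₁ heavyA ih
            finish : Dec (Any (λ pp → 2 * Z L (U ∩ proj₁ pp) ≤ 7 * q ^ suc e) pencil) → Result
            finish (yes any) = let (p , p′) , pp∈ , h = find any in p , Member.moves (member pp∈) , proj₁ (Member.fromA (member pp∈) k₀R k₁R) , heavy h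
            finish (no none) = ⊥-elim (AllLight.FromCollection.absurd all-light (AllLight.collect all-light pencil id))
              where
              not-heavy : ∀ {pp} → pp ∈ pencil → Light L (U ∩ proj₁ pp) (q ^ suc e) ⊎ Heavy L (U ∩ proj₁ pp) (q ^ suc e) → Light L (U ∩ proj₁ pp) (q ^ suc e)
              not-heavy pp∈ (inj₁ l) = l
              not-heavy pp∈ (inj₂ h) = ⊥-elim (none (lose pp∈ (Heavy.bound h)))
              all-light : ∀ {pp} → pp ∈ pencil → Light L (U ∩ proj₁ pp) (q ^ suc e)
              all-light {p , p′} pp∈ = not-heavy pp∈ (light-or-heavy L good (U ∩ p) (q ^ suc e) (∣∩∣-power U p (suc (suc e)) card (Member.moves (member pp∈))))
          choose : Light L (U ∩ k₀) (q ^ suc e) ⊎ Heavy L (U ∩ k₀) (q ^ suc e) → Result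
          choose (inj₂ h) = k₀ , mv₀ , k₀R , h
          choose (inj₁ _) = second (ih (U ∩ k₀) (∣∩∣-power U k₀ (suc (suc e)) card mv₀) (∩⁺ U k₀ R∈ k₀R) R≢0 fR)

    private
      -- On a one-dimensional space through a support vector only the origin can be a zero, because
      -- f is invariant under nonzero scalars.
      heavy-line : ∀ (U : Sub m) {R} → ∣ U ∣ ≡ q * 1 → R ∈ els U → R ≢ zeroV → f R ≢ 0F → Heavy L U 1
      heavy-line U {R} card R∈ R≢0 fR = heavy (ℕ.≤-trans (ℕ.*-monoʳ-≤ 2 few) (s≤s (s≤s z≤n)))
        where
        injective : ∀ l → ap l R ≢ 0F → ∀ {s t} → s ·V R ≡ t ·V R → s ≡ t
        injective l lR {s} {t} e = sub-zero⇒≡ s t (⊠-integral lR (trans (solve 3 (λ s t x → x :* (s :+ :- t) := s :* x :+ :- (t :* x)) refl s t (ap l R))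
          (trans (cong (_⊞ ⊟ (t ⊠ ap l R)) (trans (sym (ap-· l s R)) (trans (cong (ap l) e) (ap-· l t R)))) (-‿inverseʳ _))))
        multiple : ∀ {v} → (∃ λ t → t ∈ elems⁺ × v ≡ t ·V R) → v ∈ filter (λ v → ¬? (f v ≟F 0F)) (els U)
        multiple (t , t∈ , refl) = ∈-filter⁺ (λ v → ¬? (f v ≟F 0F)) (sub-scale U t R∈) (fR ∘ trans (sym (val-scale L R (elems⁺-nonzero t∈))))
        multiples : length elems⁺ ≤ W L U
        multiples = let l , lR = separating R R≢0 in ℕ.≤-trans (ℕ.≤-reflexive (sym (List.length-map (_·V R) elems⁺)))
          (ℕ.≤-trans (unique-⊆-length (Unique.map⁺ (injective l lR) elems⁺-unique) (λ v∈ → multiple (∈-map⁻ (_·V R) v∈))) (ℕ.≤-reflexive (RankBound.nz-count F f (els U))))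
        few : Z L U ≤ 1
        few = ℕ.+-cancelˡ-≤ (length elems⁺) _ _ (begin
          length elems⁺ + Z L U     ≤⟨ ℕ.+-monoˡ-≤ (Z L U) multiples ⟩
          W L U + Z L U             ≡⟨ trans (W+Z L U) card ⟩
          q * 1                     ≡⟨ trans (ℕ.*-identityʳ q) (trans q≡ (ℕ.+-comm 1 (length elems⁺))) ⟩
          length elems⁺ + 1         ∎)
          where open ℕ.≤-Reasoning

    heavy-through : ∀ e (U : Sub m) → ∣ U ∣ ≡ q ^ suc (suc e) → HeavyThrough e U
    heavy-through zero    U card R∈ R≢0 fR = let k , mv , kR = moving-through U zero card R≢0 in
      k , mv , kR , heavy-line (U ∩ k) (∣∩∣-power U k 1 card mv) (∩⁺ U k R∈ kR) R≢0 fR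
    heavy-through (suc e) U card = heavy-step e (heavy-through e) U card

    covering : ∀ e → m ≡ suc (suc e) → Light L (full m) (q ^ suc e) → ∃ λ ks → length ks ≤ 3 × All (Moves (full m)) ks × Covers (full m) ks
    covering e refl lt = cover e (full m) (allVecs-length m) lt (heavy-through e (full m) (allVecs-length m))

-- Dual systems of functionals and line sums

module DualSystems (F : FiniteField) where
  open Words F public
  open Solver using (solve; _:=_; _:+_; _:*_; :-_; 𝟎; 𝟙)

  coords : ∀ {m d} → Vec (Lin m) d → Vector m → Vector d
  coords l v = Vec.map (λ k → ap k v) l

  coords-+ : ∀ {m d} (l : Vec (Lin m) d) u v → coords l (u +V v) ≡ coords l u +V coords l v
  coords-+ []      u v = refl
  coords-+ (k ∷ l) u v = cong₂ _∷_ (ap-+ k u v) (coords-+ l u v)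

  coords-· : ∀ {m d} (l : Vec (Lin m) d) t v → coords l (t ·V v) ≡ t ·V coords l v
  coords-· []      t v = refl
  coords-· (k ∷ l) t v = cong₂ _∷_ (ap-· k t v) (coords-· l t v)

  -- Independence of the functionals is witnessed by dual vectors, so that `proj` is the projection
  -- onto the span of e along the common kernel of l.
  record Dual (m d : ℕ) : Set where
    field
      l    : Vec (Lin m) d
      e    : Fam m d
      dual : ∀ a → coords l (lincomb a e) ≡ a

    proj : Vector m → Vector m
    proj v = lincomb (coords l v) e

    residue : Vector m → Vector m
    residue v = v +V (⊟ 1F) ·V proj v

    residue-coords : ∀ v → coords l (residue v) ≡ zeroV
    residue-coords v = trans (coords-+ l v _) (trans (cong (coords l v +V_) (trans (coords-· l (⊟ 1F) (proj v)) (cong ((⊟ 1F) ·V_) (dual (coords l v)))))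
      (vsolve (x₀ ⊕ (⊟ 1F) ⊙ x₀) ∅ (λ { (x ∷ []) → solve 1 (λ x → x :+ (:- 𝟙) :* x := 𝟎) refl x }) (coords l v ∷ [])))

    split : ∀ v → v ≡ proj v +V residue v
    split v = vsolve x₀ (x₁ ⊕ (x₀ ⊕ (⊟ 1F) ⊙ x₁)) (λ { (x ∷ y ∷ []) → solve 2 (λ x y → x := y :+ (x :+ (:- 𝟙) :* y)) refl x y }) (v ∷ proj v ∷ [])

    -- Vanishing on the common kernel replaces an explicit expression of k as a combination of the
    -- functionals in l.
    Factors : Lin m → Set
    Factors k = ∀ w → coords l w ≡ zeroV → ap k w ≡ 0F

    factors-proj : ∀ {k} → Factors k → ∀ v → ap k v ≡ ap k (proj v)
    factors-proj {k} fac v = trans (cong (ap k) (split v)) (trans (ap-+ k _ _) (trans (cong (ap k (proj v) ⊞_) (fac (residue v) (residue-coords v))) (+-identityʳ _)))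

  empty : ∀ {m} → Dual m 0
  empty = record { l = [] ; e = [] ; dual = λ { [] → refl } }

  private
    lincomb-adjust : ∀ {m d} (k : Lin m) (w : Vector m) (a : Vector d) (e : Fam m d) →
      lincomb a (Vec.map (λ x → x +V (⊟ ap k x) ·V w) e) ≡ lincomb a e +V (⊟ ap k (lincomb a e)) ·V w
    lincomb-adjust k w []       []      = sym (trans (+V-identityˡ _) (trans (cong (λ y → (⊟ y) ·V w) (ap-zero k)) (trans (cong (_·V w) neg-zero) (0·V w))))
    lincomb-adjust k w (a ∷ as) (x ∷ e) = trans (cong (a ·V (x +V (⊟ ap k x) ·V w) +V_) (lincomb-adjust k w as e))
      (trans (vsolve (a ⊙ (x₀ ⊕ (⊟ ap k x) ⊙ x₁) ⊕ (x₂ ⊕ (⊟ ap k (lincomb as e)) ⊙ x₁)) ((a ⊙ x₀ ⊕ x₂) ⊕ (⊟ (a ⊠ ap k x ⊞ ap k (lincomb as e))) ⊙ x₁)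
        (λ { (x′ ∷ w ∷ y ∷ []) → solve 6 (λ a p c x w y → a :* (x :+ (:- p) :* w) :+ (y :+ (:- c) :* w) := (a :* x :+ y) :+ (:- (a :* p :+ c)) :* w) refl a (ap k x) (ap k (lincomb as e)) x′ w y })
        (x ∷ w ∷ lincomb as e ∷ []))
        (cong (λ y → (a ·V x +V lincomb as e) +V (⊟ y) ·V w) (sym (trans (ap-+ k _ _) (cong (_⊞ ap k (lincomb as e)) (ap-· k a x))))))

  -- The vector w, scaled to value one, becomes the new dual vector. The old ones are moved into the
  -- kernel of k by multiples of it, which does not affect their other coordinates, since those of w
  -- are all zero.
  extend : ∀ {m d} (D : Dual m d) (k : Lin m) {w} → coords (Dual.l D) w ≡ zeroV → ap k w ≢ 0F → Dual m (suc d)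
  extend {m} {d} D k {w} cw kw = record { l = k ∷ l ; e = w′ ∷ Vec.map (λ x → x +V (⊟ ap k x) ·V w′) e ; dual = λ { (b ∷ a) → dual′ b a } }
    where
    open Dual D
    w′ : Vector m
    w′ = ap k w ⁻¹ ·V w
    kw′ : ap k w′ ≡ 1F
    kw′ = trans (ap-· k _ w) (inv-⊠ kw)
    cw′ : coords l w′ ≡ zeroV
    cw′ = trans (coords-· l _ w) (trans (cong (ap k w ⁻¹ ·V_) cw) (·V-zeroʳ _))
    module _ (b : 𝔽) (a : Vector d) where
      y : Vector m
      y = lincomb a e
      form : lincomb (b ∷ a) (w′ ∷ Vec.map (λ x → x +V (⊟ ap k x) ·V w′) e) ≡ y +V (b ⊞ ⊟ ap k y) ·V w′
      form = trans (cong (b ·V w′ +V_) (lincomb-adjust k w′ a e)) (vsolve (b ⊙ x₀ ⊕ (x₁ ⊕ (⊟ ap k y) ⊙ x₀)) (x₁ ⊕ (b ⊞ ⊟ ap k y) ⊙ x₀)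
        (λ { (w ∷ y′ ∷ []) → solve 4 (λ b c w y → b :* w :+ (y :+ (:- c) :* w) := y :+ (b :+ :- c) :* w) refl b (ap k y) w y′ }) (w′ ∷ y ∷ []))
      dual′ : coords (k ∷ l) (lincomb (b ∷ a) (w′ ∷ Vec.map (λ x → x +V (⊟ ap k x) ·V w′) e)) ≡ b ∷ a
      dual′ = trans (cong (coords (k ∷ l)) form) (cong₂ _∷_
        (trans (ap-line k y _ w′) (trans (cong (λ z → ap k y ⊞ (b ⊞ ⊟ ap k y) ⊠ z) kw′) (solve 2 (λ c b → c :+ (b :+ :- c) :* 𝟙 := b) refl (ap k y) b)))
        (trans (coords-+ l y _) (trans (cong₂ _+V_ (dual a) (trans (coords-· l _ w′) (trans (cong ((b ⊞ ⊟ ap k y) ·V_) cw′) (·V-zeroʳ _)))) (+V-identityʳ a))))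

  factor-or-extend : ∀ {m d} (D : Dual m d) (k : Lin m) → Dual.Factors D k ⊎ (∃ λ w → coords (Dual.l D) w ≡ zeroV × ap k w ≢ 0F)
  factor-or-extend {m} D k with Any.any? (λ w → (coords (Dual.l D) w ≟V zeroV) ×-dec ¬? (ap k w ≟F 0F)) (allVecs m)
  ... | yes any = inj₂ (let w , _ , p = find any in w , p)
  ... | no none = inj₁ fac
    where
    fac : Dual.Factors D k
    fac w cw with ap k w ≟F 0F
    ... | yes z = z
    ... | no n  = ⊥-elim (none (lose (allVecs-complete w) (cw , n)))

  basis : ∀ m → Fam m m
  basis zero    = []
  basis (suc m) = (1F ∷ zeroV) ∷ Vec.map (0F ∷_) (basis m)

  lincomb-basis : ∀ {m} (a : Vector m) → lincomb a (basis m) ≡ a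
  lincomb-basis []       = refl
  lincomb-basis (a ∷ as) = trans (cong ((a ·V (1F ∷ zeroV)) +V_) (shifted as (basis _))) (cong₂ _∷_
      (solve 1 (λ a → a :* 𝟙 :+ 𝟎 := a) refl a) (trans (cong₂ _+V_ (·V-zeroʳ a) (lincomb-basis as)) (+V-identityˡ as)))
    where
    shifted : ∀ {m d} (a : Vector d) (vs : Fam m d) → lincomb a (Vec.map (0F ∷_) vs) ≡ 0F ∷ lincomb a vs
    shifted []       []       = refl
    shifted (a ∷ as) (v ∷ vs) = trans (cong ((a ·V (0F ∷ v)) +V_) (shifted as vs)) (cong (_∷ lincomb (a ∷ as) (v ∷ vs)) (solve 1 (λ a → a :* 𝟎 :+ 𝟎 := 𝟎) refl a))

  -- The coordinate vectors of m basis vectors live in dimension d < m, and the coefficients of a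
  -- relation between them form the vector sought.
  kernel-vector : ∀ {m d} (D : Dual m d) → d < m → ∃ λ w → w ≢ zeroV × coords (Dual.l D) w ≡ zeroV
  kernel-vector {m} D lt = let a , a≢0 , e = dependent (Vec.map (coords (Dual.l D)) (basis m)) lt in
      a , a≢0 , trans (trans (cong (coords (Dual.l D)) (sym (lincomb-basis a))) (sym (push a (basis m)))) e
    where
    zero-coords : ∀ {d} (l : Vec (Lin m) d) → coords l zeroV ≡ zeroV
    zero-coords []      = refl
    zero-coords (k ∷ l) = cong₂ _∷_ (ap-zero k) (zero-coords l)
    push : ∀ {d} (a : Vector d) (vs : Fam m d) → lincomb a (Vec.map (coords (Dual.l D)) vs) ≡ coords (Dual.l D) (lincomb a vs)
    push []       []       = sym (zero-coords (Dual.l D))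
    push (a ∷ as) (v ∷ vs) = sym (trans (coords-+ (Dual.l D) _ _) (cong₂ _+V_ (coords-· (Dual.l D) a v) (sym (push as vs))))

  -- When a system is enlarged, `keeps` preserves factorisations through it, and `retains` preserves
  -- coverings by its hyperplanes.
  record _⊑_ {m d d′} (D : Dual m d) (D′ : Dual m d′) : Set where
    field
      keeps   : ∀ {w} → coords (Dual.l D′) w ≡ zeroV → coords (Dual.l D) w ≡ zeroV
      retains : ∀ i → ∃ λ j → ∀ v → ap (Vec.lookup (Dual.l D) i) v ≡ ap (Vec.lookup (Dual.l D′) j) v
  open _⊑_ public

  ⊑-refl : ∀ {m d} {D : Dual m d} → D ⊑ D
  ⊑-refl = record { keeps = id ; retains = λ i → i , λ _ → refl }

  ⊑-trans : ∀ {m d d′ d″} {D : Dual m d} {D′ : Dual m d′} {D″ : Dual m d″} → D ⊑ D′ → D′ ⊑ D″ → D ⊑ D″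
  ⊑-trans p r = record { keeps = keeps p ∘ keeps r ; retains = λ i → let j , e = retains p i ; k , e′ = retains r j in k , λ v → trans (e v) (e′ v) }

  ⊑-extend : ∀ {m d} (D : Dual m d) k {w} cw kw → D ⊑ extend D k {w} cw kw
  ⊑-extend D k cw kw = record { keeps = λ z → proj₂ (Vec.∷-injective z) ; retains = λ i → Fin.suc i , λ _ → refl }

  fill : ∀ {m} gap {d} (D : Dual m d) → d + gap ≤ m → ∃ λ (D′ : Dual m (gap + d)) → D ⊑ D′
  fill zero      D le = D , ⊑-refl
  fill {m} (suc gap) {d} D le = subst (λ n → ∃ λ (D′ : Dual m n) → D ⊑ D′) (ℕ.+-suc gap d) (step (kernel-vector D (ℕ.≤-trans (ℕ.≤-trans (s≤s (ℕ.m≤m+n d gap)) (ℕ.≤-reflexive (sym (ℕ.+-suc d gap)))) le)))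
    where
    step : (∃ λ w → w ≢ zeroV × coords (Dual.l D) w ≡ zeroV) → ∃ λ (D′ : Dual m (gap + suc d)) → D ⊑ D′
    step (w , w≢0 , cw) = let k , kw = separating w w≢0 ; D′ , p = fill gap (extend D k cw kw) (ℕ.≤-trans (ℕ.≤-reflexive (sym (ℕ.+-suc d gap))) le) in
      D′ , ⊑-trans (⊑-extend D k cw kw) p

  module _ {m} (3≤m : 3 ≤ m) where

    private
      absorb : ∀ {d} (D : Dual m d) k → ∃ λ d′ → d′ ≤ suc d × ∃ λ (D′ : Dual m d′) → D ⊑ D′ × Dual.Factors D′ k
      absorb {d} D k = decide (factor-or-extend D k)
        where
        decide : Dual.Factors D k ⊎ (∃ λ w → coords (Dual.l D) w ≡ zeroV × ap k w ≢ 0F) → _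
        decide (inj₁ fac)           = d , ℕ.n≤1+n d , D , ⊑-refl , fac
        decide (inj₂ (w , cw , kw)) = suc d , ℕ.≤-refl , extend D k cw kw , ⊑-extend D k cw kw , λ _ z → proj₁ (Vec.∷-injective z)

      top-up : ∀ {d} (D : Dual m d) → d ≤ 3 → ∃ λ (D′ : Dual m 3) → D ⊑ D′
      top-up {d} D le = subst (λ n → ∃ λ (D′ : Dual m n) → D ⊑ D′) (ℕ.m∸n+n≡m le)
        (fill (3 ∸ d) D (ℕ.≤-trans (ℕ.≤-reflexive (trans (ℕ.+-comm d (3 ∸ d)) (ℕ.m∸n+n≡m le))) 3≤m))

    pad : ∀ {d} (D : Dual m d) → d ≤ 3 → ∃ λ (D′ : Dual m 3) → D ⊑ D′
    pad = top-up

    factor-three : ∀ k₁ k₂ k₃ → ∃ λ (D : Dual m 3) → Dual.Factors D k₁ × Dual.Factors D k₂ × Dual.Factors D k₃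
    factor-three k₁ k₂ k₃ =
      let d₁ , l₁ , D₁ , _ , f₁  = absorb empty k₁
          d₂ , l₂ , D₂ , s₂ , f₂ = absorb D₁ k₂
          d₃ , l₃ , D₃ , s₃ , f₃ = absorb D₂ k₃
          D , s = top-up D₃ (ℕ.≤-trans l₃ (s≤s (ℕ.≤-trans l₂ (s≤s l₁))))
      in D , (λ w z → f₁ w (keeps s₂ (keeps s₃ (keeps s z)))) , (λ w z → f₂ w (keeps s₃ (keeps s z))) , (λ w z → f₃ w (keeps s z))

  val-zero : ∀ {m} (L : Code m) → val L zeroV ≡ S.∑ L proj₁
  val-zero L = S.∑-cong L (λ lk → trans (cong (proj₁ lk ⊠_) (δ-yes (ap-zero (proj₂ lk)))) (*-identityʳ _))

  -- A functional not vanishing at v has exactly one zero on the line and contributes its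
  -- coefficient. One that vanishes at v is constant on the line and contributes q times a value,
  -- which is zero in F.
  line-sum : ∀ {m} (L : Code m) u v → S.∑ elems (λ t → val L (u +V t ·V v)) ≡ val L zeroV ⊞ ⊟ val L v
  line-sum L u v = begin
    S.∑ elems (λ t → val L (u +V t ·V v))
      ≡⟨ S.∑-swap elems L _ ⟩
    S.∑ L (λ lk → S.∑ elems (λ t → proj₁ lk ⊠ δ (ap (proj₂ lk) (u +V t ·V v))))
      ≡⟨ S.∑-cong L (λ lk → trans (S.∑-⊠ˡ elems (proj₁ lk) _) (cong (proj₁ lk ⊠_) (trans (S.∑-cong elems (λ t → cong δ (ap-line (proj₂ lk) u t v))) (each (ap (proj₂ lk) u) (ap (proj₂ lk) v))))) ⟩
    S.∑ L (λ lk → proj₁ lk ⊠ (1F ⊞ ⊟ δ (ap (proj₂ lk) v)))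
      ≡⟨ S.∑-cong L (λ lk → solve 2 (λ l d → l :* (𝟙 :+ :- d) := l :+ (:- 𝟙) :* (l :* d)) refl (proj₁ lk) (δ (ap (proj₂ lk) v))) ⟩
    S.∑ L (λ lk → proj₁ lk ⊞ (⊟ 1F) ⊠ (proj₁ lk ⊠ δ (ap (proj₂ lk) v)))
      ≡⟨ trans (S.∑-∙ L _ _) (cong₂ _⊞_ (sym (val-zero L)) (S.∑-⊠ˡ L (⊟ 1F) _)) ⟩
    val L zeroV ⊞ (⊟ 1F) ⊠ val L v
      ≡⟨ solve 2 (λ a b → a :+ (:- 𝟙) :* b := a :+ :- b) refl (val L zeroV) (val L v) ⟩
    val L zeroV ⊞ ⊟ val L v ∎
    where
    open ≡-Reasoning
    each : ∀ a b → S.∑ elems (λ t → δ (a ⊞ t ⊠ b)) ≡ 1F ⊞ ⊟ δ b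
    each a b with b ≟F 0F
    ... | yes refl = trans (S.∑-cong elems (λ t → cong δ (solve 2 (λ a t → a :+ t :* 𝟎 := a) refl a t))) (trans (∑-constant (δ a)) (sym (-‿inverseʳ 1F)))
    ... | no b≢0 = trans (S.∑-single (⊟ (a ⊠ b ⁻¹)) _ elems-unique (elems-complete _) (λ t t≢ → δ-no (λ e → t≢ (root t e))))
        (trans (δ-yes (trans (solve 3 (λ a b i → a :+ (:- (a :* i)) :* b := a :+ :- (a :* (b :* i))) refl a b (b ⁻¹))
          (trans (cong (λ z → a ⊞ ⊟ (a ⊠ z)) (⊠-inv b≢0)) (solve 1 (λ a → a :+ :- (a :* 𝟙) := 𝟎) refl a)))) (sym (solve 0 (𝟙 :+ :- 𝟎 := 𝟙) refl)))
      where
      root : ∀ t → a ⊞ t ⊠ b ≡ 0F → t ≡ ⊟ (a ⊠ b ⁻¹)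
      root t e = trans (trans (sym (*-identityʳ t)) (cong (t ⊠_) (sym (⊠-inv b≢0))))
        (trans (solve 4 (λ a b i t → t :* (b :* i) := (a :+ t :* b) :* i :+ :- (a :* i)) refl a b (b ⁻¹) t)
          (trans (cong (λ z → z ⊠ b ⁻¹ ⊞ ⊟ (a ⊠ b ⁻¹)) e) (solve 2 (λ i c → 𝟎 :* i :+ :- c := :- c) refl (b ⁻¹) (a ⊠ b ⁻¹))))

-- Words supported on three hyperplanes

module Shapes (F : FiniteField) where
  open DualSystems F public
  open Solver using (solve; _:=_; _:+_; _:*_; :-_; 𝟎; 𝟙)

  Nonzero : ∀ {m} → Lin m → Set
  Nonzero k = ∃ λ w → ap k w ≢ 0F

  zero-or-not : {A : Set} (x : 𝔽) → (x ≢ 0F → A) → (x ≡ 0F → A) → A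
  zero-or-not x g h with x ≟F 0F
  ... | yes e = h e
  ... | no n  = g n

  -- The predicate P will say that coefficients come from the integers modulo p. Hyperplanes may
  -- coincide and coefficients may vanish, as in the definitions of the triangle and star types.
  record Combination {m} (P : 𝔽 → Set) (f : Vector m → 𝔽) : Set where
    field
      k₁ k₂ k₃   : Lin m
      λ₁ λ₂ λ₃   : 𝔽
      λ₁∈ : P λ₁
      λ₂∈ : P λ₂
      λ₃∈ : P λ₃
      nonzero₁   : Nonzero k₁
      nonzero₂   : Nonzero k₂
      nonzero₃   : Nonzero k₃
      formula    : ∀ v → f v ≡ λ₁ ⊠ δ (ap k₁ v) ⊞ (λ₂ ⊠ δ (ap k₂ v) ⊞ λ₃ ⊠ δ (ap k₃ v))

  -- The function of the odd type without coordinates: K₁ = 0, K₂ = 0 and K₁ = K₂ are the three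
  -- members of the pencil, and the division by a coordinate of v makes the formulas invariant under
  -- scaling.
  record PencilForm {m} (f : Vector m → 𝔽) (K₁ K₂ l : Lin m) (f₀ g₀ h₀ : 𝔽) : Set where
    field
      on-axis  : ∀ v → ap K₁ v ≡ 0F → ap K₂ v ≡ 0F → f v ≡ f₀ ⊞ (g₀ ⊞ h₀)
      on-first : ∀ v → ap K₁ v ≡ 0F → ap K₂ v ≢ 0F → f v ≡ f₀ ⊞ ap K₂ v ⁻¹ ⊠ ap l v
      on-second : ∀ v → ap K₁ v ≢ 0F → ap K₂ v ≡ 0F → f v ≡ g₀ ⊞ ap K₁ v ⁻¹ ⊠ ap l v
      on-third : ∀ v → ap K₁ v ≢ 0F → ap K₁ v ≡ ap K₂ v → f v ≡ h₀ ⊞ ⊟ (ap K₁ v ⁻¹ ⊠ ap l v)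
      off      : ∀ v → ap K₁ v ≢ 0F → ap K₂ v ≢ 0F → ap K₁ v ≢ ap K₂ v → f v ≡ 0F

  module _ {m} (f : Vector m → 𝔽)
      (line-sum : ∀ u v → S.∑ elems (λ t → f (u +V t ·V v)) ≡ f zeroV ⊞ ⊟ f v)
      (scale : ∀ {t} v → t ≢ 0F → f (t ·V v) ≡ f v)
      (P : 𝔽 → Set) (P-val : ∀ v → P (f v)) (P-sub : ∀ {x y} → P x → P y → P (x ⊞ ⊟ y)) where

    private
      a : 𝔽
      a = f zeroV

      line-sum⁺ : ∀ u v → f u ⊞ S.∑ elems⁺ (λ t → f (u +V t ·V v)) ≡ a ⊞ ⊟ f v
      line-sum⁺ u v = trans (cong (λ y → f y ⊞ S.∑ elems⁺ (λ t → f (u +V t ·V v))) (sym (trans (cong (u +V_) (0·V v)) (+V-identityʳ u))))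
        (trans (sym (∑-split (λ t → f (u +V t ·V v)))) (line-sum u v))

    -- The coefficient f(0) - f(eᵢ) is the sum of f along any line of direction eᵢ. The formula
    -- holds off all three hyperplanes, where both sides vanish, and is then extended across one
    -- hyperplane at a time.
    module ThreeIndependent (l₁ l₂ l₃ : Lin m) (e₁ e₂ e₃ : Vector m)
        (h₁₁ : ap l₁ e₁ ≡ 1F) (h₁₂ : ap l₁ e₂ ≡ 0F) (h₁₃ : ap l₁ e₃ ≡ 0F)
        (h₂₁ : ap l₂ e₁ ≡ 0F) (h₂₂ : ap l₂ e₂ ≡ 1F) (h₂₃ : ap l₂ e₃ ≡ 0F)
        (h₃₁ : ap l₃ e₁ ≡ 0F) (h₃₂ : ap l₃ e₂ ≡ 0F) (h₃₃ : ap l₃ e₃ ≡ 1F)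
        (cover : ∀ v → ap l₁ v ≢ 0F → ap l₂ v ≢ 0F → ap l₃ v ≢ 0F → f v ≡ 0F) where

      private
        c : Vector m → 𝔽
        c e = a ⊞ ⊟ f e

        g : Vector m → 𝔽
        g v = c e₁ ⊠ δ (ap l₁ v) ⊞ (c e₂ ⊠ δ (ap l₂ v) ⊞ c e₃ ⊠ δ (ap l₃ v))

        move : ∀ (l : Lin m) (e : Vector m) {v : Vector m} {t} → ap l e ≡ 1F → ap l v ≡ 0F → ap l (v +V t ·V e) ≡ t
        move l e {v} {t} h z = trans (ap-line l v t e) (trans (cong₂ (λ x y → x ⊞ t ⊠ y) z h) (solve 1 (λ t → 𝟎 :+ t :* 𝟙 := t) refl t))

        stay : ∀ (l : Lin m) (e : Vector m) {v : Vector m} {t} → ap l e ≡ 0F → ap l (v +V t ·V e) ≡ ap l v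
        stay l e {v} {t} h = trans (ap-line l v t e) (trans (cong (λ y → ap l v ⊞ t ⊠ y) h) (solve 2 (λ x t → x :+ t :* 𝟎 := x) refl (ap l v) t))

        -- Along the direction e only the indicator of l changes, and the line sum determines f v.
        step : ∀ (l : Lin m) (e : Vector m) (rest : Vector m → 𝔽) → ap l e ≡ 1F → (∀ v → g v ≡ c e ⊠ δ (ap l v) ⊞ rest v) → (∀ v t → rest (v +V t ·V e) ≡ rest v) →
          ∀ v → ap l v ≡ 0F → (∀ t → t ≢ 0F → f (v +V t ·V e) ≡ g (v +V t ·V e)) → f v ≡ g v
        step l e rest h form const v z ih = trans (⊞-cancelˡ (⊟ rest v) (trans (+-comm _ _) (trans (trans (cong (f v ⊞_) (sym tail)) (line-sum⁺ v e))
            (solve 2 (λ c r → c := :- r :+ (c :* 𝟙 :+ r)) refl (c e) (rest v))))) (sym (trans (form v) (cong (λ d → c e ⊠ d ⊞ rest v) (δ-yes z))))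
          where
          tail : S.∑ elems⁺ (λ t → f (v +V t ·V e)) ≡ ⊟ rest v
          tail = trans (S.∑-cong∈ elems⁺ (λ {t} t∈ → trans (ih t (elems⁺-nonzero t∈)) (trans (form (v +V t ·V e)) (trans (cong₂ (λ d r → c e ⊠ d ⊞ r)
            (δ-no (elems⁺-nonzero t∈ ∘ trans (sym (move l e {v} {t} h z)))) (const v t)) (solve 2 (λ c r → c :* 𝟎 :+ r := r) refl (c e) (rest v)))))) (∑⁺-constant (rest v))

        p₀ : ∀ v → ap l₁ v ≢ 0F → ap l₂ v ≢ 0F → ap l₃ v ≢ 0F → f v ≡ g v
        p₀ v n₁ n₂ n₃ = trans (cover v n₁ n₂ n₃) (sym (trans (cong₂ _⊞_ (⊠-zero (δ-no n₁)) (trans (cong₂ _⊞_ (⊠-zero (δ-no n₂)) (⊠-zero (δ-no n₃))) (+-identityˡ 0F))) (+-identityˡ 0F)))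

        p₁ : ∀ v → ap l₂ v ≢ 0F → ap l₃ v ≢ 0F → f v ≡ g v
        p₁ v n₂ n₃ = zero-or-not (ap l₁ v) (λ n₁ → p₀ v n₁ n₂ n₃) λ z → step l₁ e₁ (λ v → c e₂ ⊠ δ (ap l₂ v) ⊞ c e₃ ⊠ δ (ap l₃ v)) h₁₁ (λ _ → refl)
                (λ v t → cong₂ (λ x y → c e₂ ⊠ δ x ⊞ c e₃ ⊠ δ y) (stay l₂ e₁ {v} {t} h₂₁) (stay l₃ e₁ {v} {t} h₃₁)) v z
                (λ t t≢0 → p₀ (v +V t ·V e₁) (t≢0 ∘ trans (sym (move l₁ e₁ {v} {t} h₁₁ z))) (n₂ ∘ trans (sym (stay l₂ e₁ {v} {t} h₂₁))) (n₃ ∘ trans (sym (stay l₃ e₁ {v} {t} h₃₁))))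

        p₂ : ∀ v → ap l₃ v ≢ 0F → f v ≡ g v
        p₂ v n₃ = zero-or-not (ap l₂ v) (λ n₂ → p₁ v n₂ n₃) λ z → step l₂ e₂ (λ v → c e₁ ⊠ δ (ap l₁ v) ⊞ c e₃ ⊠ δ (ap l₃ v)) h₂₂
                (λ v → solve 3 (λ x y z → x :+ (y :+ z) := y :+ (x :+ z)) refl (c e₁ ⊠ δ (ap l₁ v)) (c e₂ ⊠ δ (ap l₂ v)) (c e₃ ⊠ δ (ap l₃ v)))
                (λ v t → cong₂ (λ x y → c e₁ ⊠ δ x ⊞ c e₃ ⊠ δ y) (stay l₁ e₂ {v} {t} h₁₂) (stay l₃ e₂ {v} {t} h₃₂)) v z
                (λ t t≢0 → p₁ (v +V t ·V e₂) (t≢0 ∘ trans (sym (move l₂ e₂ {v} {t} h₂₂ z))) (n₃ ∘ trans (sym (stay l₃ e₂ {v} {t} h₃₂))))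

        p₃ : ∀ v → f v ≡ g v
        p₃ v = zero-or-not (ap l₃ v) (λ n₃ → p₂ v n₃) λ z → step l₃ e₃ (λ v → c e₁ ⊠ δ (ap l₁ v) ⊞ c e₂ ⊠ δ (ap l₂ v)) h₃₃
                (λ v → solve 3 (λ x y z → x :+ (y :+ z) := z :+ (x :+ y)) refl (c e₁ ⊠ δ (ap l₁ v)) (c e₂ ⊠ δ (ap l₂ v)) (c e₃ ⊠ δ (ap l₃ v)))
                (λ v t → cong₂ (λ x y → c e₁ ⊠ δ x ⊞ c e₂ ⊠ δ y) (stay l₁ e₃ {v} {t} h₁₃) (stay l₂ e₃ {v} {t} h₂₃)) v z
                (λ t t≢0 → p₂ (v +V t ·V e₃) (t≢0 ∘ trans (sym (move l₃ e₃ {v} {t} h₃₃ z))))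

      combination : Combination P f
      combination = record { k₁ = l₁ ; k₂ = l₂ ; k₃ = l₃ ; λ₁ = c e₁ ; λ₂ = c e₂ ; λ₃ = c e₃
        ; λ₁∈ = P-sub (P-val _) (P-val _) ; λ₂∈ = P-sub (P-val _) (P-val _) ; λ₃∈ = P-sub (P-val _) (P-val _)
        ; nonzero₁ = e₁ , 1≢0 ∘ trans (sym h₁₁) ; nonzero₂ = e₂ , 1≢0 ∘ trans (sym h₂₂) ; nonzero₃ = e₃ , 1≢0 ∘ trans (sym h₃₃) ; formula = p₃ }

    independent-cover : (D : Dual m 3) → (∀ v → v ≢ zeroV → f v ≢ 0F → ∃ λ i → ap (Vec.lookup (Dual.l D) i) v ≡ 0F) → Combination P f
    independent-cover D = unpack (Dual.l D) (Dual.e D) (Dual.dual D)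
     where
     unpack : (l : Vec (Lin m) 3) (e : Fam m 3) → (∀ a → coords l (lincomb a e) ≡ a) →
       (∀ v → v ≢ zeroV → f v ≢ 0F → ∃ λ i → ap (Vec.lookup l i) v ≡ 0F) → Combination P f
     unpack (l₁ ∷ l₂ ∷ l₃ ∷ []) (e₁ ∷ e₂ ∷ e₃ ∷ []) dual cov = ThreeIndependent.combination l₁ l₂ l₃ e₁ e₂ e₃
        (nth₁ d₁) (nth₁ d₂) (nth₁ d₃) (nth₂ d₁) (nth₂ d₂) (nth₂ d₃) (nth₃ d₁) (nth₃ d₂) (nth₃ d₃) cover
      where
      E : Fam m 3
      E = e₁ ∷ e₂ ∷ e₃ ∷ []
      row : Vector m → Vector 3
      row v = ap l₁ v ∷ ap l₂ v ∷ ap l₃ v ∷ []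
      d₁ : row e₁ ≡ 1F ∷ 0F ∷ 0F ∷ []
      d₁ = trans (cong row (sym (vsolve (1F ⊙ x₀ ⊕ (0F ⊙ x₁ ⊕ (0F ⊙ x₂ ⊕ ∅))) x₀ (λ { (x ∷ y ∷ z ∷ []) → solve 3 (λ x y z → 𝟙 :* x :+ (𝟎 :* y :+ (𝟎 :* z :+ 𝟎)) := x) refl x y z }) E))) (dual _)
      d₂ : row e₂ ≡ 0F ∷ 1F ∷ 0F ∷ []
      d₂ = trans (cong row (sym (vsolve (0F ⊙ x₀ ⊕ (1F ⊙ x₁ ⊕ (0F ⊙ x₂ ⊕ ∅))) x₁ (λ { (x ∷ y ∷ z ∷ []) → solve 3 (λ x y z → 𝟎 :* x :+ (𝟙 :* y :+ (𝟎 :* z :+ 𝟎)) := y) refl x y z }) E))) (dual _)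
      d₃ : row e₃ ≡ 0F ∷ 0F ∷ 1F ∷ []
      d₃ = trans (cong row (sym (vsolve (0F ⊙ x₀ ⊕ (0F ⊙ x₁ ⊕ (1F ⊙ x₂ ⊕ ∅))) x₂ (λ { (x ∷ y ∷ z ∷ []) → solve 3 (λ x y z → 𝟎 :* x :+ (𝟎 :* y :+ (𝟙 :* z :+ 𝟎)) := z) refl x y z }) E))) (dual _)
      nth₁ : ∀ {x y z x′ y′ z′ : 𝔽} → _≡_ {A = Vector 3} (x ∷ y ∷ z ∷ []) (x′ ∷ y′ ∷ z′ ∷ []) → x ≡ x′
      nth₁ refl = refl
      nth₂ : ∀ {x y z x′ y′ z′ : 𝔽} → _≡_ {A = Vector 3} (x ∷ y ∷ z ∷ []) (x′ ∷ y′ ∷ z′ ∷ []) → y ≡ y′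
      nth₂ refl = refl
      nth₃ : ∀ {x y z x′ y′ z′ : 𝔽} → _≡_ {A = Vector 3} (x ∷ y ∷ z ∷ []) (x′ ∷ y′ ∷ z′ ∷ []) → z ≡ z′
      nth₃ refl = refl
      cover : ∀ v → ap l₁ v ≢ 0F → ap l₂ v ≢ 0F → ap l₃ v ≢ 0F → f v ≡ 0F
      cover v n₁ n₂ n₃ with f v ≟F 0F
      ... | yes z = z
      ... | no n with cov v (λ { refl → n₁ (ap-zero l₁) }) n
      ...   | Fin.zero                  , z = ⊥-elim (n₁ z)
      ...   | Fin.suc Fin.zero          , z = ⊥-elim (n₂ z)
      ...   | Fin.suc (Fin.suc Fin.zero) , z = ⊥-elim (n₃ z)

    -- The scalar ξ singles out a fourth member K₂ = ξ K₁ of the pencil, on which f vanishes off the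
    -- axis. Lines there in axis directions have sum zero, which forces f to be constant on the
    -- axis.
    module ThreePencil (K₁ K₂ : Lin m) (E₁ E₂ : Vector m)
        (h₁₁ : ap K₁ E₁ ≡ 1F) (h₁₂ : ap K₁ E₂ ≡ 0F) (h₂₁ : ap K₂ E₁ ≡ 0F) (h₂₂ : ap K₂ E₂ ≡ 1F)
        (ξ : 𝔽) (ξ≢0 : ξ ≢ 0F) (ξ≢1 : ξ ≢ 1F)
        (cover : ∀ v → ap K₁ v ≢ 0F → ap K₂ v ≢ 0F → ap K₁ v ≢ ap K₂ v → f v ≡ 0F) where

      Axis : Vector m → Set
      Axis y = ap K₁ y ≡ 0F × ap K₂ y ≡ 0F

      axis-line : ∀ {u v} t → Axis u → Axis v → Axis (u +V t ·V v)
      axis-line t (p , p′) (r , r′) = ap-line-zero K₁ p r , ap-line-zero K₂ p′ r′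

      axis-· : ∀ {y} t → Axis y → Axis (t ·V y)
      axis-· t (p , p′) = trans (ap-· K₁ t _) (⊠-zero p) , trans (ap-· K₂ t _) (⊠-zero p′)

      axis-+ : ∀ {u v} → Axis u → Axis v → Axis (u +V v)
      axis-+ {u} {v} p r = subst (λ w → Axis (u +V w)) (1·V v) (axis-line 1F p r)

      axis-0 : Axis zeroV
      axis-0 = ap-zero K₁ , ap-zero K₂

      f₀ g₀ h₀ : 𝔽
      f₀ = f E₂
      g₀ = f E₁
      h₀ = f (E₁ +V E₂)

      φ : Vector m → 𝔽
      φ y = f (E₂ +V y) ⊞ ⊟ f₀

      private
        val₁ : ∀ b c {y} → ap K₁ y ≡ 0F → ap K₁ (b ·V E₁ +V c ·V E₂ +V y) ≡ b
        val₁ b c {y} z = trans (ap-+ K₁ _ y) (trans (cong₂ _⊞_ (trans (ap-+ K₁ _ _) (cong₂ _⊞_ (trans (ap-· K₁ b E₁) (cong (b ⊠_) h₁₁)) (trans (ap-· K₁ c E₂) (cong (c ⊠_) h₁₂)))) z)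
          (solve 2 (λ b c → (b :* 𝟙 :+ c :* 𝟎) :+ 𝟎 := b) refl b c))

        val₂ : ∀ b c {y} → ap K₂ y ≡ 0F → ap K₂ (b ·V E₁ +V c ·V E₂ +V y) ≡ c
        val₂ b c {y} z = trans (ap-+ K₂ _ y) (trans (cong₂ _⊞_ (trans (ap-+ K₂ _ _) (cong₂ _⊞_ (trans (ap-· K₂ b E₁) (cong (b ⊠_) h₂₁)) (trans (ap-· K₂ c E₂) (cong (c ⊠_) h₂₂)))) z)
          (solve 2 (λ b c → (b :* 𝟎 :+ c :* 𝟙) :+ 𝟎 := c) refl b c))

        axis-value : ∀ y → Axis y → f y ≡ a
        axis-value y (z₁ , z₂) = sym (sub-zero⇒≡ a (f y) (trans (sym (line-sum (1F ·V E₁ +V ξ ·V E₂ +V zeroV) y))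
          (S.∑-zero elems (λ t → trans (cong f (vsolve (x₀ ⊕ x₁ ⊕ ∅ ⊕ t ⊙ x₂) (x₀ ⊕ x₁ ⊕ t ⊙ x₂) (λ { (x ∷ x′ ∷ y ∷ []) → solve 4 (λ x x′ y t → x :+ x′ :+ 𝟎 :+ t :* y := x :+ x′ :+ t :* y) refl x x′ y t }) (1F ·V E₁ ∷ ξ ·V E₂ ∷ y ∷ [])))
            (cover (1F ·V E₁ +V ξ ·V E₂ +V t ·V y) (λ e → 1≢0 (trans (sym (p₁ t)) e)) (λ e → ξ≢0 (trans (sym (p₂ t)) e)) (λ e → ξ≢1 (trans (sym (p₂ t)) (trans (sym e) (p₁ t)))))))))
          where
          p₁ : ∀ t → ap K₁ (1F ·V E₁ +V ξ ·V E₂ +V t ·V y) ≡ 1F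
          p₁ t = val₁ 1F ξ (proj₁ (axis-· t (z₁ , z₂)))
          p₂ : ∀ t → ap K₂ (1F ·V E₁ +V ξ ·V E₂ +V t ·V y) ≡ ξ
          p₂ t = val₂ 1F ξ (proj₂ (axis-· t (z₁ , z₂)))

        -- The line through E₂ + y with direction E₁ + y′ meets the three hyperplanes only at t = 0,
        -- at t = 1 and in its direction. Its line sum is the functional equation that governs φ.
        three-sum : ∀ y y′ → Axis y → Axis y′ → f (E₂ +V y) ⊞ (f (E₁ +V y′) ⊞ f (E₁ +V E₂ +V (y +V y′))) ≡ a
        three-sum y y′ z z′ = trans (cong (f (E₂ +V y) ⊞_) (+-comm _ _)) (trans (sym (+-assoc _ _ _)) (trans (cong (_⊞ f (E₁ +V y′)) two) (solve 2 (λ a b → (a :+ :- b) :+ b := a) refl a (f (E₁ +V y′)))))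
          where
          pt : 𝔽 → Vector m
          pt t = E₂ +V y +V t ·V (E₁ +V y′)
          shape : ∀ t → pt t ≡ t ·V E₁ +V 1F ·V E₂ +V (y +V t ·V y′)
          shape t = vsolve (x₁ ⊕ x₂ ⊕ t ⊙ (x₀ ⊕ x₃)) (t ⊙ x₀ ⊕ 1F ⊙ x₁ ⊕ (x₂ ⊕ t ⊙ x₃)) (λ { (e₁ ∷ e₂ ∷ y ∷ y′ ∷ []) → solve 5 (λ t e₁ e₂ y y′ → e₂ :+ y :+ t :* (e₁ :+ y′) := t :* e₁ :+ 𝟙 :* e₂ :+ (y :+ t :* y′)) refl t e₁ e₂ y y′ }) (E₁ ∷ E₂ ∷ y ∷ y′ ∷ [])
          vanish : ∀ t → t ≢ 0F → t ≢ 1F → f (pt t) ≡ 0F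
          vanish t t≢0 t≢1 = cover (pt t) (t≢0 ∘ trans (sym q₁)) (1≢0 ∘ trans (sym q₂)) (λ e → t≢1 (trans (sym q₁) (trans e q₂)))
            where
            q₁ : ap K₁ (pt t) ≡ t
            q₁ = trans (cong (ap K₁) (shape t)) (val₁ t 1F (proj₁ (axis-line t z z′)))
            q₂ : ap K₂ (pt t) ≡ 1F
            q₂ = trans (cong (ap K₂) (shape t)) (val₂ t 1F (proj₂ (axis-line t z z′)))
          at-1 : pt 1F ≡ E₁ +V E₂ +V (y +V y′)
          at-1 = vsolve (x₁ ⊕ x₂ ⊕ 1F ⊙ (x₀ ⊕ x₃)) (x₀ ⊕ x₁ ⊕ (x₂ ⊕ x₃)) (λ { (e₁ ∷ e₂ ∷ y ∷ y′ ∷ []) → solve 4 (λ e₁ e₂ y y′ → e₂ :+ y :+ 𝟙 :* (e₁ :+ y′) := e₁ :+ e₂ :+ (y :+ y′)) refl e₁ e₂ y y′ }) (E₁ ∷ E₂ ∷ y ∷ y′ ∷ [])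
          two : f (E₂ +V y) ⊞ f (E₁ +V E₂ +V (y +V y′)) ≡ a ⊞ ⊟ f (E₁ +V y′)
          two = trans (cong (f (E₂ +V y) ⊞_) (sym (trans sum⁺ (cong f at-1)))) (line-sum⁺ (E₂ +V y) (E₁ +V y′))
            where
            sum⁺ : S.∑ elems⁺ (λ t → f (pt t)) ≡ f (pt 1F)
            sum⁺ = S.∑-single∈ 1F (λ t → f (pt t)) elems⁺-unique (elems⁺-complete 1≢0) (λ {t} t∈ → vanish t (elems⁺-nonzero t∈))

        +V-0 : ∀ {k} (v : Vector k) → v +V zeroV ≡ v
        +V-0 = +V-identityʳ

        total : f₀ ⊞ (g₀ ⊞ h₀) ≡ a
        total = trans (cong₂ _⊞_ (cong f (sym (+V-0 E₂))) (cong₂ _⊞_ (cong f (sym (+V-0 E₁))) (cong f (sym (trans (cong (E₁ +V E₂ +V_) (+V-0 zeroV)) (+V-0 _)))))) (three-sum zeroV zeroV axis-0 axis-0)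

      first-value : ∀ y → f (E₂ +V y) ≡ f₀ ⊞ φ y
      first-value y = solve 2 (λ x y → x := y :+ (x :+ :- y)) refl (f (E₂ +V y)) f₀

      -- With y′ = 0 the functional equation ties the third hyperplane to the first; with y = 0 it
      -- ties the second to the third. One function φ thus describes the word on all three.
      third-value : ∀ y → Axis y → f (E₁ +V E₂ +V y) ≡ h₀ ⊞ ⊟ φ y
      third-value y z = trans (solve 3 (λ x g h → h := (x :+ (g :+ h)) :+ :- (x :+ g)) refl (f (E₂ +V y)) g₀ (f (E₁ +V E₂ +V y)))
        (trans (cong (_⊞ ⊟ (f (E₂ +V y) ⊞ g₀)) (trans (cong (f (E₂ +V y) ⊞_) (cong₂ _⊞_ (cong f (sym (+V-0 E₁))) (cong (λ w → f (E₁ +V E₂ +V w)) (sym (+V-0 y))))) (trans (three-sum y zeroV z axis-0) (sym total))))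
          (solve 4 (λ x f g h → (f :+ (g :+ h)) :+ :- (x :+ g) := h :+ :- (x :+ :- f)) refl (f (E₂ +V y)) f₀ g₀ h₀))

      second-value : ∀ y → Axis y → f (E₁ +V y) ≡ g₀ ⊞ φ y
      second-value y z = trans (solve 3 (λ x g h → g := (x :+ (g :+ h)) :+ :- (x :+ h)) refl f₀ (f (E₁ +V y)) (f (E₁ +V E₂ +V y)))
        (trans (cong₂ (λ u w → u ⊞ ⊟ (f₀ ⊞ w)) (trans (cong₂ _⊞_ (cong f (sym (+V-0 E₂))) (cong (f (E₁ +V y) ⊞_) (cong (λ w → f (E₁ +V E₂ +V w)) (sym (+V-identityˡ y))))) (trans (three-sum zeroV y axis-0 z) (sym total))) (third-value y z))
          (solve 4 (λ p f g h → (f :+ (g :+ h)) :+ :- (f :+ (h :+ :- p)) := g :+ p) refl (φ y) f₀ g₀ h₀))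

      -- In the functional equation the constants add up to f(0), and the deviations φ(y), φ(y′) and
      -- -φ(y + y′) must cancel.
      φ-+ : ∀ y y′ → Axis y → Axis y′ → φ (y +V y′) ≡ φ y ⊞ φ y′
      φ-+ y y′ z z′ = trans (solve 3 (λ p h s → p := h :+ :- (h :+ :- p)) refl (φ (y +V y′)) h₀ a) (trans (cong (λ w → h₀ ⊞ ⊟ w) (sym (third-value (y +V y′) (axis-+ z z′))))
        (trans (solve 4 (λ h x g t → h :+ :- t := h :+ (x :+ g) :+ :- (x :+ (g :+ t))) refl h₀ (f (E₂ +V y)) (f (E₁ +V y′)) (f (E₁ +V E₂ +V (y +V y′))))
          (trans (cong₂ (λ u w → h₀ ⊞ u ⊞ ⊟ w) (cong₂ _⊞_ (first-value y) (second-value y′ z′)) (trans (three-sum y y′ z z′) (sym total)))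
            (solve 5 (λ f g h p r → h :+ ((f :+ p) :+ (g :+ r)) :+ :- (f :+ (g :+ h)) := p :+ r) refl f₀ g₀ h₀ (φ y) (φ y′)))))

      -- Additivity of φ does not make it linear over F. Homogeneity is supplied where φ is zero, or
      -- where the field turns out to be prime.
      module Linear (φ-· : ∀ s y → Axis y → φ (s ·V y) ≡ s ⊠ φ y) where

        res : Vector m → Vector m
        res v = v +V (⊟ ap K₁ v) ·V E₁ +V (⊟ ap K₂ v) ·V E₂

        res-axis : ∀ v → Axis (res v)
        res-axis v =
          trans (ap-line K₁ _ _ E₂) (trans (cong₂ (λ x y → x ⊞ (⊟ ap K₂ v) ⊠ y) (trans (ap-line K₁ v _ E₁) (cong (λ y → ap K₁ v ⊞ (⊟ ap K₁ v) ⊠ y) h₁₁)) h₁₂)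
            (solve 2 (λ x y → (x :+ (:- x) :* 𝟙) :+ (:- y) :* 𝟎 := 𝟎) refl (ap K₁ v) (ap K₂ v))) ,
          trans (ap-line K₂ _ _ E₂) (trans (cong₂ (λ x y → x ⊞ (⊟ ap K₂ v) ⊠ y) (trans (ap-line K₂ v _ E₁) (cong (λ y → ap K₂ v ⊞ (⊟ ap K₁ v) ⊠ y) h₂₁)) h₂₂)
            (solve 2 (λ x y → (y :+ (:- x) :* 𝟎) :+ (:- y) :* 𝟙 := 𝟎) refl (ap K₁ v) (ap K₂ v)))

        private
          scalar-sum : ∀ p r (e : Vector m) → (⊟ (p ⊞ r)) ·V e ≡ (⊟ p) ·V e +V (⊟ r) ·V e
          scalar-sum p r e = vsolve ((⊟ (p ⊞ r)) ⊙ x₀) ((⊟ p) ⊙ x₀ ⊕ (⊟ r) ⊙ x₀) (λ { (x ∷ []) → solve 3 (λ p r x → (:- (p :+ r)) :* x := (:- p) :* x :+ (:- r) :* x) refl p r x }) (e ∷ [])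

          shuffle : ∀ (u v p r : Vector m) → u +V v +V (p +V r) ≡ (u +V p) +V (v +V r)
          shuffle u v p r = vsolve (x₀ ⊕ x₁ ⊕ (x₂ ⊕ x₃)) ((x₀ ⊕ x₂) ⊕ (x₁ ⊕ x₃)) (λ { (x ∷ y ∷ z ∷ w ∷ []) → solve 4 (λ x y z w → x :+ y :+ (z :+ w) := (x :+ z) :+ (y :+ w)) refl x y z w }) (u ∷ v ∷ p ∷ r ∷ [])

          res-sum : ∀ u v p r s t → u +V v +V (⊟ (p ⊞ r)) ·V E₁ +V (⊟ (s ⊞ t)) ·V E₂ ≡ (u +V (⊟ p) ·V E₁ +V (⊟ s) ·V E₂) +V (v +V (⊟ r) ·V E₁ +V (⊟ t) ·V E₂)
          res-sum u v p r s t = trans (cong₂ _+V_ (trans (cong (u +V v +V_) (scalar-sum p r E₁)) (shuffle u v _ _)) (scalar-sum s t E₂)) (shuffle _ _ _ _)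

        l : Lin m
        l = record
          { ap   = λ v → φ (res v)
          ; ap-+ = λ u v → trans (cong φ (trans (cong₂ (λ x y → u +V v +V (⊟ x) ·V E₁ +V (⊟ y) ·V E₂) (ap-+ K₁ u v) (ap-+ K₂ u v))
              (res-sum u v (ap K₁ u) (ap K₁ v) (ap K₂ u) (ap K₂ v)))) (φ-+ (res u) (res v) (res-axis u) (res-axis v))
          ; ap-· = λ t v → trans (cong φ (trans (cong₂ (λ x y → t ·V v +V (⊟ x) ·V E₁ +V (⊟ y) ·V E₂) (ap-· K₁ t v) (ap-· K₂ t v))
              (vsolve (t ⊙ x₀ ⊕ (⊟ (t ⊠ ap K₁ v)) ⊙ x₁ ⊕ (⊟ (t ⊠ ap K₂ v)) ⊙ x₂) (t ⊙ (x₀ ⊕ (⊟ ap K₁ v) ⊙ x₁ ⊕ (⊟ ap K₂ v) ⊙ x₂))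
                (λ { (x ∷ e ∷ e′ ∷ []) → solve 6 (λ t p s x e e′ → t :* x :+ (:- (t :* p)) :* e :+ (:- (t :* s)) :* e′ := t :* (x :+ (:- p) :* e :+ (:- s) :* e′)) refl t (ap K₁ v) (ap K₂ v) x e e′ })
                (v ∷ E₁ ∷ E₂ ∷ [])))) (φ-· t (res v) (res-axis v))
          }

        l-axis : ∀ y → Axis y → ap l y ≡ φ y
        l-axis y (z₁ , z₂) = cong φ (trans (cong₂ (λ b c → y +V (⊟ b) ·V E₁ +V (⊟ c) ·V E₂) z₁ z₂)
          (vsolve (x₀ ⊕ (⊟ 0F) ⊙ x₁ ⊕ (⊟ 0F) ⊙ x₂) x₀ (λ { (x ∷ y ∷ z ∷ []) → solve 3 (λ x y z → x :+ (:- 𝟎) :* y :+ (:- 𝟎) :* z := x) refl x y z }) (y ∷ E₁ ∷ E₂ ∷ [])))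

        private
          rebuild : ∀ v → v ≡ ap K₁ v ·V E₁ +V ap K₂ v ·V E₂ +V res v
          rebuild v = vsolve x₀ (ap K₁ v ⊙ x₁ ⊕ ap K₂ v ⊙ x₂ ⊕ (x₀ ⊕ (⊟ ap K₁ v) ⊙ x₁ ⊕ (⊟ ap K₂ v) ⊙ x₂))
            (λ { (x ∷ e ∷ e′ ∷ []) → solve 5 (λ p s x e e′ → x := p :* e :+ s :* e′ :+ (x :+ (:- p) :* e :+ (:- s) :* e′)) refl (ap K₁ v) (ap K₂ v) x e e′ }) (v ∷ E₁ ∷ E₂ ∷ [])

          normalised-to : ∀ v {s} → s ≢ 0F → ∀ w → v ≡ s ·V w → f v ≡ f w
          normalised-to v n w e = trans (cong f e) (scale w n)

          scaled : ∀ {s} → s ≢ 0F → ∀ v → φ (s ⁻¹ ·V res v) ≡ s ⁻¹ ⊠ ap l v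
          scaled {s} n v = φ-· (s ⁻¹) (res v) (res-axis v)

        -- Dividing v by its nonzero coordinate, which f does not notice, brings it to the form E₂ +
        -- y, E₁ + y or E₁ + E₂ + y with y on the axis.
        pencil-form : PencilForm f K₁ K₂ l f₀ g₀ h₀
        pencil-form = record
          { on-axis = λ v z₁ z₂ → trans (axis-value v (z₁ , z₂)) (sym total)
          ; on-first = λ v z₁ n₂ → trans (normalised-to v n₂ (E₂ +V ap K₂ v ⁻¹ ·V res v) (trans (rebuild v) (trans (cong (λ x → x ·V E₁ +V ap K₂ v ·V E₂ +V res v) z₁)
              (trans (cong (0F ·V E₁ +V ap K₂ v ·V E₂ +V_) (sym (·V-cancel′ n₂ (res v)))) (vsolve (0F ⊙ x₀ ⊕ ap K₂ v ⊙ x₁ ⊕ ap K₂ v ⊙ x₂) (ap K₂ v ⊙ (x₁ ⊕ x₂))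
                (λ { (e ∷ e′ ∷ x ∷ []) → solve 4 (λ s e e′ x → 𝟎 :* e :+ s :* e′ :+ s :* x := s :* (e′ :+ x)) refl (ap K₂ v) e e′ x }) (E₁ ∷ E₂ ∷ ap K₂ v ⁻¹ ·V res v ∷ []))))))
              (trans (first-value _) (cong (f₀ ⊞_) (scaled n₂ v)))
          ; on-second = λ v n₁ z₂ → trans (normalised-to v n₁ (E₁ +V ap K₁ v ⁻¹ ·V res v) (trans (rebuild v) (trans (cong (λ x → ap K₁ v ·V E₁ +V x ·V E₂ +V res v) z₂)
              (trans (cong (ap K₁ v ·V E₁ +V 0F ·V E₂ +V_) (sym (·V-cancel′ n₁ (res v)))) (vsolve (ap K₁ v ⊙ x₀ ⊕ 0F ⊙ x₁ ⊕ ap K₁ v ⊙ x₂) (ap K₁ v ⊙ (x₀ ⊕ x₂))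
                (λ { (e ∷ e′ ∷ x ∷ []) → solve 4 (λ s e e′ x → s :* e :+ 𝟎 :* e′ :+ s :* x := s :* (e :+ x)) refl (ap K₁ v) e e′ x }) (E₁ ∷ E₂ ∷ ap K₁ v ⁻¹ ·V res v ∷ []))))))
              (trans (second-value _ (axis-· _ (res-axis v))) (cong (g₀ ⊞_) (scaled n₁ v)))
          ; on-third = λ v n₁ e → trans (normalised-to v n₁ (E₁ +V E₂ +V ap K₁ v ⁻¹ ·V res v) (trans (rebuild v) (trans (cong (λ x → ap K₁ v ·V E₁ +V x ·V E₂ +V res v) (sym e))
              (trans (cong (ap K₁ v ·V E₁ +V ap K₁ v ·V E₂ +V_) (sym (·V-cancel′ n₁ (res v)))) (vsolve (ap K₁ v ⊙ x₀ ⊕ ap K₁ v ⊙ x₁ ⊕ ap K₁ v ⊙ x₂) (ap K₁ v ⊙ (x₀ ⊕ x₁ ⊕ x₂))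
                (λ { (e ∷ e′ ∷ x ∷ []) → solve 4 (λ s e e′ x → s :* e :+ s :* e′ :+ s :* x := s :* (e :+ e′ :+ x)) refl (ap K₁ v) e e′ x }) (E₁ ∷ E₂ ∷ ap K₁ v ⁻¹ ·V res v ∷ []))))))
              (trans (third-value _ (axis-· _ (res-axis v))) (cong (λ y → h₀ ⊞ ⊟ y) (scaled n₁ v)))
          ; off = cover
          }

      -- If φ vanishes, the word is constant on each of the three hyperplanes.
      flat : (∀ y → Axis y → φ y ≡ 0F) → Combination P f
      flat φ≡0 = record { k₁ = K₁ ; k₂ = K₂ ; k₃ = combine K₁ (⊟ 1F) K₂ ; λ₁ = f₀ ; λ₂ = g₀ ; λ₃ = h₀ ; λ₁∈ = P-val _ ; λ₂∈ = P-val _ ; λ₃∈ = P-val _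
        ; nonzero₁ = E₁ , 1≢0 ∘ trans (sym h₁₁) ; nonzero₂ = E₂ , 1≢0 ∘ trans (sym h₂₂)
        ; nonzero₃ = E₁ , 1≢0 ∘ trans (sym (trans (cong₂ (λ x y → x ⊞ (⊟ 1F) ⊠ y) h₁₁ h₂₁) (solve 0 (𝟙 :+ (:- 𝟙) :* 𝟎 := 𝟙) refl)))
        ; formula = formula }
        where
        open Linear (λ s y z → trans (φ≡0 _ (axis-· s z)) (sym (⊠-zero (φ≡0 y z))))
        open PencilForm pencil-form
        lv : ∀ v s → s ⊠ ap l v ≡ 0F
        lv v s = ⊠-zero (φ≡0 (res v) (res-axis v))
        diff : ∀ v → ap (combine K₁ (⊟ 1F) K₂) v ≡ ap K₁ v ⊞ ⊟ ap K₂ v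
        diff v = solve 2 (λ x y → x :+ (:- 𝟙) :* y := x :+ :- y) refl (ap K₁ v) (ap K₂ v)
        same : ∀ v → ap K₁ v ≡ ap K₂ v → ap (combine K₁ (⊟ 1F) K₂) v ≡ 0F
        same v e = trans (diff v) (trans (cong (_⊞ ⊟ ap K₂ v) e) (-‿inverseʳ _))
        differ : ∀ v → ap K₁ v ≢ ap K₂ v → ap (combine K₁ (⊟ 1F) K₂) v ≢ 0F
        differ v n e = n (sub-zero⇒≡ _ _ (trans (sym (diff v)) e))
        formula : ∀ v → f v ≡ f₀ ⊠ δ (ap K₁ v) ⊞ (g₀ ⊠ δ (ap K₂ v) ⊞ h₀ ⊠ δ (ap (combine K₁ (⊟ 1F) K₂) v))
        formula v with ap K₁ v ≟F 0F | ap K₂ v ≟F 0F | ap K₁ v ≟F ap K₂ v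
        ... | yes z₁ | yes z₂ | _     = trans (on-axis v z₁ z₂) (sym (trans (cong (λ d → f₀ ⊠ 1F ⊞ (g₀ ⊠ 1F ⊞ h₀ ⊠ d)) (δ-yes (same v (trans z₁ (sym z₂))))) (solve 3 (λ f g h → f :* 𝟙 :+ (g :* 𝟙 :+ h :* 𝟙) := f :+ (g :+ h)) refl f₀ g₀ h₀)))
        ... | yes z₁ | no n₂  | _     = trans (on-first v z₁ n₂) (trans (cong (f₀ ⊞_) (lv v _)) (sym (trans (cong (λ d → f₀ ⊠ 1F ⊞ (g₀ ⊠ 0F ⊞ h₀ ⊠ d)) (δ-no (differ v (λ e → n₂ (trans (sym e) z₁))))) (solve 3 (λ f g h → f :* 𝟙 :+ (g :* 𝟎 :+ h :* 𝟎) := f :+ 𝟎) refl f₀ g₀ h₀))))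
        ... | no n₁  | yes z₂ | _     = trans (on-second v n₁ z₂) (trans (cong (g₀ ⊞_) (lv v _)) (sym (trans (cong (λ d → f₀ ⊠ 0F ⊞ (g₀ ⊠ 1F ⊞ h₀ ⊠ d)) (δ-no (differ v (λ e → n₁ (trans e z₂))))) (solve 3 (λ f g h → f :* 𝟎 :+ (g :* 𝟙 :+ h :* 𝟎) := g :+ 𝟎) refl f₀ g₀ h₀))))
        ... | no n₁  | no n₂  | yes e = trans (on-third v n₁ e) (trans (cong (λ y → h₀ ⊞ ⊟ y) (lv v _)) (sym (trans (cong (λ d → f₀ ⊠ 0F ⊞ (g₀ ⊠ 0F ⊞ h₀ ⊠ d)) (δ-yes (same v e))) (solve 3 (λ f g h → f :* 𝟎 :+ (g :* 𝟎 :+ h :* 𝟙) := h :+ :- 𝟎) refl f₀ g₀ h₀))))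
        ... | no n₁  | no n₂  | no n  = trans (off v n₁ n₂ n) (sym (trans (cong (λ d → f₀ ⊠ 0F ⊞ (g₀ ⊠ 0F ⊞ h₀ ⊠ d)) (δ-no (differ v n))) (solve 3 (λ f g h → f :* 𝟎 :+ (g :* 𝟎 :+ h :* 𝟎) := 𝟎) refl f₀ g₀ h₀)))

-- The prime field and additive maps into it

module PrimeField (F : FiniteField) (p : ℕ) (pr : Prime p) (char : FiniteField.ι F p ≡ FiniteField.0# F) where
  open Shapes F public
  open Solver using (solve; _:=_; _:+_; _:*_; :-_; 𝟎; 𝟙)
  open import Data.Nat.Primality using (prime⇒nonTrivial; prime⇒nonZero)
  open import Data.Nat.Coprimality using (prime⇒coprime; coprime-Bézout)
  open import Data.Nat.GCD using (module Bézout)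
  open import Data.Nat.DivMod using (_/_; _%_; m≡m%n+[m/n]*n; m%n<n)
  open import Data.List.Membership.Propositional.Properties using (∈-upTo⁺; ∈-upTo⁻)

  private instance
    p-nonZero : NonZero p
    p-nonZero = prime⇒nonZero pr

  ι-*p : ∀ k → ι (k * p) ≡ 0F
  ι-*p k = trans (ι-* k p) (⊠-zero char)

  -- As d is prime to p, a Bézout relation would write 1 in terms of ι p and ι d, both of which
  -- would be zero.
  ι-nonzero : ∀ {d} → 0 < d → d < p → ι d ≢ 0F
  ι-nonzero {suc d} _ d<p e = bézout (coprime-Bézout (prime⇒coprime pr d<p))
    where
    open Bézout
    ι-*d : ∀ k → ι (k * suc d) ≡ 0F
    ι-*d k = trans (ι-* k (suc d)) (⊠-zero e)
    bézout : Identity 1 p (suc d) → ⊥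
    bézout (+- x y eq) = 1≢0 (trans (sym (trans (cong (1F ⊞_) (ι-*d y)) (+-identityʳ 1F))) (trans (cong ι eq) (ι-*p x)))
    bézout (-+ x y eq) = 1≢0 (trans (sym (trans (cong (1F ⊞_) (ι-*p x)) (+-identityʳ 1F))) (trans (cong ι eq) (ι-*d y)))

  ι-injective : ∀ {a b} → a < p → b < p → ι a ≡ ι b → a ≡ b
  ι-injective {a} {b} a<p b<p e with ℕ.<-cmp a b
  ... | tri≈ _ eq _ = eq
  ... | tri< lt _ _ = ⊥-elim (ι-nonzero (ℕ.m<n⇒0<n∸m lt) (ℕ.≤-trans (s≤s (ℕ.m∸n≤m b a)) b<p)
          (⊞-cancelˡ (ι a) (trans (sym (ι-+ a (b ∸ a))) (trans (cong ι (ℕ.m+[n∸m]≡n (ℕ.<⇒≤ lt))) (trans (sym e) (sym (+-identityʳ _)))))))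
  ... | tri> _ _ gt = ⊥-elim (ι-nonzero (ℕ.m<n⇒0<n∸m gt) (ℕ.≤-trans (s≤s (ℕ.m∸n≤m a b)) a<p)
          (⊞-cancelˡ (ι b) (trans (sym (ι-+ b (a ∸ b))) (trans (cong ι (ℕ.m+[n∸m]≡n (ℕ.<⇒≤ gt))) (trans e (sym (+-identityʳ _)))))))

  Prime𝔽 : 𝔽 → Set
  Prime𝔽 x = ∃ λ k → k < p × x ≡ ι k

  ι-prime : ∀ k → Prime𝔽 (ι k)
  ι-prime k = k % p , m%n<n k p , trans (cong ι (m≡m%n+[m/n]*n k p)) (trans (ι-+ (k % p) _) (trans (cong (ι (k % p) ⊞_) (ι-*p (k / p))) (+-identityʳ _)))

  prime-+ : ∀ {x y} → Prime𝔽 x → Prime𝔽 y → Prime𝔽 (x ⊞ y)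
  prime-+ (a , _ , refl) (b , _ , refl) = subst Prime𝔽 (ι-+ a b) (ι-prime (a + b))

  prime-sub : ∀ {x y} → Prime𝔽 x → Prime𝔽 y → Prime𝔽 (x ⊞ ⊟ y)
  prime-sub (a , _ , refl) (b , b<p , refl) = subst Prime𝔽 eq (ι-prime (a + (p ∸ b)))
    where
    eq : ι (a + (p ∸ b)) ≡ ι a ⊞ ⊟ ι b
    eq = trans (ι-+ a (p ∸ b)) (cong (ι a ⊞_) (⊞-cancelˡ (ι b) (trans (sym (ι-+ b (p ∸ b))) (trans (cong ι (ℕ.m+[n∸m]≡n (ℕ.<⇒≤ b<p))) (trans char (sym (-‿inverseʳ (ι b))))))))

  multiples : List 𝔽
  multiples = map ι (upTo p)

  multiples-∈ : ∀ {x} → Prime𝔽 x → x ∈ multiples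
  multiples-∈ (k , k<p , refl) = ∈-map⁺ ι (∈-upTo⁺ k<p)

  map-unique : {A B : Set} (f : A → B) (xs : List A) → Unique xs → (∀ {x y} → x ∈ xs → y ∈ xs → f x ≡ f y → x ≡ y) → Unique (map f xs)
  map-unique f []       _        _   = []
  map-unique f (x ∷ xs) (px ∷ u) inj = All.map⁺ (All.tabulate (λ y∈ e → All.lookup px y∈ (inj (here refl) (there y∈) e))) ∷ map-unique f xs u (λ x∈ y∈ → inj (there x∈) (there y∈))

  upTo-unique : Unique (upTo p)
  upTo-unique = Unique.upTo⁺ p

  multiples-unique : Unique multiples
  multiples-unique = map-unique ι (upTo p) upTo-unique (λ a∈ b∈ → ι-injective (∈-upTo⁻ a∈) (∈-upTo⁻ b∈))

  multiples-length : length multiples ≡ p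
  multiples-length = trans (List.length-map ι (upTo p)) (List.length-upTo p)

  p≤q : p ≤ q
  p≤q = ℕ.≤-trans (ℕ.≤-reflexive (sym multiples-length)) (unique-⊆-length multiples-unique (λ {x} _ → elems-complete x))

  -- The p multiples of 1 are distinct and already fill a field with at most p elements.
  q≤p⇒prime : q ≤ p → ∀ x → Prime𝔽 x
  q≤p⇒prime q≤p x with Any.any? (x ≟F_) multiples
  ... | yes x∈ with ∈-map⁻ ι x∈
  ...   | k , k∈ , e = k , ∈-upTo⁻ k∈ , e
  q≤p⇒prime q≤p x | no x∉ = ⊥-elim (ℕ.<⇒≱ (ℕ.≤-trans (s≤s (ℕ.≤-reflexive (sym multiples-length))) (ℕ.≤-trans
    (unique-⊆-length (All.tabulate (λ y∈ e → x∉ (subst (_∈ multiples) (sym e) y∈)) ∷ multiples-unique) (λ {y} _ → elems-complete y)) q≤p)) ℕ.≤-refl)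

  -- An additive map into the prime field is injective or has large fibres; the latter is excluded by hypothesis.
  module Additive (26≤q : 26 ≤ q) (ψ : 𝔽 → 𝔽) (ψ-+ : ∀ s t → ψ (s ⊞ t) ≡ ψ s ⊞ ψ t) (ψ∈ : ∀ s → Prime𝔽 (ψ s)) (ψ1 : ψ 1F ≢ 0F)
      (dichotomy : N.∑ elems (λ t → nz (ψ t)) ≤ 3 ⊎ q ≤ N.∑ elems (λ t → nz (ψ t)) + 3) where

    private
      A B : ℕ
      A = N.∑ elems (λ t → nz (ψ t))
      B = N.∑ elems (λ t → zz (ψ t))

      A+B : A + B ≡ q
      A+B = trans (sym (N.∑-∙ elems _ _)) (trans (N.∑-cong elems (λ t → nz+zz (ψ t))) (trans (N.∑-const elems 1) (ℕ.*-identityʳ q)))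

      -- Translation by 1 carries zeros of ψ to places where ψ has the nonzero value ψ(1).
      B≤A : B ≤ A
      B≤A = ℕ.≤-trans (N.∑-mono elems pointwise) (ℕ.≤-reflexive (N∑-translate 1F (λ t → nz (ψ t))))
        where
        pointwise : ∀ t → zz (ψ t) ≤ nz (ψ (1F ⊞ t))
        pointwise t = zero-or-not (ψ t) (λ n → ℕ.≤-trans (ℕ.≤-reflexive (zz-no n)) z≤n)
          (λ z → ℕ.≤-reflexive (trans (zz-yes z) (sym (nz-no (λ e → ψ1 (trans (sym (trans (ψ-+ 1F t) (trans (cong (ψ 1F ⊞_) z) (+-identityʳ _)))) e))))))

      -- Few nonzero values mean few zeros by `B≤A`, so both sides of the dichotomy bound the
      -- kernel.
      B≤3 : B ≤ 3
      B≤3 = decide dichotomy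
        where
        decide : A ≤ 3 ⊎ q ≤ A + 3 → B ≤ 3
        decide (inj₂ le) = ℕ.+-cancelˡ-≤ A _ _ (ℕ.≤-trans (ℕ.≤-reflexive A+B) le)
        decide (inj₁ le) = ℕ.≤-trans B≤A le

      -- A nonempty fibre is a translate of the kernel.
      fibre : ∀ c → N.∑ elems (λ t → zz (ψ t ⊞ ⊟ c)) ≤ B
      fibre c = decide (Any.any? (λ t → ψ t ≟F c) elems)
        where
        decide : Dec (Any (λ t → ψ t ≡ c) elems) → N.∑ elems (λ t → zz (ψ t ⊞ ⊟ c)) ≤ B
        decide (no none) = ℕ.≤-trans (ℕ.≤-reflexive (N.∑-zero elems (λ t → zz-no (λ e → none (lose (elems-complete t) (sub-zero⇒≡ _ _ e)))))) z≤n
        decide (yes any) = let t₀ , _ , e = find any in ℕ.≤-reflexive (trans (sym (N∑-translate t₀ (λ t → zz (ψ t ⊞ ⊟ c))))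
          (N.∑-cong elems (λ t → cong zz (trans (cong (_⊞ ⊟ c) (trans (ψ-+ t₀ t) (cong (_⊞ ψ t) e))) (solve 2 (λ c x → (c :+ x) :+ :- c := x) refl c (ψ t))))))

      q≤pB : q ≤ p * B
      q≤pB = begin
        q                                                                  ≡⟨ sym (trans (N.∑-const elems 1) (ℕ.*-identityʳ q)) ⟩
        N.∑ elems (λ t → 1)                                                ≤⟨ N.∑-mono elems (λ t → hit (ψ t) (ψ∈ t)) ⟩
        N.∑ elems (λ t → N.∑ (upTo p) (λ k → zz (ψ t ⊞ ⊟ ι k)))            ≡⟨ N.∑-swap elems (upTo p) _ ⟩
        N.∑ (upTo p) (λ k → N.∑ elems (λ t → zz (ψ t ⊞ ⊟ ι k)))            ≤⟨ N.∑-mono (upTo p) (λ k → fibre (ι k)) ⟩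
        N.∑ (upTo p) (λ k → B)                                             ≡⟨ trans (N.∑-const (upTo p) B) (cong (_* B) (List.length-upTo p)) ⟩
        p * B                                                              ∎
        where
        open ℕ.≤-Reasoning
        hit : ∀ x → Prime𝔽 x → 1 ≤ N.∑ (upTo p) (λ k → zz (x ⊞ ⊟ ι k))
        hit x (k , k<p , e) = ℕ.≤-trans (ℕ.≤-reflexive (sym (zz-yes (trans (cong (_⊞ ⊟ ι k) e) (-‿inverseʳ _))))) (N.∑-member (λ k → zz (x ⊞ ⊟ ι k)) (∈-upTo⁺ k<p))

      ψ-ι : ∀ k t → ψ (ι k ⊠ t) ≡ ι k ⊠ ψ t
      ψ-ι zero    t = trans (cong ψ (zeroˡ t)) (trans ψ0 (sym (zeroˡ _)))
        where
        ψ0 : ψ 0F ≡ 0F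
        ψ0 = ⊞-cancelˡ (ψ 0F) (trans (sym (ψ-+ 0F 0F)) (trans (cong ψ (+-identityˡ 0F)) (sym (+-identityʳ _))))
      ψ-ι (suc k) t = trans (cong ψ (trans (distribʳ t 1F (ι k)) (cong (_⊞ ι k ⊠ t) (*-identityˡ t)))) (trans (ψ-+ t (ι k ⊠ t))
        (trans (cong (ψ t ⊞_) (ψ-ι k t)) (solve 2 (λ x k → x :+ k :* x := (𝟙 :+ k) :* x) refl (ψ t) (ι k))))

      zero-multiples : ∀ t → t ≢ 0F → ψ t ≡ 0F → p ≤ B
      zero-multiples t t≢0 z = ℕ.≤-trans (ℕ.≤-reflexive (sym (trans (List.length-map (λ k → ι k ⊠ t) (upTo p)) (List.length-upTo p))))
        (ℕ.≤-trans (unique-⊆-length (map-unique (λ k → ι k ⊠ t) (upTo p) upTo-unique inj) inside) (ℕ.≤-reflexive (zeros elems)))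
        where
        inj : ∀ {a b} → a ∈ upTo p → b ∈ upTo p → ι a ⊠ t ≡ ι b ⊠ t → a ≡ b
        inj {a} {b} a∈ b∈ e = ι-injective (∈-upTo⁻ a∈) (∈-upTo⁻ b∈) (sub-zero⇒≡ _ _ (⊠-integral t≢0
          (trans (solve 3 (λ a b t → t :* (a :+ :- b) := a :* t :+ :- (b :* t)) refl (ι a) (ι b) t) (trans (cong (_⊞ ⊟ (ι b ⊠ t)) e) (-‿inverseʳ _)))))
        inside : ∀ {x} → x ∈ map (λ k → ι k ⊠ t) (upTo p) → x ∈ filter (λ t → ψ t ≟F 0F) elems
        inside x∈ = let k , _ , e = ∈-map⁻ (λ k → ι k ⊠ t) x∈ in
          ∈-filter⁺ (λ t → ψ t ≟F 0F) (elems-complete _) (trans (cong ψ e) (trans (ψ-ι k t) (⊠-zero z)))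
        zeros : ∀ xs → length (filter (λ t → ψ t ≟F 0F) xs) ≡ N.∑ xs (λ t → zz (ψ t))
        zeros []       = refl
        zeros (x ∷ xs) with ψ x ≟F 0F
        ... | yes _ = cong suc (zeros xs)
        ... | no _  = zeros xs

      -- The p multiples of a nonzero kernel element lie in the kernel, so p ≤ B ≤ 3 and q ≤ p B ≤
      -- 9.
      kernel-trivial : ∀ t → ψ t ≡ 0F → t ≡ 0F
      kernel-trivial t z = zero-or-not t (λ t≢0 → ⊥-elim (too-small (zero-multiples t t≢0 z))) id
        where
        too-small : p ≤ B → ⊥
        too-small p≤B = ℕ.<⇒≱ (ℕ.≤-trans (ℕ.m≤m+n 10 16) 26≤q) (ℕ.≤-trans q≤pB (ℕ.*-mono-≤ (ℕ.≤-trans p≤B B≤3) B≤3))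

    q≡p : q ≡ p
    q≡p = ℕ.≤-antisym (ℕ.≤-trans (ℕ.≤-trans (ℕ.≤-reflexive (sym (List.length-map ψ elems))) (unique-⊆-length (map-unique ψ elems elems-unique (λ {s} {t} _ _ → injective s t)) inside)) (ℕ.≤-reflexive multiples-length)) p≤q
      where
      injective : ∀ s t → ψ s ≡ ψ t → s ≡ t
      injective s t e = sub-zero⇒≡ s t (kernel-trivial (s ⊞ ⊟ t) (⊞-cancelˡ (ψ t) (trans (sym (ψ-+ t (s ⊞ ⊟ t))) (trans (cong ψ (solve 2 (λ s t → t :+ (s :+ :- t) := s) refl s t)) (trans e (sym (+-identityʳ _)))))))
      inside : ∀ {x} → x ∈ map ψ elems → x ∈ multiples
      inside x∈ = let t , _ , e = ∈-map⁻ ψ x∈ in subst (_∈ multiples) (sym e) (multiples-∈ (ψ∈ t))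

    all-prime : ∀ x → Prime𝔽 x
    all-prime = q≤p⇒prime (ℕ.≤-reflexive q≡p)

  -- The functional l, which extends φ from the axis, completes K₁ and K₂ to coordinates of a plane;
  -- the dual vectors witness its independence from them.
  record OddForm {m} (f : Vector m → 𝔽) : Set where
    field
      q≡p      : q ≡ p
      K₁ K₂ l  : Lin m
      f₀ g₀ h₀ : 𝔽
      f₀∈      : Prime𝔽 f₀
      g₀∈      : Prime𝔽 g₀
      h₀∈      : Prime𝔽 h₀
      form     : PencilForm f K₁ K₂ l f₀ g₀ h₀
      E₁ E₂ E₃ : Vector m
      dual     : ∀ a → coords (K₁ ∷ K₂ ∷ l ∷ []) (lincomb a (E₁ ∷ E₂ ∷ E₃ ∷ [])) ≡ a

-- Classification by the position of the hyperplanes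

module Classification (F : FiniteField) (p : ℕ) (pr : Prime p) (char : FiniteField.ι F p ≡ FiniteField.0# F) where
  open PrimeField F p pr char public
  open Solver using (solve; _:=_; _:+_; _:*_; :-_; 𝟎; 𝟙)

  prime-val : ∀ {m} (L : Code m) → All (λ lk → Prime𝔽 (proj₁ lk)) L → ∀ v → Prime𝔽 (val L v)
  prime-val []              []       v = ι-prime 0
  prime-val ((c , k) ∷ L) (c∈ ∷ ps) v = prime-+ (zero-or-not (ap k v) (λ n → subst Prime𝔽 (sym (⊠-zero (δ-no n))) (ι-prime 0))
    (λ z → subst Prime𝔽 (sym (trans (cong (c ⊠_) (δ-yes z)) (*-identityʳ c))) c∈)) (prime-val L ps v)

  module _ {m} (3≤m : 3 ≤ m) (26≤q : 26 ≤ q) (L : Code m) (coefficients : All (λ lk → Prime𝔽 (proj₁ lk)) L) (good : Good L) where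
    private
      f : Vector m → 𝔽
      f = val L

      combination-from : (D : Dual m 3) → (∀ v → v ≢ zeroV → f v ≢ 0F → ∃ λ i → ap (Vec.lookup (Dual.l D) i) v ≡ 0F) → Combination Prime𝔽 f
      combination-from = independent-cover f (line-sum L) (val-scale L) Prime𝔽 (prime-val L coefficients) prime-sub

      padded : ∀ {d} (D : Dual m d) → d ≤ 3 → (∀ v → v ≢ zeroV → f v ≢ 0F → ∃ λ i → ap (Vec.lookup (Dual.l D) i) v ≡ 0F) → Combination Prime𝔽 f
      padded D le cov = let D′ , s = pad 3≤m D le in combination-from D′
        (λ v v≢0 fv → let i , z = cov v v≢0 fv ; j , e = retains s i in j , trans (sym (e v)) z)

    private
      module Three (K₁ K₂ : Lin m) (E₁ E₂ : Vector m)
          (h₁₁ : ap K₁ E₁ ≡ 1F) (h₁₂ : ap K₁ E₂ ≡ 0F) (h₂₁ : ap K₂ E₁ ≡ 0F) (h₂₂ : ap K₂ E₂ ≡ 1F)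
          (ξ : 𝔽) (ξ≢0 : ξ ≢ 0F) (ξ≢1 : ξ ≢ 1F)
          (cov : ∀ v → ap K₁ v ≢ 0F → ap K₂ v ≢ 0F → ap K₁ v ≢ ap K₂ v → f v ≡ 0F) where
        open ThreePencil f (line-sum L) (val-scale L) Prime𝔽 (prime-val L coefficients) prime-sub K₁ K₂ E₁ E₂ h₁₁ h₁₂ h₂₁ h₂₂ ξ ξ≢0 ξ≢1 cov

        -- On the line E₂ + s y₁ the word is f₀ + ψ(s), so the dichotomy for deviations from f₀
        -- applies to the additive map ψ. It forces q = p, and over a prime field the additive map φ
        -- is linear.
        module Slanted (y₁ : Vector m) (axis₁ : Axis y₁) (φ₁ : φ y₁ ≢ 0F) where
          ψ : 𝔽 → 𝔽
          ψ s = φ (s ·V y₁)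

          ψ-+ : ∀ s t → ψ (s ⊞ t) ≡ ψ s ⊞ ψ t
          ψ-+ s t = trans (cong φ (vsolve ((s ⊞ t) ⊙ x₀) (s ⊙ x₀ ⊕ t ⊙ x₀) (λ { (x ∷ []) → distribʳ x s t }) (y₁ ∷ []))) (φ-+ (s ·V y₁) (t ·V y₁) (axis-· s axis₁) (axis-· t axis₁))

          open Additive 26≤q ψ ψ-+ (λ s → prime-sub (prime-val L coefficients _) (prime-val L coefficients _)) (φ₁ ∘ trans (cong φ (sym (1·V y₁)))) (good E₂ y₁ f₀)

          φ-ι : ∀ k y → Axis y → φ (ι k ·V y) ≡ ι k ⊠ φ y
          φ-ι zero    y z = trans (cong φ (0·V y)) (trans (⊞-cancelˡ (φ zeroV) (trans (sym (φ-+ zeroV zeroV axis-0 axis-0)) (trans (cong φ (+V-identityˡ zeroV)) (sym (+-identityʳ _))))) (sym (zeroˡ _)))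
          φ-ι (suc k) y z = trans (cong φ (vsolve ((1F ⊞ ι k) ⊙ x₀) (x₀ ⊕ ι k ⊙ x₀) (λ { (x ∷ []) → solve 2 (λ k x → (𝟙 :+ k) :* x := x :+ k :* x) refl (ι k) x }) (y ∷ [])))
            (trans (φ-+ y (ι k ·V y) z (axis-· (ι k) z)) (trans (cong (φ y ⊞_) (φ-ι k y z)) (solve 2 (λ x k → x :+ k :* x := (𝟙 :+ k) :* x) refl (φ y) (ι k))))

          φ-· : ∀ s y → Axis y → φ (s ·V y) ≡ s ⊠ φ y
          φ-· s y z = let k , _ , e = all-prime s in trans (cong (λ t → φ (t ·V y)) e) (trans (φ-ι k y z) (cong (_⊠ φ y) (sym e)))

          open Linear φ-·

          E₃ : Vector m
          E₃ = φ y₁ ⁻¹ ·V y₁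

          axis₃ : Axis E₃
          axis₃ = axis-· _ axis₁

          l₃ : ap l E₃ ≡ 1F
          l₃ = trans (ap-· l _ y₁) (trans (cong (φ y₁ ⁻¹ ⊠_) (l-axis y₁ axis₁)) (inv-⊠ φ₁))

          φ-zero : φ zeroV ≡ 0F
          φ-zero = φ-ι′
            where
            φ-ι′ : φ zeroV ≡ 0F
            φ-ι′ = trans (cong φ (sym (0·V zeroV))) (trans (φ-ι 0 zeroV axis-0) (zeroˡ _))

          l-E : ∀ E → res E ≡ zeroV → ap l E ≡ 0F
          l-E E e = trans (cong φ e) φ-zero

          res₁ : res E₁ ≡ zeroV
          res₁ = trans (cong₂ (λ b c → E₁ +V (⊟ b) ·V E₁ +V (⊟ c) ·V E₂) h₁₁ h₂₁) (vsolve (x₀ ⊕ (⊟ 1F) ⊙ x₀ ⊕ (⊟ 0F) ⊙ x₁) ∅ (λ { (x ∷ y ∷ []) → solve 2 (λ x y → x :+ (:- 𝟙) :* x :+ (:- 𝟎) :* y := 𝟎) refl x y }) (E₁ ∷ E₂ ∷ []))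

          res₂ : res E₂ ≡ zeroV
          res₂ = trans (cong₂ (λ b c → E₂ +V (⊟ b) ·V E₁ +V (⊟ c) ·V E₂) h₁₂ h₂₂) (vsolve (x₁ ⊕ (⊟ 0F) ⊙ x₀ ⊕ (⊟ 1F) ⊙ x₁) ∅ (λ { (x ∷ y ∷ []) → solve 2 (λ x y → y :+ (:- 𝟎) :* x :+ (:- 𝟙) :* y := 𝟎) refl x y }) (E₁ ∷ E₂ ∷ []))

          ap-three : ∀ (k : Lin m) {x y z} → ap k E₁ ≡ x → ap k E₂ ≡ y → ap k E₃ ≡ z → ∀ a b c → ap k (lincomb (a ∷ b ∷ c ∷ []) (E₁ ∷ E₂ ∷ E₃ ∷ [])) ≡ a ⊠ x ⊞ (b ⊠ y ⊞ (c ⊠ z ⊞ 0F))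
          ap-three k refl refl refl a b c = trans (ap-+ k _ _) (cong₂ _⊞_ (ap-· k a E₁) (trans (ap-+ k _ _) (cong₂ _⊞_ (ap-· k b E₂) (trans (ap-+ k _ _) (cong₂ _⊞_ (ap-· k c E₃) (ap-zero k))))))

          odd-form : OddForm f
          odd-form = record { q≡p = q≡p ; K₁ = K₁ ; K₂ = K₂ ; l = l ; f₀ = f₀ ; g₀ = g₀ ; h₀ = h₀
            ; f₀∈ = prime-val L coefficients _ ; g₀∈ = prime-val L coefficients _ ; h₀∈ = prime-val L coefficients _
            ; form = pencil-form ; E₁ = E₁ ; E₂ = E₂ ; E₃ = E₃
            ; dual = λ { (a ∷ b ∷ c ∷ []) → cong₂ _∷_ (trans (ap-three K₁ h₁₁ h₁₂ (proj₁ axis₃) a b c) (solve 3 (λ a b c → a :* 𝟙 :+ (b :* 𝟎 :+ (c :* 𝟎 :+ 𝟎)) := a) refl a b c))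
                (cong₂ _∷_ (trans (ap-three K₂ h₂₁ h₂₂ (proj₂ axis₃) a b c) (solve 3 (λ a b c → a :* 𝟎 :+ (b :* 𝟙 :+ (c :* 𝟎 :+ 𝟎)) := b) refl a b c))
                  (cong (_∷ []) (trans (ap-three l (l-E E₁ res₁) (l-E E₂ res₂) l₃ a b c) (solve 3 (λ a b c → a :* 𝟎 :+ (b :* 𝟎 :+ (c :* 𝟙 :+ 𝟎)) := c) refl a b c)))) }
            }

        result : Combination Prime𝔽 f ⊎ OddForm f
        result = decide (Any.any? (λ y → ((ap K₁ y ≟F 0F) ×-dec (ap K₂ y ≟F 0F)) ×-dec ¬? (φ y ≟F 0F)) (allVecs m))
          where
          decide : Dec (Any (λ y → Axis y × φ y ≢ 0F) (allVecs m)) → Combination Prime𝔽 f ⊎ OddForm f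
          decide (yes any) = let y , _ , z , n = find any in inj₂ (Slanted.odd-form y z n)
          decide (no none) = inj₁ (flat (λ y z → zero-or-not (φ y) (λ n → ⊥-elim (none (lose (allVecs-complete y) (z , n)))) id))

      third : ∃ λ ξ → ξ ≢ 0F × ξ ≢ 1F
      third = decide (Any.any? (λ x → ¬? (x ≟F 0F) ×-dec ¬? (x ≟F 1F)) elems)
        where
        decide : Dec (Any (λ x → x ≢ 0F × x ≢ 1F) elems) → ∃ λ ξ → ξ ≢ 0F × ξ ≢ 1F
        decide (yes any) = let x , _ , p = find any in x , p
        decide (no none) = ⊥-elim (ℕ.<⇒≱ (ℕ.≤-trans (s≤s (s≤s (s≤s z≤n))) 26≤q) (unique-⊆-length {ys = 0F ∷ 1F ∷ []} elems-unique inside))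
          where
          inside : ∀ {x} → x ∈ elems → x ∈ 0F ∷ 1F ∷ []
          inside {x} x∈ with x ≟F 0F | x ≟F 1F
          ... | yes z | _     = here z
          ... | no _  | yes o = there (here o)
          ... | no n  | no n′ = ⊥-elim (none (lose x∈ (n , n′)))

    module _ (k₁ k₂ k₃ : Lin m) (nz₁ : Nonzero k₁) (nz₂ : Nonzero k₂) (nz₃ : Nonzero k₃)
        (cov : ∀ v → v ≢ zeroV → f v ≢ 0F → ap k₁ v ≡ 0F ⊎ ap k₂ v ≡ 0F ⊎ ap k₃ v ≡ 0F) where
      private
        Result : Set
        Result = Combination Prime𝔽 f ⊎ OddForm f

        D₁ : Dual m 1
        D₁ = extend empty k₁ {proj₁ nz₁} refl (proj₂ nz₁)

        absorbed₁ : ∀ k → Nonzero k → Dual.Factors D₁ k → ∀ v → ap k v ≡ 0F → ap k₁ v ≡ 0F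
        absorbed₁ k (w , kw) fac v z = zero-or-not (ap k₁ v) (λ n → ⊥-elim (kw (vanish n))) id
          where
          vanish : ap k₁ v ≢ 0F → ap k w ≡ 0F
          vanish n = trans (solve 3 (λ x s y → x := (x :+ (:- s) :* y) :+ s :* y) refl (ap k w) s (ap k v))
            (trans (cong₂ (λ x y → x ⊞ s ⊠ y) (trans (sym (ap-line k w (⊟ s) v)) (fac _ (cong (_∷ []) (trans (ap-line k₁ w (⊟ s) v)
              (trans (solve 3 (λ a b i → a :+ (:- (a :* i)) :* b := a :+ :- (a :* (b :* i))) refl (ap k₁ w) (ap k₁ v) (ap k₁ v ⁻¹))
                (trans (cong (λ z → ap k₁ w ⊞ ⊟ (ap k₁ w ⊠ z)) (⊠-inv n)) (solve 1 (λ a → a :+ :- (a :* 𝟙) := 𝟎) refl (ap k₁ w)))))))) z) (solve 1 (λ s → 𝟎 :+ s :* 𝟎 := 𝟎) refl s))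
            where
            s : 𝔽
            s = ap k₁ w ⊠ ap k₁ v ⁻¹

        pick₁ : ∀ {v} → ap k₁ v ≡ 0F → ∃ λ (i : Fin 1) → ap (Vec.lookup (k₁ ∷ []) i) v ≡ 0F
        pick₁ z = Fin.zero , z

        module Second (k : Lin m) (w : Vector m) (cw : coords (Dual.l D₁) w ≡ zeroV) (kw : ap k w ≢ 0F) where
          D₂ : Dual m 2
          D₂ = extend D₁ k cw kw

          first₂ : ∀ {v} → ap k₁ v ≡ 0F → ∃ λ (i : Fin 2) → ap (Vec.lookup (k ∷ k₁ ∷ []) i) v ≡ 0F
          first₂ z = Fin.suc Fin.zero , z

          second₂ : ∀ {v} → ap k v ≡ 0F → ∃ λ (i : Fin 2) → ap (Vec.lookup (k ∷ k₁ ∷ []) i) v ≡ 0F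
          second₂ z = Fin.zero , z

          e₂ e₁ : Vector m
          e₂ = Vec.lookup (Dual.e D₂) Fin.zero
          e₁ = Vec.lookup (Dual.e D₂) (Fin.suc Fin.zero)

          table₂ : coords (k ∷ k₁ ∷ []) e₂ ≡ 1F ∷ 0F ∷ []
          table₂ = trans (cong (coords (k ∷ k₁ ∷ [])) (sym (vsolve (1F ⊙ x₀ ⊕ (0F ⊙ x₁ ⊕ ∅)) x₀ (λ { (x ∷ y ∷ []) → solve 2 (λ x y → 𝟙 :* x :+ (𝟎 :* y :+ 𝟎) := x) refl x y }) (e₂ ∷ e₁ ∷ [])))) (Dual.dual D₂ (1F ∷ 0F ∷ []))

          table₁ : coords (k ∷ k₁ ∷ []) e₁ ≡ 0F ∷ 1F ∷ []
          table₁ = trans (cong (coords (k ∷ k₁ ∷ [])) (sym (vsolve (0F ⊙ x₀ ⊕ (1F ⊙ x₁ ⊕ ∅)) x₁ (λ { (x ∷ y ∷ []) → solve 2 (λ x y → 𝟎 :* x :+ (𝟙 :* y :+ 𝟎) := y) refl x y }) (e₂ ∷ e₁ ∷ [])))) (Dual.dual D₂ (0F ∷ 1F ∷ []))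

          second-of : ∀ {x y x′ y′ : 𝔽} → _≡_ {A = Vector 2} (x ∷ y ∷ []) (x′ ∷ y′ ∷ []) → y ≡ y′
          second-of refl = refl

          combined : ∀ k′ → Dual.Factors D₂ k′ → ∀ v → ap k′ v ≡ ap k v ⊠ ap k′ e₂ ⊞ ap k₁ v ⊠ ap k′ e₁
          combined k′ fac v = trans (Dual.factors-proj D₂ {k′} fac v) (trans (ap-+ k′ _ _) (cong₂ _⊞_ (ap-· k′ (ap k v) e₂)
            (trans (ap-+ k′ _ _) (trans (cong₂ _⊞_ (ap-· k′ (ap k₁ v) e₁) (ap-zero k′)) (+-identityʳ _)))))

          -- k₃ = β k + α k₁; if α and β are nonzero the three hyperplanes form a pencil.
          pencil : Dual.Factors D₂ k₃ → (∀ v → v ≢ zeroV → f v ≢ 0F → ap k₁ v ≡ 0F ⊎ ap k v ≡ 0F ⊎ ap k₃ v ≡ 0F) → Result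
          pencil fac cov′ = zero-or-not (ap k₃ e₂) (λ β≢0 → zero-or-not (ap k₃ e₁) (λ α≢0 → proper α≢0 β≢0) only-second) only-first
            where
            α β : 𝔽
            α = ap k₃ e₁
            β = ap k₃ e₂
            three-not-zero : ∀ {x y} → x ≡ 0F → y ≡ 0F → ∀ v → ap k v ⊠ x ⊞ ap k₁ v ⊠ y ≡ 0F
            three-not-zero z z′ v = trans (cong₂ _⊞_ (⊠-zero z) (⊠-zero z′)) (+-identityˡ 0F)
            only-first : β ≡ 0F → Result
            only-first z = inj₁ (padded D₂ (s≤s (s≤s z≤n)) (λ v v≢0 fv → case cov′ v v≢0 fv of λ
              { (inj₁ z₁) → first₂ z₁ ; (inj₂ (inj₁ z₂)) → second₂ z₂ ; (inj₂ (inj₂ z₃)) → first₂ (⊠-integral α≢0 (trans (*-comm _ _) (trans (sym (trans (cong (_⊞ ap k₁ v ⊠ α) (⊠-zero z)) (+-identityˡ _))) (trans (sym (combined k₃ fac v)) z₃)))) }))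
              where
              α≢0 : α ≢ 0F
              α≢0 z′ = proj₂ nz₃ (trans (combined k₃ fac _) (three-not-zero z z′ _))
            only-second : α ≡ 0F → Result
            only-second z = inj₁ (padded D₂ (s≤s (s≤s z≤n)) (λ v v≢0 fv → case cov′ v v≢0 fv of λ
              { (inj₁ z₁) → first₂ z₁ ; (inj₂ (inj₁ z₂)) → second₂ z₂ ; (inj₂ (inj₂ z₃)) → second₂ (⊠-integral β≢0 (trans (*-comm _ _) (trans (sym (trans (cong (ap k v ⊠ β ⊞_) (⊠-zero z)) (+-identityʳ _))) (trans (sym (combined k₃ fac v)) z₃)))) }))
              where
              β≢0 : β ≢ 0F
              β≢0 z′ = proj₂ nz₃ (trans (combined k₃ fac _) (three-not-zero z′ z _))
            -- Scaling the first functional by α and the second by -β turns the third hyperplane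
            -- into K₁ = K₂; the dual vectors are divided by the same scalars.
            proper : α ≢ 0F → β ≢ 0F → Result
            proper α≢0 β≢0 = Three.result K₁ K₂ (α ⁻¹ ·V e₁) ((⊟ β) ⁻¹ ·V e₂)
                (entry α k₁ (α ⁻¹) e₁ (second-of table₁) (trans (cong (α ⊠_) (*-identityʳ _)) (⊠-inv α≢0)))
                (entry α k₁ ((⊟ β) ⁻¹) e₂ (second-of table₂) (⊠-zero (zeroʳ _)))
                (entry (⊟ β) k (α ⁻¹) e₁ (cong Vec.head table₁) (⊠-zero (zeroʳ _)))
                (entry (⊟ β) k ((⊟ β) ⁻¹) e₂ (cong Vec.head table₂) (trans (cong (⊟ β ⊠_) (*-identityʳ _)) (⊠-inv (neg-nonzero β≢0))))
                (proj₁ third) (proj₁ (proj₂ third)) (proj₂ (proj₂ third)) off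
              where
              K₁ K₂ : Lin m
              K₁ = scaleL α k₁
              K₂ = scaleL (⊟ β) k
              entry : ∀ c (k : Lin m) s e {x y} → ap k e ≡ x → c ⊠ (s ⊠ x) ≡ y → ap (scaleL c k) (s ·V e) ≡ y
              entry c k s e h h′ = trans (ap-scaleL c k _) (trans (cong (c ⊠_) (trans (ap-· k s e) (cong (s ⊠_) h))) h′)
              off : ∀ v → ap K₁ v ≢ 0F → ap K₂ v ≢ 0F → ap K₁ v ≢ ap K₂ v → f v ≡ 0F
              off v n₁ n₂ n = zero-or-not (f v) (λ fv → ⊥-elim (absurd (cov′ v (λ { refl → n₁ (ap-zero K₁) }) fv))) id
                where
                absurd : ap k₁ v ≡ 0F ⊎ ap k v ≡ 0F ⊎ ap k₃ v ≡ 0F → ⊥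
                absurd (inj₁ z)        = n₁ (trans (ap-scaleL α k₁ v) (⊠-zero z))
                absurd (inj₂ (inj₁ z)) = n₂ (trans (ap-scaleL (⊟ β) k v) (⊠-zero z))
                absurd (inj₂ (inj₂ z)) = n (sub-zero⇒≡ _ _ (trans (cong₂ (λ x y → x ⊞ ⊟ y) (ap-scaleL α k₁ v) (ap-scaleL (⊟ β) k v))
                  (trans (solve 4 (λ a b x y → a :* x :+ :- ((:- b) :* y) := y :* b :+ x :* a) refl α β (ap k₁ v) (ap k v)) (trans (sym (combined k₃ fac v)) z))))

      -- Dependent functionals either repeat a hyperplane, and the one or two remaining are padded
      -- to an independent triple, or are three distinct members of a pencil. Only the latter can
      -- lead to the odd form.
      classify : Result
      classify = second (factor-or-extend D₁ k₂)
        where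
        alone : Dual.Factors D₁ k₂ → Dual.Factors D₁ k₃ ⊎ (∃ λ w → coords (Dual.l D₁) w ≡ zeroV × ap k₃ w ≢ 0F) → Result
        alone fac₂ (inj₁ fac₃) = inj₁ (padded D₁ (s≤s z≤n) (λ v v≢0 fv → case cov v v≢0 fv of λ
          { (inj₁ z) → pick₁ z ; (inj₂ (inj₁ z)) → pick₁ (absorbed₁ k₂ nz₂ fac₂ v z) ; (inj₂ (inj₂ z)) → pick₁ (absorbed₁ k₃ nz₃ fac₃ v z) }))
        alone fac₂ (inj₂ (w , cw , kw)) = inj₁ (padded (Second.D₂ k₃ w cw kw) (s≤s (s≤s z≤n)) (λ v v≢0 fv → case cov v v≢0 fv of λ
          { (inj₁ z) → Second.first₂ k₃ w cw kw z ; (inj₂ (inj₁ z)) → Second.first₂ k₃ w cw kw (absorbed₁ k₂ nz₂ fac₂ v z) ; (inj₂ (inj₂ z)) → Second.second₂ k₃ w cw kw z }))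
        second : Dual.Factors D₁ k₂ ⊎ (∃ λ w → coords (Dual.l D₁) w ≡ zeroV × ap k₂ w ≢ 0F) → Result
        second (inj₁ fac)           = alone fac (factor-or-extend D₁ k₃)
        second (inj₂ (w , cw , kw)) = third-step (factor-or-extend D₂ k₃)
          where
          open Second k₂ w cw kw
          third-step : Dual.Factors D₂ k₃ ⊎ (∃ λ w → coords (Dual.l D₂) w ≡ zeroV × ap k₃ w ≢ 0F) → Result
          third-step (inj₁ fac)              = pencil fac cov
          third-step (inj₂ (w₃ , cw₃ , kw₃)) = inj₁ (combination-from (extend D₂ k₃ cw₃ kw₃) (λ v v≢0 fv → case cov v v≢0 fv of λ
            { (inj₁ z) → Fin.suc (Fin.suc Fin.zero) , z ; (inj₂ (inj₁ z)) → Fin.suc Fin.zero , z ; (inj₂ (inj₂ z)) → Fin.zero , z }))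

  module _ (r : ℕ) (qr : q ≡ 26 + r) where
    private
      module C = Covering F r qr

    classify-light : ∀ {e} (L : Code (suc (suc (suc e)))) → All (λ lk → Prime𝔽 (proj₁ lk)) L → Good L →
      ¬ 2 * Z L (full (suc (suc (suc e)))) ≤ 7 * q ^ suc (suc e) → Combination Prime𝔽 (val L) ⊎ OddForm (val L)
    classify-light {e} L coefficients good not-heavy = choose (C.light-or-heavy L good (full _) (q ^ suc (suc e)) (allVecs-length (suc (suc (suc e)))))
      where
      m : ℕ
      m = suc (suc (suc e))
      run : ∀ k₁ k₂ k₃ → Nonzero k₁ → Nonzero k₂ → Nonzero k₃ → (∀ v → v ≢ zeroV → val L v ≢ 0F → Any (λ k → ap k v ≡ 0F) (k₁ ∷ k₂ ∷ k₃ ∷ [])) →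
        Combination Prime𝔽 (val L) ⊎ OddForm (val L)
      run k₁ k₂ k₃ n₁ n₂ n₃ cov = classify (s≤s (s≤s (s≤s z≤n))) C.26≤q L coefficients good k₁ k₂ k₃ n₁ n₂ n₃ (λ v v≢0 fv → case cov v v≢0 fv of λ
        { (here z) → inj₁ z ; (there (here z)) → inj₂ (inj₁ z) ; (there (there (here z))) → inj₂ (inj₂ z) })
      start : Lin m
      start = headL
      start-nonzero : Nonzero start
      start-nonzero = 1F ∷ zeroV , 1≢0
      covered : (∃ λ ks → length ks ≤ 3 × All (C.Moves (full m)) ks × C.Covers L good (full m) ks) → Combination Prime𝔽 (val L) ⊎ OddForm (val L)
      covered ([] , _ , _ , cov) = run start start start start-nonzero start-nonzero start-nonzero (λ v v≢0 fv → ⊥-elim (case cov (allVecs-complete v) v≢0 fv of λ ()))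
      covered (k ∷ [] , _ , (w , _ , n) ∷ [] , cov) = run k k k (w , n) (w , n) (w , n) (λ v v≢0 fv → case cov (allVecs-complete v) v≢0 fv of λ { (here z) → here z })
      covered (k ∷ k′ ∷ [] , _ , (w , _ , n) ∷ (w′ , _ , n′) ∷ [] , cov) = run k k′ k′ (w , n) (w′ , n′) (w′ , n′)
        (λ v v≢0 fv → case cov (allVecs-complete v) v≢0 fv of λ { (here z) → here z ; (there (here z)) → there (here z) })
      covered (k ∷ k′ ∷ k″ ∷ [] , _ , (w , _ , n) ∷ (w′ , _ , n′) ∷ (w″ , _ , n″) ∷ [] , cov) = run k k′ k″ (w , n) (w′ , n′) (w″ , n″)
        (λ v v≢0 fv → cov (allVecs-complete v) v≢0 fv)
      covered (_ ∷ _ ∷ _ ∷ _ ∷ _ , s≤s (s≤s (s≤s ())) , _ , _)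
      choose : C.Light L (full m) (q ^ suc (suc e)) ⊎ C.Heavy L (full m) (q ^ suc (suc e)) → Combination Prime𝔽 (val L) ⊎ OddForm (val L)
      choose (inj₁ lt) = covered (C.covering L good (suc e) refl lt)
      choose (inj₂ h)  = ⊥-elim (not-heavy (C.Heavy.bound h))

-- From points and residues modulo p to vectors over the field

module Bridge (F : FiniteField) (p : ℕ) (pr : Prime p) (char : FiniteField.ι F p ≡ FiniteField.0# F) where
  open Classification F p pr char public
  open Code F p pr public using (Word; χ; wt; InCode; [_]ₚ; sumOverPlane; p≢0; TypeOdd; TypeTriangle; TypeStar; CombOfLines; c₀; X₀; X₁; toFp; [_≈_]; IsCollineationOnto)
  open Solver using (solve; _:=_; _:+_; _:*_; :-_; 𝟎; 𝟙)

  -- An embedding of the integers modulo p into F; since it is injective, identities between words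
  -- may be checked in F.
  J : Fin p → 𝔽
  J k = ι (toℕ k)

  J-mod : ∀ n → J [ n ]ₚ ≡ ι n
  J-mod n = trans (cong ι (Fin.toℕ-fromℕ< (m%n<n n p))) (sym (proj₂ (proj₂ (ι-prime n))))
    where open import Data.Nat.DivMod using (m%n<n)

  J-injective : ∀ {a b} → J a ≡ J b → a ≡ b
  J-injective {a} {b} e = Fin.toℕ-injective (ι-injective (Fin.toℕ<n a) (Fin.toℕ<n b) e)

  J-prime : ∀ a → Prime𝔽 (J a)
  J-prime a = toℕ a , Fin.toℕ<n a , refl

  Prime𝔽⇒J : ∀ {x} → Prime𝔽 x → ∃ λ a → J a ≡ x
  Prime𝔽⇒J (k , k<p , e) = Fin.fromℕ< k<p , trans (cong ι (Fin.toℕ-fromℕ< k<p)) (sym e)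

  private
    T⇒≡ : ∀ {b} → T b → b ≡ true
    T⇒≡ {true} _ = refl
    ¬T⇒≡ : ∀ {b} → ¬ T b → b ≡ false
    ¬T⇒≡ {true}  n = ⊥-elim (n _)
    ¬T⇒≡ {false} n = refl
    isYes⁺ : ∀ {P : Set} (d : Dec P) → P → T (isYes d)
    isYes⁺ (yes _) _ = _
    isYes⁺ (no n)  x = ⊥-elim (n x)
    isYes⁻ : ∀ {P : Set} (d : Dec P) → T (isYes d) → P
    isYes⁻ (yes x) _ = x

  inSpanᵇ⁺ : ∀ {m k} (vs : Fam m k) {x} → InSpan vs x → T (inSpanᵇ vs x)
  inSpanᵇ⁺ vs {x} (a , e) = any⁺ _ (lose (allVecs-complete a) (isYes⁺ (lincomb a vs ≟V x) e))

  inSpanᵇ⁻ : ∀ {m k} (vs : Fam m k) {x} → T (inSpanᵇ vs x) → InSpan vs x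
  inSpanᵇ⁻ {k = k} vs {x} t = let a , _ , y = find (any⁻ _ (allVecs k) t) in a , isYes⁻ (lincomb a vs ≟V x) y

  inSpan? : ∀ {m k} (vs : Fam m k) x → Dec (InSpan vs x)
  inSpan? vs x with T? (inSpanᵇ vs x)
  ... | yes t = yes (inSpanᵇ⁻ vs t)
  ... | no n  = no (n ∘ inSpanᵇ⁺ vs)

  spanᶠ : ∀ {m k} → Fam m k → Vector m → 𝔽
  spanᶠ vs x = ι (if inSpanᵇ vs x then 1 else 0)

  spanᶠ-yes : ∀ {m k} (vs : Fam m k) {x} → InSpan vs x → spanᶠ vs x ≡ 1F
  spanᶠ-yes vs s = trans (cong (λ b → ι (if b then 1 else 0)) (T⇒≡ (inSpanᵇ⁺ vs s))) (+-identityʳ 1F)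

  spanᶠ-no : ∀ {m k} (vs : Fam m k) {x} → ¬ InSpan vs x → spanᶠ vs x ≡ 0F
  spanᶠ-no vs n = cong (λ b → ι (if b then 1 else 0)) (¬T⇒≡ (n ∘ inSpanᵇ⁻ vs))

  spanᶠ-cong : ∀ {m k m′ k′} (vs : Fam m k) {x} (ws : Fam m′ k′) {y} → (InSpan vs x → InSpan ws y) → (InSpan ws y → InSpan vs x) → spanᶠ vs x ≡ spanᶠ ws y
  spanᶠ-cong vs {x} ws {y} to from = decide (inSpan? vs x)
    where
    decide : Dec (InSpan vs x) → _
    decide (yes s) = trans (spanᶠ-yes vs s) (sym (spanᶠ-yes ws (to s)))
    decide (no n)  = trans (spanᶠ-no vs n) (sym (spanᶠ-no ws (n ∘ from)))

  -- Transposed, the family is n + 1 vectors in dimension n, and a relation a between them gives a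
  -- functional `dot a` vanishing on vs. Conversely, x in its kernel, some w outside it and vs are n
  -- + 2 vectors in dimension n + 1; in a relation between them the coefficient of w vanishes, so
  -- that of x cannot.
  hyperplane : ∀ {n} (vs : Fam (suc n) n) → Independent vs → ∃ λ k → ∀ x → (InSpan vs x → ap k x ≡ 0F) × (ap k x ≡ 0F → InSpan vs x)
  hyperplane {n} vs ind = build (dependent (transpose vs) ℕ.≤-refl)
    where
    transpose : ∀ {m d} → Fam m d → Fam d m
    transpose []       = Vec.replicate _ []
    transpose (v ∷ vs) = Vec.zipWith _∷_ v (transpose vs)
    transpose-lincomb : ∀ {m d} (a : Vector m) (vs : Fam m d) → lincomb a (transpose vs) ≡ Vec.map (λ v → ap (dot a) v) vs
    transpose-lincomb a []       = empty-case a
      where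
      empty-case : ∀ {m} (a : Vector m) → lincomb a (Vec.replicate m []) ≡ []
      empty-case []       = refl
      empty-case (a ∷ as) with lincomb as (Vec.replicate _ [])
      ... | [] = refl
    transpose-lincomb a (v ∷ vs) = trans (cons-case a v (transpose vs)) (cong (ap (dot a) v ∷_) (transpose-lincomb a vs))
      where
      cons-case : ∀ {m d} (a v : Vector m) (ws : Fam d m) → lincomb a (Vec.zipWith _∷_ v ws) ≡ ap (dot a) v ∷ lincomb a ws
      cons-case []       []       []       = refl
      cons-case (a ∷ as) (x ∷ v) (w ∷ ws) = trans (cong ((a ·V (x ∷ w)) +V_) (cons-case as v ws)) (cong (_∷ (a ·V w +V lincomb as ws)) (+-comm _ _))
    lookup-zero : ∀ {m d} (k : Lin m) (vs : Fam m d) → Vec.map (ap k) vs ≡ zeroV → ∀ i → ap k (Vec.lookup vs i) ≡ 0F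
    lookup-zero k (v ∷ vs) e Fin.zero    = proj₁ (Vec.∷-injective e)
    lookup-zero k (v ∷ vs) e (Fin.suc i) = lookup-zero k vs (proj₂ (Vec.∷-injective e)) i
    dot-nonzero : ∀ {m} (a : Vector m) → a ≢ zeroV → Nonzero (dot a)
    dot-nonzero []       n = ⊥-elim (n refl)
    dot-nonzero (x ∷ xs) n = zero-or-not x (λ x≢0 → 1F ∷ zeroV , x≢0 ∘ trans (sym (trans (cong (_⊞ x ⊠ 1F) (ap-zero (dot xs))) (solve 1 (λ x → 𝟎 :+ x :* 𝟙 := x) refl x))))
      (λ x≡0 → let w , nw = dot-nonzero xs (λ e → n (cong₂ _∷_ x≡0 e)) in 0F ∷ w , nw ∘ trans (solve 2 (λ y x → y := y :+ x :* 𝟎) refl (ap (dot xs) w) x))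
    build : (∃ λ a → a ≢ zeroV × lincomb a (transpose vs) ≡ zeroV) → _
    build (a , a≢0 , e) = dot a , λ x → (λ { (b , refl) → ap-lincomb-zero (dot a) b vs kills }) , back x
      where
      kills : ∀ i → ap (dot a) (Vec.lookup vs i) ≡ 0F
      kills = lookup-zero (dot a) vs (trans (sym (transpose-lincomb a vs)) e)
      back : ∀ x → ap (dot a) x ≡ 0F → InSpan vs x
      back x z = solve-for (dependent (w ∷ x ∷ vs) ℕ.≤-refl)
        where
        w : Vector (suc n)
        w = proj₁ (dot-nonzero a a≢0)
        solve-for : (∃ λ b → b ≢ zeroV × lincomb b (w ∷ x ∷ vs) ≡ zeroV) → InSpan vs x
        solve-for (s ∷ t ∷ b , b≢0 , e) = zero-or-not t (λ t≢0 → (⊟ (t ⁻¹)) ·V b , trans (lincomb-· (⊟ (t ⁻¹)) b vs) (value t≢0)) (λ t≡0 → ⊥-elim (b≢0 (cong₂ _∷_ s≡0 (cong₂ _∷_ t≡0 (ind b (rest t≡0))))))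
          where
          y : Vector (suc n)
          y = lincomb b vs
          s≡0 : s ≡ 0F
          s≡0 = ⊠-integral (proj₂ (dot-nonzero a a≢0)) (trans (*-comm _ _) (trans (sym (trans (trans (ap-+ (dot a) (s ·V w) (t ·V x +V y)) (cong₂ _⊞_ (ap-· (dot a) s w)
            (trans (ap-+ (dot a) _ _) (cong₂ _⊞_ (trans (ap-· (dot a) t x) (⊠-zero z)) (ap-lincomb-zero (dot a) b vs kills))))) (trans (cong (s ⊠ ap (dot a) w ⊞_) (+-identityˡ 0F)) (+-identityʳ _))))
            (trans (cong (ap (dot a)) e) (ap-zero (dot a)))))
          tx+y : t ·V x +V y ≡ zeroV
          tx+y = trans (sym (trans (cong (λ c → c ·V w +V (t ·V x +V y)) s≡0) (trans (cong (_+V (t ·V x +V y)) (0·V w)) (+V-identityˡ _)))) e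
          rest : t ≡ 0F → y ≡ zeroV
          rest t≡0 = trans (sym (trans (cong (λ c → c ·V x +V y) t≡0) (trans (cong (_+V y) (0·V x)) (+V-identityˡ _)))) tx+y
          value : t ≢ 0F → (⊟ (t ⁻¹)) ·V y ≡ x
          value t≢0 = trans (vsolve ((⊟ (t ⁻¹)) ⊙ x₁) (t ⁻¹ ⊙ t ⊙ x₀ ⊕ (⊟ (t ⁻¹)) ⊙ (t ⊙ x₀ ⊕ x₁))
              (λ { (x ∷ y ∷ []) → solve 4 (λ t i x y → (:- i) :* y := i :* (t :* x) :+ (:- i) :* (t :* x :+ y)) refl t (t ⁻¹) x y }) (x ∷ y ∷ []))
            (trans (cong₂ _+V_ (·V-cancel t≢0 x) (trans (cong ((⊟ (t ⁻¹)) ·V_) tx+y) (·V-zeroʳ _))) (+V-identityʳ x))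

  ι-sum : {A : Set} (xs : List A) (g : A → ℕ) → ι (sum (map g xs)) ≡ S.∑ xs (λ x → ι (g x))
  ι-sum []       g = refl
  ι-sum (x ∷ xs) g = trans (ι-+ (g x) _) (cong (ι (g x) ⊞_) (ι-sum xs g))

  toCode : ∀ {n} (c : Word n) → InCode n c → ∃ λ (L : Code (suc n)) → All (λ lk → Prime𝔽 (proj₁ lk)) L × (∀ P → J (c P) ≡ val L (vec P))
  toCode {n} c (Ls , inds , eq) = let L , ps , h = convert Ls inds in L , ps , λ P → trans (cong J (eq P)) (trans (J-mod _) (trans (ι-sum Ls _) (h P)))
    where
    convert : ∀ Ls → All (λ t → Independent (proj₂ t)) Ls → ∃ λ (L : Code (suc n)) → All (λ lk → Prime𝔽 (proj₁ lk)) L ×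
      (∀ P → S.∑ Ls (λ t → ι (toℕ (proj₁ t) * χ (proj₂ t) P)) ≡ val L (vec P))
    convert []              []           = [] , [] , λ _ → refl
    convert ((a , vs) ∷ Ls) (ind ∷ inds) with convert Ls inds | hyperplane vs ind
    ... | L , ps , h | k , k-spec = (J a , k) ∷ L , J-prime a ∷ ps , λ P → cong₂ _⊞_ (trans (ι-* (toℕ a) (χ vs P)) (cong (J a ⊠_) (indicator P))) (h P)
      where
      indicator : ∀ P → spanᶠ vs (vec P) ≡ δ (ap k (vec P))
      indicator P = zero-or-not (ap k (vec P)) (λ n → trans (spanᶠ-no vs (n ∘ proj₁ (k-spec (vec P)))) (sym (δ-no n)))
        (λ z → trans (spanᶠ-yes vs (proj₂ (k-spec (vec P)) z)) (sym (δ-yes z)))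

  norm-0 : ∀ {m} (xs : Vector m) → normalised (0F ∷ xs) ≡ normalised xs
  norm-0 xs with 0F ≟F 0F
  ... | yes _ = refl
  ... | no n  = ⊥-elim (n refl)

  norm-1 : ∀ {m} (xs : Vector m) → normalised (1F ∷ xs) ≡ true
  norm-1 xs with 1F ≟F 0F
  ... | yes e = ⊥-elim (1≢0 e)
  ... | no _ with 1F ≟F 1F
  ...   | yes _ = refl
  ...   | no n  = ⊥-elim (n refl)

  norm-other : ∀ {m x} (xs : Vector m) → x ≢ 0F → x ≢ 1F → normalised (x ∷ xs) ≡ false
  norm-other {x = x} xs n n′ with x ≟F 0F
  ... | yes e = ⊥-elim (n e)
  ... | no _ with x ≟F 1F
  ...   | yes e = ⊥-elim (n′ e)
  ...   | no _  = refl

  norms : ∀ m → List (Vector m)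
  norms m = filterᵇ normalised (allVecs m)

  Homogeneous : ∀ {m} {A : Set} → (Vector m → A) → Set
  Homogeneous g = ∀ {t} v → t ≢ 0F → g (t ·V v) ≡ g v

  -- Every point is represented by q - 1 nonzero vectors. The monoid is left open because ℕ gives
  -- the weights, while F gives the values, where q - 1 acts as -1.
  module HomogeneousSum {M : Set} {_∙_ : M → M → M} {ε : M} (cm : IsCommutativeMonoid _≡_ _∙_ ε) where
    open FinSum cm
    open IsCommutativeMonoid cm using (assoc; identityˡ; identityʳ)

    private
      when : Bool → M → M
      when true  x = x
      when false x = ε

      ∑-filterᵇ : {A : Set} (b : A → Bool) (xs : List A) (g : A → M) → ∑ (filterᵇ b xs) g ≡ ∑ xs (λ x → when (b x) (g x))
      ∑-filterᵇ b xs g = ∑-filter (T? ∘ b) xs g (λ x t → cong (λ c → when c (g x)) (sym (T⇒≡ t))) (λ x n → cong (λ c → when c (g x)) (¬T⇒≡ n))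

    norms-suc : ∀ m (g : Vector (suc m) → M) → ∑ (norms (suc m)) g ≡ ∑ (norms m) (λ v → g (0F ∷ v)) ∙ ∑ (allVecs m) (λ v → g (1F ∷ v))
    norms-suc m g = begin
      ∑ (norms (suc m)) g
        ≡⟨ trans (∑-filterᵇ normalised (allVecs (suc m)) g) (∑-× _∷_ elems (allVecs m) _) ⟩
      ∑ elems column
        ≡⟨ ∑-↭ column elems-↭ ⟩
      column 0F ∙ ∑ elems⁺ column
        ≡⟨ cong₂ _∙_ (trans (∑-cong (allVecs m) (λ v → cong (λ b → when b (g (0F ∷ v))) (norm-0 v))) (sym (∑-filterᵇ normalised (allVecs m) _)))
             (trans (∑-single∈ 1F column elems⁺-unique (elems⁺-complete 1≢0) (λ x∈ n → ∑-zero (allVecs m) (λ v → cong (λ b → when b (g (_ ∷ v))) (norm-other v (elems⁺-nonzero x∈) n))))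
               (∑-cong (allVecs m) (λ v → cong (λ b → when b (g (1F ∷ v))) (norm-1 v)))) ⟩
      ∑ (norms m) (λ v → g (0F ∷ v)) ∙ ∑ (allVecs m) (λ v → g (1F ∷ v)) ∎
      where
      open ≡-Reasoning
      column : 𝔽 → M
      column x = ∑ (allVecs m) (λ v → when (normalised (x ∷ v)) (g (x ∷ v)))

    ∑-allVecs : ∀ m (g : Vector m → M) → Homogeneous g → ∑ (allVecs m) g ≡ g zeroV ∙ ∑ elems⁺ (λ _ → ∑ (norms m) g)
    ∑-allVecs zero    g hom = cong (g [] ∙_) (sym (∑-zero elems⁺ (λ _ → refl)))
    ∑-allVecs (suc m) g hom = begin
      ∑ (allVecs (suc m)) g
        ≡⟨ trans (∑-× _∷_ elems (allVecs m) g) (∑-↭ (λ x → ∑ (allVecs m) (λ v → g (x ∷ v))) elems-↭) ⟩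
      ∑ (allVecs m) (λ v → g (0F ∷ v)) ∙ ∑ elems⁺ (λ x → ∑ (allVecs m) (λ v → g (x ∷ v)))
        ≡⟨ cong₂ _∙_ (∑-allVecs m (λ v → g (0F ∷ v)) (λ {t} v t≢0 → trans (cong (λ x → g (x ∷ t ·V v)) (sym (zeroʳ t))) (hom (0F ∷ v) t≢0)))
             (∑-cong∈ elems⁺ (λ x∈ → rescale (elems⁺-nonzero x∈))) ⟩
      (g zeroV ∙ ∑ elems⁺ (λ _ → ∑ (norms m) (λ v → g (0F ∷ v)))) ∙ ∑ elems⁺ (λ _ → ∑ (allVecs m) (λ v → g (1F ∷ v)))
        ≡⟨ trans (assoc _ _ _) (cong (g zeroV ∙_) (trans (sym (∑-∙ elems⁺ _ _)) (∑-cong elems⁺ (λ _ → sym (norms-suc m g))))) ⟩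
      g zeroV ∙ ∑ elems⁺ (λ _ → ∑ (norms (suc m)) g) ∎
      where
      open ≡-Reasoning
      rescale : ∀ {x} → x ≢ 0F → ∑ (allVecs m) (λ v → g (x ∷ v)) ≡ ∑ (allVecs m) (λ v → g (1F ∷ v))
      rescale {x} n = trans (∑-cong (allVecs m) (λ v → trans (cong g (cong₂ _∷_ (sym (*-identityʳ x)) (sym (·V-cancel′ n v)))) (hom (1F ∷ x ⁻¹ ·V v) n)))
        (∑-bij (x ⁻¹ ·V_) (x ·V_) (λ v → g (1F ∷ v)) (allVecs-unique m) (λ _ → allVecs-complete _) (λ _ → allVecs-complete _) (·V-cancel′ n) (·V-cancel n))

    ∑-points : ∀ m (g : Vector (suc m) → M) → ∑ (allPoints m) (g ∘ vec) ≡ ∑ (norms (suc m)) g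
    ∑-points m g = go (allVecs (suc m))
      where
      accept : ∀ v → T (normalised v) → ∀ vs → ∑ (mapMaybe toPoint (v ∷ vs)) (g ∘ vec) ≡ g v ∙ ∑ (mapMaybe toPoint vs) (g ∘ vec)
      accept v t vs with T? (normalised v)
      ... | yes _ = refl
      ... | no n  = ⊥-elim (n t)
      reject : ∀ v → ¬ T (normalised v) → ∀ vs → ∑ (mapMaybe toPoint (v ∷ vs)) (g ∘ vec) ≡ ∑ (mapMaybe toPoint vs) (g ∘ vec)
      reject v n vs with T? (normalised v)
      ... | yes t = ⊥-elim (n t)
      ... | no _  = refl
      go : ∀ vs → ∑ (mapMaybe toPoint vs) (g ∘ vec) ≡ ∑ (filterᵇ normalised vs) g
      go []       = refl
      go (v ∷ vs) = decide (T? (normalised v))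
        where
        decide : Dec (T (normalised v)) → ∑ (mapMaybe toPoint (v ∷ vs)) (g ∘ vec) ≡ ∑ (filterᵇ normalised (v ∷ vs)) g
        decide (yes t) = trans (accept v t vs) (trans (cong (g v ∙_) (go vs)) (cong (λ xs → ∑ xs g) (sym (List.filter-accept (T? ∘ normalised) {x = v} {xs = vs} t))))
        decide (no n)  = trans (reject v n vs) (trans (go vs) (cong (λ xs → ∑ xs g) (sym (List.filter-reject (T? ∘ normalised) {x = v} {xs = vs} n))))

  -- The origin belongs to no point, hence the separate summand, at most 1, that later estimates
  -- have to pay for.
  weight-formula : ∀ {n} (c : Word n) (L : Code (suc n)) → (∀ P → J (c P) ≡ val L (vec P)) → W L (full (suc n)) ≡ nz (val L zeroV) + length elems⁺ * wt c
  weight-formula {n} c L eq = trans (HomogeneousSum.∑-allVecs ℕ.+-0-isCommutativeMonoid (suc n) (λ v → nz (val L v)) (λ v t≢0 → cong nz (val-scale L v t≢0)))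
    (cong (nz (val L zeroV) +_) (trans (N.∑-const elems⁺ _) (cong (length elems⁺ *_) (sym (trans (count (allPoints n)) (HomogeneousSum.∑-points ℕ.+-0-isCommutativeMonoid n (λ v → nz (val L v))))))))
    where
    count : ∀ Ps → length (filterᵇ (λ P → not (isYes (toℕ (c P) ℕ.≟ 0))) Ps) ≡ N.∑ Ps (λ P → nz (val L (vec P)))
    count []       = refl
    count (P ∷ Ps) with toℕ (c P) ℕ.≟ 0
    ... | yes z = trans (count Ps) (cong (_+ N.∑ Ps (λ P → nz (val L (vec P)))) (sym (nz-yes (trans (sym (eq P)) (cong ι z)))))
    ... | no nz₀ = trans (cong suc (count Ps)) (cong (_+ N.∑ Ps (λ P → nz (val L (vec P)))) (sym (nz-no (λ e → ι-nonzero (ℕ.n≢0⇒n>0 nz₀) (Fin.toℕ<n (c P)) (trans (eq P) e)))))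

-- Words as cones over a plane

module Cones (F : FiniteField) (p : ℕ) (pr : Prime p) (char : FiniteField.ι F p ≡ FiniteField.0# F) where
  open Bridge F p pr char public
  open Solver using (solve; _:=_; _:+_; _:*_; :-_; 𝟎; 𝟙)

  dual-independent : ∀ {m d} (D : Dual m d) → Independent (Dual.e D)
  dual-independent D a e = trans (sym (Dual.dual D a)) (trans (cong (coords (Dual.l D)) e) (zero-coords (Dual.l D)))
    where
    zero-coords : ∀ {m d} (l : Vec (Lin m) d) → coords l zeroV ≡ zeroV
    zero-coords []      = refl
    zero-coords (k ∷ l) = cong₂ _∷_ (ap-zero k) (zero-coords l)

  units : ∀ {m} (e₁ e₂ e₃ : Vector m) → lincomb (1F ∷ 0F ∷ 0F ∷ []) (e₁ ∷ e₂ ∷ e₃ ∷ []) ≡ e₁ ×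
    lincomb (0F ∷ 1F ∷ 0F ∷ []) (e₁ ∷ e₂ ∷ e₃ ∷ []) ≡ e₂ × lincomb (0F ∷ 0F ∷ 1F ∷ []) (e₁ ∷ e₂ ∷ e₃ ∷ []) ≡ e₃
  units e₁ e₂ e₃ =
    vsolve (1F ⊙ x₀ ⊕ (0F ⊙ x₁ ⊕ (0F ⊙ x₂ ⊕ ∅))) x₀ (λ { (x ∷ y ∷ z ∷ []) → solve 3 (λ x y z → 𝟙 :* x :+ (𝟎 :* y :+ (𝟎 :* z :+ 𝟎)) := x) refl x y z }) (e₁ ∷ e₂ ∷ e₃ ∷ []) ,
    vsolve (0F ⊙ x₀ ⊕ (1F ⊙ x₁ ⊕ (0F ⊙ x₂ ⊕ ∅))) x₁ (λ { (x ∷ y ∷ z ∷ []) → solve 3 (λ x y z → 𝟎 :* x :+ (𝟙 :* y :+ (𝟎 :* z :+ 𝟎)) := y) refl x y z }) (e₁ ∷ e₂ ∷ e₃ ∷ []) ,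
    vsolve (0F ⊙ x₀ ⊕ (0F ⊙ x₁ ⊕ (1F ⊙ x₂ ⊕ ∅))) x₂ (λ { (x ∷ y ∷ z ∷ []) → solve 3 (λ x y z → 𝟎 :* x :+ (𝟎 :* y :+ (𝟙 :* z :+ 𝟎)) := z) refl x y z }) (e₁ ∷ e₂ ∷ e₃ ∷ [])

  -- The three kernels are cut out one after another, and the dual vectors show that each cut lowers
  -- the dimension.
  vertex-basis : ∀ {e} (D : Dual (suc (suc (suc e))) 3) → ∃ λ (κ : Fam (suc (suc (suc e))) e) → Independent κ ×
    (∀ x → InSpan κ x → coords (Dual.l D) x ≡ zeroV) × (∀ x → coords (Dual.l D) x ≡ zeroV → InSpan κ x)
  vertex-basis {e} D = unpack (Dual.l D) (Dual.e D) (Dual.dual D)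
    where
    m : ℕ
    m = suc (suc (suc e))
    unpack : (l : Vec (Lin m) 3) (E : Fam m 3) → (∀ a → coords l (lincomb a E) ≡ a) → ∃ λ (κ : Fam m e) → Independent κ ×
      (∀ x → InSpan κ x → coords l x ≡ zeroV) × (∀ x → coords l x ≡ zeroV → InSpan κ x)
    unpack (l₁ ∷ l₂ ∷ l₃ ∷ []) (e₁ ∷ e₂ ∷ e₃ ∷ []) dual =
      let w₁ , i₁ , to₁ , from₁ = kernel-basis l₁ (basis m) (λ a z → trans (sym (lincomb-basis a)) z) (e₁ , (e₁ , lincomb-basis e₁) , 1≢0 ∘ trans (sym (first (row d₁ (proj₁ (units e₁ e₂ e₃))))))
          w₂ , i₂ , to₂ , from₂ = kernel-basis l₂ w₁ i₁ (e₂ , from₁ e₂ (e₂ , lincomb-basis e₂) (first r₂) , 1≢0 ∘ trans (sym (second r₂)))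
          w₃ , i₃ , to₃ , from₃ = kernel-basis l₃ w₂ i₂ (e₃ , from₂ e₃ (from₁ e₃ (e₃ , lincomb-basis e₃) (first r₃)) (second r₃) , 1≢0 ∘ trans (sym (third r₃)))
      in w₃ , i₃ ,
         (λ x s → let s₂ , z₃ = to₃ x s ; s₁ , z₂ = to₂ x s₂ ; _ , z₁ = to₁ x s₁ in cong₂ _∷_ z₁ (cong₂ _∷_ z₂ (cong (_∷ []) z₃))) ,
         (λ x z → from₃ x (from₂ x (from₁ x (x , lincomb-basis x) (first z)) (second z)) (third z))
      where
      E : Fam m 3
      E = e₁ ∷ e₂ ∷ e₃ ∷ []
      d₁ : coords (l₁ ∷ l₂ ∷ l₃ ∷ []) (lincomb (1F ∷ 0F ∷ 0F ∷ []) E) ≡ 1F ∷ 0F ∷ 0F ∷ []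
      d₁ = dual _
      row : ∀ {a v} → coords (l₁ ∷ l₂ ∷ l₃ ∷ []) (lincomb a E) ≡ a → lincomb a E ≡ v → coords (l₁ ∷ l₂ ∷ l₃ ∷ []) v ≡ a
      row d u = trans (cong (coords (l₁ ∷ l₂ ∷ l₃ ∷ [])) (sym u)) d
      r₂ : coords (l₁ ∷ l₂ ∷ l₃ ∷ []) e₂ ≡ 0F ∷ 1F ∷ 0F ∷ []
      r₂ = row (dual _) (proj₁ (proj₂ (units e₁ e₂ e₃)))
      r₃ : coords (l₁ ∷ l₂ ∷ l₃ ∷ []) e₃ ≡ 0F ∷ 0F ∷ 1F ∷ []
      r₃ = row (dual _) (proj₂ (proj₂ (units e₁ e₂ e₃)))
      first : ∀ {x y z x′ y′ z′ : 𝔽} → _≡_ {A = Vector 3} (x ∷ y ∷ z ∷ []) (x′ ∷ y′ ∷ z′ ∷ []) → x ≡ x′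
      first refl = refl
      second : ∀ {x y z x′ y′ z′ : 𝔽} → _≡_ {A = Vector 3} (x ∷ y ∷ z ∷ []) (x′ ∷ y′ ∷ z′ ∷ []) → y ≡ y′
      second refl = refl
      third : ∀ {x y z x′ y′ z′ : 𝔽} → _≡_ {A = Vector 3} (x ∷ y ∷ z ∷ []) (x′ ∷ y′ ∷ z′ ∷ []) → z ≡ z′
      third refl = refl

  independent-injective : ∀ {m k} (vs : Fam m k) → Independent vs → ∀ a b → lincomb a vs ≡ lincomb b vs → a ≡ b
  independent-injective vs ind a b e = trans (vsolve x₀ ((x₀ ⊕ (⊟ 1F) ⊙ x₁) ⊕ x₁) (λ { (x ∷ y ∷ []) → solve 2 (λ x y → x := (x :+ (:- 𝟙) :* y) :+ y) refl x y }) (a ∷ b ∷ []))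
    (trans (cong (_+V b) (ind (a +V (⊟ 1F) ·V b) (trans (lincomb-+ a _ vs) (trans (cong₂ _+V_ e (lincomb-· (⊟ 1F) b vs))
      (vsolve (x₀ ⊕ (⊟ 1F) ⊙ x₀) ∅ (λ { (x ∷ []) → solve 1 (λ x → x :+ (:- 𝟙) :* x := 𝟎) refl x }) (lincomb b vs ∷ [])))))) (+V-identityˡ b))

  private
    δV : ∀ {m} → Vector m → Vector m → 𝔽
    δV u v = if isYes (u ≟V v) then 1F else 0F

    δV-yes : ∀ {m} {u v : Vector m} → u ≡ v → δV u v ≡ 1F
    δV-yes {u = u} {v} e with u ≟V v
    ... | yes _ = refl
    ... | no n  = ⊥-elim (n e)

    δV-no : ∀ {m} {u v : Vector m} → u ≢ v → δV u v ≡ 0F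
    δV-no {u = u} {v} n with u ≟V v
    ... | yes e = ⊥-elim (n e)
    ... | no _  = refl

    ∑-δV : ∀ {m} (u : Vector m) (g : Vector m → 𝔽) → S.∑ (allVecs m) (λ v → δV v u ⊠ g v) ≡ g u
    ∑-δV {m} u g = trans (S.∑-single u _ (allVecs-unique m) (allVecs-complete u) (λ v n → zero-⊠ (δV-no n))) (trans (cong (_⊠ g u) (δV-yes refl)) (*-identityˡ _))

    ∑-span : ∀ {m k} (vs : Fam m k) → Independent vs → (g : Vector m → 𝔽) → S.∑ (allVecs m) (λ v → spanᶠ vs v ⊠ g v) ≡ S.∑ (allVecs k) (λ a → g (lincomb a vs))
    ∑-span {m} {k} vs ind g = trans (S.∑-cong (allVecs m) (λ v → trans (cong (_⊠ g v) (expand-span v)) (sym (S.∑-⊠ʳ (allVecs k) (g v) _))))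
      (trans (S.∑-swap (allVecs m) (allVecs k) _) (S.∑-cong (allVecs k) (λ a → ∑-δV (lincomb a vs) g)))
      where
      expand-span : ∀ v → spanᶠ vs v ≡ S.∑ (allVecs k) (λ a → δV v (lincomb a vs))
      expand-span v = decide (inSpan? vs v)
        where
        decide : Dec (InSpan vs v) → spanᶠ vs v ≡ S.∑ (allVecs k) (λ a → δV v (lincomb a vs))
        decide (yes (a , e)) = trans (spanᶠ-yes vs (a , e)) (sym (trans (S.∑-single a _ (allVecs-unique k) (allVecs-complete a)
          (λ b n → δV-no (λ f → n (independent-injective vs ind b a (trans (sym f) (sym e)))))) (δV-yes (sym e))))
        decide (no n) = trans (spanᶠ-no vs n) (sym (S.∑-zero (allVecs k) (λ a → δV-no (λ f → n (a , sym f)))))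

  -- Summing over the last coordinate gives a line sum of direction e₃, the same for all values of
  -- the other two; a constant summed over F is zero.
  plane-sum : ∀ {m} (L : Code m) e₁ e₂ e₃ → S.∑ (allVecs 3) (λ a → val L (lincomb a (e₁ ∷ e₂ ∷ e₃ ∷ []))) ≡ 0F
  plane-sum L e₁ e₂ e₃ = trans (S.∑-× _∷_ elems (allVecs 2) _) (S.∑-zero elems (λ a → trans (S.∑-× _∷_ elems (allVecs 1) _)
      (trans (S.∑-cong elems (λ b → trans (S.∑-× _∷_ elems (allVecs 0) _) (trans (S.∑-cong elems (λ c → trans (+-identityʳ _) (cong (val L) (shape a b c)))) (line-sum L (a ·V e₁ +V b ·V e₂) e₃))))
        (∑-constant _))))
    where
    shape : ∀ a b c → a ·V e₁ +V (b ·V e₂ +V (c ·V e₃ +V zeroV)) ≡ a ·V e₁ +V b ·V e₂ +V c ·V e₃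
    shape a b c = vsolve (a ⊙ x₀ ⊕ (b ⊙ x₁ ⊕ (c ⊙ x₂ ⊕ ∅))) (a ⊙ x₀ ⊕ b ⊙ x₁ ⊕ c ⊙ x₂)
      (λ { (x ∷ y ∷ z ∷ []) → solve 6 (λ a b c x y z → a :* x :+ (b :* y :+ (c :* z :+ 𝟎)) := a :* x :+ b :* y :+ c :* z) refl a b c x y z }) (e₁ ∷ e₂ ∷ e₃ ∷ [])

  normalised-nonzero : ∀ {m} (v : Vector m) → T (normalised v) → v ≢ zeroV
  normalised-nonzero (x ∷ xs) t refl = normalised-nonzero xs (subst T (norm-0 xs) t) refl

  module Cone {e} (c : Word (suc (suc e))) (L : Code (suc (suc (suc e)))) (eq : ∀ P → J (c P) ≡ val L (vec P))
      (D : Dual (suc (suc (suc e))) 3) (cone : ∀ v → val L v ≡ val L (Dual.proj D v)) where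
    private
      m : ℕ
      m = suc (suc (suc e))
      f : Vector m → 𝔽
      f = val L

    π : Fam m 3
    π = Dual.e D

    plane : Independent π
    plane = dual-independent D

    private
      vertex = vertex-basis D

    κ : Fam m e
    κ = proj₁ vertex

    κ-independent : Independent κ
    κ-independent = proj₁ (proj₂ vertex)

    private
      κ⁻ : ∀ x → InSpan κ x → coords (Dual.l D) x ≡ zeroV
      κ⁻ = proj₁ (proj₂ (proj₂ vertex))

      κ⁺ : ∀ x → coords (Dual.l D) x ≡ zeroV → InSpan κ x
      κ⁺ = proj₂ (proj₂ (proj₂ vertex))

    disjoint : DisjointSpaces π κ
    disjoint ((v , t) , (a , e) , s) = normalised-nonzero v t (trans (sym e) (trans (cong (λ b → lincomb b π) (trans (sym (Dual.dual D a)) (trans (cong (coords (Dual.l D)) e) (κ⁻ v s)))) (lincomb-zero π)))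

    module _ (y : Vector m) where
      private
        b : Vector 3
        b = coords (Dual.l D) y

        h : Vector m → 𝔽
        h v = spanᶠ π v ⊠ (f v ⊠ spanᶠ (v ∷ κ) y)

        join⁻ : ∀ v → InSpan (v ∷ κ) y → ∃ λ s → b ≡ s ·V coords (Dual.l D) v
        join⁻ v (s ∷ a , refl) = s , trans (coords-+ (Dual.l D) _ _) (trans (cong₂ _+V_ (coords-· (Dual.l D) s v) (κ⁻ _ (a , refl))) (+V-identityʳ _))

        join⁺ : ∀ v s → b ≡ s ·V coords (Dual.l D) v → InSpan (v ∷ κ) y
        join⁺ v s z = s ∷ proj₁ rest , trans (cong (s ·V v +V_) (proj₂ rest)) (vsolve (s ⊙ x₀ ⊕ (x₁ ⊕ (⊟ s) ⊙ x₀)) x₁ (λ { (x ∷ y ∷ []) → solve 3 (λ s x y → s :* x :+ (y :+ (:- s) :* x) := y) refl s x y }) (v ∷ y ∷ []))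
          where
          rest : InSpan κ (y +V (⊟ s) ·V v)
          rest = κ⁺ (y +V (⊟ s) ·V v) (trans (coords-+ (Dual.l D) _ _) (trans (cong₂ _+V_ z (coords-· (Dual.l D) (⊟ s) v))
            (vsolve (s ⊙ x₀ ⊕ (⊟ s) ⊙ x₀) ∅ (λ { (x ∷ []) → solve 2 (λ s x → s :* x :+ (:- s) :* x := 𝟎) refl s x }) (coords (Dual.l D) v ∷ []))))

        h-homogeneous : Homogeneous h
        h-homogeneous {t} v t≢0 = cong₂ _⊠_ (spanᶠ-cong π π (λ { (a , z) → t ⁻¹ ·V a , trans (lincomb-· _ a π) (trans (cong (t ⁻¹ ·V_) z) (·V-cancel t≢0 v)) }) (λ { (a , z) → t ·V a , trans (lincomb-· t a π) (cong (t ·V_) z) }))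
          (cong₂ _⊠_ (val-scale L v t≢0) (spanᶠ-cong (t ·V v ∷ κ) (v ∷ κ)
            (λ { (s ∷ a , z) → s ⊠ t ∷ a , trans (cong (_+V lincomb a κ) (sym (·V-assoc s t v))) z })
            (λ { (s ∷ a , z) → s ⊠ t ⁻¹ ∷ a , trans (cong (_+V lincomb a κ) (trans (·V-assoc _ t v) (cong (_·V v) (trans (*-assoc s _ t) (trans (cong (s ⊠_) (inv-⊠ t≢0)) (*-identityʳ s)))))) z })))

        total : S.∑ (norms m) h ≡ h zeroV ⊞ ⊟ S.∑ (allVecs 3) (λ a → f (lincomb a π) ⊠ spanᶠ (lincomb a π ∷ κ) y)
        total = trans (solve 2 (λ n x → n := x :+ :- (x :+ :- n)) refl (S.∑ (norms m) h) (h zeroV)) (cong (λ z → h zeroV ⊞ ⊟ z)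
          (trans (cong (h zeroV ⊞_) (sym (∑⁺-constant _))) (trans (sym (HomogeneousSum.∑-allVecs +-isCommutativeMonoid m h h-homogeneous)) (∑-span π plane _))))

        span-0 : spanᶠ π zeroV ≡ 1F
        span-0 = spanᶠ-yes π (zeroV , lincomb-zero π)

        coords-0 : coords (Dual.l D) zeroV ≡ zeroV
        coords-0 = trans (cong (coords (Dual.l D)) (sym (0·V zeroV))) (trans (coords-· (Dual.l D) 0F zeroV) (0·V _))

        -- For y in the vertex every join with κ contains y, and the sum over the plane is zero; the
        -- value at the origin remains.
        in-vertex : b ≡ zeroV → S.∑ (norms m) h ≡ f y
        in-vertex z = trans total (trans (cong₂ (λ u w → u ⊞ ⊟ w) at-0 (trans (S.∑-cong (allVecs 3) (λ a → trans (cong (f (lincomb a π) ⊠_) (all (lincomb a π))) (*-identityʳ _))) plane-zero))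
            (trans (solve 1 (λ x → x :+ :- 𝟎 := x) refl (f zeroV)) (sym (trans (cone y) (cong f (trans (cong (λ a → lincomb a π) z) (lincomb-zero π)))))))
          where
          all : ∀ v → spanᶠ (v ∷ κ) y ≡ 1F
          all v = spanᶠ-yes (v ∷ κ) (join⁺ v 0F (trans z (sym (0·V _))))
          at-0 : h zeroV ≡ f zeroV
          at-0 = trans (cong₂ (λ u w → u ⊠ (f zeroV ⊠ w)) span-0 (all zeroV)) (solve 1 (λ x → 𝟙 :* (x :* 𝟙) := x) refl (f zeroV))
          plane-zero : S.∑ (allVecs 3) (λ a → f (lincomb a π)) ≡ 0F
          plane-zero = go π
            where
            go : (E : Fam m 3) → S.∑ (allVecs 3) (λ a → f (lincomb a E)) ≡ 0F
            go (e₁ ∷ e₂ ∷ e₃ ∷ []) = plane-sum L e₁ e₂ e₃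

        -- Exactly the nonzero multiples of the projection of y have a join with κ through y. The
        -- word takes one value on them, and q - 1 copies of it give its negative.
        off-vertex : b ≢ zeroV → S.∑ (norms m) h ≡ f y
        off-vertex b≢0 = trans total (trans (cong₂ (λ u w → u ⊞ ⊟ w) at-0 sum-all) (trans (solve 1 (λ x → 𝟎 :+ :- (:- x) := x) refl (f (lincomb b π))) (sym (cone y))))
          where
          at-0 : h zeroV ≡ 0F
          at-0 = ⊠-zero (⊠-zero (spanᶠ-no (zeroV ∷ κ) (λ s → let t , w = join⁻ zeroV s in b≢0 (trans w (trans (cong (t ·V_) coords-0) (·V-zeroʳ t))))))
          pointwise : ∀ a → f (lincomb a π) ⊠ spanᶠ (lincomb a π ∷ κ) y ≡ S.∑ elems⁺ (λ t → δV a (t ·V b) ⊠ f (lincomb b π))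
          pointwise a = decide (inSpan? (lincomb a π ∷ κ) y)
            where
            scalar : ∀ s t → s ·V b ≡ t ·V b → s ≡ t
            scalar s t z = let k , kb = separating b b≢0 in sub-zero⇒≡ s t (⊠-integral kb (trans (solve 3 (λ s t x → x :* (s :+ :- t) := s :* x :+ :- (t :* x)) refl s t (ap k b))
              (trans (cong (_⊞ ⊟ (t ⊠ ap k b)) (trans (sym (ap-· k s b)) (trans (cong (ap k) z) (ap-· k t b)))) (-‿inverseʳ _))))
            decide : Dec (InSpan (lincomb a π ∷ κ) y) → _
            decide (yes sp) = trans (cong₂ _⊠_ (trans (cong (λ x → f (lincomb x π)) a≡) (trans (cong f (lincomb-· (s ⁻¹) b π)) (val-scale L (lincomb b π) (inv-nonzero s≢0)))) (spanᶠ-yes (lincomb a π ∷ κ) sp))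
                (trans (*-identityʳ _) (sym (trans (S.∑-single∈ (s ⁻¹) _ elems⁺-unique (elems⁺-complete (inv-nonzero s≢0)) (λ {t} _ t≢ → zero-⊠ (δV-no (λ z → t≢ (scalar t (s ⁻¹) (trans (sym z) a≡))))))
                  (trans (cong (_⊠ f (lincomb b π)) (δV-yes a≡)) (*-identityˡ _)))))
              where
              s : 𝔽
              s = proj₁ (join⁻ (lincomb a π) sp)
              b≡sa : b ≡ s ·V a
              b≡sa = trans (proj₂ (join⁻ (lincomb a π) sp)) (cong (s ·V_) (Dual.dual D a))
              s≢0 : s ≢ 0F
              s≢0 z = b≢0 (trans b≡sa (trans (cong (_·V a) z) (0·V a)))
              a≡ : a ≡ s ⁻¹ ·V b
              a≡ = trans (sym (·V-cancel s≢0 a)) (cong (s ⁻¹ ·V_) (sym b≡sa))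
            decide (no n) = trans (⊠-zero (spanᶠ-no (lincomb a π ∷ κ) n)) (sym (trans (S.∑-cong∈ elems⁺ (λ {t} t∈ → zero-⊠ (δV-no (λ z → n (join⁺ (lincomb a π) (t ⁻¹)
              (trans (sym (·V-cancel (elems⁺-nonzero t∈) b)) (cong (t ⁻¹ ·V_) (trans (sym z) (sym (Dual.dual D a)))))))))) (S.∑-ε elems⁺)))
          sum-all : S.∑ (allVecs 3) (λ a → f (lincomb a π) ⊠ spanᶠ (lincomb a π ∷ κ) y) ≡ ⊟ f (lincomb b π)
          sum-all = trans (S.∑-cong (allVecs 3) pointwise) (trans (S.∑-swap (allVecs 3) elems⁺ _) (trans (S.∑-cong elems⁺ (λ t → ∑-δV (t ·V b) (λ _ → f (lincomb b π)))) (∑⁺-constant _)))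

      vector-formula : S.∑ (norms m) (λ v → spanᶠ π v ⊠ (f v ⊠ spanᶠ (v ∷ κ) y)) ≡ f y
      vector-formula = decide (b ≟V zeroV)
        where
        decide : Dec (b ≡ zeroV) → S.∑ (norms m) h ≡ f y
        decide (yes z) = in-vertex z
        decide (no n)  = off-vertex n

    formula : ∀ Q → c Q ≡ sumOverPlane c π κ Q
    formula Q = J-injective (sym (trans (J-mod _) (trans (ι-sum (filterᵇ (λ P → inSpanᵇ π (vec P)) (allPoints (suc (suc e)))) _)
      (trans (S.∑-filter (λ P → T? (inSpanᵇ π (vec P))) (allPoints (suc (suc e))) _ {g = λ P → spanᶠ π (vec P) ⊠ (f (vec P) ⊠ spanᶠ (vec P ∷ κ) (vec Q))} on off)
        (trans (HomogeneousSum.∑-points +-isCommutativeMonoid (suc (suc e)) (λ v → spanᶠ π v ⊠ (f v ⊠ spanᶠ (v ∷ κ) (vec Q)))) (trans (vector-formula (vec Q)) (sym (eq Q))))))))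
      where
      on : ∀ P → T (inSpanᵇ π (vec P)) → ι (toℕ (c P) * χ (vec P ∷ κ) Q) ≡ spanᶠ π (vec P) ⊠ (f (vec P) ⊠ spanᶠ (vec P ∷ κ) (vec Q))
      on P t = trans (ι-* (toℕ (c P)) _) (trans (cong (_⊠ spanᶠ (vec P ∷ κ) (vec Q)) (eq P)) (sym (trans (cong (λ z → z ⊠ (f (vec P) ⊠ spanᶠ (vec P ∷ κ) (vec Q))) (spanᶠ-yes π (inSpanᵇ⁻ π t))) (*-identityˡ _))))
      off : ∀ P → ¬ T (inSpanᵇ π (vec P)) → spanᶠ π (vec P) ⊠ (f (vec P) ⊠ spanᶠ (vec P ∷ κ) (vec Q)) ≡ 0F
      off P n = zero-⊠ (spanᶠ-no π (n ∘ inSpanᵇ⁺ π))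

-- Recognising the three types

module Types (F : FiniteField) (p : ℕ) (pr : Prime p) (char : FiniteField.ι F p ≡ FiniteField.0# F) where
  open Cones F p pr char public
  open Geometry F using (search)
  open Solver using (solve; _:=_; _:+_; _:*_; :-_; 𝟎; 𝟙)

  Conclusion : ∀ {e} → Word (suc (suc e)) → Set
  Conclusion {e} c = ∃ λ (π : Fam (suc (suc (suc e))) 3) → Independent π × (TypeOdd c π ⊎ TypeTriangle c π ⊎ TypeStar c π)
    × ∃ λ (κ : Fam (suc (suc (suc e))) e) → Independent κ × DisjointSpaces π κ × (∀ Q → c Q ≡ sumOverPlane c π κ Q)

  conclude : ∀ {e} (c : Word (suc (suc e))) (L : Code (suc (suc (suc e)))) → (∀ P → J (c P) ≡ val L (vec P)) →
    (D : Dual (suc (suc (suc e))) 3) → (∀ v → val L v ≡ val L (Dual.proj D v)) → TypeOdd c (Dual.e D) ⊎ TypeTriangle c (Dual.e D) ⊎ TypeStar c (Dual.e D) → Conclusion c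
  conclude c L eq D cone type = π , plane , type , κ , κ-independent , disjoint , formula
    where open Cone c L eq D cone

  -- A dual system through which the three functionals factor provides π; each kernel cuts π in a
  -- line, and a search for a common point decides between triangle and star.
  combination⇒conclusion : ∀ {e} (c : Word (suc (suc e))) (L : Code (suc (suc (suc e)))) → (∀ P → J (c P) ≡ val L (vec P)) → Combination Prime𝔽 (val L) → Conclusion c
  combination⇒conclusion {e} c L eq C = build (factor-three (s≤s (s≤s (s≤s z≤n))) k₁ k₂ k₃)
    where
    open Combination C
    m : ℕ
    m = suc (suc (suc e))
    build : (∃ λ (D : Dual m 3) → Dual.Factors D k₁ × Dual.Factors D k₂ × Dual.Factors D k₃) → Conclusion c
    build (D , F₁ , F₂ , F₃) = conclude c L eq D cone (inj₂ (decide (Any.any? concurrent? (allVecs m))))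
      where
      π : Fam m 3
      π = Dual.e D
      cone : ∀ v → val L v ≡ val L (Dual.proj D v)
      cone v = trans (formula v) (trans (cong₂ (λ x y → λ₁ ⊠ δ x ⊞ y) (Dual.factors-proj D {k₁} F₁ v)
        (cong₂ (λ x y → λ₂ ⊠ δ x ⊞ λ₃ ⊠ δ y) (Dual.factors-proj D {k₂} F₂ v) (Dual.factors-proj D {k₃} F₃ v))) (sym (formula (Dual.proj D v))))
      LineOf : Lin m → Set
      LineOf k = ∃ λ (ℓ : Fam m 2) → Independent ℓ × (∀ x → InSpan ℓ x → InSpan π x × ap k x ≡ 0F) × (∀ x → InSpan π x → ap k x ≡ 0F → InSpan ℓ x)
      line : ∀ k → Nonzero k → Dual.Factors D k → LineOf k
      line k (w , n) Fk = kernel-basis k π (dual-independent D) (Dual.proj D w , (coords (Dual.l D) w , refl) , n ∘ trans (Dual.factors-proj D {k} Fk w))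
      L₁ : LineOf k₁
      L₁ = line k₁ nonzero₁ F₁
      L₂ : LineOf k₂
      L₂ = line k₂ nonzero₂ F₂
      L₃ : LineOf k₃
      L₃ = line k₃ nonzero₃ F₃
      ℓ₁ ℓ₂ ℓ₃ : Fam m 2
      ℓ₁ = proj₁ L₁
      ℓ₂ = proj₁ L₂
      ℓ₃ = proj₁ L₃
      isLine : ∀ {k} (ℓ : LineOf k) → Independent (proj₁ ℓ) × (∀ P → InSpan (proj₁ ℓ) (vec {suc (suc e)} P) → InSpan π (vec P))
      isLine (_ , ind , to , _) = ind , λ P s → proj₁ (to (vec P) s)
      indicator : ∀ {k} (ℓ : LineOf k) v → InSpan π v → spanᶠ (proj₁ ℓ) v ≡ δ (ap k v)
      indicator {k} (ℓ , _ , to , from) v s = zero-or-not (ap k v) (λ n → trans (spanᶠ-no ℓ (n ∘ proj₂ ∘ to v)) (sym (δ-no n))) (λ z → trans (spanᶠ-yes ℓ (from v s z)) (sym (δ-yes z)))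
      combination : CombOfLines c π ℓ₁ ℓ₂ ℓ₃
      combination = proj₁ a₁ , proj₁ a₂ , proj₁ a₃ , λ P s → J-injective (trans (eq P) (trans (formula (vec P)) (sym (trans (J-mod _)
          (trans (trans (ι-+ (x₁′ P + x₂′ P) (x₃′ P)) (cong (_⊞ ι (x₃′ P)) (ι-+ (x₁′ P) (x₂′ P))))
            (trans (+-assoc _ _ _) (cong₂ _⊞_ (term {k = k₁} a₁ L₁ P s) (cong₂ _⊞_ (term {k = k₂} a₂ L₂ P s) (term {k = k₃} a₃ L₃ P s)))))))))
        where
        a₁ : ∃ λ a → J a ≡ λ₁
        a₁ = Prime𝔽⇒J λ₁∈
        a₂ : ∃ λ a → J a ≡ λ₂
        a₂ = Prime𝔽⇒J λ₂∈
        a₃ : ∃ λ a → J a ≡ λ₃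
        a₃ = Prime𝔽⇒J λ₃∈
        x₁′ x₂′ x₃′ : Point (suc (suc e)) → ℕ
        x₁′ P = toℕ (proj₁ a₁) * χ ℓ₁ P
        x₂′ P = toℕ (proj₁ a₂) * χ ℓ₂ P
        x₃′ P = toℕ (proj₁ a₃) * χ ℓ₃ P
        term : ∀ {x k} (a : ∃ λ a → J a ≡ x) (ℓ : LineOf k) P → InSpan π (vec P) → ι (toℕ (proj₁ a) * χ (proj₁ ℓ) P) ≡ x ⊠ δ (ap k (vec P))
        term {k = k} (a , ja) ℓ P s = trans (ι-* (toℕ a) _) (cong₂ _⊠_ ja (indicator {k} ℓ (vec P) s))
      concurrent? : ∀ v → Dec (T (normalised v) × InSpan ℓ₁ v × InSpan ℓ₂ v × InSpan ℓ₃ v)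
      concurrent? v = T? (normalised v) ×-dec inSpan? ℓ₁ v ×-dec inSpan? ℓ₂ v ×-dec inSpan? ℓ₃ v
      decide : Dec (Any (λ v → T (normalised v) × InSpan ℓ₁ v × InSpan ℓ₂ v × InSpan ℓ₃ v) (allVecs m)) → TypeTriangle c π ⊎ TypeStar c π
      decide (yes any) = let v , _ , t , s = find any in inj₂ (ℓ₁ , ℓ₂ , ℓ₃ , isLine {k₁} L₁ , isLine {k₂} L₂ , isLine {k₃} L₃ , ((v , t) , s) , combination)
      decide (no none) = inj₁ (ℓ₁ , ℓ₂ , ℓ₃ , isLine {k₁} L₁ , isLine {k₂} L₂ , isLine {k₃} L₃ , (λ { ((v , t) , s) → none (lose (allVecs-complete v) (t , s)) }) , combination)

  normalise : ∀ {m} (v : Vector m) → v ≢ zeroV → ∃ λ t → t ≢ 0F × T (normalised (t ·V v))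
  normalise []       n = ⊥-elim (n refl)
  normalise (x ∷ xs) n = zero-or-not x (λ x≢0 → x ⁻¹ , inv-nonzero x≢0 , subst T (sym (trans (cong (λ y → normalised (y ∷ x ⁻¹ ·V xs)) (inv-⊠ x≢0)) (norm-1 _))) _)
    (λ x≡0 → let t , t≢0 , nt = normalise xs (n ∘ cong₂ _∷_ x≡0) in t , t≢0 , subst T (sym (trans (cong (λ y → normalised (y ∷ t ·V xs)) (⊠-zero x≡0)) (norm-0 _))) nt)

  normalised-head : ∀ {m} x (xs : Vector m) → T (normalised (x ∷ xs)) → x ≢ 0F → x ≡ 1F
  normalised-head x xs t n with x ≟F 1F
  ... | yes e = e
  ... | no n′ = ⊥-elim (subst T (norm-other xs n n′) t)

  normalised-tail : ∀ {m x} (xs : Vector m) → T (normalised (x ∷ xs)) → x ≡ 0F → T (normalised xs)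
  normalised-tail xs t refl = subst T (norm-0 xs) t

  normalised-scale : ∀ {m s} (v : Vector m) → s ≢ 0F → T (normalised v) → T (normalised (s ·V v)) → s ≡ 1F
  normalised-scale {s = s} (x ∷ xs) s≢0 t t′ = zero-or-not x
    (λ n → trans (sym (*-identityʳ s)) (trans (cong (s ⊠_) (sym (normalised-head x xs t n))) (normalised-head (s ⊠ x) _ t′ (⊠-nonzero s≢0 n))))
    (λ z → normalised-scale xs s≢0 (normalised-tail xs t z) (normalised-tail (s ·V xs) t′ (⊠-zero z)))

  proportional⇒≡ : ∀ {m s} (P Q : Point m) → s ≢ 0F → vec P ≡ s ·V vec Q → P ≡ Q
  proportional⇒≡ {s = s} (u , t) (v , t′) s≢0 e = same (trans e (trans (cong (_·V v) (normalised-scale v s≢0 t′ (subst (T ∘ normalised) e t))) (1·V v))) t t′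
    where
    same : ∀ {u v} → u ≡ v → (t : T (normalised u)) (t′ : T (normalised v)) → _≡_ {A = Point _} (u , t) (v , t′)
    same refl t t′ = cong (_ ,_) (T-irrelevant t t′)

  independent-scale : ∀ {m a b c} {u v w : Vector m} → a ≢ 0F → b ≢ 0F → c ≢ 0F → Independent (u ∷ v ∷ w ∷ []) → Independent (a ·V u ∷ b ·V v ∷ c ·V w ∷ [])
  independent-scale {a = a} {b} {c} {u} {v} {w} a≢0 b≢0 c≢0 ind (α ∷ β ∷ γ ∷ []) z =
    components (ind (α ⊠ a ∷ β ⊠ b ∷ γ ⊠ c ∷ []) (trans (cong₂ _+V_ (sym (·V-assoc α a u)) (cong₂ _+V_ (sym (·V-assoc β b v)) (cong (_+V zeroV) (sym (·V-assoc γ c w))))) z))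
    where
    cancel : ∀ {x y} → y ≢ 0F → x ⊠ y ≡ 0F → x ≡ 0F
    cancel n e = ⊠-integral n (trans (*-comm _ _) e)
    components : _≡_ {A = Vector 3} (α ⊠ a ∷ β ⊠ b ∷ γ ⊠ c ∷ []) zeroV → _≡_ {A = Vector 3} (α ∷ β ∷ γ ∷ []) zeroV
    components e = let e₁ , r₁ = Vec.∷-injective e ; e₂ , r₂ = Vec.∷-injective r₁ ; e₃ , _ = Vec.∷-injective r₂ in
      cong₂ _∷_ (cancel a≢0 e₁) (cong₂ _∷_ (cancel b≢0 e₂) (cong (_∷ []) (cancel c≢0 e₃)))

  -- x ↦ ⟨x₀E₁ + x₁E₂ + x₂E₃⟩ is a collineation from PG(2,q) onto the plane spanned by E.
  module Frame {m} (E : Fam (suc m) 3) (ind : Independent E) where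
    private
      lift : ∀ (x : Point 2) → ∃ λ t → t ≢ 0F × T (normalised (t ·V lincomb (vec x) E))
      lift x = normalise (lincomb (vec x) E) (λ z → normalised-nonzero (vec x) (proj₂ x) (ind (vec x) z))

      s : Point 2 → 𝔽
      s x = proj₁ (lift x)

    φ : Point 2 → Point m
    φ x = s x ·V lincomb (vec x) E , proj₂ (proj₂ (lift x))

    φ-scale : ∀ x → ∃ λ t → t ≢ 0F × vec (φ x) ≡ t ·V lincomb (vec x) E
    φ-scale x = s x , proj₁ (proj₂ (lift x)) , refl

    private
      s≢0 : ∀ x → s x ≢ 0F
      s≢0 x = proj₁ (proj₂ (lift x))

      compose : ∀ (α β γ : 𝔽) (x y z : Vector 3) → lincomb (α ∷ β ∷ γ ∷ []) (lincomb x E ∷ lincomb y E ∷ lincomb z E ∷ []) ≡ lincomb (lincomb (α ∷ β ∷ γ ∷ []) (x ∷ y ∷ z ∷ [])) E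
      compose α β γ x y z = sym (trans (lincomb-+ (α ·V x) (β ·V y +V (γ ·V z +V zeroV)) E) (cong₂ _+V_ (lincomb-· α x E) (trans (lincomb-+ (β ·V y) (γ ·V z +V zeroV) E) (cong₂ _+V_ (lincomb-· β y E)
        (trans (lincomb-+ (γ ·V z) zeroV E) (cong₂ _+V_ (lincomb-· γ z E) (lincomb-zero E)))))))

      map-independent : ∀ {x y z} → Independent (x ∷ y ∷ z ∷ []) → Independent (lincomb x E ∷ lincomb y E ∷ lincomb z E ∷ [])
      map-independent {x} {y} {z} i (α ∷ β ∷ γ ∷ []) e = i (α ∷ β ∷ γ ∷ []) (ind _ (trans (sym (compose α β γ x y z)) e))

      unmap-independent : ∀ {x y z} → Independent (lincomb x E ∷ lincomb y E ∷ lincomb z E ∷ []) → Independent (x ∷ y ∷ z ∷ [])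
      unmap-independent {x} {y} {z} i (α ∷ β ∷ γ ∷ []) e = i (α ∷ β ∷ γ ∷ []) (trans (compose α β γ x y z) (trans (cong (λ a → lincomb a E) e) (lincomb-zero E)))

      unscale : ∀ {x y z} → Independent (vec (φ x) ∷ vec (φ y) ∷ vec (φ z) ∷ []) → Independent (lincomb (vec x) E ∷ lincomb (vec y) E ∷ lincomb (vec z) E ∷ [])
      unscale {x} {y} {z} i = subst Independent (cong₂ _∷_ (·V-cancel (s≢0 x) _) (cong₂ _∷_ (·V-cancel (s≢0 y) _) (cong (_∷ []) (·V-cancel (s≢0 z) _))))
        (independent-scale (inv-nonzero (s≢0 x)) (inv-nonzero (s≢0 y)) (inv-nonzero (s≢0 z)) i)

    collineation : IsCollineationOnto φ E
    collineation = injective , (λ x → s x ·V vec x , lincomb-· (s x) (vec x) E) , onto ,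
      λ x y z → (λ n i → n (unmap-independent (unscale {x} {y} {z} i))) , (λ n i → n (independent-scale (s≢0 x) (s≢0 y) (s≢0 z) (map-independent i)))
      where
      injective : ∀ x y → φ x ≡ φ y → x ≡ y
      injective x y e = proportional⇒≡ x y (⊠-nonzero (inv-nonzero (s≢0 x)) (s≢0 y)) (trans (sym (·V-cancel (s≢0 x) (vec x)))
        (trans (cong (s x ⁻¹ ·V_) (independent-injective E ind (s x ·V vec x) (s y ·V vec y) (trans (lincomb-· (s x) (vec x) E) (trans (cong vec e) (sym (lincomb-· (s y) (vec y) E)))))) (·V-assoc _ _ _)))
      onto : ∀ P → P ∈ₛ E → ∃ λ x → φ x ≡ P
      onto P (a , e) = x , proportional⇒≡ (φ x) P (⊠-nonzero (s≢0 x) (proj₁ (proj₂ na)))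
          (trans (cong (s x ·V_) (trans (lincomb-· _ a E) (cong (proj₁ na ·V_) e))) (·V-assoc _ _ _))
        where
        na : ∃ λ t → t ≢ 0F × T (normalised (t ·V a))
        na = normalise a (λ z → normalised-nonzero (vec P) (proj₂ P) (trans (sym e) (trans (cong (λ b → lincomb b E) z) (lincomb-zero E))))
        x : Point 2
        x = proj₁ na ·V a , proj₂ (proj₂ na)

  -- This bound makes `p ∸ toFp x` in `c₀` a true difference.
  search≤ : ∀ k x → search k x ≤ k
  search≤ zero    x = z≤n
  search≤ (suc k) x with ι k ≟F x
  ... | yes _ = ℕ.n≤1+n k
  ... | no _  = ℕ.m≤n⇒m≤1+n (search≤ k x)

  ι-search : ∀ k x → (∃ λ j → j < k × x ≡ ι j) → ι (search k x) ≡ x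
  ι-search (suc k) x (j , s≤s j≤k , e) with ι k ≟F x
  ... | yes f = f
  ... | no n  = ι-search k x (j , ℕ.≤∧≢⇒< j≤k (λ { refl → n (sym e) }) , e)

  private
    ≈-yes : ∀ {x y} → x ≡ y → ι [ x ≈ y ] ≡ 1F
    ≈-yes {x} {y} e with x ≟F y
    ... | yes _ = +-identityʳ 1F
    ... | no n  = ⊥-elim (n e)

    ≈-no : ∀ {x y} → x ≢ y → ι [ x ≈ y ] ≡ 0F
    ≈-no {x} {y} n with x ≟F y
    ... | yes e = ⊥-elim (n e)
    ... | no _  = refl

    c₀-axis : ∀ {x₀ x₁ x₂ t} → x₀ ≡ 0F → x₁ ≡ 0F → c₀ ((x₀ ∷ x₁ ∷ x₂ ∷ []) , t) ≡ 0
    c₀-axis {x₀} {x₁} e₀ e₁ with x₀ ≟F 0F | x₀ ≟F 1F | x₁ ≟F 0F | x₁ ≟F 1F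
    ... | yes _ | _     | _     | yes e = ⊥-elim (1≢0 (trans (sym e) e₁))
    ... | yes _ | yes _ | yes _ | no _ = refl
    ... | yes _ | yes _ | no _  | no _ = refl
    ... | yes _ | no _  | yes _ | no _ = refl
    ... | yes _ | no _  | no _  | no _ = refl
    ... | no n  | _     | _     | _    = ⊥-elim (n e₀)

    c₀-first : ∀ {x₀ x₁ x₂ t} → x₀ ≡ 0F → x₁ ≡ 1F → c₀ ((x₀ ∷ x₁ ∷ x₂ ∷ []) , t) ≡ toFp x₂
    c₀-first {x₀} {x₁} e₀ e₁ with x₀ ≟F 0F | x₀ ≟F 1F | x₁ ≟F 0F | x₁ ≟F 1F
    ... | yes _ | yes _ | yes _ | yes _ = refl
    ... | yes _ | yes _ | no _  | yes _ = refl
    ... | yes _ | no _  | yes _ | yes _ = refl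
    ... | yes _ | no _  | no _  | yes _ = refl
    ... | yes _ | _     | _     | no n = ⊥-elim (n e₁)
    ... | no n  | _     | _     | _    = ⊥-elim (n e₀)

    c₀-second : ∀ {x₀ x₁ x₂ t} → x₀ ≡ 1F → x₁ ≡ 0F → c₀ ((x₀ ∷ x₁ ∷ x₂ ∷ []) , t) ≡ toFp x₂
    c₀-second {x₀} {x₁} e₀ e₁ with x₀ ≟F 0F | x₀ ≟F 1F | x₁ ≟F 0F | x₁ ≟F 1F
    ... | yes e | _     | _     | _     = ⊥-elim (1≢0 (trans (sym e₀) e))
    ... | no _  | no n  | _     | _     = ⊥-elim (n e₀)
    ... | no _  | yes _ | no n  | _     = ⊥-elim (n e₁)
    ... | no _  | yes _ | yes _ | yes _ = refl
    ... | no _  | yes _ | yes _ | no _  = refl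

    c₀-third : ∀ {x₀ x₁ x₂ t} → x₀ ≡ 1F → x₁ ≡ 1F → c₀ ((x₀ ∷ x₁ ∷ x₂ ∷ []) , t) ≡ p ∸ toFp x₂
    c₀-third {x₀} {x₁} e₀ e₁ with x₀ ≟F 0F | x₀ ≟F 1F | x₁ ≟F 0F | x₁ ≟F 1F
    ... | yes e | _     | _     | _     = ⊥-elim (1≢0 (trans (sym e₀) e))
    ... | no _  | no n  | _     | _     = ⊥-elim (n e₀)
    ... | no _  | yes _ | yes e | _     = ⊥-elim (1≢0 (trans (sym e₁) e))
    ... | no _  | yes _ | no _  | no n  = ⊥-elim (n e₁)
    ... | no _  | yes _ | no _  | yes _ = refl

    c₀-off : ∀ {x₀ x₁ x₂ t} → x₀ ≡ 1F → x₁ ≢ 0F → x₁ ≢ 1F → c₀ ((x₀ ∷ x₁ ∷ x₂ ∷ []) , t) ≡ 0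
    c₀-off {x₀} {x₁} e₀ n₁ n₂ with x₀ ≟F 0F | x₀ ≟F 1F | x₁ ≟F 0F | x₁ ≟F 1F
    ... | yes e | _     | _     | _     = ⊥-elim (1≢0 (trans (sym e₀) e))
    ... | no _  | no n  | _     | _     = ⊥-elim (n e₀)
    ... | no _  | yes _ | yes e | _     = ⊥-elim (n₁ e)
    ... | no _  | yes _ | no _  | yes e = ⊥-elim (n₂ e)
    ... | no _  | yes _ | no _  | no _  = refl

  -- The functionals K₁, K₂ and l serve as X₀, X₁ and X₂. The scalar γ is 1 because l is read off
  -- from the word itself.
  odd⇒conclusion : ∀ {e} (c : Word (suc (suc e))) (L : Code (suc (suc (suc e)))) → (∀ P → J (c P) ≡ val L (vec P)) → p ≢ 2 → OddForm (val L) → Conclusion c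
  odd⇒conclusion {e} c L eq p≢2 O = conclude c L eq D cone (inj₁ (q≡p , p≢2 , φ , collineation , proj₁ γ , γ≢0 , proj₁ a₁ , proj₁ a₂ , proj₁ a₃ , value))
    where
    open OddForm O
    open PencilForm form
    m : ℕ
    m = suc (suc (suc e))
    D : Dual m 3
    D = record { l = K₁ ∷ K₂ ∷ l ∷ [] ; e = E₁ ∷ E₂ ∷ E₃ ∷ [] ; dual = dual }
    E : Fam m 3
    E = E₁ ∷ E₂ ∷ E₃ ∷ []
    open Frame E (dual-independent D)

    coordinates : ∀ {x y z : 𝔽} {v} → coords (K₁ ∷ K₂ ∷ l ∷ []) v ≡ x ∷ y ∷ z ∷ [] → ap K₁ v ≡ x × ap K₂ v ≡ y × ap l v ≡ z
    coordinates e = let e₁ , r₁ = Vec.∷-injective e ; e₂ , r₂ = Vec.∷-injective r₁ ; e₃ , _ = Vec.∷-injective r₂ in e₁ , e₂ , e₃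

    -- Every clause of the pencil form involves only these three coordinates, which is why the word
    -- is a cone over the plane.
    determined : ∀ u v → ap K₁ u ≡ ap K₁ v → ap K₂ u ≡ ap K₂ v → ap l u ≡ ap l v → val L u ≡ val L v
    determined u v e₁ e₂ e₃ = zero-or-not (ap K₁ v)
      (λ n₁ → zero-or-not (ap K₂ v)
        (λ n₂ → zero-or-not (ap K₁ v ⊞ ⊟ ap K₂ v)
          (λ n → trans (off u (n₁ ∘ trans (sym e₁)) (n₂ ∘ trans (sym e₂)) (λ f → unequal n (trans (sym e₁) (trans f e₂)))) (sym (off v n₁ n₂ (unequal n))))
          (λ z → trans (on-third u (n₁ ∘ trans (sym e₁)) (trans e₁ (trans (sub-zero⇒≡ _ _ z) (sym e₂)))) (trans (cong₂ (λ x y → h₀ ⊞ ⊟ (x ⁻¹ ⊠ y)) e₁ e₃) (sym (on-third v n₁ (sub-zero⇒≡ _ _ z))))))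
        (λ z₂ → trans (on-second u (n₁ ∘ trans (sym e₁)) (trans e₂ z₂)) (trans (cong₂ (λ x y → g₀ ⊞ x ⁻¹ ⊠ y) e₁ e₃) (sym (on-second v n₁ z₂)))))
      (λ z₁ → zero-or-not (ap K₂ v)
        (λ n₂ → trans (on-first u (trans e₁ z₁) (n₂ ∘ trans (sym e₂))) (trans (cong₂ (λ x y → f₀ ⊞ x ⁻¹ ⊠ y) e₂ e₃) (sym (on-first v z₁ n₂))))
        (λ z₂ → trans (on-axis u (trans e₁ z₁) (trans e₂ z₂)) (sym (on-axis v z₁ z₂))))
      where
      unequal : ∀ {x y} → x ⊞ ⊟ y ≢ 0F → x ≢ y
      unequal n refl = n (-‿inverseʳ _)

    cone : ∀ v → val L v ≡ val L (Dual.proj D v)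
    cone v = let e₁ , e₂ , e₃ = coordinates (dual (coords (K₁ ∷ K₂ ∷ l ∷ []) v)) in determined v (Dual.proj D v) (sym e₁) (sym e₂) (sym e₃)

    prime : ∀ x → Prime𝔽 x
    prime = q≤p⇒prime (ℕ.≤-reflexive q≡p)
    γ : ∃ λ a → J a ≡ 1F
    γ = Prime𝔽⇒J (prime 1F)
    γ≢0 : toℕ (proj₁ γ) ≢ 0
    γ≢0 z = 1≢0 (trans (sym (proj₂ γ)) (cong ι z))
    a₁ : ∃ λ a → J a ≡ f₀
    a₁ = Prime𝔽⇒J f₀∈
    a₂ : ∃ λ a → J a ≡ g₀
    a₂ = Prime𝔽⇒J g₀∈
    a₃ : ∃ λ a → J a ≡ h₀
    a₃ = Prime𝔽⇒J h₀∈

    ι-toFp : ∀ x → ι (toFp x) ≡ x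
    ι-toFp x = ι-search p x (prime x)

    ι-negate : ∀ x → ι (p ∸ toFp x) ≡ ⊟ x
    ι-negate x = trans (solve 2 (λ a b → a := (a :+ b) :+ :- b) refl (ι (p ∸ toFp x)) x) (trans (cong (_⊞ ⊟ x) (trans (cong (ι (p ∸ toFp x) ⊞_) (sym (ι-toFp x)))
      (trans (sym (ι-+ (p ∸ toFp x) (toFp x))) (trans (cong ι (ℕ.m∸n+n≡m (search≤ p x))) char)))) (+-identityˡ _))

    inverse-one : ∀ {x y} → x ≡ 1F → x ⁻¹ ⊠ y ≡ y
    inverse-one {x} {y} refl = trans (cong (_⊠ y) (trans (sym (*-identityʳ _)) (inv-⊠ 1≢0))) (*-identityˡ y)

    number : Point 2 → ℕ
    number x = toℕ (proj₁ γ) * c₀ x + toℕ (proj₁ a₁) * [ X₀ x ≈ 0F ] + toℕ (proj₁ a₂) * [ X₁ x ≈ 0F ] + toℕ (proj₁ a₃) * [ X₀ x ≈ X₁ x ]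

    ι-number : ∀ x {b b₁ b₂ b₃} → ι (c₀ x) ≡ b → ι [ X₀ x ≈ 0F ] ≡ b₁ → ι [ X₁ x ≈ 0F ] ≡ b₂ → ι [ X₀ x ≈ X₁ x ] ≡ b₃ → ι (number x) ≡ b ⊞ f₀ ⊠ b₁ ⊞ g₀ ⊠ b₂ ⊞ h₀ ⊠ b₃
    ι-number x {b} e e₁ e₂ e₃ = trans (ι-+ (n₀ + n₁ + n₂) n₃) (cong₂ _⊞_ (trans (ι-+ (n₀ + n₁) n₂) (cong₂ _⊞_ (trans (ι-+ n₀ n₁) (cong₂ _⊞_
        (trans (ι-* (toℕ (proj₁ γ)) _) (trans (cong₂ _⊠_ (proj₂ γ) e) (*-identityˡ b))) (term a₁ e₁))) (term a₂ e₂))) (term a₃ e₃))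
      where
      n₀ n₁ n₂ n₃ : ℕ
      n₀ = toℕ (proj₁ γ) * c₀ x
      n₁ = toℕ (proj₁ a₁) * [ X₀ x ≈ 0F ]
      n₂ = toℕ (proj₁ a₂) * [ X₁ x ≈ 0F ]
      n₃ = toℕ (proj₁ a₃) * [ X₀ x ≈ X₁ x ]
      term : ∀ {y n b} (a : ∃ λ a → J a ≡ y) → ι n ≡ b → ι (toℕ (proj₁ a) * n) ≡ y ⊠ b
      term {n = n} (a , ja) e = trans (ι-* (toℕ a) n) (cong₂ _⊠_ ja e)

    -- The first nonzero coordinate of a normalised vector is 1, so the divisions in the pencil form
    -- have no effect and the values of `c₀` appear.
    pointwise : ∀ x₀ x₁ x₂ t → val L (lincomb (x₀ ∷ x₁ ∷ x₂ ∷ []) E) ≡ ι (number ((x₀ ∷ x₁ ∷ x₂ ∷ []) , t))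
    pointwise x₀ x₁ x₂ t = zero-or-not x₀
        (λ n₀ → let x₀≡1 = normalised-head x₀ _ t n₀ in zero-or-not x₁
          (λ n₁ → by-third x₀≡1 n₁ (x₁ ≟F 1F))
          (λ z₁ → trans (on-second v (n₀ ∘ trans (sym e₁)) (trans e₂ z₁)) (trans (cong₂ (λ x y → g₀ ⊞ x ⁻¹ ⊠ y) e₁ e₃) (trans (cong (g₀ ⊞_) (inverse-one x₀≡1))
            (sym (trans (ι-number P (trans (cong ι (c₀-second {t = t} x₀≡1 z₁)) (ι-toFp x₂)) (≈-no n₀) (≈-yes z₁) (≈-no (λ f → n₀ (trans f z₁))))
              (solve 4 (λ x f g h → x :+ f :* 𝟎 :+ g :* 𝟙 :+ h :* 𝟎 := g :+ x) refl x₂ f₀ g₀ h₀)))))))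
        (λ z₀ → zero-or-not x₁
          (λ n₁ → let x₁≡1 = normalised-head x₁ (x₂ ∷ []) (normalised-tail (x₁ ∷ x₂ ∷ []) t z₀) n₁ in
            trans (on-first v (trans e₁ z₀) (n₁ ∘ trans (sym e₂))) (trans (cong₂ (λ x y → f₀ ⊞ x ⁻¹ ⊠ y) e₂ e₃) (trans (cong (f₀ ⊞_) (inverse-one x₁≡1))
              (sym (trans (ι-number P (trans (cong ι (c₀-first {t = t} z₀ x₁≡1)) (ι-toFp x₂)) (≈-yes z₀) (≈-no n₁) (≈-no (λ f → n₁ (trans (sym f) z₀))))
                (solve 4 (λ x f g h → x :+ f :* 𝟙 :+ g :* 𝟎 :+ h :* 𝟎 := f :+ x) refl x₂ f₀ g₀ h₀))))))
          (λ z₁ → trans (on-axis v (trans e₁ z₀) (trans e₂ z₁)) (sym (trans (ι-number P (cong ι (c₀-axis {x₂ = x₂} {t = t} z₀ z₁)) (≈-yes z₀) (≈-yes z₁) (≈-yes (trans z₀ (sym z₁))))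
              (solve 3 (λ f g h → 𝟎 :+ f :* 𝟙 :+ g :* 𝟙 :+ h :* 𝟙 := f :+ (g :+ h)) refl f₀ g₀ h₀)))))
      where
      P : Point 2
      P = (x₀ ∷ x₁ ∷ x₂ ∷ []) , t
      v : Vector m
      v = lincomb (x₀ ∷ x₁ ∷ x₂ ∷ []) E
      e₁ : ap K₁ v ≡ x₀
      e₁ = proj₁ (coordinates (dual (x₀ ∷ x₁ ∷ x₂ ∷ [])))
      e₂ : ap K₂ v ≡ x₁
      e₂ = proj₁ (proj₂ (coordinates (dual (x₀ ∷ x₁ ∷ x₂ ∷ []))))
      e₃ : ap l v ≡ x₂
      e₃ = proj₂ (proj₂ (coordinates (dual (x₀ ∷ x₁ ∷ x₂ ∷ []))))
      by-third : x₀ ≡ 1F → x₁ ≢ 0F → Dec (x₁ ≡ 1F) → val L v ≡ ι (number P)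
      by-third x₀≡1 n₁ (yes x₁≡1) = trans (on-third v (λ z → 1≢0 (trans (sym x₀≡1) (trans (sym e₁) z))) (trans e₁ (trans x₀≡1 (sym (trans e₂ x₁≡1)))))
        (trans (cong₂ (λ x y → h₀ ⊞ ⊟ (x ⁻¹ ⊠ y)) e₁ e₃) (trans (cong (λ x → h₀ ⊞ ⊟ x) (inverse-one x₀≡1))
          (sym (trans (ι-number P (trans (cong ι (c₀-third {t = t} x₀≡1 x₁≡1)) (ι-negate x₂)) (≈-no (λ z → 1≢0 (trans (sym x₀≡1) z))) (≈-no n₁) (≈-yes (trans x₀≡1 (sym x₁≡1))))
            (solve 4 (λ x f g h → (:- x) :+ f :* 𝟎 :+ g :* 𝟎 :+ h :* 𝟙 := h :+ :- x) refl x₂ f₀ g₀ h₀)))))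
      by-third x₀≡1 n₁ (no x₁≢1) = trans (off v (λ z → 1≢0 (trans (sym x₀≡1) (trans (sym e₁) z))) (λ z → n₁ (trans (sym e₂) z)) (λ f → x₁≢1 (trans (sym e₂) (trans (sym f) (trans e₁ x₀≡1)))))
        (sym (trans (ι-number P (cong ι (c₀-off {x₂ = x₂} {t = t} x₀≡1 n₁ x₁≢1)) (≈-no (λ z → 1≢0 (trans (sym x₀≡1) z))) (≈-no n₁) (≈-no (λ f → x₁≢1 (trans (sym f) x₀≡1))))
          (solve 3 (λ f g h → 𝟎 :+ f :* 𝟎 :+ g :* 𝟎 :+ h :* 𝟎 := 𝟎) refl f₀ g₀ h₀)))

    value : ∀ x → c (φ x) ≡ [ number x ]ₚ
    value x@((x₀ ∷ x₁ ∷ x₂ ∷ []) , t) = J-injective (trans (eq (φ x)) (trans (trans (cong (val L) (proj₂ (proj₂ (φ-scale x)))) (val-scale L _ (proj₁ (proj₂ (φ-scale x)))))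
      (trans (pointwise x₀ x₁ x₂ t) (sym (J-mod (number x))))))

-- The fields with two and three elements

module SmallFields (F : FiniteField) (p : ℕ) (pr : Prime p) (char : FiniteField.ι F p ≡ FiniteField.0# F) where
  open Types F p pr char public
  open Solver using (solve; _:=_; _:+_; _:*_; :-_; 𝟎; 𝟙)

  private
    prime-0 : Prime𝔽 0F
    prime-0 = ι-prime 0

    prime-1 : Prime𝔽 1F
    prime-1 = subst Prime𝔽 (+-identityʳ 1F) (ι-prime 1)

    all-or-some : ∀ {m} {g : Vector m → 𝔽} → (∃ λ v → g v ≢ 0F) ⊎ (∀ v → g v ≡ 0F)
    all-or-some {m} {g} with Any.any? (λ v → ¬? (g v ≟F 0F)) (allVecs m)
    ... | yes any = inj₁ (let v , _ , n = find any in v , n)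
    ... | no none = inj₂ zero-all
      where
      zero-all : ∀ v → g v ≡ 0F
      zero-all v with g v ≟F 0F
      ... | yes z = z
      ... | no n  = ⊥-elim (none (lose (allVecs-complete v) n))

  -- Over 𝔽₂ the indicator of zero is 1 + x, so a word is an affine function.
  module Binary (q≡2 : q ≡ 2) where
    private
      length⁺ : length elems⁺ ≡ 1
      length⁺ = ℕ.suc-injective (trans (sym q≡) q≡2)

      two : 1F ⊞ 1F ≡ 0F
      two = trans (cong (_⊞ 1F) (trans (sym (trans (one elems⁺ length⁺) (+-identityʳ 1F))) (∑⁺-constant 1F))) (-‿inverseˡ 1F)
        where
        one : ∀ (xs : List 𝔽) → length xs ≡ 1 → S.∑ xs (λ _ → 1F) ≡ 1F ⊞ 0F
        one (_ ∷ []) _ = refl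

      nonzero⇒one : ∀ {x} → x ≢ 0F → x ≡ 1F
      nonzero⇒one {x} n with x ≟F 1F
      ... | yes e = e
      ... | no n′ = ⊥-elim (refute 0 refl (ℕ.≤-trans (unique-⊆-length ((n ∷ n′ ∷ []) ∷ (1≢0 ∘ sym ∷ []) ∷ [] ∷ []) (λ {y} _ → elems-complete y)) (ℕ.≤-reflexive q≡2)))

      δ-affine : ∀ x → δ x ≡ 1F ⊞ x
      δ-affine x = zero-or-not x (λ n → trans (δ-no n) (sym (trans (cong (1F ⊞_) (nonzero⇒one n)) two))) (λ z → trans (δ-yes z) (sym (trans (cong (1F ⊞_) z) (+-identityʳ 1F))))

      linear : ∀ {m} → Code m → Lin m
      linear []            = zeroL
      linear ((c , k) ∷ L) = combine (linear L) c k

      affine : ∀ {m} (L : Code m) v → val L v ≡ val L zeroV ⊞ ap (linear L) v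
      affine []            v = sym (+-identityˡ 0F)
      affine ((c , k) ∷ L) v = trans (cong₂ (λ x y → c ⊠ x ⊞ y) (δ-affine (ap k v)) (affine L v)) (trans
        (solve 4 (λ c x a y → c :* (𝟙 :+ x) :+ (a :+ y) := (c :* 𝟙 :+ a) :+ (y :+ c :* x)) refl c (ap k v) (val L zeroV) (ap (linear L) v))
        (cong (λ x → (c ⊠ x ⊞ val L zeroV) ⊞ ap (linear ((c , k) ∷ L)) v) (sym (δ-yes (ap-zero k)))))

    -- Here f = a + K with a = f(0), and the weight bounds exclude K = 0. For a = 1 this is the
    -- indicator of K = 0. For a = 0 it is the sum of the indicators of k = 0 and K - k = 0, where k
    -- is nonzero at some u in the kernel of K, so that K - k is nonzero there as well.
    combination : ∀ {e} (L : Code (suc (suc e))) {w Y} → W L (full (suc (suc e))) ≡ nz (val L zeroV) + w → 3 ≤ w → w ≤ 2 * suc Y →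
      length (allVecs (suc (suc e))) ≡ 4 * suc Y → Combination Prime𝔽 (val L)
    combination {e} L {w} {Y} weight 3≤w w≤ size = decide all-or-some
      where
      m : ℕ
      m = suc (suc e)
      a : 𝔽
      a = val L zeroV
      K : Lin m
      K = linear L
      constant : (∀ v → ap K v ≡ 0F) → ∀ v → val L v ≡ a
      constant z v = trans (affine L v) (trans (cong (a ⊞_) (z v)) (+-identityʳ a))
      W-constant : (∀ v → ap K v ≡ 0F) → W L (full m) ≡ 4 * suc Y * nz a
      W-constant z = trans (N.∑-cong (allVecs m) (λ v → cong nz (constant z v))) (trans (N.∑-const (allVecs m) (nz a)) (cong (_* nz a) size))
      not-constant : (∀ v → ap K v ≡ 0F) → ⊥
      not-constant z = zero-or-not a
        (λ n → refute (2 * Y) (solveₙ 1 (λ y → # 4 ⟨*⟩ (# 1 ⟨+⟩ y) ⟨*⟩ # 1 ⟨=⟩ (# 1 ⟨+⟩ # 2 ⟨*⟩ (# 1 ⟨+⟩ y)) ⟨+⟩ (# 1 ⟨+⟩ # 2 ⟨*⟩ y)) refl Y) (ℕ.≤-trans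
          (ℕ.≤-reflexive (trans (cong (4 * suc Y *_) (sym (nz-no n))) (trans (sym (W-constant z)) (trans weight (cong (_+ w) (nz-no n)))))) (s≤s w≤)))
        (λ e → refute 2 refl (ℕ.≤-trans 3≤w (ℕ.≤-trans (ℕ.m≤n+m w (nz a)) (ℕ.≤-reflexive (trans (sym weight) (trans (W-constant z) (trans (cong (4 * suc Y *_) (nz-yes e)) (ℕ.*-zeroʳ (4 * suc Y)))))))))
      single : Nonzero K → a ≡ 1F → Combination Prime𝔽 (val L)
      single n a≡1 = record { k₁ = K ; k₂ = K ; k₃ = K ; λ₁ = 1F ; λ₂ = 0F ; λ₃ = 0F ; λ₁∈ = prime-1 ; λ₂∈ = prime-0 ; λ₃∈ = prime-0 ; nonzero₁ = n ; nonzero₂ = n ; nonzero₃ = n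
        ; formula = λ v → trans (affine L v) (trans (cong (_⊞ ap K v) a≡1) (trans (sym (δ-affine (ap K v))) (solve 1 (λ d → d := 𝟙 :* d :+ (𝟎 :* d :+ 𝟎 :* d)) refl (δ (ap K v))))) }
      pair : Nonzero K → a ≡ 0F → (∃ λ u → u ≢ zeroV × ap K u ≡ 0F) → Combination Prime𝔽 (val L)
      pair n a≡0 (u , u≢0 , Ku) = record { k₁ = k ; k₂ = l ; k₃ = K ; λ₁ = 1F ; λ₂ = 1F ; λ₃ = 0F ; λ₁∈ = prime-1 ; λ₂∈ = prime-1 ; λ₃∈ = prime-0
          ; nonzero₁ = u , ku ; nonzero₂ = u , (λ z → ku (trans (sym (sub-zero⇒≡ 0F (ap k u) (trans (cong₂ _⊞_ (sym Ku) (solve 1 (λ x → :- x := (:- 𝟙) :* x) refl (ap k u))) z))) refl)) ; nonzero₃ = n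
          ; formula = λ v → trans (affine L v) (trans (cong (_⊞ ap K v) a≡0) (sym (trans (cong₂ (λ x y → 1F ⊠ x ⊞ (1F ⊠ y ⊞ 0F ⊠ δ (ap K v))) (δ-affine (ap k v)) (δ-affine (ap l v)))
            (trans (solve 3 (λ x K d → 𝟙 :* (𝟙 :+ x) :+ (𝟙 :* (𝟙 :+ (K :+ (:- 𝟙) :* x)) :+ 𝟎 :* d) := (𝟙 :+ 𝟙) :+ K) refl (ap k v) (ap K v) (δ (ap K v))) (cong (_⊞ ap K v) two))))) }
        where
        k : Lin m
        k = proj₁ (separating u u≢0)
        ku : ap k u ≢ 0F
        ku = proj₂ (separating u u≢0)
        l : Lin m
        l = combine K (⊟ 1F) k
      decide : Nonzero K ⊎ (∀ v → ap K v ≡ 0F) → Combination Prime𝔽 (val L)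
      decide (inj₂ z) = ⊥-elim (not-constant z)
      decide (inj₁ n) = zero-or-not a (λ a≢0 → single n (nonzero⇒one a≢0))
        (λ a≡0 → pair n a≡0 (let u , u≢0 , z = kernel-vector (extend empty K {proj₁ n} refl (proj₂ n)) (s≤s (s≤s z≤n)) in u , u≢0 , proj₁ (Vec.∷-injective z)))

  -- Over 𝔽₃ the indicator of zero is 1 − x², so a word is a constant minus a quadratic form.
  module Ternary (q≡3 : q ≡ 3) where
    private
      length⁺ : length elems⁺ ≡ 2
      length⁺ = ℕ.suc-injective (trans (sym q≡) q≡3)

      double : 1F ⊞ (1F ⊞ 0F) ≡ ⊟ 1F
      double = trans (sym (two elems⁺ length⁺)) (∑⁺-constant 1F)
        where
        two : ∀ (xs : List 𝔽) → length xs ≡ 2 → S.∑ xs (λ _ → 1F) ≡ 1F ⊞ (1F ⊞ 0F)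
        two (_ ∷ _ ∷ []) _ = refl

      doubled : ∀ x → x ⊞ x ≡ ⊟ x
      doubled x = trans (solve 1 (λ x → x :+ x := x :* (𝟙 :+ (𝟙 :+ 𝟎))) refl x) (trans (cong (x ⊠_) double) (solve 1 (λ x → x :* (:- 𝟙) := :- x) refl x))

      neg≢ : ∀ {x} → x ≢ 0F → x ≢ ⊟ x
      neg≢ {x} n e = n (⊞-cancelˡ x (trans (doubled x) (trans (sym e) (sym (+-identityʳ x)))))

      sign : ∀ {x} → x ≢ 0F → x ≡ 1F ⊎ x ≡ ⊟ 1F
      sign {x} n with x ≟F 1F | x ≟F (⊟ 1F)
      ... | yes e | _     = inj₁ e
      ... | no _  | yes e = inj₂ e
      ... | no n₁ | no n₂ = ⊥-elim (refute 0 refl (ℕ.≤-trans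
        (unique-⊆-length ((n ∷ n₁ ∷ n₂ ∷ []) ∷ (1≢0 ∘ sym ∷ neg-nonzero 1≢0 ∘ sym ∷ []) ∷ (neg≢ 1≢0 ∷ []) ∷ [] ∷ []) (λ {y} _ → elems-complete y)) (ℕ.≤-reflexive q≡3)))

      square : ∀ {x} → x ≢ 0F → x ⊠ x ≡ 1F
      square n with sign n
      ... | inj₁ refl = *-identityˡ 1F
      ... | inj₂ refl = solve 0 ((:- 𝟙) :* (:- 𝟙) := 𝟙) refl

      same-or-opposite : ∀ {x y} → x ≢ 0F → y ≢ 0F → y ≡ x ⊎ y ≡ ⊟ x
      same-or-opposite n n′ with sign n | sign n′
      ... | inj₁ refl | inj₁ refl = inj₁ refl
      ... | inj₁ refl | inj₂ refl = inj₂ refl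
      ... | inj₂ refl | inj₁ refl = inj₂ (solve 0 (𝟙 := :- (:- 𝟙)) refl)
      ... | inj₂ refl | inj₂ refl = inj₁ refl

      δ-square : ∀ x → δ x ≡ 1F ⊞ ⊟ (x ⊠ x)
      δ-square x = zero-or-not x (λ n → trans (δ-no n) (sym (trans (cong (λ y → 1F ⊞ ⊟ y) (square n)) (-‿inverseʳ 1F))))
        (λ z → trans (δ-yes z) (sym (trans (cong (λ y → 1F ⊞ ⊟ y) (zero-⊠ z)) (solve 0 (𝟙 :+ :- 𝟎 := 𝟙) refl))))

      prime : ∀ x → Prime𝔽 x
      prime x = zero-or-not x nonzero (λ z → subst Prime𝔽 (sym z) prime-0)
        where
        nonzero : x ≢ 0F → Prime𝔽 x
        nonzero n with sign n
        ... | inj₁ e = subst Prime𝔽 (sym e) prime-1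
        ... | inj₂ e = subst Prime𝔽 (trans (+-identityˡ _) (sym e)) (prime-sub prime-0 prime-1)

      squares : (H : 𝔽 → ℕ) → N.∑ elems (λ t → H (t ⊠ t)) ≡ H 0F + 2 * H 1F
      squares H = trans (N∑-split _) (cong₂ _+_ (cong H (zeroˡ 0F)) (trans (N.∑-cong∈ elems⁺ (λ t∈ → cong H (square (elems⁺-nonzero t∈)))) (trans (N.∑-const elems⁺ (H 1F)) (cong (_* H 1F) length⁺))))

      -- Along e the function runs through D - b s² for all s, and s² is 0 once and 1 twice;
      -- averaging over translates by e thus eliminates the variable x.
      complete-square : ∀ {m} (f D : Vector m → 𝔽) (x : Lin m) e b → ap x e ≡ 1F → (∀ v → f v ≡ D v ⊞ ⊟ (b ⊠ (ap x v ⊠ ap x v))) → (∀ v t → D (v +V t ·V e) ≡ D v) →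
        (H : 𝔽 → ℕ) → 3 * N.∑ (allVecs m) (λ v → H (f v)) ≡ N.∑ (allVecs m) (λ v → H (D v) + 2 * H (D v ⊞ ⊟ b))
      complete-square {m} f D x e b xe f≡ invariant H = begin
        3 * N.∑ (allVecs m) (λ v → H (f v))
          ≡⟨ trans (cong (_* N.∑ (allVecs m) (λ v → H (f v))) (sym q≡3)) (sym (N.∑-const elems _)) ⟩
        N.∑ elems (λ _ → N.∑ (allVecs m) (λ v → H (f v)))
          ≡⟨ N.∑-cong elems (λ t → sym (translate t)) ⟩
        N.∑ elems (λ t → N.∑ (allVecs m) (λ v → H (f (v +V t ·V e))))
          ≡⟨ N.∑-swap elems (allVecs m) _ ⟩
        N.∑ (allVecs m) (λ v → N.∑ elems (λ t → H (f (v +V t ·V e))))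
          ≡⟨ N.∑-cong (allVecs m) fibre ⟩
        N.∑ (allVecs m) (λ v → H (D v) + 2 * H (D v ⊞ ⊟ b)) ∎
        where
        open ≡-Reasoning
        translate : ∀ t → N.∑ (allVecs m) (λ v → H (f (v +V t ·V e))) ≡ N.∑ (allVecs m) (λ v → H (f v))
        translate t = N.∑-bij (λ v → v +V t ·V e) (λ v → v +V (⊟ t) ·V e) (λ v → H (f v)) (allVecs-unique m) (λ _ → allVecs-complete _) (λ _ → allVecs-complete _)
          (λ v → vsolve (x₀ ⊕ t ⊙ x₁ ⊕ (⊟ t) ⊙ x₁) x₀ (λ { (v ∷ e ∷ []) → solve 3 (λ t v e → v :+ t :* e :+ (:- t) :* e := v) refl t v e }) (v ∷ e ∷ []))
          (λ v → vsolve (x₀ ⊕ (⊟ t) ⊙ x₁ ⊕ t ⊙ x₁) x₀ (λ { (v ∷ e ∷ []) → solve 3 (λ t v e → v :+ (:- t) :* e :+ t :* e := v) refl t v e }) (v ∷ e ∷ []))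
        fibre : ∀ v → N.∑ elems (λ t → H (f (v +V t ·V e))) ≡ H (D v) + 2 * H (D v ⊞ ⊟ b)
        fibre v = trans (N.∑-cong elems (λ t → cong H (trans (f≡ _) (cong₂ (λ d y → d ⊞ ⊟ (b ⊠ (y ⊠ y))) (invariant v t) (trans (ap-line x v t e) (cong (ap x v ⊞_) (trans (cong (t ⊠_) xe) (*-identityʳ t))))))))
          (trans (N∑-translate (ap x v) (λ s → H (D v ⊞ ⊟ (b ⊠ (s ⊠ s))))) (trans (squares (λ s → H (D v ⊞ ⊟ (b ⊠ s))))
            (cong₂ (λ y z → H y + 2 * H z) (solve 2 (λ d b → d :+ :- (b :* 𝟎) := d) refl (D v) b) (cong (λ y → D v ⊞ ⊟ y) (*-identityʳ b)))))

      -- A quadratic form is kept as a symmetric bilinear map, of which it is the diagonal.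
      record Form (m : ℕ) : Set where
        field
          B     : Vector m → Lin m
          B-sym : ∀ u v → ap (B u) v ≡ ap (B v) u
      open Form

      value : ∀ {m} → Form m → 𝔽 → Vector m → 𝔽
      value Q a v = a ⊞ ⊟ ap (B Q v) v

      polar : ∀ {m} → Code m → Form m
      polar []            = record { B = λ _ → zeroL ; B-sym = λ _ _ → refl }
      polar ((c , k) ∷ L) = record { B = λ u → combine (B (polar L) u) (c ⊠ ap k u) k
        ; B-sym = λ u v → cong₂ _⊞_ (B-sym (polar L) u v) (solve 3 (λ c x y → c :* x :* y := c :* y :* x) refl c (ap k u) (ap k v)) }

      polar-value : ∀ {m} (L : Code m) v → val L v ≡ value (polar L) (val L zeroV) v
      polar-value []            v = sym (-‿inverseʳ 0F)
      polar-value ((c , k) ∷ L) v = trans (cong₂ (λ x y → c ⊠ x ⊞ y) (δ-square (ap k v)) (polar-value L v)) (trans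
        (solve 4 (λ c x a y → c :* (𝟙 :+ :- (x :* x)) :+ (a :+ :- y) := (c :* 𝟙 :+ a) :+ :- (y :+ c :* x :* x)) refl c (ap k v) (val L zeroV) (ap (B (polar L) v) v))
        (cong (λ x → (c ⊠ x ⊞ val L zeroV) ⊞ ⊟ ap (B (polar ((c , k) ∷ L)) v) v) (sym (δ-yes (ap-zero k)))))

      -- One step of diagonalisation. As b² = 1, the functional x = b B(e, ·) takes the value 1 at
      -- e, and removing b x² puts e into the radical of the remaining form.
      module Reduce {m} (Q : Form m) (e : Vector m) (b≢0 : ap (B Q e) e ≢ 0F) where
        b : 𝔽
        b = ap (B Q e) e

        x : Lin m
        x = scaleL b (B Q e)

        x-e : ap x e ≡ 1F
        x-e = trans (ap-scaleL b (B Q e) e) (square b≢0)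

        Q′ : Form m
        Q′ = record { B = λ u → combine (B Q u) (⊟ (b ⊠ ap x u)) x
          ; B-sym = λ u v → cong₂ _⊞_ (B-sym Q u v) (solve 3 (λ b y z → (:- (b :* y)) :* z := (:- (b :* z)) :* y) refl b (ap x u) (ap x v)) }

        decompose : ∀ a v → value Q a v ≡ value Q′ a v ⊞ ⊟ (b ⊠ (ap x v ⊠ ap x v))
        decompose a v = solve 4 (λ a y b z → a :+ :- y := (a :+ :- (y :+ (:- (b :* z)) :* z)) :+ :- (b :* (z :* z))) refl a (ap (B Q v) v) b (ap x v)

        kills : ∀ u → ap (B Q′ u) e ≡ 0F
        kills u = trans (cong₂ (λ y z → ap (B Q u) e ⊞ (⊟ (b ⊠ y)) ⊠ z) (trans (ap-scaleL b (B Q e) u) (cong (b ⊠_) (B-sym Q e u))) x-e)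
          (trans (solve 2 (λ y b → y :+ (:- (b :* (b :* y))) :* 𝟙 := y :+ :- (b :* b :* y)) refl (ap (B Q u) e) b)
            (trans (cong (λ z → ap (B Q u) e ⊞ ⊟ (z ⊠ ap (B Q u) e)) (square b≢0)) (solve 1 (λ y → y :+ :- (𝟙 :* y) := 𝟎) refl (ap (B Q u) e))))

        invariant : ∀ a v t → value Q′ a (v +V t ·V e) ≡ value Q′ a v
        invariant a v t = cong (λ y → a ⊞ ⊟ y) (trans (absorb (v +V t ·V e)) (trans (B-sym Q′ (v +V t ·V e) v) (absorb v)))
          where
          absorb : ∀ w → ap (B Q′ w) (v +V t ·V e) ≡ ap (B Q′ w) v
          absorb w = trans (ap-line (B Q′ w) v t e) (trans (cong (λ y → ap (B Q′ w) v ⊞ t ⊠ y) (kills w)) (trans (cong (ap (B Q′ w) v ⊞_) (zeroʳ t)) (+-identityʳ _)))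

        ∑-reduce : ∀ a (H : 𝔽 → ℕ) → 3 * N.∑ (allVecs m) (λ v → H (value Q a v)) ≡ N.∑ (allVecs m) (λ v → H (value Q′ a v) + 2 * H (value Q′ a v ⊞ ⊟ b))
        ∑-reduce a = complete-square (value Q a) (value Q′ a) x e b x-e (decompose a) (invariant a)

    -- Two completed squares give f = D - b x² - b′ y². Forms of rank zero and one contradict the
    -- weight bounds, and b′ = b makes the weight too large. For b′ = -b so few nonzero values of D
    -- are left that a = 0 and D = 0, whence f = b δ(x) - b δ(y).
    combination : ∀ {m} (L : Code m) {w Y} → W L (full m) ≡ nz (val L zeroV) + 2 * w → 3 * (3 * suc Y) + 3 ≤ 2 * w → w ≤ 2 * (3 * suc Y) →
      length (allVecs m) ≡ 27 * suc Y → Combination Prime𝔽 (val L)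
    combination {m} L {w} {Y} weight lower upper size = first all-or-some
      where
      a : 𝔽
      a = val L zeroV
      f : Vector m → 𝔽
      f = val L
      Q : Form m
      Q = polar L
      W′ : ℕ
      W′ = W L (full m)
      ∑v : (Vector m → ℕ) → ℕ
      ∑v = N.∑ (allVecs m)
      ∑-constant′ : ∀ {g : Vector m → ℕ} c → (∀ v → g v ≡ c) → ∑v g ≡ 27 * suc Y * c
      ∑-constant′ c e = trans (N.∑-cong (allVecs m) e) (trans (N.∑-const (allVecs m) c) (cong (_* c) size))
      W≤ : W′ ≤ nz a + 12 * suc Y
      W≤ = ℕ.≤-trans (ℕ.≤-reflexive weight) (ℕ.+-monoʳ-≤ (nz a) (ℕ.≤-trans (ℕ.*-monoʳ-≤ 2 upper) (ℕ.≤-reflexive (solveₙ 1 (λ y → # 2 ⟨*⟩ (# 2 ⟨*⟩ (# 3 ⟨*⟩ y)) ⟨=⟩ # 12 ⟨*⟩ y) refl (suc Y)))))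
      ≤W : 9 * suc Y + 3 ≤ W′
      ≤W = ℕ.≤-trans (ℕ.≤-reflexive (solveₙ 1 (λ y → # 9 ⟨*⟩ y ⟨+⟩ # 3 ⟨=⟩ # 3 ⟨*⟩ (# 3 ⟨*⟩ y) ⟨+⟩ # 3) refl (suc Y))) (ℕ.≤-trans lower (ℕ.≤-trans (ℕ.m≤n+m _ (nz a)) (ℕ.≤-reflexive (sym weight))))
      W≤′ : W′ ≤ 1 + 12 * suc Y
      W≤′ = ℕ.≤-trans W≤ (ℕ.+-monoˡ-≤ _ (nz≤1 a))

      not-constant : (∀ v → ap (B Q v) v ≡ 0F) → ⊥
      not-constant z = zero-or-not a
        (λ n → refute (13 + 15 * Y) (solveₙ 1 (λ y → # 27 ⟨*⟩ (# 1 ⟨+⟩ y) ⟨*⟩ # 1 ⟨=⟩ (# 1 ⟨+⟩ # 12 ⟨*⟩ (# 1 ⟨+⟩ y)) ⟨+⟩ (# 1 ⟨+⟩ (# 13 ⟨+⟩ # 15 ⟨*⟩ y))) refl Y)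
          (ℕ.≤-trans (ℕ.≤-reflexive (sym (total (nz-no n)))) W≤′))
        (λ e → refute (9 * suc Y + 2) (ℕ.+-suc (9 * suc Y) 2) (ℕ.≤-trans ≤W (ℕ.≤-reflexive (trans (total (nz-yes e)) (ℕ.*-zeroʳ (27 * suc Y))))))
        where
        total : ∀ {c} → nz a ≡ c → W′ ≡ 27 * suc Y * c
        total e = ∑-constant′ _ (λ v → trans (cong nz (trans (polar-value L v) (trans (cong (λ y → a ⊞ ⊟ y) (z v)) (solve 1 (λ a → a :+ :- 𝟎 := a) refl a)))) e)

      module First (e : Vector m) (b≢0 : ap (B Q e) e ≢ 0F) where
        open Reduce Q e b≢0 public
        G : 𝔽 → ℕ
        G y = nz y + 2 * nz (y ⊞ ⊟ b)
        3W : 3 * W′ ≡ ∑v (λ v → G (value Q′ a v))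
        3W = trans (cong (3 *_) (N.∑-cong (allVecs m) (λ v → cong nz (polar-value L v)))) (∑-reduce a nz)

        -- If Q = b x², the weight is too large unless a = b; then the word is b times the indicator
        -- of x = 0 and its weight is too small.
        not-rank-one : (∀ v → ap (B Q′ v) v ≡ 0F) → ⊥
        not-rank-one z = zero-or-not (a ⊞ ⊟ b)
          (λ n → refute (14 + 18 * Y) (solveₙ 1 (λ y → # 27 ⟨*⟩ (# 1 ⟨+⟩ y) ⟨*⟩ # 2 ⟨=⟩ # 3 ⟨*⟩ (# 1 ⟨+⟩ # 12 ⟨*⟩ (# 1 ⟨+⟩ y)) ⟨+⟩ (# 1 ⟨+⟩ (# 14 ⟨+⟩ # 18 ⟨*⟩ y))) refl Y)
            (ℕ.≤-trans (ℕ.*-monoʳ-≤ (27 * suc Y) (ℕ.≤-trans (ℕ.≤-reflexive (cong (2 *_) (sym (nz-no n)))) (ℕ.m≤n+m _ (nz a)))) (ℕ.≤-trans (ℕ.≤-reflexive (sym total)) (ℕ.*-monoʳ-≤ 3 W≤′))))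
          (λ e → refute 8 (solveₙ 1 (λ y → # 3 ⟨*⟩ (# 9 ⟨*⟩ y ⟨+⟩ # 3) ⟨=⟩ # 27 ⟨*⟩ y ⟨*⟩ # 1 ⟨+⟩ # 9) refl (suc Y))
            (ℕ.≤-trans (ℕ.*-monoʳ-≤ 3 ≤W) (ℕ.≤-reflexive (trans total (cong (27 * suc Y *_) (cong₂ (λ s t → s + 2 * t) (nz-no (λ z → b≢0 (trans (sym (sub-zero⇒≡ a b e)) z))) (nz-yes e)))))))
          where
          total : 3 * W′ ≡ 27 * suc Y * G a
          total = trans 3W (∑-constant′ (G a) (λ v → cong G (trans (cong (λ y → a ⊞ ⊟ y) (z v)) (solve 1 (λ a → a :+ :- 𝟎 := a) refl a))))

        module Second (e′ : Vector m) (b′≢0 : ap (B Q′ e′) e′ ≢ 0F) where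
          private
            module R = Reduce Q′ e′ b′≢0
          y : Lin m
          y = R.x
          D : Vector m → 𝔽
          D = value R.Q′ a
          9W : 9 * W′ ≡ ∑v (λ v → G (D v) + 2 * G (D v ⊞ ⊟ R.b))
          9W = trans (ℕ.*-assoc 3 3 W′) (trans (cong (3 *_) 3W) (R.∑-reduce a G))

          -- Of the nine copies of D, shifted by 0 once and by b and -b four times each, at least
          -- five are nonzero whatever the value of D, while the upper bound allows about 12 in 27.
          same-sign : R.b ≡ b → ⊥
          same-sign b′≡b = refute (17 + 27 * Y) (solveₙ 1 (λ y → # 27 ⟨*⟩ (# 1 ⟨+⟩ y) ⟨*⟩ # 5 ⟨=⟩ # 9 ⟨*⟩ (# 1 ⟨+⟩ # 12 ⟨*⟩ (# 1 ⟨+⟩ y)) ⟨+⟩ (# 1 ⟨+⟩ (# 17 ⟨+⟩ # 27 ⟨*⟩ y))) refl Y)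
            (ℕ.≤-trans (ℕ.≤-reflexive (trans (cong (_* 5) (sym size)) (sym (N.∑-const (allVecs m) 5)))) (ℕ.≤-trans (N.∑-mono (allVecs m) (λ v → five (D v))) (ℕ.≤-trans (ℕ.≤-reflexive (sym 9W)) (ℕ.*-monoʳ-≤ 9 W≤′))))
            where
            regroup : ∀ y → G y + 2 * G (y ⊞ ⊟ R.b) ≡ nz y + 4 * nz (y ⊞ ⊟ b) + 4 * nz (y ⊞ b)
            regroup y = trans (cong₂ (λ u w → G y + 2 * (nz u + 2 * nz w)) (cong (λ z → y ⊞ ⊟ z) b′≡b)
              (trans (cong (λ z → y ⊞ ⊟ z ⊞ ⊟ b) b′≡b) (trans (solve 2 (λ y b → y :+ :- b :+ :- b := y :+ :- (b :+ b)) refl y b) (trans (cong (λ z → y ⊞ ⊟ z) (doubled b)) (solve 2 (λ y b → y :+ :- (:- b) := y :+ b) refl y b)))))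
              (solveₙ 3 (λ s t u → s ⟨+⟩ # 2 ⟨*⟩ t ⟨+⟩ # 2 ⟨*⟩ (t ⟨+⟩ # 2 ⟨*⟩ u) ⟨=⟩ s ⟨+⟩ # 4 ⟨*⟩ t ⟨+⟩ # 4 ⟨*⟩ u) refl (nz y) (nz (y ⊞ ⊟ b)) (nz (y ⊞ b)))
            five : ∀ y → 5 ≤ G y + 2 * G (y ⊞ ⊟ R.b)
            five y = ℕ.≤-trans (zero-or-not (y ⊞ ⊟ b)
                (λ n → zero-or-not (y ⊞ b)
                  (λ n′ → ℕ.≤-trans (ℕ.m≤m+n 5 3) (ℕ.≤-trans (ℕ.m≤n+m 8 (nz y)) (ℕ.≤-reflexive (trans (sym (ℕ.+-assoc (nz y) 4 4)) (cong₂ (λ s t → nz y + 4 * s + 4 * t) (sym (nz-no n)) (sym (nz-no n′)))))))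
                  (λ z → ℕ.≤-trans (ℕ.≤-reflexive (cong₂ (λ s t → s + 4 * t) (sym (nz-no (λ y≡0 → b≢0 (trans (sym (+-identityˡ b)) (trans (cong (_⊞ b) (sym y≡0)) z))))) (sym (nz-no n)))) (ℕ.m≤m+n _ _)))
                (λ z → let y≡b = sub-zero⇒≡ y b z in ℕ.≤-reflexive (sym (cong₂ _+_ (cong₂ (λ s t → s + 4 * t) (nz-no (λ y≡0 → b≢0 (trans (sym y≡b) y≡0))) (nz-yes z))
                  (cong (4 *_) (nz-no (λ z′ → b≢0 (neg-zero⇒ (trans (sym (doubled b)) (trans (cong (_⊞ b) (sym y≡b)) z′))))))))))
              (ℕ.≤-reflexive (sym (regroup y)))
              where
              neg-zero⇒ : ∀ {x} → ⊟ x ≡ 0F → x ≡ 0F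
              neg-zero⇒ {x} e = trans (solve 1 (λ x → x := :- (:- x)) refl x) (trans (cong ⊟_ e) neg-zero)

          module Opposite (b′≡-b : R.b ≡ ⊟ b) where
            private
              regroup : ∀ y → G y + 2 * G (y ⊞ ⊟ R.b) ≡ 4 + 3 * nz y
              regroup y = trans (cong₂ (λ u w → G y + 2 * (nz u + 2 * nz w)) (trans (cong (λ z → y ⊞ ⊟ z) b′≡-b) (solve 2 (λ y b → y :+ :- (:- b) := y :+ b) refl y b))
                  (trans (cong (λ z → y ⊞ ⊟ z ⊞ ⊟ b) b′≡-b) (solve 2 (λ y b → y :+ :- (:- b) :+ :- b := y) refl y b)))
                (trans (solveₙ 3 (λ s t u → s ⟨+⟩ # 2 ⟨*⟩ t ⟨+⟩ # 2 ⟨*⟩ (u ⟨+⟩ # 2 ⟨*⟩ s) ⟨=⟩ # 5 ⟨*⟩ s ⟨+⟩ # 2 ⟨*⟩ (t ⟨+⟩ u)) refl (nz y) (nz (y ⊞ ⊟ b)) (nz (y ⊞ b))) count)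
                where
                zero-case : ∀ {s t u} → s ≡ 0 → t ≡ 1 → u ≡ 1 → 5 * s + 2 * (t + u) ≡ 4 + 3 * s
                zero-case refl refl refl = refl
                one-case : ∀ {s v} → s ≡ 1 → v ≡ 1 → 5 * s + 2 * v ≡ 4 + 3 * s
                one-case refl refl = refl
                count : 5 * nz y + 2 * (nz (y ⊞ ⊟ b) + nz (y ⊞ b)) ≡ 4 + 3 * nz y
                count = zero-or-not y
                  (λ n → one-case (nz-no n) (hit n (same-or-opposite b≢0 n)))
                  (λ z → zero-case (nz-yes z) (nz-no (λ e → b≢0 (trans (sym (sub-zero⇒≡ y b e)) z))) (nz-no (λ e → b≢0 (trans (sym (+-identityˡ b)) (trans (cong (_⊞ b) (sym z)) e)))))
                  where
                  hit : y ≢ 0F → y ≡ b ⊎ y ≡ ⊟ b → nz (y ⊞ ⊟ b) + nz (y ⊞ b) ≡ 1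
                  hit n (inj₁ e) = cong₂ _+_ (nz-yes (trans (cong (_⊞ ⊟ b) e) (-‿inverseʳ b))) (nz-no (λ z → neg-nonzero b≢0 (trans (sym (doubled b)) (trans (cong (_⊞ b) (sym e)) z))))
                  hit n (inj₂ e) = cong₂ _+_ (nz-no (λ z → neg≢ b≢0 (trans (sym (sub-zero⇒≡ y b z)) e))) (nz-yes (trans (cong (_⊞ b) e) (-‿inverseˡ b)))

              -- Four of the nine shifted copies of D are nonzero in any case, which exhausts the
              -- share 12/27; only the summand `nz a` of the origin is left for D.
              few : ∑v (λ v → nz (D v)) ≤ 3 * nz a
              few = ℕ.*-cancelˡ-≤ 3 (ℕ.+-cancelˡ-≤ (27 * suc Y * 4) _ _ (ℕ.≤-trans (ℕ.≤-reflexive (sym (trans 9W (trans (N.∑-cong (allVecs m) (λ v → regroup (D v)))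
                  (trans (N.∑-∙ (allVecs m) (λ _ → 4) (λ v → 3 * nz (D v))) (cong₂ _+_ (∑-constant′ 4 (λ _ → refl)) (N.∑-*ˡ (allVecs m) 3 (λ v → nz (D v)))))))))
                (ℕ.≤-trans (ℕ.*-monoʳ-≤ 9 W≤) (ℕ.≤-reflexive (solveₙ 2 (λ n y → # 9 ⟨*⟩ (n ⟨+⟩ # 12 ⟨*⟩ y) ⟨=⟩ # 27 ⟨*⟩ y ⟨*⟩ # 4 ⟨+⟩ # 3 ⟨*⟩ (# 3 ⟨*⟩ n)) refl (nz a) (suc Y))))))

            at-zero : a ≡ 0F → Combination Prime𝔽 f
            at-zero a≡0 = record { k₁ = x ; k₂ = y ; k₃ = x ; λ₁ = b ; λ₂ = ⊟ b ; λ₃ = 0F ; λ₁∈ = prime _ ; λ₂∈ = prime _ ; λ₃∈ = prime _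
                ; nonzero₁ = e , 1≢0 ∘ trans (sym x-e) ; nonzero₂ = e′ , 1≢0 ∘ trans (sym R.x-e) ; nonzero₃ = e , 1≢0 ∘ trans (sym x-e) ; formula = formula }
              where
              D≡0 : ∀ v → D v ≡ 0F
              D≡0 v = zero-or-not (D v) (λ n → ⊥-elim (refute 0 refl (ℕ.≤-trans (ℕ.≤-reflexive (sym (nz-no n))) (ℕ.≤-trans (N.∑-member (λ v → nz (D v)) (allVecs-complete v))
                (ℕ.≤-trans few (ℕ.≤-reflexive (cong (3 *_) (nz-yes a≡0)))))))) id
              formula : ∀ v → f v ≡ b ⊠ δ (ap x v) ⊞ ((⊟ b) ⊠ δ (ap y v) ⊞ 0F ⊠ δ (ap x v))
              formula v = trans (polar-value L v) (trans (decompose a v) (trans (cong (_⊞ ⊟ (b ⊠ (ap x v ⊠ ap x v))) (trans (R.decompose a v) (cong₂ (λ d c → d ⊞ ⊟ (c ⊠ (ap y v ⊠ ap y v))) (D≡0 v) b′≡-b)))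
                (trans (solve 4 (λ b x y d → 𝟎 :+ :- ((:- b) :* (y :* y)) :+ :- (b :* (x :* x)) := b :* (𝟙 :+ :- (x :* x)) :+ ((:- b) :* (𝟙 :+ :- (y :* y)) :+ 𝟎 :* d)) refl b (ap x v) (ap y v) (δ (ap x v)))
                  (cong₂ (λ s t → b ⊠ s ⊞ ((⊟ b) ⊠ t ⊞ 0F ⊠ δ (ap x v))) (sym (δ-square (ap x v))) (sym (δ-square (ap y v)))))))

            -- The vectors 0, e, -e and e′ are zeros of the remaining form, so D has the value a at
            -- all four, against the three places permitted by `few`.
            not-at-zero : a ≢ 0F → ⊥
            not-at-zero a≢0 = refute 0 refl (ℕ.≤-trans (unique-⊆-length {xs = zeroV ∷ e ∷ (⊟ 1F) ·V e ∷ e′ ∷ []} distinct nonzero-values) (ℕ.≤-trans (ℕ.≤-reflexive (counted (allVecs m)))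
                (ℕ.≤-trans few (ℕ.*-monoʳ-≤ 3 (nz≤1 a)))))
              where
              nonzero? : ∀ v → Dec (D v ≢ 0F)
              nonzero? v = ¬? (D v ≟F 0F)
              counted : ∀ vs → length (filter nonzero? vs) ≡ N.∑ vs (λ v → nz (D v))
              counted vs = trans (sym (ℕ.*-identityʳ _)) (trans (sym (N.∑-const (filter nonzero? vs) 1)) (N.∑-filter nonzero? vs (λ _ → 1) {g = λ v → nz (D v)}
                (λ v n → sym (nz-no n)) (λ v n → zero-or-not (D v) (λ n′ → ⊥-elim (n n′)) nz-yes)))
              D-of : ∀ {v} → ap (B R.Q′ v) v ≡ 0F → D v ≢ 0F
              D-of z d = a≢0 (trans (solve 1 (λ a → a := a :+ :- 𝟎) refl a) (trans (cong (λ y → a ⊞ ⊟ y) (sym z)) d))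
              ye : ∀ t → ap y (t ·V e) ≡ 0F
              ye t = trans (ap-· y t e) (⊠-zero (trans (ap-scaleL R.b (B Q′ e′) e) (⊠-zero (kills e′))))
              on-e : ∀ t → ap (B R.Q′ (t ·V e)) (t ·V e) ≡ 0F
              on-e t = trans (cong₂ _⊞_ (trans (ap-· (B Q′ (t ·V e)) t e) (⊠-zero (kills (t ·V e)))) (⊠-zero (ye t))) (+-identityˡ 0F)
              member : ∀ {v} → ap (B R.Q′ v) v ≡ 0F → v ∈ filter nonzero? (allVecs m)
              member {v} z = ∈-filter⁺ nonzero? (allVecs-complete v) (D-of z)
              nonzero-values : ∀ {v} → v ∈ zeroV ∷ e ∷ (⊟ 1F) ·V e ∷ e′ ∷ [] → v ∈ filter nonzero? (allVecs m)
              nonzero-values (here refl)                         = member (ap-zero (B R.Q′ zeroV))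
              nonzero-values (there (here refl))                 = member (subst (λ v → ap (B R.Q′ v) v ≡ 0F) (1·V e) (on-e 1F))
              nonzero-values (there (there (here refl)))         = member (on-e (⊟ 1F))
              nonzero-values (there (there (there (here refl)))) = member (R.kills e′)
              scaled≢ : ∀ {s t} → s ≢ t → s ·V e ≢ t ·V e
              scaled≢ {s} {t} n z = n (trans (sym (scalar s)) (trans (cong (ap x) z) (scalar t)))
                where
                scalar : ∀ s → ap x (s ·V e) ≡ s
                scalar s = trans (ap-· x s e) (trans (cong (s ⊠_) x-e) (*-identityʳ s))
              apart : ∀ {v} t → t ·V e ≡ v → v ≢ e′
              apart t z f = 1≢0 (trans (sym R.x-e) (trans (cong (ap y) (sym (trans z f))) (ye t)))
              distinct : Unique (zeroV ∷ e ∷ (⊟ 1F) ·V e ∷ e′ ∷ [])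
              distinct = ((λ z → scaled≢ (1≢0 ∘ sym) (trans (0·V e) (trans z (sym (1·V e))))) ∷ (λ z → scaled≢ (neg-nonzero 1≢0 ∘ sym) (trans (0·V e) z)) ∷ apart 0F (0·V e) ∷ [])
                ∷ ((λ z → scaled≢ (neg≢ 1≢0) (trans (1·V e) z)) ∷ apart 1F (1·V e) ∷ []) ∷ (apart (⊟ 1F) refl ∷ []) ∷ [] ∷ []

        second : (∃ λ e′ → ap (B Q′ e′) e′ ≢ 0F) ⊎ (∀ v → ap (B Q′ v) v ≡ 0F) → Combination Prime𝔽 f
        second (inj₂ z)         = ⊥-elim (not-rank-one z)
        second (inj₁ (e′ , b′≢0)) with same-or-opposite b≢0 b′≢0
        ... | inj₁ same     = ⊥-elim (Second.same-sign e′ b′≢0 same)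
        ... | inj₂ opposite = zero-or-not a (λ n → ⊥-elim (O.not-at-zero n)) O.at-zero
          where module O = Second.Opposite e′ b′≢0 opposite

      first : (∃ λ e → ap (B Q e) e ≢ 0F) ⊎ (∀ v → ap (B Q v) v ≡ 0F) → Combination Prime𝔽 f
      first (inj₂ z)         = ⊥-elim (not-constant z)
      first (inj₁ (e , b≢0)) = First.second e b≢0 all-or-some

-- Numerical estimates

module Numerics where
  open import Relation.Nullary.Decidable using (from-yes)

  θ-geometric : ∀ Q k → Q * θ (suc Q) k + 1 ≡ suc Q ^ suc k
  θ-geometric Q zero    = solveₙ 1 (λ Q → Q ⟨*⟩ # 1 ⟨+⟩ # 1 ⟨=⟩ (# 1 ⟨+⟩ Q) ⟨*⟩ # 1) refl Q
  θ-geometric Q (suc k) = trans (solveₙ 3 (λ Q x t → Q ⟨*⟩ (x ⟨+⟩ t) ⟨+⟩ # 1 ⟨=⟩ (Q ⟨*⟩ t ⟨+⟩ # 1) ⟨+⟩ Q ⟨*⟩ x) refl Q (suc Q ^ suc k) (θ (suc Q) k))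
    (cong (_+ Q * suc Q ^ suc k) (θ-geometric Q k))

  θ-lower : ∀ s e → s ^ e ≤ θ s e
  θ-lower s zero    = ℕ.≤-refl
  θ-lower s (suc e) = ℕ.m≤m+n _ _

  -- Since q^(e+1) = (q - 1)θ + 1, twice this power is 2(q - 1)θ + 2, which is below (3q - 6)θ + 3
  -- once q ≥ 4.
  small-bound : ∀ r e w → (3 * (4 + r) ∸ 6) * θ (4 + r) e + 3 ≤ w → w ≤ 2 * (4 + r) ^ suc e → ⊥
  small-bound r e w lower upper = refute (r * t) (solveₙ 2 (λ r t → (# 6 ⟨+⟩ # 3 ⟨*⟩ r) ⟨*⟩ t ⟨+⟩ # 3 ⟨=⟩ # 2 ⟨*⟩ ((# 3 ⟨+⟩ r) ⟨*⟩ t ⟨+⟩ # 1) ⟨+⟩ (# 1 ⟨+⟩ r ⟨*⟩ t)) refl r t)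
      (ℕ.≤-trans (ℕ.≤-reflexive (cong (λ k → k * t + 3) (sym coefficient))) (ℕ.≤-trans lower (ℕ.≤-trans upper (ℕ.≤-reflexive (cong (2 *_) (sym (θ-geometric (3 + r) e)))))))
    where
    t : ℕ
    t = θ (4 + r) e
    coefficient : 3 * (4 + r) ∸ 6 ≡ 6 + 3 * r
    coefficient = cong (_∸ 6) (solveₙ 1 (λ r → # 3 ⟨*⟩ (# 4 ⟨+⟩ r) ⟨=⟩ # 6 ⟨+⟩ (# 6 ⟨+⟩ # 3 ⟨*⟩ r)) refl r)

  power-positive : ∀ s e → 0 < s → 0 < s ^ e
  power-positive s e s>0 = ℕ.m^n>0 s ⦃ >-nonZero s>0 ⦄ e

  -- If 2w is within k s^e of a s^e, the subtracted root is at most k s^e, so √d ≤ k; comparing d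
  -- with k² then refutes a bound without square roots.
  sqrt-bound : ∀ {s} e a w d k → 0 < s → a * s ^ e ≤ 2 * w + k * s ^ e → d * s ^ (2 * e) ≤ (a * s ^ e ∸ 2 * w) ^ 2 → d ≤ k * k
  sqrt-bound {s} e a w d k s>0 close le = ℕ.*-cancelʳ-≤ d (k * k) (X * X) ⦃ >-nonZero (ℕ.*-mono-≤ X>0 X>0) ⦄ (ℕ.≤-trans (ℕ.≤-reflexive (cong (d *_) (sym square)))
      (ℕ.≤-trans le (ℕ.≤-trans (ℕ.^-monoˡ-≤ 2 gap) (ℕ.≤-reflexive (solveₙ 2 (λ k x → (k ⟨*⟩ x) ⟨*⟩ ((k ⟨*⟩ x) ⟨*⟩ # 1) ⟨=⟩ k ⟨*⟩ k ⟨*⟩ (x ⟨*⟩ x)) refl k X)))))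
    where
    X : ℕ
    X = s ^ e
    X>0 : 0 < X
    X>0 = power-positive s e s>0
    square : s ^ (2 * e) ≡ X * X
    square = trans (ℕ.^-distribˡ-+-* s e (e + 0)) (cong (λ i → X * s ^ i) (ℕ.+-identityʳ e))
    gap : a * X ∸ 2 * w ≤ k * X
    gap = ℕ.m≤n+o⇒m∸n≤o (a * X) (2 * w) close

  -- As θ is at least its leading power s^e, the lower bound gives 2w ≥ 2(3s - 6)s^e, so k only has
  -- to cover the excess of a over 2(3s - 6).
  near : ∀ s e {w} a k → (3 * s ∸ 6) * θ s e + 3 ≤ w → a ≤ 2 * (3 * s ∸ 6) + k → a * s ^ e ≤ 2 * w + k * s ^ e
  near s e {w} a k lower a≤ = ℕ.≤-trans (ℕ.*-monoˡ-≤ (s ^ e) a≤) (ℕ.≤-trans (ℕ.≤-reflexive (solveₙ 3 (λ c k x → (# 2 ⟨*⟩ c ⟨+⟩ k) ⟨*⟩ x ⟨=⟩ # 2 ⟨*⟩ (c ⟨*⟩ x) ⟨+⟩ k ⟨*⟩ x) refl (3 * s ∸ 6) k (s ^ e)))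
    (ℕ.+-monoˡ-≤ (k * s ^ e) (ℕ.*-monoʳ-≤ 2 (ℕ.≤-trans (ℕ.*-monoʳ-≤ (3 * s ∸ 6) (θ-lower s e)) (ℕ.≤-trans (ℕ.m≤m+n _ 3) lower)))))

  -- Here 6q - 1 = 2(3q - 6) + 11, and 11² = 121 is below 24q.
  class-a : ∀ s e w → ClassA s → (3 * s ∸ 6) * θ s e + 3 ≤ w → SqrtBound ((6 * s ∸ 1) * s ^ e) (24 * s * s ^ (2 * e)) w → ⊥
  class-a s e w (here refl)                         lower (_ , le) = refute 46 refl (sqrt-bound {7} e 41 w 168 11 (s≤s z≤n) (near 7 e 41 11 lower ℕ.≤-refl) le)
  class-a s e w (there (here refl))                 lower (_ , le) = refute 142 refl (sqrt-bound {11} e 65 w 264 11 (s≤s z≤n) (near 11 e 65 11 lower ℕ.≤-refl) le)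
  class-a s e w (there (there (here refl)))         lower (_ , le) = refute 190 refl (sqrt-bound {13} e 77 w 312 11 (s≤s z≤n) (near 13 e 77 11 lower ℕ.≤-refl) le)
  class-a s e w (there (there (there (here refl)))) lower (_ , le) = refute 286 refl (sqrt-bound {17} e 101 w 408 11 (s≤s z≤n) (near 17 e 101 11 lower ℕ.≤-refl) le)

  -- Here 6q + 9 = 2(3q - 6) + 21, and 21² = 441 is below 24 · 19 = 456.
  class-b : ∀ s e w → ClassB s → (3 * s ∸ 6) * θ s e + 3 ≤ w → SqrtBound ((6 * s + 9) * s ^ e) (24 * s * s ^ (2 * e)) w → ⊥
  class-b s e w (here refl)         lower (_ , le) = refute 14 refl (sqrt-bound {19} e 123 w 456 21 (s≤s z≤n) (near 19 e 123 21 lower ℕ.≤-refl) le)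
  class-b s e w (there (here refl)) lower (_ , le) = refute 2462 refl (sqrt-bound {121} e 735 w 2904 21 (s≤s z≤n) (near 121 e 735 21 lower ℕ.≤-refl) le)

  -- Up to truncation 8q - 33 = 2(3q - 6) + (2q - 21). The square of 2q - 21 stays below 32q as far
  -- as q = 24 but not at q = 25.
  default-small : ∀ t e w → t < 24 → (3 * suc t ∸ 6) * θ (suc t) e + 3 ≤ w → SqrtBound ((8 * suc t ∸ 33) * suc t ^ e) (32 * suc t * suc t ^ (2 * e)) w → ⊥
  default-small t e w t<24 lower (_ , le) = let a≤ , k< = table t<24 in
      ℕ.<⇒≱ k< (sqrt-bound {suc t} e (8 * suc t ∸ 33) w (32 * suc t) (2 * suc t ∸ 21) (s≤s z≤n) (near (suc t) e (8 * suc t ∸ 33) (2 * suc t ∸ 21) lower a≤) le)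
    where
    table : ∀ {t} → t < 24 → 8 * suc t ∸ 33 ≤ 2 * (3 * suc t ∸ 6) + (2 * suc t ∸ 21) × (2 * suc t ∸ 21) * (2 * suc t ∸ 21) < 32 * suc t
    table = from-yes (ℕ.allUpTo? (λ t → (8 * suc t ∸ 33 ≤? 2 * (3 * suc t ∸ 6) + (2 * suc t ∸ 21)) ×-dec ((2 * suc t ∸ 21) * (2 * suc t ∸ 21) <? 32 * suc t)) 24)

  -- With q = 26 + r the number 152 + 8r is 2 · 4(q - 7). A weight of 4(q - 7)q^e or more would
  -- leave at most k q^e for the root, against k² < d.
  large-bound : ∀ r e w a d k → a ≡ 152 + 8 * r + k → k * k < d → SqrtBound (a * (26 + r) ^ e) (d * (26 + r) ^ (2 * e)) w → w < (19 + r) * 4 * (26 + r) ^ e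
  large-bound r e w a d k refl k<d (_ , le) = ℕ.*-cancelˡ-< 2 _ _ (ℕ.+-cancelʳ-< (k * X) _ _ (ℕ.<-≤-trans
      (ℕ.≰⇒> (λ close → ℕ.<⇒≱ k<d (sqrt-bound {26 + r} e a w d k (s≤s z≤n) close le)))
      (ℕ.≤-reflexive (solveₙ 3 (λ r k x → (# 152 ⟨+⟩ # 8 ⟨*⟩ r ⟨+⟩ k) ⟨*⟩ x ⟨=⟩ # 2 ⟨*⟩ ((# 19 ⟨+⟩ r) ⟨*⟩ # 4 ⟨*⟩ x) ⟨+⟩ k ⟨*⟩ x) refl r k X))))
    where
    X : ℕ
    X = (26 + r) ^ e

  class-c : ∀ r e w → SqrtBound ((8 * (26 + r) ∸ 25) * (26 + r) ^ e) (64 * (26 + r) * (26 + r) ^ (2 * e)) w → w < (19 + r) * 4 * (26 + r) ^ e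
  class-c r e w = large-bound r e w (8 * (26 + r) ∸ 25) (64 * (26 + r)) 31
    (cong (_∸ 25) (solveₙ 1 (λ r → # 8 ⟨*⟩ (# 26 ⟨+⟩ r) ⟨=⟩ # 25 ⟨+⟩ (# 152 ⟨+⟩ # 8 ⟨*⟩ r ⟨+⟩ # 31)) refl r))
    (ℕ.<-≤-trans (ℕ.m<m+n 961 {703} (s≤s z≤n)) (ℕ.*-monoʳ-≤ 64 (ℕ.m≤m+n 26 r)))

  default-large : ∀ r e w → SqrtBound ((8 * (26 + r) ∸ 33) * (26 + r) ^ e) (32 * (26 + r) * (26 + r) ^ (2 * e)) w → w < (19 + r) * 4 * (26 + r) ^ e
  default-large r e w = large-bound r e w (8 * (26 + r) ∸ 33) (32 * (26 + r)) 23
    (cong (_∸ 33) (solveₙ 1 (λ r → # 8 ⟨*⟩ (# 26 ⟨+⟩ r) ⟨=⟩ # 33 ⟨+⟩ (# 152 ⟨+⟩ # 8 ⟨*⟩ r ⟨+⟩ # 23)) refl r))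
    (ℕ.<-≤-trans (ℕ.m<m+n 529 {303} (s≤s z≤n)) (ℕ.*-monoʳ-≤ 32 (ℕ.m≤m+n 26 r)))

  -- Here Q + 1 is the order of the field, K (Q + 1)^e exceeds the weight, and V is the number of vectors on which the word does not vanish.
  good-bound : ∀ Q e K w V → V ≤ 1 + Q * w → 0 < Q → w < K * suc Q ^ e → Q * (suc Q * V) < suc Q ^ suc (suc (suc e)) * K
  good-bound Q e K w V V≤ Q>0 w< = ℕ.≤-<-trans (ℕ.*-monoʳ-≤ Q (ℕ.*-monoʳ-≤ (suc Q) V≤′)) (ℕ.≤-trans (ℕ.+-mono-≤ positive ℕ.≤-refl)
      (ℕ.≤-reflexive (solveₙ 3 (λ Q K X → ((# 1 ⟨+⟩ Q) ⟨*⟩ (# 1 ⟨+⟩ # 2 ⟨*⟩ Q)) ⟨*⟩ (K ⟨*⟩ X) ⟨+⟩ Q ⟨*⟩ ((# 1 ⟨+⟩ Q) ⟨*⟩ (Q ⟨*⟩ (K ⟨*⟩ X))) ⟨=⟩ (# 1 ⟨+⟩ Q) ⟨*⟩ ((# 1 ⟨+⟩ Q) ⟨*⟩ ((# 1 ⟨+⟩ Q) ⟨*⟩ X)) ⟨*⟩ K) refl Q K (suc Q ^ e))))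
    where
    V≤′ : V ≤ Q * (K * suc Q ^ e)
    V≤′ = ℕ.≤-trans V≤ (ℕ.≤-trans (ℕ.+-monoˡ-≤ (Q * w) Q>0) (ℕ.≤-trans (ℕ.≤-reflexive (sym (ℕ.*-suc Q w))) (ℕ.*-monoʳ-≤ Q w<)))
    positive : 0 < suc Q * (1 + 2 * Q) * (K * suc Q ^ e)
    positive = ℕ.*-mono-≤ {1} {suc Q * (1 + 2 * Q)} {1} (s≤s z≤n) (ℕ.≤-trans (s≤s z≤n) w<)

  -- At most 4 q^(e+2) nonzero values and 7/2 · q^(e+2) zeros would account for fewer than 8 q^(e+2)
  -- vectors, far from q^(e+3).
  light-bound : ∀ r e w V Z → V ≤ 1 + (25 + r) * w → w < (19 + r) * 4 * (26 + r) ^ e → V + Z ≡ (26 + r) ^ suc (suc (suc e)) → ¬ 2 * Z ≤ 7 * (26 + r) ^ suc (suc e)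
  light-bound r e w V Z V≤ w< V+Z heavy = ℕ.<⇒≱ (ℕ.≤-trans (ℕ.+-monoˡ-≤ (15 * (s * (s * X))) positive)
        (ℕ.≤-reflexive (solveₙ 2 (λ r X → (# 37 ⟨+⟩ # 2 ⟨*⟩ r) ⟨*⟩ ((# 26 ⟨+⟩ r) ⟨*⟩ ((# 26 ⟨+⟩ r) ⟨*⟩ X)) ⟨+⟩ # 15 ⟨*⟩ ((# 26 ⟨+⟩ r) ⟨*⟩ ((# 26 ⟨+⟩ r) ⟨*⟩ X)) ⟨=⟩ # 2 ⟨*⟩ ((# 26 ⟨+⟩ r) ⟨*⟩ ((# 26 ⟨+⟩ r) ⟨*⟩ ((# 26 ⟨+⟩ r) ⟨*⟩ X)))) refl r X)))
      (ℕ.≤-trans (ℕ.≤-reflexive (trans (cong (2 *_) (sym V+Z)) (ℕ.*-distribˡ-+ 2 V Z))) (ℕ.≤-trans (ℕ.+-mono-≤ (ℕ.*-monoʳ-≤ 2 V≤′) heavy)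
        (ℕ.≤-reflexive (solveₙ 1 (λ y → # 2 ⟨*⟩ (# 4 ⟨*⟩ y) ⟨+⟩ # 7 ⟨*⟩ y ⟨=⟩ # 15 ⟨*⟩ y) refl (s * (s * X))))))
    where
    s X : ℕ
    s = 26 + r
    X = s ^ e
    positive : 0 < (37 + 2 * r) * (s * (s * X))
    positive = ℕ.*-mono-≤ {1} {37 + 2 * r} {1} (s≤s z≤n) (ℕ.*-mono-≤ {1} {s} {1} (s≤s z≤n) (ℕ.*-mono-≤ {1} {s} {1} (s≤s z≤n) (power-positive s e (s≤s z≤n))))
    V≤′ : V ≤ 4 * (s * (s * X))
    V≤′ = ℕ.≤-trans V≤ (ℕ.≤-trans (ℕ.+-monoˡ-≤ ((25 + r) * w) {1} {25 + r} (s≤s z≤n)) (ℕ.≤-trans (ℕ.≤-reflexive (sym (ℕ.*-suc (25 + r) w))) (ℕ.≤-trans (ℕ.*-mono-≤ (ℕ.n≤1+n (25 + r)) w<)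
      (ℕ.≤-trans (ℕ.*-monoʳ-≤ s (ℕ.*-monoˡ-≤ X (ℕ.*-monoˡ-≤ 4 (ℕ.+-monoˡ-≤ r {19} {26} (ℕ.m≤m+n 19 7))))) (ℕ.≤-reflexive (solveₙ 2 (λ s X → s ⟨*⟩ (s ⟨*⟩ # 4 ⟨*⟩ X) ⟨=⟩ # 4 ⟨*⟩ (s ⟨*⟩ (s ⟨*⟩ X))) refl s X))))))

  positive⇒suc : ∀ {x} → 0 < x → ∃ λ y → x ≡ suc y
  positive⇒suc {suc y} _ = y , refl

-- The cases of the order q

module Main (F : FiniteField) (p : ℕ) (pr : Prime p) (char : FiniteField.ι F p ≡ FiniteField.0# F) where
  open SmallFields F p pr char
  open Numerics

  module _ {e} (c : Word (suc (suc e))) (inCode : InCode (suc (suc e)) c) (lower : (3 * q ∸ 6) * θ q e + 3 ≤ wt c) where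
    private
      m : ℕ
      m = suc (suc (suc e))

      w : ℕ
      w = wt c

      L : Code m
      L = proj₁ (toCode c inCode)

      coefficients : All (λ lk → Prime𝔽 (proj₁ lk)) L
      coefficients = proj₁ (proj₂ (toCode c inCode))

      eq : ∀ P → J (c P) ≡ val L (vec P)
      eq = proj₂ (proj₂ (toCode c inCode))

      Q⁺ : ∀ {s} → q ≡ suc s → length elems⁺ ≡ s
      Q⁺ q≡s = ℕ.suc-injective (trans (sym q≡) q≡s)

      weight : ∀ {s} → q ≡ suc s → W L (full m) ≡ nz (val L zeroV) + s * w
      weight q≡s = trans (weight-formula c L eq) (cong (λ k → nz (val L zeroV) + k * w) (Q⁺ q≡s))

      size : ∀ {s} → q ≡ s → length (allVecs m) ≡ s ^ m
      size q≡s = trans (allVecs-length m) (cong (_^ m) q≡s)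

      lower′ : ∀ {s} → q ≡ s → (3 * s ∸ 6) * θ s e + 3 ≤ w
      lower′ q≡s = subst (λ s → (3 * s ∸ 6) * θ s e + 3 ≤ w) q≡s lower

    -- The factor 4(q - 7) is (Q + 1)τ for τ = 4 and Q = q - 8, so the bound on w is just what makes
    -- every line good; it also rules out that the whole space is heavy.
    large : ∀ r → q ≡ 26 + r → w < (19 + r) * 4 * (26 + r) ^ e → Conclusion c
    large r q≡s w< = conclusion (classify-light r q≡s L coefficients good not-heavy)
      where
      V≤ : W L (full m) ≤ 1 + (25 + r) * w
      V≤ = ℕ.≤-trans (ℕ.≤-reflexive (weight q≡s)) (ℕ.+-monoˡ-≤ _ (nz≤1 (val L zeroV)))
      good : Good L
      good = few⇒good L (18 + r) q≡s (transport (good-bound (25 + r) e ((19 + r) * 4) w (W L (full m)) V≤ (s≤s z≤n) w<))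
        where
        transport : (25 + r) * ((26 + r) * W L (full m)) < (26 + r) ^ m * ((19 + r) * 4) → length elems⁺ * (q * W L (full m)) < q ^ m * ((19 + r) * 4)
        transport = subst (λ k → k * (q * W L (full m)) < q ^ m * ((19 + r) * 4)) (sym (Q⁺ q≡s)) ∘ subst (λ s → (25 + r) * (s * W L (full m)) < s ^ m * ((19 + r) * 4)) (sym q≡s)
      not-heavy : ¬ 2 * Z L (full m) ≤ 7 * q ^ suc (suc e)
      not-heavy h = light-bound r e w (W L (full m)) (Z L (full m)) V≤ w< (trans (W+Z L (full m)) (size q≡s)) (ℕ.≤-trans h (ℕ.≤-reflexive (cong (λ s → 7 * s ^ suc (suc e)) q≡s)))
      conclusion : Combination Prime𝔽 (val L) ⊎ OddForm (val L) → Conclusion c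
      conclusion (inj₁ C) = combination⇒conclusion c L eq C
      -- In the odd case p = q ≥ 26, so p is odd.
      conclusion (inj₂ O) = odd⇒conclusion c L eq (λ p≡2 → refute (23 + r) refl (ℕ.≤-reflexive (trans (sym q≡s) (trans (OddForm.q≡p O) p≡2)))) O

    small : ∀ s → q ≡ s → w ≤ 2 * q ^ suc e → Conclusion c
    small 0 q≡0 _ = ⊥-elim (ℕ.1+n≢0 (trans (sym q≡) q≡0))
    small 1 q≡1 _ = ⊥-elim (refute 0 refl (ℕ.≤-trans (unique-⊆-length {xs = 0F ∷ 1F ∷ []} ((1≢0 ∘ sym ∷ []) ∷ [] ∷ []) (λ {y} _ → elems-complete y)) (ℕ.≤-reflexive q≡1)))
    small 2 q≡2 upper = combination⇒conclusion c L eq (binary (positive⇒suc (power-positive 2 (suc e) (s≤s z≤n))))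
      where
      binary : (∃ λ Y → 2 ^ suc e ≡ suc Y) → Combination Prime𝔽 (val L)
      binary (Y , X≡) = Binary.combination q≡2 L {w} {Y} (trans (weight q≡2) (cong (nz (val L zeroV) +_) (ℕ.*-identityˡ w))) (lower′ q≡2)
        (ℕ.≤-trans upper (ℕ.≤-reflexive (cong (2 *_) (trans (cong (_^ suc e) q≡2) X≡)))) (trans (size q≡2) (trans (cong (λ x → 2 * (2 * x)) X≡) (sym (ℕ.*-assoc 2 2 (suc Y)))))
    small 3 q≡3 upper = combination⇒conclusion c L eq (ternary (positive⇒suc (power-positive 3 e (s≤s z≤n))))
      where
      ternary : (∃ λ Y → 3 ^ e ≡ suc Y) → Combination Prime𝔽 (val L)
      ternary (Y , X≡) = Ternary.combination q≡3 L {w} {Y} (weight q≡3)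
        (ℕ.≤-trans (ℕ.≤-reflexive (trans (cong (λ x → 3 * x + 3) (trans (cong (3 *_) (sym X≡)) (sym (θ-geometric 2 e)))) (solveₙ 1 (λ t → # 3 ⟨*⟩ (# 2 ⟨*⟩ t ⟨+⟩ # 1) ⟨+⟩ # 3 ⟨=⟩ # 2 ⟨*⟩ (# 3 ⟨*⟩ t ⟨+⟩ # 3)) refl (θ 3 e)))) (ℕ.*-monoʳ-≤ 2 (lower′ q≡3)))
        (ℕ.≤-trans upper (ℕ.≤-reflexive (cong (2 *_) (trans (cong (_^ suc e) q≡3) (cong (3 *_) X≡)))))
        (trans (size q≡3) (trans (cong (λ x → 3 * (3 * (3 * x))) X≡) (solveₙ 1 (λ y → # 3 ⟨*⟩ (# 3 ⟨*⟩ (# 3 ⟨*⟩ y)) ⟨=⟩ # 27 ⟨*⟩ y) refl (suc Y))))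
    small (suc (suc (suc (suc r)))) q≡s upper = ⊥-elim (small-bound r e w (lower′ q≡s) (ℕ.≤-trans upper (ℕ.≤-reflexive (cong (λ s → 2 * s ^ suc e) q≡s))))

    main : WtLeB (suc (suc e)) q w → Conclusion c
    main (inj₁ (_ , upper)) = small q refl upper
    main (inj₂ (inj₁ (A , bound))) = ⊥-elim (class-a q e w A lower bound)
    main (inj₂ (inj₂ (inj₁ (B , bound)))) = ⊥-elim (class-b q e w B lower bound)
    main (inj₂ (inj₂ (inj₂ (inj₁ (C , bound))))) = by-class C
      where
      go : ∀ r → q ≡ 26 + r → Conclusion c
      go r q≡s = large r q≡s (class-c r e w (subst (λ s → SqrtBound ((8 * s ∸ 25) * s ^ e) (64 * s * s ^ (2 * e)) w) q≡s bound))
      by-class : ClassC q → Conclusion c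
      by-class (here e)                 = go 3 e
      by-class (there (here e))         = go 5 e
      by-class (there (there (here e))) = go 6 e
    main (inj₂ (inj₂ (inj₂ (inj₂ ((¬small , _) , bound))))) = by-size q refl (q ≤? 24) (q ℕ.≟ 25)
      where
      bound′ : ∀ {s} → q ≡ s → SqrtBound ((8 * s ∸ 33) * s ^ e) (32 * s * s ^ (2 * e)) w
      bound′ q≡s = subst (λ s → SqrtBound ((8 * s ∸ 33) * s ^ e) (32 * s * s ^ (2 * e)) w) q≡s bound
      by-size : ∀ s → q ≡ s → Dec (q ≤ 24) → Dec (q ≡ 25) → Conclusion c
      by-size zero    q≡0 _        _          = ⊥-elim (ℕ.1+n≢0 (trans (sym q≡) q≡0))
      by-size (suc t) q≡s (yes le) _          = ⊥-elim (default-small t e w (ℕ.≤-trans (ℕ.≤-reflexive (sym q≡s)) le) (lower′ q≡s) (bound′ q≡s))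
      -- The order 25 has the small bound, so the general class passes from 24 directly to 26.
      by-size (suc t) q≡s (no _)   (yes q≡25) = ⊥-elim (¬small (inj₂ (there (there (there (here q≡25))))))
      by-size (suc t) q≡s (no n)   (no n′)    = large (q ∸ 26) q≡26 (default-large (q ∸ 26) e w (bound′ q≡26))
        where
        q≡26 : q ≡ 26 + (q ∸ 26)
        q≡26 = sym (ℕ.m+[n∸m]≡n (ℕ.≤∧≢⇒< (ℕ.≰⇒> n) (n′ ∘ sym)))

theorem3p21 : (F : FiniteField) (p : ℕ) (pr : Prime p) →
    let open Geometry F
        open Code F p pr
    in FiniteField.ι F p ≡ FiniteField.0# F →
       (n : ℕ) → 2 ≤ n →
       (c : Word n) → InCode n c →
       (3 * FiniteField.q F ∸ 6) * θ (FiniteField.q F) (n ∸ 2) + 3 ≤ wt c →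
       WtLeB n (FiniteField.q F) (wt c) →
       ∃ λ (π : Fam (suc n) 3) → IsPlane π
         × (TypeOdd c π ⊎ TypeTriangle c π ⊎ TypeStar c π)
         × ∃ λ (κ : Fam (suc n) (n ∸ 2)) → Independent κ
           × DisjointSpaces π κ
           × (∀ (Q : Point n) → c Q ≡ sumOverPlane c π κ Q)
theorem3p21 F p pr char (suc (suc e)) (s≤s (s≤s _)) c inCode lower bound = Main.main F p pr char c inCode lower bound
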